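{- For each $k\in\{1,2,3,4\}$ there exists at least one finite simple graph $G$ with independence number four such that $\mathcal{A}(G)=[-\frac{4}{k},0]$. Further, for $k\in\{1,2\}$ there is no disconnected graph with independence number four whose independence attractor is $[-\frac{4}{k},0]$.
   Context: For a finite simple graph $G$, an independent set is a set of pairwise non-adjacent vertices. The independence polynomial is $I_G(z)=\sum_{i=0}^{\alpha} a_i z^i$, where $a_i$ is the number of independent sets of cardinality $i$ and $\alpha$ (the independence number) is the largest cardinality of an independent set. The lexicographic product $G[H]$ has vertex set $V(G)\times V(H)$, with $(u,v)\sim(u',v')$ iff $u\sim u'$ in $G$, or $u=u'$ and $v\sim v'$ in $H$. Let $G^m$ denote the $m$-fold lexicographic product of $G$ with itself. The independence attractor is $\mathcal{A}(G)=\lim_{m\to\infty}\{z\in\mathbb{C}: I_{G^m}(z)=0\}$, the limit taken in the Hausdorff metric on nonempty compact subsets of $\mathbb{C}$. -}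

module Defs where

open import Level using (0ℓ)
open import Data.Nat as ℕ using (ℕ; zero; suc)
import Data.Nat.Properties as ℕ
open import Data.Integer using (+_)
open import Data.Rational as ℚ using (ℚ; 0ℚ; 1ℚ; ½; Positive; positive; ∣_∣)
import Data.Rational.Properties as ℚ
open import Data.Rational.Solver using (module +-*-Solver)
open import Data.Fin using (Fin; quotient; remainder)
import Data.Fin.Properties as Fin
open import Data.Fin.Subset as Subset using (Subset; inside; outside; _∈_)
import Data.Fin.Subset.Properties as Subset
open import Data.List using (List; [_]; _++_; map; filter; length; foldr; upTo)
open import Data.List.Extrema.Nat using (max)
open import Data.Vec using ([]; _∷_)
open import Data.Product using (∃-syntax; _×_; _,_)
open import Data.Sum using (_⊎_; inj₁; inj₂)
open import Relation.Binary using (Rel; Decidable; Symmetric; Irreflexive)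
open import Relation.Binary.Construct.Closure.ReflexiveTransitive using (Star)
open import Relation.Binary.PropositionalEquality
  using (_≡_; refl; sym; trans; cong; subst)
open import Relation.Nullary using (¬_)
open import Relation.Nullary.Decidable using (_×-dec_; _⊎-dec_; _→-dec_; ¬?)
open import Relation.Unary using (Pred) renaming (Decidable to Decidable₁)

record ℝ : Set where
  constructor mkℝ
  field
    seq    : ℕ → ℚ
    cauchy : ∀ ε → 0ℚ ℚ.< ε →
             ∃[ N ] (∀ m n → m ℕ.≥ N → n ℕ.≥ N → ∣ seq m ℚ.- seq n ∣ ℚ.< ε)

open ℝ public

infix 4 _≈ᴿ_ _<ᴿ_ _≤ᴿ_

_≈ᴿ_ : Rel ℝ 0ℓ
x ≈ᴿ y = ∀ ε → 0ℚ ℚ.< ε → ∃[ N ] (∀ n → n ℕ.≥ N → ∣ seq x n ℚ.- seq y n ∣ ℚ.< ε)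

_<ᴿ_ : Rel ℝ 0ℓ
x <ᴿ y = ∃[ ε ] (0ℚ ℚ.< ε × ∃[ N ] (∀ n → n ℕ.≥ N → seq x n ℚ.+ ε ℚ.≤ seq y n))

_≤ᴿ_ : Rel ℝ 0ℓ
x ≤ᴿ y = ¬ (y <ᴿ x)

private

  0<-* : ∀ {p q} → 0ℚ ℚ.< p → 0ℚ ℚ.< q → 0ℚ ℚ.< p ℚ.* q
  0<-* {p} {q} 0<p 0<q = subst (ℚ._< p ℚ.* q) (ℚ.*-zeroʳ p)
    (ℚ.*-monoʳ-<-pos p {{positive 0<p}} 0<q)

  0<½* : ∀ {ε} → 0ℚ ℚ.< ε → 0ℚ ℚ.< ½ ℚ.* ε
  0<½* = 0<-* (ℚ.positive⁻¹ ½)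

  ½+½ : ∀ ε → ½ ℚ.* ε ℚ.+ ½ ℚ.* ε ≡ ε
  ½+½ ε = trans (sym (ℚ.*-distribʳ-+ ε ½ ½)) (ℚ.*-identityˡ ε)

  ∣+∣-< : ∀ p q {ε} → ∣ p ∣ ℚ.< ½ ℚ.* ε → ∣ q ∣ ℚ.< ½ ℚ.* ε → ∣ p ℚ.+ q ∣ ℚ.< ε
  ∣+∣-< p q {ε} hp hq = subst (∣ p ℚ.+ q ∣ ℚ.<_) (½+½ ε)
    (ℚ.≤-<-trans (ℚ.∣p+q∣≤∣p∣+∣q∣ p q) (ℚ.+-mono-< hp hq))

  ∣*∣-< : ∀ p q {B δ} → 0ℚ ℚ.< B → ∣ p ∣ ℚ.≤ B → ∣ q ∣ ℚ.< δ → ∣ p ℚ.* q ∣ ℚ.< B ℚ.* δ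
  ∣*∣-< p q {B} {δ} 0<B hp hq = subst (ℚ._< B ℚ.* δ) (sym (ℚ.∣p*q∣≡∣p∣*∣q∣ p q))
    (ℚ.≤-<-trans
      (ℚ.*-monoʳ-≤-nonNeg ∣ q ∣ {{ℚ.nonNegative (ℚ.0≤∣p∣ q)}} hp)
      (ℚ.*-monoʳ-<-pos B {{positive 0<B}} hq))

  bounded : (x : ℝ) →
            ∃[ B ] (0ℚ ℚ.< B × ∃[ N ] (∀ n → n ℕ.≥ N → ∣ seq x n ∣ ℚ.≤ B))
  bounded x with cauchy x 1ℚ (ℚ.positive⁻¹ 1ℚ)
  ... | N , h = 1ℚ ℚ.+ ∣ seq x N ∣
              , ℚ.<-≤-trans (ℚ.positive⁻¹ 1ℚ)
                  (subst (ℚ._≤ 1ℚ ℚ.+ ∣ seq x N ∣) (ℚ.+-identityʳ 1ℚ)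
                    (ℚ.+-monoʳ-≤ 1ℚ (ℚ.0≤∣p∣ (seq x N))))
              , N
              , λ n n≥N → subst (ℚ._≤ 1ℚ ℚ.+ ∣ seq x N ∣)
                  (cong ∣_∣ (split (seq x n) (seq x N)))
                  (ℚ.≤-trans (ℚ.∣p+q∣≤∣p∣+∣q∣ (seq x n ℚ.- seq x N) (seq x N))
                    (ℚ.+-monoˡ-≤ ∣ seq x N ∣ (ℚ.<⇒≤ (h n N n≥N ℕ.≤-refl))))
    where
    split : ∀ p q → (p ℚ.- q) ℚ.+ q ≡ p
    split = solve 2 (λ p q → (p :- q) :+ q := p) refl
      where open +-*-Solver

infixl 6 _+ᴿ_
infixl 7 _*ᴿ_
infix  8 -ᴿ_

fromℚ : ℚ → ℝ
fromℚ q = mkℝ (λ _ → q) λ ε 0<ε → 0 , λ _ _ _ _ →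
  subst (λ d → ∣ d ∣ ℚ.< ε) (sym (ℚ.+-inverseʳ q)) 0<ε

_+ᴿ_ : ℝ → ℝ → ℝ
x +ᴿ y = mkℝ (λ n → seq x n ℚ.+ seq y n) λ ε 0<ε →
  let M , hx = cauchy x (½ ℚ.* ε) (0<½* 0<ε)
      N , hy = cauchy y (½ ℚ.* ε) (0<½* 0<ε)
  in M ℕ.⊔ N , λ m n m≥ n≥ →
     subst (λ d → ∣ d ∣ ℚ.< ε)
       (rearrange (seq x m) (seq x n) (seq y m) (seq y n))
       (∣+∣-< (seq x m ℚ.- seq x n) (seq y m ℚ.- seq y n)
         (hx m n (ℕ.m⊔n≤o⇒m≤o M N m≥) (ℕ.m⊔n≤o⇒m≤o M N n≥))
         (hy m n (ℕ.m⊔n≤o⇒n≤o M N m≥) (ℕ.m⊔n≤o⇒n≤o M N n≥)))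
  where
  rearrange : ∀ a b c d → (a ℚ.- b) ℚ.+ (c ℚ.- d) ≡ (a ℚ.+ c) ℚ.- (b ℚ.+ d)
  rearrange = solve 4 (λ a b c d → (a :- b) :+ (c :- d) := (a :+ c) :- (b :+ d)) refl
    where open +-*-Solver

-ᴿ_ : ℝ → ℝ
-ᴿ x = mkℝ (λ n → ℚ.- seq x n) λ ε 0<ε →
  let N , h = cauchy x ε 0<ε
  in N , λ m n m≥ n≥ →
     subst (λ d → ∣ d ∣ ℚ.< ε) (rearrange (seq x m) (seq x n)) (h n m n≥ m≥)
  where
  rearrange : ∀ a b → b ℚ.- a ≡ (ℚ.- a) ℚ.- (ℚ.- b)
  rearrange = solve 2 (λ a b → b :- a := (:- a) :- (:- b)) refl
    where open +-*-Solver

_*ᴿ_ : ℝ → ℝ → ℝ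
x *ᴿ y = mkℝ (λ n → seq x n ℚ.* seq y n) λ ε 0<ε →
  let A , 0<A , Nx , bx = bounded x
      B , 0<B , Ny , by = bounded y
      δ , 0<δ , Aδ = shrink A 0<A ε 0<ε
      η , 0<η , Bη = shrink B 0<B ε 0<ε
      Mx , hx = cauchy x η 0<η
      My , hy = cauchy y δ 0<δ
      N₁ = Nx ℕ.⊔ Ny
      N₂ = Mx ℕ.⊔ My
  in N₁ ℕ.⊔ N₂ , λ m n m≥ n≥ →
     let m≥₁ = ℕ.m⊔n≤o⇒m≤o N₁ N₂ m≥
         n≥₁ = ℕ.m⊔n≤o⇒m≤o N₁ N₂ n≥
         m≥₂ = ℕ.m⊔n≤o⇒n≤o N₁ N₂ m≥
         n≥₂ = ℕ.m⊔n≤o⇒n≤o N₁ N₂ n≥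
         dx = seq x m ℚ.- seq x n
         dy = seq y m ℚ.- seq y n
     in subst (λ d → ∣ d ∣ ℚ.< ε)
          (rearrange (seq x m) (seq x n) (seq y m) (seq y n))
          (∣+∣-< (seq x m ℚ.* dy) (seq y n ℚ.* dx)
            (subst (∣ seq x m ℚ.* dy ∣ ℚ.<_) Aδ
              (∣*∣-< (seq x m) dy 0<A (bx m (ℕ.m⊔n≤o⇒m≤o Nx Ny m≥₁))
                (hy m n (ℕ.m⊔n≤o⇒n≤o Mx My m≥₂) (ℕ.m⊔n≤o⇒n≤o Mx My n≥₂))))
            (subst (∣ seq y n ℚ.* dx ∣ ℚ.<_) Bη
              (∣*∣-< (seq y n) dx 0<B (by n (ℕ.m⊔n≤o⇒n≤o Nx Ny n≥₁))
                (hx m n (ℕ.m⊔n≤o⇒m≤o Mx My m≥₂) (ℕ.m⊔n≤o⇒m≤o Mx My n≥₂)))))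
  where
  shrink : ∀ C → 0ℚ ℚ.< C → ∀ ε → 0ℚ ℚ.< ε →
           ∃[ δ ] (0ℚ ℚ.< δ × C ℚ.* δ ≡ ½ ℚ.* ε)
  shrink C 0<C ε 0<ε = C⁻¹ ℚ.* (½ ℚ.* ε)
    , 0<-* (ℚ.positive⁻¹ C⁻¹ {{ℚ.1/pos⇒pos C}}) (0<½* 0<ε)
    , trans (sym (ℚ.*-assoc C C⁻¹ (½ ℚ.* ε)))
        (trans (cong (ℚ._* (½ ℚ.* ε)) (ℚ.*-inverseʳ C)) (ℚ.*-identityˡ _))
    where
    instance
      C-pos : Positive C
      C-pos = positive 0<C
      C-nonZero : ℚ.NonZero C
      C-nonZero = ℚ.pos⇒nonZero C
    C⁻¹ : ℚ
    C⁻¹ = ℚ.1/ C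

  rearrange : ∀ a b c d →
              a ℚ.* (c ℚ.- d) ℚ.+ d ℚ.* (a ℚ.- b) ≡ a ℚ.* c ℚ.- b ℚ.* d
  rearrange = solve 4 (λ a b c d →
      a :* (c :- d) :+ d :* (a :- b) := a :* c :- b :* d) refl
    where open +-*-Solver

record ℂ : Set where
  constructor _+i_
  field
    re im : ℝ

open ℂ public

infix  4 _≈_
infixl 6 _+ᶜ_ _-ᶜ_
infixl 7 _*ᶜ_
infixr 8 _^ᶜ_

_≈_ : Rel ℂ 0ℓ
z ≈ w = re z ≈ᴿ re w × im z ≈ᴿ im w

fromℕ : ℕ → ℂ
fromℕ n = fromℚ (+ n ℚ./ 1) +i fromℚ 0ℚ

_+ᶜ_ _-ᶜ_ _*ᶜ_ : ℂ → ℂ → ℂ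
z +ᶜ w = (re z +ᴿ re w) +i (im z +ᴿ im w)
z -ᶜ w = (re z +ᴿ -ᴿ re w) +i (im z +ᴿ -ᴿ im w)
z *ᶜ w = (re z *ᴿ re w +ᴿ -ᴿ (im z *ᴿ im w)) +i (re z *ᴿ im w +ᴿ im z *ᴿ re w)

_^ᶜ_ : ℂ → ℕ → ℂ
z ^ᶜ zero  = fromℕ 1
z ^ᶜ suc n = z *ᶜ z ^ᶜ n

-- |z|²; distances are compared through their squares to avoid square roots.
∣_∣² : ℂ → ℝ
∣ z ∣² = re z *ᴿ re z +ᴿ im z *ᴿ im z

-- Intended for ε > 0: A lies in the open ε-neighbourhood of B.
_⊆[_]_ : Pred ℂ 0ℓ → ℚ → Pred ℂ 0ℓ → Set
A ⊆[ ε ] B = ∀ z → A z → ∃[ w ] (B w × ∣ z -ᶜ w ∣² <ᴿ fromℚ (ε ℚ.* ε))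

-- The Hausdorff distance of A and B is the infimum of the ε > 0 such that
-- A ⊆[ ε ] B and B ⊆[ ε ] A, so this says that it tends to 0.
HausdorffLimit : (ℕ → Pred ℂ 0ℓ) → Pred ℂ 0ℓ → Set
HausdorffLimit A L = ∀ ε → 0ℚ ℚ.< ε →
  ∃[ M ] (∀ m → m ℕ.≥ M → (A m ⊆[ ε ] L) × (L ⊆[ ε ] A m))

[_,0] : ℚ → Pred ℂ 0ℓ
[ q ,0] z = fromℚ q ≤ᴿ re z × re z ≤ᴿ fromℚ 0ℚ × im z ≈ᴿ fromℚ 0ℚ

record Graph : Set₁ where
  field
    order  : ℕ
    Adj    : Rel (Fin order) 0ℓ
    adj?   : Decidable Adj
    symm   : Symmetric Adj
    irrefl : Irreflexive _≡_ Adj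

open Graph public

Disconnected : Graph → Set
Disconnected G = ¬ (∀ u v → Star (Adj G) u v)

-- The vertex set is V(G) × V(H), encoded in Fin (order G * order H) through
-- the bijection Fin.remQuot.
_⟦_⟧ : Graph → Graph → Graph
G ⟦ H ⟧ = record
  { order  = order G ℕ.* order H
  ; Adj    = λ p q → Adj G (fst p) (fst q) ⊎ (fst p ≡ fst q × Adj H (snd p) (snd q))
  ; adj?   = λ p q → adj? G (fst p) (fst q)
                     ⊎-dec (fst p Fin.≟ fst q ×-dec adj? H (snd p) (snd q))
  ; symm   = λ { (inj₁ a)       → inj₁ (symm G a)
               ; (inj₂ (e , a)) → inj₂ (sym e , symm H a) }
  ; irrefl = λ { refl (inj₁ a)       → irrefl G refl a
               ; refl (inj₂ (_ , a)) → irrefl H refl a }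
  }
  where
  fst : Fin (order G ℕ.* order H) → Fin (order G)
  fst = quotient (order H)
  snd : Fin (order G ℕ.* order H) → Fin (order H)
  snd = remainder {order G} (order H)

-- G ^[1+ m ] is the (m + 1)-fold lexicographic product of G with itself.
_^[1+_] : Graph → ℕ → Graph
G ^[1+ zero  ] = G
G ^[1+ suc m ] = G ⟦ G ^[1+ m ] ⟧

Independent : (G : Graph) → Pred (Subset (order G)) 0ℓ
Independent G S = ∀ u v → u ∈ S → v ∈ S → ¬ Adj G u v

independent? : (G : Graph) → Decidable₁ (Independent G)
independent? G S = Fin.all? λ u → Fin.all? λ v →
  (u Subset.∈? S) →-dec ((v Subset.∈? S) →-dec ¬? (adj? G u v))

subsets : ∀ n → List (Subset n)
subsets zero    = [ [] ]
subsets (suc n) = map (outside ∷_) (subsets n) ++ map (inside ∷_) (subsets n)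

independentSets : (G : Graph) → List (Subset (order G))
independentSets G = filter (independent? G) (subsets (order G))

-- The default value 0 of max is harmless: the empty set is independent.
independenceNumber : Graph → ℕ
independenceNumber G = max 0 (map Subset.∣_∣ (independentSets G))

coefficient : Graph → ℕ → ℕ
coefficient G i = length (filter (λ S → Subset.∣ S ∣ ℕ.≟ i) (independentSets G))

independencePolynomial : Graph → ℂ → ℂ
independencePolynomial G z =
  foldr _+ᶜ_ (fromℕ 0)
    (map (λ i → fromℕ (coefficient G i) *ᶜ z ^ᶜ i) (upTo (suc (independenceNumber G))))

Zeros : Graph → Pred ℂ 0ℓ
Zeros G z = independencePolynomial G z ≈ fromℕ 0

-- 𝒜(G) = L.  Hausdorff limits are unique among closed sets only, so this is
-- meant for compact L.
IndependenceAttractor : Graph → Pred ℂ 0ℓ → Set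
IndependenceAttractor G L = HausdorffLimit (λ m → Zeros (G ^[1+ m ])) L

{-# OPTIONS --safe #-}
{-
Write P = I_G − 1.  Since I_{G[H]} = I_G ∘ (I_H − 1), the zeros of I_{Gᵐ} are the
points that the m-th iterate of P sends to −1.

Existence.  If I_H = 1 + Q with Q(z) = 4z + kz², then G = H[H] has P = Q ∘ Q, and
x = 2 + kz conjugates Q to T(x) = x² − 2.  All preimages of −1 stay in [−4/k,0]
because Q(z) ∈ [−4/k,0] forces z ∈ [−4/k,0].  They become dense: follow the orbit
of a rational x ∈ [−2,2] and pull 2 − k back along the branches ±√(2 + y) with the
signs of that orbit.  In terms of angles each step halves the distance, which is
expressed without trigonometry through 2 − 2cos(θ − φ), a root of
t² − (4 − xy)t + (x − y)² for x = 2cos θ, y = 2cos φ.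

Nonexistence.  If the zeros converge to J = [−4/k,0], then P maps J into J, and
the values of I_G at integers factor over a separation of G.  For k = 1 the
extremal property of T₄ together with the integrality of the leading coefficient
gives I_G(−2) = I_G(−4) = 1, which no nontrivial factorisation allows.  For k = 2
put t = z + 1 and f(t) = I_G(t − 1), so that |f| ≤ 1 on [−1,1].  If f(0) ≠ 0, the
values at t = 0, −1, −1/5 leave only f = (2t² − 1)², whose iterates have explicit
nonreal zeros away from J.  If f(0) = 0, the zeros of the iterates increase with m,
so all of them lie in J.  Then f(t) = t c(t); the quadratic cofactor of a root of c
has its roots, built by square roots, in [−1,1] too, and the finitely many c that
survive this and |f(±3/5)| ≤ 1 map some interval avoiding 0 into itself (or swap
two such), so the zeros cannot be dense in J.
-}
module Submission where

open import Level using (0ℓ)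
open import Algebra.Bundles using (CommutativeRing)
open import Data.Empty using (⊥; ⊥-elim)
open import Data.Integer as ℤ using (ℤ; +_)
import Data.Integer.Properties as ℤ
open import Data.Nat as ℕ using (ℕ; zero; suc)
import Data.Nat.Properties as ℕ
open import Data.Product using (∃-syntax; _×_; _,_; proj₁; proj₂)
open import Data.Rational as ℚ using (ℚ; 0ℚ; 1ℚ; ½)
import Data.Rational.Properties as ℚ
open import Data.Sum using (_⊎_; inj₁; inj₂)
open import Relation.Binary.PropositionalEquality as ≡ using (_≡_)
open import Relation.Nullary using (¬_; Dec; yes; no)
open import Relation.Binary using (Rel)

-- On these Cauchy reals `≤` is the negation of `<` and comparison is undecidable, which shapes both
-- halves. For existence a nearby zero must actually be produced, so branches of the square root may
-- be chosen only by signs of rational numbers; this is why the orbit of a rational point is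
-- followed and not that of the given point. Nonexistence ends in `⊥`, so case distinctions on
-- reals, reachability in the graph and the real root of the cubic c are all available under double
-- negation. Inequalities are certified by identities that a ring solver checks, and the root of c
-- is obtained from the dynamics without an intermediate value theorem. For k = 1 the extremal
-- points -2 ± √2 of the rescaled T₄ are irrational. They are replaced by -2 ± 7/5, and integrality
-- absorbs the resulting loss; points with denominator 5 are therefore evaluated in integers after
-- multiplication by 625.

module Rat where

  open import Data.Rational as ℚ hiding (*≡*; *≤*; *<*)
  open import Data.Rational.Unnormalised as ℚᵘ using (mkℚᵘ; *≡*; *≤*; *<*)
  import Data.Rational.Unnormalised.Properties as ℚᵘ
  open import Data.Rational.Solver using (module +-*-Solver)
  open import Relation.Binary.PropositionalEquality
  open import Relation.Nullary using (contradiction)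
  open import Relation.Nullary.Decidable using (True; toWitness)
  open +-*-Solver

  <⇒0<- : ∀ {p q} → p < q → 0ℚ < q - p
  <⇒0<- {p} {q} h = subst (_< q - p) (ℚ.+-inverseʳ p) (ℚ.+-monoˡ-< (- p) h)

  ≤⇒0≤- : ∀ {p q} → p ≤ q → 0ℚ ≤ q - p
  ≤⇒0≤- {p} {q} h = subst (_≤ q - p) (ℚ.+-inverseʳ p) (ℚ.+-monoˡ-≤ (- p) h)

  -- The format of most inequality proofs below, over ℚ and later over the reals: `d` is a sum of
  -- products of quantities known to be positive or nonnegative, and the solver checks the identity.
  0<-⇒< : ∀ {p q} d → 0ℚ < d → q - p ≡ d → p < q
  0<-⇒< {p} {q} d h e = subst₂ _<_ (ℚ.+-identityʳ p)
    (trans (cong (λ d → p + d) (sym e)) (solve 2 (λ p q → p :+ (q :- p) := q) refl p q))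
    (ℚ.+-monoʳ-< p h)

  0≤-⇒≤ : ∀ {p q} d → 0ℚ ≤ d → q - p ≡ d → p ≤ q
  0≤-⇒≤ {p} {q} d h e = subst₂ _≤_ (ℚ.+-identityʳ p)
    (trans (cong (λ d → p + d) (sym e)) (solve 2 (λ p q → p :+ (q :- p) := q) refl p q))
    (ℚ.+-monoʳ-≤ p h)

  infixr 6 _+⁺_ _+⁰_ _+⁺⁰_
  infixr 7 _*⁺_ _*⁰_

  _+⁺_ : ∀ {p q} → 0ℚ < p → 0ℚ < q → 0ℚ < p + q
  _+⁺_ = ℚ.+-mono-<

  _+⁰_ : ∀ {p q} → 0ℚ ≤ p → 0ℚ ≤ q → 0ℚ ≤ p + q
  _+⁰_ = ℚ.+-mono-≤

  _+⁺⁰_ : ∀ {p q} → 0ℚ < p → 0ℚ ≤ q → 0ℚ < p + q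
  _+⁺⁰_ = ℚ.+-mono-<-≤

  _*⁺_ : ∀ {p q} → 0ℚ < p → 0ℚ < q → 0ℚ < p * q
  _*⁺_ {p} {q} 0<p 0<q = subst (_< p * q) (ℚ.*-zeroʳ p)
    (ℚ.*-monoʳ-<-pos p {{positive 0<p}} 0<q)

  _*⁰_ : ∀ {p q} → 0ℚ ≤ p → 0ℚ ≤ q → 0ℚ ≤ p * q
  _*⁰_ {p} {q} 0≤p 0≤q = subst (_≤ p * q) (ℚ.*-zeroʳ p)
    (ℚ.*-monoˡ-≤-nonNeg p {{nonNegative 0≤p}} 0≤q)

  0<ₗ : ∀ q {_ : True (0ℚ ℚ.<? q)} → 0ℚ < q
  0<ₗ q {t} = toWitness t

  0≤ₗ : ∀ q {_ : True (0ℚ ℚ.≤? q)} → 0ℚ ≤ q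
  0≤ₗ q {t} = toWitness t

  ∣∣<⇒ : ∀ {p ε} → ∣ p ∣ < ε → p < ε × - p < ε
  ∣∣<⇒ {p} {ε} h = ℚ.≤-<-trans (p≤∣p∣ p) h
    , ℚ.≤-<-trans (subst (- p ≤_) (ℚ.∣-p∣≡∣p∣ p) (p≤∣p∣ (- p))) h
    where
    p≤∣p∣ : ∀ p → p ≤ ∣ p ∣
    p≤∣p∣ p with ℚ.≤-total 0ℚ p
    ... | inj₁ 0≤p = ℚ.≤-reflexive (sym (ℚ.0≤p⇒∣p∣≡p 0≤p))
    ... | inj₂ p≤0 = ℚ.≤-trans p≤0 (ℚ.0≤∣p∣ p)

  ⇒∣∣< : ∀ {p ε} → p < ε → - p < ε → ∣ p ∣ < ε
  ⇒∣∣< {p} {ε} h h' with ℚ.∣p∣≡p∨∣p∣≡-p p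
  ... | inj₁ e = subst (_< ε) (sym e) h
  ... | inj₂ e = subst (_< ε) (sym e) h'

  0≤p² : ∀ p → 0ℚ ≤ p * p
  0≤p² p with ℚ.≤-total 0ℚ p
  ... | inj₁ h = h *⁰ h
  ... | inj₂ h = subst (0ℚ ≤_) (solve 1 (λ p → :- p :* :- p := p :* p) refl p)
                   (ℚ.neg-antimono-≤ h *⁰ ℚ.neg-antimono-≤ h)

  ι : ℤ → ℚ
  ι n = n / 1

  private
    toℚᵘ-ι : ∀ n → toℚᵘ (ι n) ℚᵘ.≃ mkℚᵘ n 0
    toℚᵘ-ι n = ℚ.toℚᵘ-fromℚᵘ (mkℚᵘ n 0)

  ι-+ : ∀ m n → ι (m ℤ.+ n) ≡ ι m + ι n
  ι-+ m n = ℚ.toℚᵘ-injective (ℚᵘ.≃-trans (toℚᵘ-ι (m ℤ.+ n)) (ℚᵘ.≃-sym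
    (ℚᵘ.≃-trans (ℚ.toℚᵘ-homo-+ (ι m) (ι n))
    (ℚᵘ.≃-trans (ℚᵘ.+-cong (toℚᵘ-ι m) (toℚᵘ-ι n))
      (*≡* (cong (ℤ._* + 1) (cong₂ ℤ._+_ (ℤ.*-identityʳ m) (ℤ.*-identityʳ n))))))))

  ι-* : ∀ m n → ι (m ℤ.* n) ≡ ι m * ι n
  ι-* m n = ℚ.toℚᵘ-injective (ℚᵘ.≃-trans (toℚᵘ-ι (m ℤ.* n)) (ℚᵘ.≃-sym
    (ℚᵘ.≃-trans (ℚ.toℚᵘ-homo-* (ι m) (ι n))
      (ℚᵘ.*-cong (toℚᵘ-ι m) (toℚᵘ-ι n)))))

  ι-neg : ∀ m → ι (ℤ.- m) ≡ - ι m
  ι-neg m = ℚ.toℚᵘ-injective (ℚᵘ.≃-trans (toℚᵘ-ι (ℤ.- m)) (ℚᵘ.≃-sym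
    (ℚᵘ.≃-trans (ℚ.toℚᵘ-homo‿- (ι m)) (ℚᵘ.-‿cong (toℚᵘ-ι m)))))

  ι-≤⁻ : ∀ {m n} → ι m ≤ ι n → m ℤ.≤ n
  ι-≤⁻ {m} {n} h with ℚᵘ.≤-respʳ-≃ (toℚᵘ-ι n) (ℚᵘ.≤-respˡ-≃ (toℚᵘ-ι m) (ℚ.toℚᵘ-mono-≤ h))
  ... | *≤* e = subst₂ ℤ._≤_ (ℤ.*-identityʳ m) (ℤ.*-identityʳ n) e

  ι-≤ : ∀ {m n} → m ℤ.≤ n → ι m ≤ ι n
  ι-≤ {m} {n} h = ℚ.toℚᵘ-cancel-≤ (ℚᵘ.≤-respʳ-≃ (ℚᵘ.≃-sym (toℚᵘ-ι n))
    (ℚᵘ.≤-respˡ-≃ (ℚᵘ.≃-sym (toℚᵘ-ι m))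
      (*≤* (subst₂ ℤ._≤_ (sym (ℤ.*-identityʳ m)) (sym (ℤ.*-identityʳ n)) h))))

  0≤ι : ∀ n → 0ℚ ≤ ι (+ n)
  0≤ι n = ι-≤ {+ 0} {+ n} (ℤ.+≤+ ℕ.z≤n)

  ι-injective : ∀ {m n} → ι m ≡ ι n → m ≡ n
  ι-injective e = ℤ.≤-antisym (ι-≤⁻ (ℚ.≤-reflexive e)) (ι-≤⁻ (ℚ.≤-reflexive (sym e)))

  archimedean : ∀ q → ∃[ K ] q < ι (+ K)
  archimedean q@(mkℚ n d _) = suc ℤ.∣ n ∣ , ℚ.toℚᵘ-cancel-<
    (ℚᵘ.<-respʳ-≃ (ℚᵘ.≃-sym (toℚᵘ-ι (+ suc ℤ.∣ n ∣)))
      (*<* (subst (ℤ._< + suc ℤ.∣ n ∣ ℤ.* + suc d) (sym (ℤ.*-identityʳ n))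
        (ℤ.≤-<-trans (≤∣∣ n) (ℤ.+<+ (ℕ.≤-trans (ℕ.≤-reflexive (sym (ℕ.*-identityʳ _)))
          (ℕ.*-monoʳ-≤ (suc ℤ.∣ n ∣) (ℕ.s≤s ℕ.z≤n))))))))
    where
    ≤∣∣ : ∀ n → n ℤ.≤ + ℤ.∣ n ∣
    ≤∣∣ (+ n)      = ℤ.≤-refl
    ≤∣∣ ℤ.-[1+ n ] = ℤ.-≤+

  private
    -- Descends through the multiples of `h` to the last one whose square is at most `p`; comparing
    -- rationals is decidable.
    scan : ∀ {p} h → 0ℚ ≤ p → 0ℚ < h → ∀ K → p < (ι (+ K) * h) * (ι (+ K) * h) →
           ∃[ s ] (0ℚ ≤ s × s * s ≤ p × p < (s + h) * (s + h))
    scan h 0≤p 0<h zero lt = contradiction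
      (ℚ.<-≤-trans lt (ℚ.≤-reflexive (solve 1 (λ h → con 0ℚ :* h :* (con 0ℚ :* h) := con 0ℚ) refl h)))
      (λ p<0 → ℚ.<-irrefl refl (ℚ.≤-<-trans 0≤p p<0))
    scan {p} h 0≤p 0<h (suc K) lt with (ι (+ K) * h) * (ι (+ K) * h) ℚ.≤? p
    ... | no  ¬le = scan h 0≤p 0<h K (ℚ.≰⇒> ¬le)
    ... | yes le  = ι (+ K) * h , 0≤ι K *⁰ ℚ.<⇒≤ 0<h , le
      , subst (λ s → p < s * s) eq lt
      where
      eq : ι (+ suc K) * h ≡ ι (+ K) * h + h
      eq = trans (cong (_* h) (ι-+ (+ 1) (+ K)))
        (solve 2 (λ k h → (con 1ℚ :+ k) :* h := k :* h :+ h) refl (ι (+ K)) h)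

  -- With L bounding p/h² and L ≥ 1 one has p < (L h)².
  sqrt-approx : ∀ p h → 0ℚ ≤ p → 0ℚ < h →
                ∃[ s ] (0ℚ ≤ s × s * s ≤ p × p < (s + h) * (s + h))
  sqrt-approx p h 0≤p 0<h = scan h 0≤p 0<h (suc K) (0<-⇒< _ 
      ((<⇒0<- p/h<K *⁺ (0<h *⁺ 0<h)) +⁺⁰ ((k≥0 *⁰ k≥0 +⁰ (k≥0 +⁰ 0≤ₗ 1ℚ)) *⁰ h²≥0)) eq)
    where
    instance
      h-pos : Positive h
      h-pos = positive 0<h
      h-nonZero : NonZero h
      h-nonZero = ℚ.pos⇒nonZero h
    h⁻¹ = 1/ h
    arch = archimedean (p * (h⁻¹ * h⁻¹))
    K = proj₁ arch
    p/h<K = proj₂ arch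
    k≥0 : 0ℚ ≤ ι (+ K)
    k≥0 = 0≤ι K
    h²≥0 = ℚ.<⇒≤ 0<h *⁰ ℚ.<⇒≤ 0<h
    eq : ι (+ suc K) * h * (ι (+ suc K) * h) - p
       ≡ (ι (+ K) - p * (h⁻¹ * h⁻¹)) * (h * h) + (ι (+ K) * ι (+ K) + (ι (+ K) + 1ℚ)) * (h * h)
    eq = trans (cong₂ (λ k q → k * h * (k * h) - q) (ι-+ (+ 1) (+ K)) (p≡))
      (solve 4 (λ k h i p → (con 1ℚ :+ k) :* h :* ((con 1ℚ :+ k) :* h) :- p :* (h :* i) :* (h :* i)
           := (k :- p :* (i :* i)) :* (h :* h) :+ (k :* k :+ (k :+ con 1ℚ)) :* (h :* h)) refl
        (ι (+ K)) h h⁻¹ p)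
      where
      p≡ : p ≡ p * (h * h⁻¹) * (h * h⁻¹)
      p≡ = sym (trans (cong (λ u → p * u * u) (ℚ.*-inverseʳ h))
             (trans (ℚ.*-identityʳ _) (ℚ.*-identityʳ p)))

  abstract
    -- Division ε/B, opaque so that only the equation `B * δ ≡ ε` is ever used.
    shrink : ∀ {B} → 0ℚ < B → ∀ {ε} → 0ℚ < ε → ∃[ δ ] (0ℚ < δ × B * δ ≡ ε)
    shrink {B} 0<B {ε} 0<ε = 1/ B * ε
      , ℚ.positive⁻¹ (1/ B) {{ℚ.1/pos⇒pos B}} *⁺ 0<ε
      , trans (sym (ℚ.*-assoc B (1/ B) ε)) (trans (cong (_* ε) (ℚ.*-inverseʳ B)) (ℚ.*-identityˡ ε))
      where
      instance
        B-pos : Positive B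
        B-pos = positive 0<B
        B-nonZero : NonZero B
        B-nonZero = ℚ.pos⇒nonZero B

-- The interface of the real numbers and its Cauchy model

open import Relation.Binary using (Rel)

-- Everything about the reals that the argument needs, with the representation hidden. There is no
-- trichotomy: `tight` recovers equality from two negations, and `approx` replaces comparison of
-- reals by comparison of rationals. Completeness enters through `sqrt` alone.
record RealField : Set₁ where
  field
    commutativeRing : CommutativeRing 0ℓ 0ℓ
  open CommutativeRing commutativeRing public
  infix 4 _<_ _≤_
  field
    _<_       : Rel Carrier 0ℓ
    ι         : ℚ → Carrier
    ι-+       : ∀ p q → ι (p ℚ.+ q) ≈ ι p + ι q
    ι-*       : ∀ p q → ι (p ℚ.* q) ≈ ι p * ι q
    ι-neg     : ∀ p → ι (ℚ.- p) ≈ - ι p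
    ι-0       : ι 0ℚ ≈ 0#
    ι-1       : ι 1ℚ ≈ 1#
    ι-<       : ∀ {p q} → p ℚ.< q → ι p < ι q
    <-resp-≈  : ∀ {x x′ y y′} → x ≈ x′ → y ≈ y′ → x < y → x′ < y′
    <-irrefl  : ∀ {x} → ¬ x < x
    <-trans   : ∀ {x y z} → x < y → y < z → x < z
    +-monoˡ-< : ∀ {x y} z → x < y → x + z < y + z
    *-pos     : ∀ {x y} → ι 0ℚ < x → ι 0ℚ < y → ι 0ℚ < x * y
    tight     : ∀ {x y} → ¬ x < y → ¬ y < x → x ≈ y
    approx    : ∀ x ε → 0ℚ ℚ.< ε → ∃[ q ] (ι (q ℚ.- ε) < x × x < ι (q ℚ.+ ε))
    archimedean : ∀ {x} → ι 0ℚ < x → ∃[ ε ] (0ℚ ℚ.< ε × ι ε < x)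
  _≤_ : Rel Carrier 0ℓ
  x ≤ y = ¬ y < x
  field
    sqrt      : ∀ x → ι 0ℚ ≤ x → ∃[ s ] (ι 0ℚ ≤ s × s * s ≈ x)

module RealNumbers where

  open import Defs
  open Rat
  open import Data.Rational using (_+_; _*_; -_; _-_; _<_; ∣_∣; positive)
  open import Data.Rational.Solver using (module +-*-Solver)
  open import Relation.Binary.PropositionalEquality
  open import Relation.Nullary using (contradiction)
  open +-*-Solver

  half : ∀ {ε} → 0ℚ < ε → 0ℚ < ½ * ε
  half = 0<ₗ ½ *⁺_

  ≐⇒≈ : ∀ x y → (∀ n → seq x n ≡ seq y n) → x ≈ᴿ y
  ≐⇒≈ x y h ε 0<ε = 0 , λ n _ →
    subst (λ q → ∣ seq x n - q ∣ < ε) (h n)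
      (subst (λ q → ∣ q ∣ < ε) (sym (ℚ.+-inverseʳ (seq x n))) 0<ε)

  ≈ᴿ-refl : ∀ {x} → x ≈ᴿ x
  ≈ᴿ-refl {x} = ≐⇒≈ x x λ _ → refl

  ≈ᴿ-sym : ∀ {x y} → x ≈ᴿ y → y ≈ᴿ x
  ≈ᴿ-sym {x} {y} h ε 0<ε with h ε 0<ε
  ... | N , b = N , λ n n≥N → subst (_< ε)
    (trans (sym (ℚ.∣-p∣≡∣p∣ _)) (cong ∣_∣ (solve 2 (λ a b → :- (a :- b) := b :- a) refl (seq x n) (seq y n))))
    (b n n≥N)

  ∣+∣< : ∀ {p q ε} → ∣ p ∣ < ½ * ε → ∣ q ∣ < ½ * ε → ∣ p + q ∣ < ε
  ∣+∣< {p} {q} {ε} hp hq = subst (∣ p + q ∣ <_)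
    (solve 1 (λ ε → con ½ :* ε :+ con ½ :* ε := ε) refl ε)
    (ℚ.≤-<-trans (ℚ.∣p+q∣≤∣p∣+∣q∣ p q) (ℚ.+-mono-< hp hq))

  ≈ᴿ-trans : ∀ {x y z} → x ≈ᴿ y → y ≈ᴿ z → x ≈ᴿ z
  ≈ᴿ-trans {x} {y} {z} h k ε 0<ε with h (½ * ε) (half 0<ε) | k (½ * ε) (half 0<ε)
  ... | M , b | N , c = M ℕ.⊔ N , λ n n≥ → subst (λ d → ∣ d ∣ < ε)
    (solve 3 (λ x y z → (x :- y) :+ (y :- z) := x :- z) refl (seq x n) (seq y n) (seq z n))
    (∣+∣< (b n (ℕ.m⊔n≤o⇒m≤o M N n≥)) (c n (ℕ.m⊔n≤o⇒n≤o M N n≥)))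

  +ᴿ-cong : ∀ {x x′ y y′} → x ≈ᴿ x′ → y ≈ᴿ y′ → x +ᴿ y ≈ᴿ x′ +ᴿ y′
  +ᴿ-cong {x} {x′} {y} {y′} h k ε 0<ε with h (½ * ε) (half 0<ε) | k (½ * ε) (half 0<ε)
  ... | M , b | N , c = M ℕ.⊔ N , λ n n≥ → subst (λ d → ∣ d ∣ < ε)
    (solve 4 (λ x x′ y y′ → (x :- x′) :+ (y :- y′) := (x :+ y) :- (x′ :+ y′)) refl
      (seq x n) (seq x′ n) (seq y n) (seq y′ n))
    (∣+∣< (b n (ℕ.m⊔n≤o⇒m≤o M N n≥)) (c n (ℕ.m⊔n≤o⇒n≤o M N n≥)))

  -ᴿ-cong : ∀ {x y} → x ≈ᴿ y → -ᴿ x ≈ᴿ -ᴿ y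
  -ᴿ-cong {x} {y} h ε 0<ε with h ε 0<ε
  ... | N , b = N , λ n n≥N → subst (_< ε)
    (trans (sym (ℚ.∣-p∣≡∣p∣ _)) (cong ∣_∣ (solve 2 (λ a b → :- (a :- b) := :- a :- :- b) refl (seq x n) (seq y n))))
    (b n n≥N)

  abstract
    bound : ∀ x → ∃[ B ] (0ℚ < B × ∃[ N ] (∀ n → n ℕ.≥ N → ∣ seq x n ∣ < B))
    bound x with cauchy x 1ℚ (0<ₗ 1ℚ)
    ... | N , h = 1ℚ + ∣ seq x N ∣ , 0<ₗ 1ℚ +⁺⁰ ℚ.0≤∣p∣ (seq x N) , N , λ n n≥N →
      subst (λ d → ∣ d ∣ < 1ℚ + ∣ seq x N ∣)
        (solve 2 (λ p q → (p :- q) :+ q := p) refl (seq x n) (seq x N))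
        (ℚ.≤-<-trans (ℚ.∣p+q∣≤∣p∣+∣q∣ (seq x n - seq x N) (seq x N))
          (ℚ.+-monoˡ-< ∣ seq x N ∣ (h n N n≥N ℕ.≤-refl)))

  ∣*∣< : ∀ {p q B δ} → 0ℚ < B → ∣ p ∣ < B → ∣ q ∣ < δ → ∣ p * q ∣ < B * δ
  ∣*∣< {p} {q} {B} {δ} 0<B hp hq = subst (_< B * δ) (sym (ℚ.∣p*q∣≡∣p∣*∣q∣ p q))
    (ℚ.≤-<-trans
      (ℚ.*-monoʳ-≤-nonNeg ∣ q ∣ {{ℚ.nonNegative (ℚ.0≤∣p∣ q)}} (ℚ.<⇒≤ hp))
      (ℚ.*-monoʳ-<-pos B {{positive 0<B}} hq))

  *ᴿ-congˡ : ∀ {x y y′} → y ≈ᴿ y′ → x *ᴿ y ≈ᴿ x *ᴿ y′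
  *ᴿ-congˡ {x} {y} {y′} h ε 0<ε =
    let B , 0<B , M , b = bound x
        δ , 0<δ , Bδ≡ε = shrink 0<B 0<ε
        N , c = h δ 0<δ
    in M ℕ.⊔ N , λ n n≥ → subst₂ (λ d ε → ∣ d ∣ < ε)
      (solve 3 (λ x y y′ → x :* (y :- y′) := x :* y :- x :* y′) refl (seq x n) (seq y n) (seq y′ n)) Bδ≡ε
      (∣*∣< 0<B (b n (ℕ.m⊔n≤o⇒m≤o M N n≥)) (c n (ℕ.m⊔n≤o⇒n≤o M N n≥)))

  *ᴿ-comm : ∀ x y → x *ᴿ y ≈ᴿ y *ᴿ x
  *ᴿ-comm x y = ≐⇒≈ (x *ᴿ y) (y *ᴿ x) λ n → ℚ.*-comm (seq x n) (seq y n)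

  *ᴿ-cong : ∀ {x x′ y y′} → x ≈ᴿ x′ → y ≈ᴿ y′ → x *ᴿ y ≈ᴿ x′ *ᴿ y′
  *ᴿ-cong {x} {x′} {y} {y′} h k = ≈ᴿ-trans {x *ᴿ y} {x *ᴿ y′} {x′ *ᴿ y′} (*ᴿ-congˡ {x} {y} {y′} k)
    (≈ᴿ-trans {x *ᴿ y′} {y′ *ᴿ x} {x′ *ᴿ y′} (*ᴿ-comm x y′) (≈ᴿ-trans {y′ *ᴿ x} {y′ *ᴿ x′} {x′ *ᴿ y′} (*ᴿ-congˡ {y′} {x} {x′} h) (*ᴿ-comm y′ x′)))

  ℝ-ring : CommutativeRing _ _
  ℝ-ring = record
    { Carrier = ℝ ; _≈_ = _≈ᴿ_ ; _+_ = _+ᴿ_ ; _*_ = _*ᴿ_ ; -_ = -ᴿ_ ; 0# = fromℚ 0ℚ ; 1# = fromℚ 1ℚ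
    ; isCommutativeRing = record
      { isRing = record
        { +-isAbelianGroup = record
          { isGroup = record
            { isMonoid = record
              { isSemigroup = record
                { isMagma = record
                  { isEquivalence = record
                    { refl  = λ {x} → ≈ᴿ-refl {x}
                    ; sym   = λ {x} {y} → ≈ᴿ-sym {x} {y}
                    ; trans = λ {x} {y} {z} → ≈ᴿ-trans {x} {y} {z} }
                  ; ∙-cong = λ {x} {x′} {y} {y′} → +ᴿ-cong {x} {x′} {y} {y′} }
                ; assoc = λ x y z → ≐⇒≈ (x +ᴿ y +ᴿ z) (x +ᴿ (y +ᴿ z)) λ n → ℚ.+-assoc (seq x n) (seq y n) (seq z n) }
              ; identity = (λ x → ≐⇒≈ (fromℚ 0ℚ +ᴿ x) x λ n → ℚ.+-identityˡ (seq x n))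
                         , (λ x → ≐⇒≈ (x +ᴿ fromℚ 0ℚ) x λ n → ℚ.+-identityʳ (seq x n)) }
            ; inverse = (λ x → ≐⇒≈ (-ᴿ x +ᴿ x) (fromℚ 0ℚ) λ n → ℚ.+-inverseˡ (seq x n))
                      , (λ x → ≐⇒≈ (x +ᴿ -ᴿ x) (fromℚ 0ℚ) λ n → ℚ.+-inverseʳ (seq x n))
            ; ⁻¹-cong = λ {x} {y} → -ᴿ-cong {x} {y} }
          ; comm = λ x y → ≐⇒≈ (x +ᴿ y) (y +ᴿ x) λ n → ℚ.+-comm (seq x n) (seq y n) }
        ; *-cong = λ {x} {x′} {y} {y′} → *ᴿ-cong {x} {x′} {y} {y′}
        ; *-assoc = λ x y z → ≐⇒≈ (x *ᴿ y *ᴿ z) (x *ᴿ (y *ᴿ z)) λ n → ℚ.*-assoc (seq x n) (seq y n) (seq z n)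
        ; *-identity = (λ x → ≐⇒≈ (fromℚ 1ℚ *ᴿ x) x λ n → ℚ.*-identityˡ (seq x n))
                     , (λ x → ≐⇒≈ (x *ᴿ fromℚ 1ℚ) x λ n → ℚ.*-identityʳ (seq x n))
        ; distrib = (λ x y z → ≐⇒≈ (x *ᴿ (y +ᴿ z)) (x *ᴿ y +ᴿ x *ᴿ z) λ n → ℚ.*-distribˡ-+ (seq x n) (seq y n) (seq z n))
                  , (λ x y z → ≐⇒≈ ((y +ᴿ z) *ᴿ x) (y *ᴿ x +ᴿ z *ᴿ x) λ n → ℚ.*-distribʳ-+ (seq x n) (seq y n) (seq z n)) }
      ; *-comm = *ᴿ-comm } }

  ¼ = ½ * ½

  <ᴿ-resp-≈ : ∀ {x x′ y y′} → x ≈ᴿ x′ → y ≈ᴿ y′ → x <ᴿ y → x′ <ᴿ y′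
  <ᴿ-resp-≈ {x} {x′} {y} {y′} h k (ε , 0<ε , N , b)
    with h (¼ * ε) (0<ₗ ¼ *⁺ 0<ε) | k (¼ * ε) (0<ₗ ¼ *⁺ 0<ε)
  ... | N₁ , b₁ | N₂ , b₂ = ½ * ε , half 0<ε , N ℕ.⊔ (N₁ ℕ.⊔ N₂) , λ n n≥ →
    let n≥′ = ℕ.m⊔n≤o⇒n≤o N (N₁ ℕ.⊔ N₂) n≥ in
    0≤-⇒≤ _ (≤⇒0≤- (b n (ℕ.m⊔n≤o⇒m≤o N (N₁ ℕ.⊔ N₂) n≥))
      +⁰ ℚ.<⇒≤ (<⇒0<- (proj₂ (∣∣<⇒ (b₁ n (ℕ.m⊔n≤o⇒m≤o N₁ N₂ n≥′))))
        +⁺ <⇒0<- (proj₁ (∣∣<⇒ (b₂ n (ℕ.m⊔n≤o⇒n≤o N₁ N₂ n≥′))))))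
      (solve 5 (λ x x′ y y′ ε → y′ :- (x′ :+ con ½ :* ε)
        := (y :- (x :+ ε)) :+ ((con ¼ :* ε :- :- (x :- x′)) :+ (con ¼ :* ε :- (y :- y′)))) refl
        (seq x n) (seq x′ n) (seq y n) (seq y′ n) ε)

  <ᴿ-irrefl : ∀ {x} → ¬ x <ᴿ x
  <ᴿ-irrefl {x} (ε , 0<ε , N , b) = ℚ.<-irrefl refl (ℚ.<-≤-trans 0<ε
    (0≤-⇒≤ _ (≤⇒0≤- (b N ℕ.≤-refl))
      (solve 2 (λ x ε → con 0ℚ :- ε := x :- (x :+ ε)) refl (seq x N) ε)))

  <ᴿ-trans : ∀ {x y z} → x <ᴿ y → y <ᴿ z → x <ᴿ z
  <ᴿ-trans {x} {y} {z} (ε , 0<ε , M , b) (δ , 0<δ , N , c) = ε , 0<ε , M ℕ.⊔ N , λ n n≥ →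
    0≤-⇒≤ _ (≤⇒0≤- (b n (ℕ.m⊔n≤o⇒m≤o M N n≥)) +⁰ ≤⇒0≤- (c n (ℕ.m⊔n≤o⇒n≤o M N n≥)) +⁰ ℚ.<⇒≤ 0<δ)
      (solve 5 (λ x y z ε δ → z :- (x :+ ε) := (y :- (x :+ ε)) :+ ((z :- (y :+ δ)) :+ δ)) refl
        (seq x n) (seq y n) (seq z n) ε δ)

  +ᴿ-monoˡ-< : ∀ {x y} z → x <ᴿ y → x +ᴿ z <ᴿ y +ᴿ z
  +ᴿ-monoˡ-< {x} {y} z (ε , 0<ε , N , b) = ε , 0<ε , N , λ n n≥ →
    0≤-⇒≤ _ (≤⇒0≤- (b n n≥))
      (solve 4 (λ x y z ε → y :+ z :- (x :+ z :+ ε) := y :- (x :+ ε)) refl (seq x n) (seq y n) (seq z n) ε)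

  *ᴿ-pos : ∀ {x y} → fromℚ 0ℚ <ᴿ x → fromℚ 0ℚ <ᴿ y → fromℚ 0ℚ <ᴿ x *ᴿ y
  *ᴿ-pos {x} {y} (ε , 0<ε , M , b) (δ , 0<δ , N , c) = ε * δ , 0<ε *⁺ 0<δ , M ℕ.⊔ N , λ n n≥ →
    *-lower (seq x n) (seq y n) (b n (ℕ.m⊔n≤o⇒m≤o M N n≥)) (c n (ℕ.m⊔n≤o⇒n≤o M N n≥))
    where
    *-lower : ∀ p q → 0ℚ + ε ℚ.≤ p → 0ℚ + δ ℚ.≤ q → 0ℚ + ε * δ ℚ.≤ p * q
    *-lower p q h k = 0≤-⇒≤ _
      (≤⇒0≤- h *⁰ ≤⇒0≤- k +⁰ ≤⇒0≤- h *⁰ ℚ.<⇒≤ 0<δ +⁰ ≤⇒0≤- k *⁰ ℚ.<⇒≤ 0<ε)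
      (solve 4 (λ x y ε δ → x :* y :- (con 0ℚ :+ ε :* δ)
        := (x :- (con 0ℚ :+ ε)) :* (y :- (con 0ℚ :+ δ))
           :+ ((x :- (con 0ℚ :+ ε)) :* δ :+ (y :- (con 0ℚ :+ δ)) :* ε)) refl p q ε δ)

  fromℚ-< : ∀ {p q} → p < q → fromℚ p <ᴿ fromℚ q
  fromℚ-< {p} {q} h = q - p , <⇒0<- h , 0 , λ _ _ →
    ℚ.≤-reflexive (solve 2 (λ p q → p :+ (q :- p) := q) refl p q)

  ⅛ = ½ * ¼

  -- Makes a negated inequality quantitative. One rational comparison at an index where both
  -- sequences have settled within ε/8 decides: a gap of at least ε/2 there would persist as a gap
  -- ε/4 and prove x < y, and a smaller one stays below ε.
  ≮ᴿ⇒ : ∀ {x y} → ¬ x <ᴿ y → ∀ ε → 0ℚ < ε →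
        ∃[ N ] (∀ n → n ℕ.≥ N → seq y n - seq x n < ε)
  ≮ᴿ⇒ {x} {y} x≮y ε 0<ε
    with cauchy x (⅛ * ε) (0<ₗ ⅛ *⁺ 0<ε) | cauchy y (⅛ * ε) (0<ₗ ⅛ *⁺ 0<ε)
  ... | M , b | N , c with seq y (M ℕ.⊔ N) - seq x (M ℕ.⊔ N) ℚ.<? ½ * ε
  ... | yes lt = M ℕ.⊔ N , λ n n≥ → 0<-⇒< _
    (<⇒0<- (proj₁ (∣∣<⇒ (c n (M ℕ.⊔ N) (ℕ.m⊔n≤o⇒n≤o M N n≥) (ℕ.m≤n⊔m M N))))
      +⁺ <⇒0<- (proj₁ (∣∣<⇒ (b (M ℕ.⊔ N) n (ℕ.m≤m⊔n M N) (ℕ.m⊔n≤o⇒m≤o M N n≥))))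
      +⁺ <⇒0<- lt +⁺ 0<ₗ ¼ *⁺ 0<ε)
    (solve 5 (λ x x′ y y′ ε → ε :- (y :- x)
        := (con ⅛ :* ε :- (y :- y′)) :+ ((con ⅛ :* ε :- (x′ :- x)) :+ ((con ½ :* ε :- (y′ :- x′)) :+ con ¼ :* ε))) refl
      (seq x n) (seq x (M ℕ.⊔ N)) (seq y n) (seq y (M ℕ.⊔ N)) ε)
  ... | no ¬lt = contradiction
    (¼ * ε , 0<ₗ ¼ *⁺ 0<ε , M ℕ.⊔ N , λ n n≥ → 0≤-⇒≤ _
      (≤⇒0≤- (ℚ.≮⇒≥ ¬lt)
        +⁰ ℚ.<⇒≤ (<⇒0<- (proj₁ (∣∣<⇒ (c (M ℕ.⊔ N) n (ℕ.m≤n⊔m M N) (ℕ.m⊔n≤o⇒n≤o M N n≥)))))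
        +⁰ ℚ.<⇒≤ (<⇒0<- (proj₁ (∣∣<⇒ (b n (M ℕ.⊔ N) (ℕ.m⊔n≤o⇒m≤o M N n≥) (ℕ.m≤m⊔n M N))))))
      (solve 5 (λ x x′ y y′ ε → y :- (x :+ con ¼ :* ε)
        := ((y′ :- x′) :- con ½ :* ε) :+ ((con ⅛ :* ε :- (y′ :- y)) :+ (con ⅛ :* ε :- (x :- x′)))) refl
        (seq x n) (seq x (M ℕ.⊔ N)) (seq y n) (seq y (M ℕ.⊔ N)) ε))
    x≮y

  ≈ᴿ-tight : ∀ {x y} → ¬ x <ᴿ y → ¬ y <ᴿ x → x ≈ᴿ y
  ≈ᴿ-tight {x} {y} x≮y y≮x ε 0<ε =
    let M , b = ≮ᴿ⇒ {x} {y} x≮y ε 0<ε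
        N , c = ≮ᴿ⇒ {y} {x} y≮x ε 0<ε
    in M ℕ.⊔ N , λ n n≥ → ⇒∣∣< (c n (ℕ.m⊔n≤o⇒n≤o M N n≥))
      (subst (_< ε) (solve 2 (λ x y → y :- x := :- (x :- y)) refl (seq x n) (seq y n))
        (b n (ℕ.m⊔n≤o⇒m≤o M N n≥)))

  approxᴿ : ∀ x ε → 0ℚ < ε → ∃[ q ] (fromℚ (q - ε) <ᴿ x × x <ᴿ fromℚ (q + ε))
  approxᴿ x ε 0<ε with cauchy x (½ * ε) (half 0<ε)
  ... | N , b = seq x N
    , (½ * ε , half 0<ε , N , λ n n≥ → 0≤-⇒≤ _ (ℚ.<⇒≤ (<⇒0<- (proj₁ (∣∣<⇒ (b N n ℕ.≤-refl n≥)))))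
        (solve 3 (λ x x′ ε → x :- (x′ :- ε :+ con ½ :* ε) := con ½ :* ε :- (x′ :- x)) refl (seq x n) (seq x N) ε))
    , (½ * ε , half 0<ε , N , λ n n≥ → 0≤-⇒≤ _ (ℚ.<⇒≤ (<⇒0<- (proj₁ (∣∣<⇒ (b n N n≥ ℕ.≤-refl)))))
        (solve 3 (λ x x′ ε → x′ :+ ε :- (x :+ con ½ :* ε) := con ½ :* ε :- (x :- x′)) refl (seq x n) (seq x N) ε))

  archimedeanᴿ : ∀ {x} → fromℚ 0ℚ <ᴿ x → ∃[ ε ] (0ℚ < ε × fromℚ ε <ᴿ x)
  archimedeanᴿ {x} (ε , 0<ε , N , b) = ½ * ε , half 0<ε , ½ * ε , half 0<ε , N , λ n n≥ →
    0≤-⇒≤ _ (≤⇒0≤- (b n n≥))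
      (solve 2 (λ x ε → x :- (con ½ :* ε :+ con ½ :* ε) := x :- (con 0ℚ :+ ε)) refl (seq x n) ε)

  module Sqrt (x : ℝ) (0≤x : ¬ x <ᴿ fromℚ 0ℚ) where

    suc>0 : ∀ n → 0ℚ < ℚ.1ℚ + ι (+ n)
    suc>0 n = 0<ₗ 1ℚ +⁺⁰ 0≤ι n

    abstract
      mesh : ℕ → ℚ
      mesh n = proj₁ (shrink (suc>0 n) (0<ₗ 1ℚ))

      0<mesh : ∀ n → 0ℚ < mesh n
      0<mesh n = proj₁ (proj₂ (shrink (suc>0 n) (0<ₗ 1ℚ)))

      mesh-eq : ∀ n → (1ℚ + ι (+ n)) * mesh n ≡ 1ℚ
      mesh-eq n = proj₂ (proj₂ (shrink (suc>0 n) (0<ₗ 1ℚ)))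

      mesh-small : ∀ ε → 0ℚ < ε → ∃[ N ] (∀ n → n ℕ.≥ N → mesh n < ε)
      mesh-small ε 0<ε =
        let e , 0<e , εe≡1 = shrink 0<ε (0<ₗ 1ℚ)
            K , e<K = archimedean e
        in K , λ n n≥K → ℚ.≰⇒> λ ε≤h → ℚ.<-irrefl refl (0<-⇒< {1ℚ} {1ℚ} _
          ((<⇒0<- e<K +⁺⁰ (≤⇒0≤- (ι-≤ (ℤ.+≤+ n≥K)) +⁰ 0≤ₗ 1ℚ)) *⁺ 0<ε +⁺⁰ ℚ.<⇒≤ (suc>0 n) *⁰ ≤⇒0≤- ε≤h)
          (trans (cong₂ _-_ (sym (mesh-eq n)) (sym εe≡1))
            (solve 5 (λ n k h e ε → (con 1ℚ :+ n) :* h :- ε :* e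
                := ((k :- e) :+ ((n :- k) :+ con 1ℚ)) :* ε :+ (con 1ℚ :+ n) :* (h :- ε)) refl
              (ι (+ n)) (ι (+ K)) (mesh n) e ε)))

    -- The hypothesis bounds the terms of `x` from below only in the limit, so they are cut off at 0
    -- before a root is taken.
    part : ℕ → ℚ
    part n = 0ℚ ℚ.⊔ seq x n

    abstract
      root : ∀ n → ∃[ s ] (0ℚ ℚ.≤ s × s * s ℚ.≤ part n × part n < (s + mesh n) * (s + mesh n))
      root n = sqrt-approx (part n) (mesh n) (ℚ.p≤p⊔q 0ℚ (seq x n)) (0<mesh n)

    s : ℕ → ℚ
    s n = proj₁ (root n)

    0≤s : ∀ n → 0ℚ ℚ.≤ s n
    0≤s n = proj₁ (proj₂ (root n))

    s²≤ : ∀ n → s n * s n ℚ.≤ part n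
    s²≤ n = proj₁ (proj₂ (proj₂ (root n)))

    part< : ∀ n → part n < (s n + mesh n) * (s n + mesh n)
    part< n = proj₂ (proj₂ (proj₂ (root n)))

    part-lip : ∀ m n {δ} → 0ℚ < δ → seq x m - seq x n < δ → part m - part n < δ
    part-lip m n {δ} 0<δ h with ℚ.≤-total 0ℚ (seq x m)
    ... | inj₁ 0≤xm = subst (λ p → p - part n < δ) (sym (ℚ.p≤q⇒p⊔q≡q 0≤xm))
            (ℚ.≤-<-trans (ℚ.+-monoʳ-≤ (seq x m) (ℚ.neg-antimono-≤ (ℚ.p≤q⊔p 0ℚ (seq x n)))) h)
    ... | inj₂ xm≤0 = subst (λ p → p - part n < δ) (sym (ℚ.p≥q⇒p⊔q≡p xm≤0))
            (ℚ.≤-<-trans (ℚ.+-monoʳ-≤ 0ℚ (ℚ.neg-antimono-≤ (ℚ.p≤p⊔q 0ℚ (seq x n)))) 0<δ)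

    -- The square root is Hölder continuous of order 1/2: if the roots differed by 2γ, their squares
    -- would differ by at least γ², even after allowing for the mesh.
    s-lip : ∀ m n {γ} → 0ℚ < γ → part m - part n < γ * γ → mesh n < γ → s m - s n < γ + γ
    s-lip m n {γ} 0<γ dp hn = ℚ.≰⇒> λ le → ℚ.<-irrefl refl (0<-⇒< {0ℚ} {0ℚ} _
      (<⇒0<- dp +⁺⁰ (≤⇒0≤- (s²≤ m) +⁰ ℚ.<⇒≤ (<⇒0<- (part< n))
        +⁰ ≤⇒0≤- le *⁰ (0≤s m +⁰ 0≤s n +⁰ (ℚ.<⇒≤ 0<γ +⁰ ℚ.<⇒≤ 0<γ))
        +⁰ ℚ.<⇒≤ (<⇒0<- hn) *⁰ (0≤s n +⁰ (0≤s n +⁰ (ℚ.<⇒≤ (0<mesh n) +⁰ ℚ.<⇒≤ 0<γ)))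
        +⁰ (ℚ.<⇒≤ 0<γ *⁰ (0≤s n +⁰ 0≤s n) +⁰ (ℚ.<⇒≤ 0<γ *⁰ (ℚ.<⇒≤ 0<γ +⁰ ℚ.<⇒≤ 0<γ)))))
      (solve 6 (λ sm sn pm pn h γ → con 0ℚ :- con 0ℚ
         := (γ :* γ :- (pm :- pn)) :+ ((pm :- sm :* sm) :+ (((sn :+ h) :* (sn :+ h) :- pn)
            :+ (((sm :- sn) :- (γ :+ γ)) :* (sm :+ (sn :+ (γ :+ γ)))
            :+ ((γ :- h) :* (sn :+ (sn :+ (h :+ γ)))
            :+ (γ :* (sn :+ sn) :+ γ :* (γ :+ γ))))))) refl
        (s m) (s n) (part m) (part n) (mesh n) γ))

    result : ℝ
    result = mkℝ s λ ε 0<ε →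
      let γ = ½ * ε
          0<γ = half 0<ε
          M , b = cauchy x (γ * γ) (0<γ *⁺ 0<γ)
          N , c = mesh-small γ 0<γ
          ≤ε : ∀ m n → m ℕ.≥ M ℕ.⊔ N → n ℕ.≥ M ℕ.⊔ N → s m - s n < ε
          ≤ε m n m≥ n≥ = subst (s m - s n <_) (solve 1 (λ ε → con ½ :* ε :+ con ½ :* ε := ε) refl ε)
            (s-lip m n 0<γ (part-lip m n (0<γ *⁺ 0<γ)
                (proj₁ (∣∣<⇒ (b m n (ℕ.m⊔n≤o⇒m≤o M N m≥) (ℕ.m⊔n≤o⇒m≤o M N n≥)))))
              (c n (ℕ.m⊔n≤o⇒n≤o M N n≥)))
      in M ℕ.⊔ N , λ m n m≥ n≥ → ⇒∣∣< (≤ε m n m≥ n≥)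
        (subst (_< ε) (solve 2 (λ a b → b :- a := :- (a :- b)) refl (s m) (s n)) (≤ε n m n≥ m≥))

    0≤result : ¬ result <ᴿ fromℚ 0ℚ
    0≤result (ε , 0<ε , N , b) = ℚ.<-irrefl refl (0<-⇒< {0ℚ} {0ℚ} _
      (0<ε +⁺⁰ (0≤s N +⁰ ≤⇒0≤- (b N ℕ.≤-refl)))
      (solve 2 (λ s ε → con 0ℚ :- con 0ℚ := ε :+ (s :+ (con 0ℚ :- (s :+ ε)))) refl (s N) ε))

    result² : result *ᴿ result ≈ᴿ x
    result² ε 0<ε =
      let B , 0<B , N₁ , b = bound result
          -- The factor 2B + 1 bounds 2s + h in (s + h)² - s² = h(2s + h), since s < B and h < 1.
          δ , 0<δ , Bδ≡ε = shrink (0<B +⁺ (0<B +⁺ 0<ₗ 1ℚ)) 0<ε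
          N₂ , c = mesh-small δ 0<δ
          N₃ , d = mesh-small 1ℚ (0<ₗ 1ℚ)
          N₄ , e = ≮ᴿ⇒ {x} {fromℚ 0ℚ} 0≤x ε 0<ε
          N₁₂ = N₁ ℕ.⊔ N₂
          N₃₄ = N₃ ℕ.⊔ N₄
      in N₁₂ ℕ.⊔ N₃₄ , λ n n≥ →
        let n≥₁₂ = ℕ.m⊔n≤o⇒m≤o N₁₂ N₃₄ n≥
            n≥₃₄ = ℕ.m⊔n≤o⇒n≤o N₁₂ N₃₄ n≥
        in ⇒∣∣< (upper n (e n (ℕ.m⊔n≤o⇒n≤o N₃ N₄ n≥₃₄)))
          (lower n Bδ≡ε (proj₁ (∣∣<⇒ (b n (ℕ.m⊔n≤o⇒m≤o N₁ N₂ n≥₁₂)))) (c n (ℕ.m⊔n≤o⇒n≤o N₁ N₂ n≥₁₂))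
            (d n (ℕ.m⊔n≤o⇒m≤o N₃ N₄ n≥₃₄)) 0<B)
      where
      upper : ∀ n → 0ℚ - seq x n < ε → s n * s n - seq x n < ε
      upper n h with ℚ.≤-total 0ℚ (seq x n)
      ... | inj₁ 0≤xn = ℚ.≤-<-trans (ℚ.+-monoˡ-≤ (- seq x n) (s²≤ n))
              (subst (λ p → p - seq x n < ε) (sym (ℚ.p≤q⇒p⊔q≡q 0≤xn))
                (subst (_< ε) (sym (ℚ.+-inverseʳ (seq x n))) 0<ε))
      ... | inj₂ xn≤0 = ℚ.≤-<-trans (ℚ.+-monoˡ-≤ (- seq x n) (s²≤ n))
              (subst (λ p → p - seq x n < ε) (sym (ℚ.p≥q⇒p⊔q≡p xn≤0)) h)
      lower : ∀ n {B δ} → (B + (B + 1ℚ)) * δ ≡ ε → s n < B → mesh n < δ → mesh n < 1ℚ → 0ℚ < B →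
              - (s n * s n - seq x n) < ε
      lower n {B} {δ} eq sB hδ h1 0<B = 0<-⇒< _
        (<⇒0<- (part< n) +⁺⁰ (≤⇒0≤- (ℚ.p≤q⊔p 0ℚ (seq x n))
          +⁰ (ℚ.<⇒≤ (<⇒0<- hδ) *⁰ (ℚ.<⇒≤ 0<B +⁰ (ℚ.<⇒≤ 0<B +⁰ 0≤ₗ 1ℚ)))
          +⁰ ℚ.<⇒≤ (0<mesh n) *⁰ (ℚ.<⇒≤ (<⇒0<- sB) +⁰ (ℚ.<⇒≤ (<⇒0<- sB) +⁰ ℚ.<⇒≤ (<⇒0<- h1)))))
        (trans (cong (_- - (s n * s n - seq x n)) (sym eq))
          (solve 6 (λ s x p h B δ → (B :+ (B :+ con 1ℚ)) :* δ :- :- (s :* s :- x)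
             := ((s :+ h) :* (s :+ h) :- p) :+ ((p :- x)
               :+ ((δ :- h) :* (B :+ (B :+ con 1ℚ))
               :+ h :* ((B :- s) :+ ((B :- s) :+ (con 1ℚ :- h)))))) refl
            (s n) (seq x n) (part n) (mesh n) B δ))

  realField : RealField
  realField = record
    { commutativeRing = ℝ-ring
    ; _<_       = _<ᴿ_
    ; ι         = fromℚ
    ; ι-+       = λ p q → ≐⇒≈ (fromℚ (p + q)) (fromℚ p +ᴿ fromℚ q) λ _ → refl
    ; ι-*       = λ p q → ≐⇒≈ (fromℚ (p * q)) (fromℚ p *ᴿ fromℚ q) λ _ → refl
    ; ι-neg     = λ p → ≐⇒≈ (fromℚ (- p)) (-ᴿ fromℚ p) λ _ → refl
    ; ι-0       = ≐⇒≈ (fromℚ 0ℚ) (fromℚ 0ℚ) λ _ → refl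
    ; ι-1       = ≐⇒≈ (fromℚ 1ℚ) (fromℚ 1ℚ) λ _ → refl
    ; ι-<       = fromℚ-<
    ; <-resp-≈  = λ {x} {x′} {y} {y′} → <ᴿ-resp-≈ {x} {x′} {y} {y′}
    ; <-irrefl  = λ {x} → <ᴿ-irrefl {x}
    ; <-trans   = λ {x} {y} {z} → <ᴿ-trans {x} {y} {z}
    ; +-monoˡ-< = λ {x} {y} → +ᴿ-monoˡ-< {x} {y}
    ; *-pos     = λ {x} {y} → *ᴿ-pos {x} {y}
    ; tight     = λ {x} {y} → ≈ᴿ-tight {x} {y}
    ; approx    = approxᴿ
    ; archimedean = λ {x} → archimedeanᴿ {x}
    ; sqrt      = λ x 0≤x → Sqrt.result x 0≤x , Sqrt.0≤result x 0≤x , Sqrt.result² x 0≤x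
    }

-- Order reasoning without trichotomy

module OrderedField (F : RealField) where

  open RealField F public
  open import Algebra.Solver.Ring.AlmostCommutativeRing
  import Algebra.Solver.Ring
  open import Data.Maybe using (Maybe; just; nothing)
  open import Data.Rational.Solver using (module +-*-Solver)
  open import Relation.Nullary.Decidable using (True; toWitness)

  private
    ι-homomorphism : ℚ.+-*-rawRing -Raw-AlmostCommutative⟶ fromCommutativeRing commutativeRing
    ι-homomorphism = record
      { ⟦_⟧ = ι ; +-homo = ι-+ ; *-homo = ι-* ; -‿homo = ι-neg ; 0-homo = ι-0 ; 1-homo = ι-1 }

    ι-≟ : ∀ p q → Maybe (ι p ≈ ι q)
    ι-≟ p q with p ℚ.≟ q
    ... | yes p≡q = just (reflexive (≡.cong ι p≡q))
    ... | no  _   = nothing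

  module Solver = Algebra.Solver.Ring ℚ.+-*-rawRing (fromCommutativeRing commutativeRing) ι-homomorphism ι-≟
  open Solver using (solve; _:=_; _:+_; _:*_; _:-_; :-_; con)

  -- The image of the rational 0 and not `0#`, because this is what `con 0ℚ` denotes in the solver.
  0r : Carrier
  0r = ι 0ℚ

  -- By `tight`, refuting both strict comparisons already gives equality. The case split is thus
  -- available whenever the goal is a refutation, in particular for `≤` and `≈`.
  tri : ∀ x y → ¬ ¬ (x < y ⊎ x ≈ y ⊎ y < x)
  tri x y k = k (inj₂ (inj₁ (tight (λ h → k (inj₁ h)) (λ h → k (inj₂ (inj₂ h))))))

  <-respˡ : ∀ {x x′ y} → x ≈ x′ → x < y → x′ < y
  <-respˡ e = <-resp-≈ e refl

  <-respʳ : ∀ {x y y′} → y ≈ y′ → x < y → x < y′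
  <-respʳ e = <-resp-≈ refl e

  ≤-resp : ∀ {x x′ y y′} → x ≈ x′ → y ≈ y′ → x ≤ y → x′ ≤ y′
  ≤-resp e f h y<x = h (<-resp-≈ (sym f) (sym e) y<x)

  ≤-respʳ : ∀ {x y y′} → y ≈ y′ → x ≤ y → x ≤ y′
  ≤-respʳ = ≤-resp refl

  <⇒≤ : ∀ {x y} → x < y → x ≤ y
  <⇒≤ h k = <-irrefl (<-trans h k)

  ≈⇒≤ : ∀ {x y} → x ≈ y → x ≤ y
  ≈⇒≤ e k = <-irrefl (<-respʳ e k)

  ≤-antisym : ∀ {x y} → x ≤ y → y ≤ x → x ≈ y
  ≤-antisym h k = tight k h

  ≤⇒¬¬ : ∀ {x y} → x ≤ y → ¬ ¬ (x < y ⊎ x ≈ y)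
  ≤⇒¬¬ {x} {y} h k = tri x y λ where
    (inj₁ a)        → k (inj₁ a)
    (inj₂ (inj₁ a)) → k (inj₂ a)
    (inj₂ (inj₂ a)) → h a

  ≤-trans : ∀ {x y z} → x ≤ y → y ≤ z → x ≤ z
  ≤-trans h k z<x = ≤⇒¬¬ h λ where
    (inj₁ x<y) → k (<-trans z<x x<y)
    (inj₂ x≈y) → k (<-respʳ x≈y z<x)

  <⇒0<- : ∀ {x y} → x < y → 0r < y - x
  <⇒0<- {x} {y} h = <-respˡ (solve 1 (λ x → x :- x := con 0ℚ) refl x) (+-monoˡ-< (- x) h)

  0<-⇒< : ∀ {x y} d → 0r < d → y - x ≈ d → x < y
  0<-⇒< {x} {y} d h e = <-resp-≈ (solve 1 (λ x → con 0ℚ :+ x := x) refl x)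
    (trans (+-congʳ (sym e)) (solve 2 (λ x y → y :- x :+ x := y) refl x y)) (+-monoˡ-< x h)

  ≤⇒0≤- : ∀ {x y} → x ≤ y → 0r ≤ y - x
  ≤⇒0≤- {x} {y} h k = h (0<-⇒< _ (<⇒0<- k) (solve 2 (λ x y → x :- y := con 0ℚ :- (y :- x)) refl x y))

  0≤-⇒≤ : ∀ {x y} d → 0r ≤ d → y - x ≈ d → x ≤ y
  0≤-⇒≤ {x} {y} d h e k = h (0<-⇒< _ (<⇒0<- k)
    (trans (+-congˡ (-‿cong (sym e))) (solve 2 (λ x y → con 0ℚ :- (y :- x) := x :- y) refl x y)))

  infixr 6 _+⁺_ _+⁰_
  infixr 7 _*⁺_ _*⁰_

  _+⁺_ : ∀ {x y} → 0r < x → 0r < y → 0r < x + y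
  _+⁺_ {x} {y} h k = <-trans k (<-respˡ (solve 1 (λ y → con 0ℚ :+ y := y) refl y) (+-monoˡ-< y h))

  _*⁺_ : ∀ {x y} → 0r < x → 0r < y → 0r < x * y
  _*⁺_ = *-pos

  _+⁰_ : ∀ {x y} → 0r ≤ x → 0r ≤ y → 0r ≤ x + y
  _+⁰_ {x} {y} h k = ≤-trans k (0≤-⇒≤ x h (solve 2 (λ x y → x :+ y :- y := x) refl x y))

  _*⁰_ : ∀ {x y} → 0r ≤ x → 0r ≤ y → 0r ≤ x * y
  _*⁰_ {x} {y} h k n = ≤⇒¬¬ h λ where
    (inj₂ 0≈x) → <-irrefl (<-respˡ (trans (*-congʳ (sym 0≈x)) (solve 1 (λ y → con 0ℚ :* y := con 0ℚ) refl y)) n)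
    (inj₁ 0<x) → ≤⇒¬¬ k λ where
      (inj₂ 0≈y) → <-irrefl (<-respˡ (trans (*-congˡ (sym 0≈y)) (solve 1 (λ x → x :* con 0ℚ := con 0ℚ) refl x)) n)
      (inj₁ 0<y) → <-irrefl (<-trans n (0<x *⁺ 0<y))

  0≤x² : ∀ x → 0r ≤ x * x
  0≤x² x n = tri x 0r λ where
    (inj₁ x<0) → let 0<-x = <⇒0<- x<0 in
      <-irrefl (<-trans n (<-respʳ (solve 1 (λ x → (con 0ℚ :- x) :* (con 0ℚ :- x) := x :* x) refl x) (0<-x *⁺ 0<-x)))
    (inj₂ (inj₁ x≈0)) → <-irrefl (<-respˡ (trans (*-congʳ x≈0) (solve 1 (λ x → con 0ℚ :* x := con 0ℚ) refl x)) n)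
    (inj₂ (inj₂ 0<x)) → <-irrefl (<-trans n (0<x *⁺ 0<x))

  -- The standard end of a refutation: a positive and a nonnegative certificate whose sum the solver
  -- reduces to 0 by means of the hypotheses.
  absurd : ∀ {x y} → 0r < x → 0r ≤ y → x + y ≈ 0r → ⊥
  absurd {x} {y} h k e = k (<-respʳ e (<-respˡ (solve 1 (λ y → con 0ℚ :+ y := y) refl y) (+-monoˡ-< y h)))

  absurd⁺ : ∀ {x} → 0r < x → x ≈ 0r → ⊥
  absurd⁺ h e = <-irrefl (<-respʳ e h)

  0<ₗ : ∀ q {_ : True (0ℚ ℚ.<? q)} → 0r < ι q
  0<ₗ q {t} = ι-< (toWitness t)

  ι-≤ : ∀ {p q} → p ℚ.≤ q → ι p ≤ ι q
  ι-≤ {p} {q} h k with p ℚ.<? q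
  ... | yes p<q = <-irrefl (<-trans k (ι-< p<q))
  ... | no  p≮q = <-irrefl (<-respˡ (reflexive (≡.cong ι (ℚ.≤-antisym (ℚ.≮⇒≥ p≮q) h))) k)

  0≤ₗ : ∀ q {_ : True (0ℚ ℚ.≤? q)} → 0r ≤ ι q
  0≤ₗ q {t} = ι-≤ (toWitness t)

  ι-≤⁻ : ∀ {p q} → ι p ≤ ι q → p ℚ.≤ q
  ι-≤⁻ h = ℚ.≮⇒≥ λ q<p → h (ι-< q<p)

  ι-injective : ∀ {p q} → ι p ≈ ι q → p ≡.≡ q
  ι-injective e = ℚ.≤-antisym (ι-≤⁻ (≈⇒≤ e)) (ι-≤⁻ (≈⇒≤ (sym e)))

  x*y≈0 : ∀ {x y} → x * y ≈ 0r → ¬ x ≈ 0r → y ≈ 0r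
  x*y≈0 {x} {y} e x≉0 = tight
    (λ y<0 → case-x (<⇒0<- y<0) (trans (solve 2 (λ x y → x :* (con 0ℚ :- y) := :- (x :* y)) refl x y) -xy≈0))
    (λ 0<y → case-x 0<y e)
    where
    -xy≈0 = trans (-‿cong e) (solve 0 (:- con 0ℚ := con 0ℚ) refl)
    case-x : ∀ {y} → 0r < y → x * y ≈ 0r → ⊥
    case-x {y} 0<y e = x≉0 (tight
      (λ x<0 → absurd⁺ (<⇒0<- x<0 *⁺ 0<y)
        (trans (solve 2 (λ x y → (con 0ℚ :- x) :* y := :- (x :* y)) refl x y)
          (trans (-‿cong e) (solve 0 (:- con 0ℚ := con 0ℚ) refl))))
      (λ 0<x → absurd⁺ (0<x *⁺ 0<y) e))

  x²≈0 : ∀ {x} → x * x ≈ 0r → x ≈ 0r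
  x²≈0 {x} e = tight
    (λ x<0 → absurd⁺ (<⇒0<- x<0 *⁺ <⇒0<- x<0) (trans (solve 1 (λ x → (con 0ℚ :- x) :* (con 0ℚ :- x) := x :* x) refl x) e))
    (λ 0<x → absurd⁺ (0<x *⁺ 0<x) e)

  -- Doubly negated because ≤ is a negation: the case distinction 0 < y or 0 ≈ y is only available in refutations.
  pos+nonneg : ∀ {x y} → 0r < x → 0r ≤ y → ¬ ¬ (0r < x + y)
  pos+nonneg {x} h k n = ≤⇒¬¬ k λ where
    (inj₁ 0<y) → n (h +⁺ 0<y)
    (inj₂ 0≈y) → n (<-respʳ (trans (solve 1 (λ x → x := x :+ con 0ℚ) refl x) (+-congˡ 0≈y)) h)

  -- Equality is a conjunction of negations by `tight`, so classical case distinctions are allowed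
  -- when proving it.
  stable-≈ : ∀ {x y} → ¬ ¬ x ≈ y → x ≈ y
  stable-≈ nn = tight (λ x<y → nn λ e → <-irrefl (<-respˡ e x<y)) (λ y<x → nn λ e → <-irrefl (<-respʳ e y<x))

  -- A strict inequality carries a witness, which `≤` does not supply. It is extracted from a
  -- rational approximation of `x` within (d - c)/4.
  ≤-ι⇒<-ι : ∀ {x c d} → x ≤ ι c → c ℚ.< d → x < ι d
  ≤-ι⇒<-ι {x} {c} {d} x≤c c<d = <-trans (proj₂ (proj₂ a)) (ι-< (ℚ.≤-<-trans q≤ close))
    where
    module ℚS = +-*-Solver
    ε = (½ ℚ.* ½) ℚ.* (d ℚ.- c)
    0<ε : 0ℚ ℚ.< ε
    0<ε = Rat.0<ₗ (½ ℚ.* ½) Rat.*⁺ Rat.<⇒0<- c<d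
    a = approx x ε 0<ε
    q = proj₁ a
    q-ε≤c : q ℚ.- ε ℚ.≤ c
    q-ε≤c = ℚ.≮⇒≥ λ c<q-ε → x≤c (<-trans (ι-< c<q-ε) (proj₁ (proj₂ a)))
    q≤ : q ℚ.+ ε ℚ.≤ c ℚ.+ (ε ℚ.+ ε)
    q≤ = Rat.0≤-⇒≤ _ (Rat.≤⇒0≤- q-ε≤c)
      (ℚS.solve 3 (λ q ε c → (c ℚS.:+ (ε ℚS.:+ ε)) ℚS.:- (q ℚS.:+ ε) ℚS.:= c ℚS.:- (q ℚS.:- ε)) ≡.refl q ε c)
    close : c ℚ.+ (ε ℚ.+ ε) ℚ.< d
    close = Rat.0<-⇒< _ (Rat.0<ₗ ½ Rat.*⁺ Rat.<⇒0<- c<d)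
      (ℚS.solve 2 (λ c d → d ℚS.:- (c ℚS.:+ (ℚS.con (½ ℚ.* ½) ℚS.:* (d ℚS.:- c) ℚS.:+ ℚS.con (½ ℚ.* ½) ℚS.:* (d ℚS.:- c)))
        ℚS.:= ℚS.con ½ ℚS.:* (d ℚS.:- c)) ≡.refl c d)

-- Complex numbers over the abstract reals, and zeros as preimages of -1

record ComplexField (F : RealField) : Set₁ where
  private module R = RealField F
  field
    commutativeRing : CommutativeRing 0ℓ 0ℓ
  open CommutativeRing commutativeRing public
  infix 8 _+i_
  field
    re im   : Carrier → R.Carrier
    _+i_    : R.Carrier → R.Carrier → Carrier
    ext     : ∀ {z w} → re z R.≈ re w → im z R.≈ im w → z ≈ w
    re-cong : ∀ {z w} → z ≈ w → re z R.≈ re w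
    im-cong : ∀ {z w} → z ≈ w → im z R.≈ im w
    re-+i   : ∀ x y → re (x +i y) R.≈ x
    im-+i   : ∀ x y → im (x +i y) R.≈ y
    re-+    : ∀ z w → re (z + w) R.≈ re z R.+ re w
    im-+    : ∀ z w → im (z + w) R.≈ im z R.+ im w
    re-neg  : ∀ z → re (- z) R.≈ R.- re z
    im-neg  : ∀ z → im (- z) R.≈ R.- im z
    re-*    : ∀ z w → re (z * w) R.≈ re z R.* re w R.- im z R.* im w
    im-*    : ∀ z w → im (z * w) R.≈ re z R.* im w R.+ im z R.* re w
    re-0    : re 0# R.≈ R.0#
    im-0    : im 0# R.≈ R.0#
    re-1    : re 1# R.≈ R.1#
    im-1    : im 1# R.≈ R.0#

module ComplexNumbers where

  open import Defs
  open RealNumbers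
  open import Data.Rational.Solver using (module +-*-Solver)
  open import Relation.Binary.PropositionalEquality
  open +-*-Solver

  -ᶜ_ : ℂ → ℂ
  -ᶜ z = (-ᴿ re z) +i (-ᴿ im z)

  *ᶜ-cong : ∀ z z′ w w′ → z ≈ z′ → w ≈ w′ → z *ᶜ w ≈ z′ *ᶜ w′
  *ᶜ-cong z z′ w w′ (a , b) (c , d) =
      +ᴿ-cong {re z *ᴿ re w} {re z′ *ᴿ re w′} { -ᴿ (im z *ᴿ im w)} { -ᴿ (im z′ *ᴿ im w′)}
        (*ᴿ-cong {re z} {re z′} {re w} {re w′} a c)
        (-ᴿ-cong {im z *ᴿ im w} {im z′ *ᴿ im w′} (*ᴿ-cong {im z} {im z′} {im w} {im w′} b d))
    , +ᴿ-cong {re z *ᴿ im w} {re z′ *ᴿ im w′} {im z *ᴿ re w} {im z′ *ᴿ re w′}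
        (*ᴿ-cong {re z} {re z′} {im w} {im w′} a d)
        (*ᴿ-cong {im z} {im z′} {re w} {re w′} b c)

  ≐⇒≈ᶜ : ∀ z w → (∀ n → seq (re z) n ≡ seq (re w) n) → (∀ n → seq (im z) n ≡ seq (im w) n) → z ≈ w
  ≐⇒≈ᶜ z w h k = ≐⇒≈ (re z) (re w) h , ≐⇒≈ (im z) (im w) k

  ℂ-ring : CommutativeRing _ _
  ℂ-ring = record
    { Carrier = ℂ ; _≈_ = _≈_ ; _+_ = _+ᶜ_ ; _*_ = _*ᶜ_ ; -_ = -ᶜ_ ; 0# = fromℕ 0 ; 1# = fromℕ 1
    ; isCommutativeRing = record
      { isRing = record
        { +-isAbelianGroup = record
          { isGroup = record
            { isMonoid = record
              { isSemigroup = record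
                { isMagma = record
                  { isEquivalence = record
                    { refl  = λ {z} → ≈ᴿ-refl {re z} , ≈ᴿ-refl {im z}
                    ; sym   = λ {z} {w} (a , b) → ≈ᴿ-sym {re z} {re w} a , ≈ᴿ-sym {im z} {im w} b
                    ; trans = λ {z} {w} {v} (a , b) (c , d) →
                        ≈ᴿ-trans {re z} {re w} {re v} a c , ≈ᴿ-trans {im z} {im w} {im v} b d }
                  ; ∙-cong = λ {z} {z′} {w} {w′} (a , b) (c , d) →
                      +ᴿ-cong {re z} {re z′} {re w} {re w′} a c , +ᴿ-cong {im z} {im z′} {im w} {im w′} b d }
                ; assoc = λ z w v → ≐⇒≈ᶜ (z +ᶜ w +ᶜ v) (z +ᶜ (w +ᶜ v))
                    (λ n → ℚ.+-assoc (seq (re z) n) (seq (re w) n) (seq (re v) n))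
                    (λ n → ℚ.+-assoc (seq (im z) n) (seq (im w) n) (seq (im v) n)) }
              ; identity = (λ z → ≐⇒≈ᶜ (fromℕ 0 +ᶜ z) z
                             (λ n → ℚ.+-identityˡ (seq (re z) n)) (λ n → ℚ.+-identityˡ (seq (im z) n)))
                         , (λ z → ≐⇒≈ᶜ (z +ᶜ fromℕ 0) z
                             (λ n → ℚ.+-identityʳ (seq (re z) n)) (λ n → ℚ.+-identityʳ (seq (im z) n))) }
            ; inverse = (λ z → ≐⇒≈ᶜ ((-ᶜ z) +ᶜ z) (fromℕ 0)
                           (λ n → ℚ.+-inverseˡ (seq (re z) n)) (λ n → ℚ.+-inverseˡ (seq (im z) n)))
                      , (λ z → ≐⇒≈ᶜ (z +ᶜ (-ᶜ z)) (fromℕ 0)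
                           (λ n → ℚ.+-inverseʳ (seq (re z) n)) (λ n → ℚ.+-inverseʳ (seq (im z) n)))
            ; ⁻¹-cong = λ {z} {w} (a , b) → -ᴿ-cong {re z} {re w} a , -ᴿ-cong {im z} {im w} b }
          ; comm = λ z w → ≐⇒≈ᶜ (z +ᶜ w) (w +ᶜ z)
              (λ n → ℚ.+-comm (seq (re z) n) (seq (re w) n)) (λ n → ℚ.+-comm (seq (im z) n) (seq (im w) n)) }
        ; *-cong = λ {z} {z′} {w} {w′} → *ᶜ-cong z z′ w w′
        ; *-assoc = λ z w v → ≐⇒≈ᶜ (z *ᶜ w *ᶜ v) (z *ᶜ (w *ᶜ v))
            (λ n → solve 6 (λ a b c d e f →
                (a :* c :+ :- (b :* d)) :* e :+ :- ((a :* d :+ b :* c) :* f)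
                := a :* (c :* e :+ :- (d :* f)) :+ :- (b :* (c :* f :+ d :* e))) refl
              (seq (re z) n) (seq (im z) n) (seq (re w) n) (seq (im w) n) (seq (re v) n) (seq (im v) n))
            (λ n → solve 6 (λ a b c d e f →
                (a :* c :+ :- (b :* d)) :* f :+ (a :* d :+ b :* c) :* e
                := a :* (c :* f :+ d :* e) :+ b :* (c :* e :+ :- (d :* f))) refl
              (seq (re z) n) (seq (im z) n) (seq (re w) n) (seq (im w) n) (seq (re v) n) (seq (im v) n))
        ; *-identity =
              (λ z → ≐⇒≈ᶜ (fromℕ 1 *ᶜ z) z
                (λ n → solve 2 (λ a b → con 1ℚ :* a :+ :- (con 0ℚ :* b) := a) refl (seq (re z) n) (seq (im z) n))
                (λ n → solve 2 (λ a b → con 1ℚ :* b :+ con 0ℚ :* a := b) refl (seq (re z) n) (seq (im z) n)))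
            , (λ z → ≐⇒≈ᶜ (z *ᶜ fromℕ 1) z
                (λ n → solve 2 (λ a b → a :* con 1ℚ :+ :- (b :* con 0ℚ) := a) refl (seq (re z) n) (seq (im z) n))
                (λ n → solve 2 (λ a b → a :* con 0ℚ :+ b :* con 1ℚ := b) refl (seq (re z) n) (seq (im z) n)))
        ; distrib =
              (λ z w v → ≐⇒≈ᶜ (z *ᶜ (w +ᶜ v)) (z *ᶜ w +ᶜ z *ᶜ v)
                (λ n → distribʳᵉ (seq (re z) n) (seq (im z) n) (seq (re w) n) (seq (im w) n) (seq (re v) n) (seq (im v) n))
                (λ n → distribⁱᵐ (seq (re z) n) (seq (im z) n) (seq (re w) n) (seq (im w) n) (seq (re v) n) (seq (im v) n)))
            , (λ z w v → ≐⇒≈ᶜ ((w +ᶜ v) *ᶜ z) (w *ᶜ z +ᶜ v *ᶜ z)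
                (λ n → solve 6 (λ a b c d e f →
                    (c :+ e) :* a :+ :- ((d :+ f) :* b) := c :* a :+ :- (d :* b) :+ (e :* a :+ :- (f :* b))) refl
                  (seq (re z) n) (seq (im z) n) (seq (re w) n) (seq (im w) n) (seq (re v) n) (seq (im v) n))
                (λ n → solve 6 (λ a b c d e f →
                    (c :+ e) :* b :+ (d :+ f) :* a := c :* b :+ d :* a :+ (e :* b :+ f :* a)) refl
                  (seq (re z) n) (seq (im z) n) (seq (re w) n) (seq (im w) n) (seq (re v) n) (seq (im v) n))) }
      ; *-comm = λ z w → ≐⇒≈ᶜ (z *ᶜ w) (w *ᶜ z)
          (λ n → solve 4 (λ a b c d → a :* c :+ :- (b :* d) := c :* a :+ :- (d :* b)) refl
            (seq (re z) n) (seq (im z) n) (seq (re w) n) (seq (im w) n))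
          (λ n → solve 4 (λ a b c d → a :* d :+ b :* c := c :* b :+ d :* a) refl
            (seq (re z) n) (seq (im z) n) (seq (re w) n) (seq (im w) n)) } }
    where
    distribʳᵉ : ∀ a b c d e f → a ℚ.* (c ℚ.+ e) ℚ.+ ℚ.- (b ℚ.* (d ℚ.+ f))
      ≡ a ℚ.* c ℚ.+ ℚ.- (b ℚ.* d) ℚ.+ (a ℚ.* e ℚ.+ ℚ.- (b ℚ.* f))
    distribʳᵉ = solve 6 (λ a b c d e f →
      a :* (c :+ e) :+ :- (b :* (d :+ f)) := a :* c :+ :- (b :* d) :+ (a :* e :+ :- (b :* f))) refl
    distribⁱᵐ : ∀ a b c d e f → a ℚ.* (d ℚ.+ f) ℚ.+ b ℚ.* (c ℚ.+ e)
      ≡ a ℚ.* d ℚ.+ b ℚ.* c ℚ.+ (a ℚ.* f ℚ.+ b ℚ.* e)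
    distribⁱᵐ = solve 6 (λ a b c d e f →
      a :* (d :+ f) :+ b :* (c :+ e) := a :* d :+ b :* c :+ (a :* f :+ b :* e)) refl

  complexField : ComplexField realField
  complexField = record
    { commutativeRing = ℂ-ring
    ; re = re ; im = im ; _+i_ = _+i_
    ; ext = λ a b → a , b
    ; re-cong = λ (a , _) → a
    ; im-cong = λ (_ , b) → b
    ; re-+i = λ x _ → ≈ᴿ-refl {x}
    ; im-+i = λ _ y → ≈ᴿ-refl {y}
    ; re-+ = λ z w → ≈ᴿ-refl {re z +ᴿ re w}
    ; im-+ = λ z w → ≈ᴿ-refl {im z +ᴿ im w}
    ; re-neg = λ z → ≈ᴿ-refl { -ᴿ re z}
    ; im-neg = λ z → ≈ᴿ-refl { -ᴿ im z}
    ; re-* = λ z w → ≈ᴿ-refl {re z *ᴿ re w +ᴿ -ᴿ (im z *ᴿ im w)}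
    ; im-* = λ z w → ≈ᴿ-refl {re z *ᴿ im w +ᴿ im z *ᴿ re w}
    ; re-0 = ≈ᴿ-refl {fromℚ 0ℚ} ; im-0 = ≈ᴿ-refl {fromℚ 0ℚ}
    ; re-1 = ≈ᴿ-refl {fromℚ 1ℚ} ; im-1 = ≈ᴿ-refl {fromℚ 0ℚ}
    }

module ComplexPlane (F : RealField) (K : ComplexField F) where

  private module R = OrderedField F
  open R using (0r; ι)
  open ComplexField K public
  open import Algebra.Solver.Ring.AlmostCommutativeRing
  import Algebra.Solver.Ring
  open import Data.Maybe using (Maybe; just; nothing)
  private module RS = R.Solver

  real : R.Carrier → Carrier
  real x = x +i 0r

  κ : ℚ → Carrier
  κ q = real (ι q)

  re-real : ∀ x → re (real x) R.≈ x
  re-real x = re-+i x 0r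

  im-real : ∀ x → im (real x) R.≈ 0r
  im-real x = im-+i x 0r

  real-cong : ∀ {x y} → x R.≈ y → real x ≈ real y
  real-cong {x} {y} e = ext (R.trans (re-real x) (R.trans e (R.sym (re-real y))))
                            (R.trans (im-real x) (R.sym (im-real y)))

  real-+ : ∀ x y → real (x R.+ y) ≈ real x + real y
  real-+ x y = ext
    (R.trans (re-real _) (R.sym (R.trans (re-+ _ _) (R.+-cong (re-real x) (re-real y)))))
    (R.trans (im-real _) (R.sym (R.trans (im-+ _ _) (R.trans (R.+-cong (im-real x) (im-real y))
      (RS.solve 0 (con 0ℚ :+ con 0ℚ := con 0ℚ) R.refl)))))
    where open RS

  real-* : ∀ x y → real (x R.* y) ≈ real x * real y
  real-* x y = ext
    (R.trans (re-real _) (R.sym (R.trans (re-* _ _) (R.trans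
      (R.+-cong (R.*-cong (re-real x) (re-real y)) (R.-‿cong (R.*-cong (im-real x) (im-real y))))
      (RS.solve 2 (λ x y → x :* y :- con 0ℚ :* con 0ℚ := x :* y) R.refl x y)))))
    (R.trans (im-real _) (R.sym (R.trans (im-* _ _) (R.trans
      (R.+-cong (R.*-cong (re-real x) (im-real y)) (R.*-cong (im-real x) (re-real y)))
      (RS.solve 2 (λ x y → x :* con 0ℚ :+ con 0ℚ :* y := con 0ℚ) R.refl x y)))))
    where open RS

  real-neg : ∀ x → real (R.- x) ≈ - real x
  real-neg x = ext
    (R.trans (re-real _) (R.sym (R.trans (re-neg _) (R.-‿cong (re-real x)))))
    (R.trans (im-real _) (R.sym (R.trans (im-neg _) (R.trans (R.-‿cong (im-real x))
      (RS.solve 0 (:- con 0ℚ := con 0ℚ) R.refl)))))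
    where open RS

  real-0 : κ 0ℚ ≈ 0#
  real-0 = ext (R.trans (re-real _) (R.trans R.ι-0 (R.sym re-0))) (R.trans (im-real _) (R.trans R.ι-0 (R.sym im-0)))

  real-1 : κ 1ℚ ≈ 1#
  real-1 = ext (R.trans (re-real _) (R.trans R.ι-1 (R.sym re-1))) (R.trans (im-real _) (R.trans R.ι-0 (R.sym im-1)))

  private
    κ-homomorphism : ℚ.+-*-rawRing -Raw-AlmostCommutative⟶ fromCommutativeRing commutativeRing
    κ-homomorphism = record
      { ⟦_⟧ = κ
      ; +-homo = λ p q → trans (real-cong (R.ι-+ p q)) (real-+ (ι p) (ι q))
      ; *-homo = λ p q → trans (real-cong (R.ι-* p q)) (real-* (ι p) (ι q))
      ; -‿homo = λ p → trans (real-cong (R.ι-neg p)) (real-neg (ι p))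
      ; 0-homo = real-0 ; 1-homo = real-1 }

    κ-≟ : ∀ p q → Maybe (κ p ≈ κ q)
    κ-≟ p q with p ℚ.≟ q
    ... | yes p≡q = just (reflexive (≡.cong κ p≡q))
    ... | no  _   = nothing

  module Solver = Algebra.Solver.Ring ℚ.+-*-rawRing (fromCommutativeRing commutativeRing) κ-homomorphism κ-≟

  ∣_∣² : Carrier → R.Carrier
  ∣ z ∣² = re z R.* re z R.+ im z R.* im z

  -- The zeros of I_{Gᵐ⁺¹} are the points that the m+1-st iterate of P = I_G − 1 sends to −1.
  Root : (Carrier → Carrier) → ℕ → Carrier → Set
  Root P zero    z = P z ≈ κ (ℚ.- 1ℚ)
  Root P (suc m) z = Root P m (P z)

  Congruent : (Carrier → Carrier) → Set
  Congruent P = ∀ {z w} → z ≈ w → P z ≈ P w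

  Root-resp : ∀ {P} → Congruent P → ∀ m {z w} → z ≈ w → Root P m z → Root P m w
  Root-resp cong zero    e r = trans (cong (sym e)) r
  Root-resp cong (suc m) e r = Root-resp cong m (cong e) r

  _∈[_,0] : Carrier → ℚ → Set
  z ∈[ q ,0] = ι q R.≤ re z × re z R.≤ ι 0ℚ × im z R.≈ ι 0ℚ

  re-κ* : ∀ p z → re (κ p * z) R.≈ ι p R.* re z
  re-κ* p z = R.trans (re-* (κ p) z) (R.trans
    (R.+-cong (R.*-congʳ (re-real _)) (R.-‿cong (R.*-congʳ (im-real _))))
    (RS.solve 3 (λ p x y → p :* x :- con 0ℚ :* y := p :* x) R.refl (ι p) (re z) (im z)))
    where open RS

  im-κ* : ∀ p z → im (κ p * z) R.≈ ι p R.* im z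
  im-κ* p z = R.trans (im-* (κ p) z) (R.trans
    (R.+-cong (R.*-congʳ (re-real _)) (R.*-congʳ (im-real _)))
    (RS.solve 3 (λ p x y → p :* y :+ con 0ℚ :* x := p :* y) R.refl (ι p) (re z) (im z)))
    where open RS

  -- `HausdorffLimit` to the interval, restated over the abstract fields with preimages of -1 in
  -- place of zero sets.
  RootLimit : (Carrier → Carrier) → ℚ → Set
  RootLimit P q = ∀ ε → 0ℚ ℚ.< ε → ∃[ M ] (∀ m → m ℕ.≥ M →
      (∀ z → Root P m z → ∃[ w ] (w ∈[ q ,0] × ∣ z - w ∣² R.< ι (ε ℚ.* ε)))
    × (∀ z → z ∈[ q ,0] → ∃[ w ] (Root P m w × ∣ z - w ∣² R.< ι (ε ℚ.* ε))))

  self-distance : ∀ z ε → 0ℚ ℚ.< ε → ∣ z - z ∣² R.< ι (ε ℚ.* ε)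
  self-distance z ε 0<ε = R.<-respˡ (R.sym (R.trans (R.+-cong (R.*-cong r r) (R.*-cong i i))
    (RS.solve 0 (con 0ℚ :* con 0ℚ :+ con 0ℚ :* con 0ℚ := con 0ℚ) R.refl))) (R.ι-< (0<ε Rat.*⁺ 0<ε))
    where
    open RS
    z-z≈0 : z - z ≈ κ 0ℚ
    z-z≈0 = trans (-‿inverseʳ z) (sym real-0)
    r = R.trans (re-cong z-z≈0) (re-real _)
    i = R.trans (im-cong z-z≈0) (im-real _)

-- The Chebyshev map x² - 2 and the shadowing of rational orbits

module AngleDoubling (F : RealField) (K : ComplexField F) where

  open OrderedField F
  open Solver using (solve; _:=_; _:+_; _:*_; _:-_; :-_; con)
  open import Data.Rational.Solver using (module +-*-Solver)

  2ℚ 4ℚ 8ℚ : ℚ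
  2ℚ = + 2 ℚ./ 1
  4ℚ = + 4 ℚ./ 1
  8ℚ = + 8 ℚ./ 1

  T : Carrier → Carrier
  T x = x * x - ι 2ℚ

  T-cong : ∀ {x y} → x ≈ y → T x ≈ T y
  T-cong e = +-congʳ (*-cong e e)

  iterate : (Carrier → Carrier) → ℕ → Carrier → Carrier
  iterate f zero    x = x
  iterate f (suc n) x = iterate f n (f x)

  iterate-cong : ∀ {f} → (∀ {x y} → x ≈ y → f x ≈ f y) → ∀ n {x y} → x ≈ y → iterate f n x ≈ iterate f n y
  iterate-cong cong zero    e = e
  iterate-cong cong (suc n) e = iterate-cong cong n (cong e)

  -- For x = 2cos θ and y = 2cos φ, Far e x y says that the smaller root
  -- 2 − 2cos(|θ| − |φ|) of t² − (4 − xy)t + (x − y)² exceeds e.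
  Far : Carrier → Carrier → Carrier → Set
  Far e x y = 0r < 4-xy - (e + e) × 0r < (x - y) * (x - y) - e * (4-xy - e)
    where 4-xy = ι 4ℚ - x * y

  -- Doubling the angles of two points of the same sign at least doubles that root.
  Far-T : ∀ {e x y} → 0r ≤ e → e ≤ ι 2ℚ → 0r ≤ x * y → Far e x y → ¬ ¬ Far (e + e) (T x) (T y)
  Far-T {e} {x} {y} 0≤e e≤2 0≤xy (h₁ , h₂) n =
    pos+nonneg (h₂ +⁺ h₂) (<⇒≤ h₁ *⁰ 0≤xy +⁰ (e2 +⁰ e2)) λ a →
    pos+nonneg (h₂ *⁺ h₂)
      (<⇒≤ h₂ *⁰ (0≤xy *⁰ (≤⇒0≤- e≤2 +⁰ ≤⇒0≤- e≤2)) +⁰ e2 *⁰ (<⇒≤ (h₂ +⁺ h₂) +⁰ (<⇒≤ h₁ *⁰ 0≤xy +⁰ e2))) λ b →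
    n ( <-respʳ (solve 3 (λ e x y →
          let s = con 4ℚ :- x :* y ; d₁ = s :- (e :+ e) ; d₂ = (x :- y) :* (x :- y) :- e :* (s :- e)
              s′ = con 4ℚ :- (x :* x :- con 2ℚ) :* (y :* y :- con 2ℚ) in
          d₂ :+ d₂ :+ (d₁ :* (x :* y) :+ (e :* (con 2ℚ :- e) :+ e :* (con 2ℚ :- e))) := s′ :- (e :+ e :+ (e :+ e)))
          refl e x y) a
      , <-respʳ (solve 3 (λ e x y →
          let s = con 4ℚ :- x :* y ; d₁ = s :- (e :+ e) ; d₂ = (x :- y) :* (x :- y) :- e :* (s :- e)
              x′ = x :* x :- con 2ℚ ; y′ = y :* y :- con 2ℚ ; s′ = con 4ℚ :- x′ :* y′ in
          d₂ :* d₂ :+ (d₂ :* (x :* y :* (con 2ℚ :- e :+ (con 2ℚ :- e)))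
            :+ e :* (con 2ℚ :- e) :* (d₂ :+ d₂ :+ (d₁ :* (x :* y) :+ e :* (con 2ℚ :- e))))
            := (x′ :- y′) :* (x′ :- y′) :- (e :+ e) :* (s′ :- (e :+ e)))
          refl e x y) b)
    where
    e2 = 0≤e *⁰ ≤⇒0≤- e≤2

  Far-resp : ∀ {e e′ x x′ y y′} → e ≈ e′ → x ≈ x′ → y ≈ y′ → Far e x y → Far e′ x′ y′
  Far-resp f g h (a , b) =
      <-respʳ (+-cong s (-‿cong (+-cong f f))) a
    , <-respʳ (+-cong (*-cong d d) (-‿cong (*-cong f (+-cong s (-‿cong f))))) b
    where
    s = +-cong (refl {ι 4ℚ}) (-‿cong (*-cong g h))
    d = +-cong g (-‿cong h)

  infix 4 _∈[-2,2]
  _∈[-2,2] : Carrier → Set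
  x ∈[-2,2] = ι (ℚ.- 2ℚ) ≤ x × x ≤ ι 2ℚ

  private
    2+ : ∀ {x} → x ∈[-2,2] → 0r ≤ x + ι 2ℚ
    2+ (h , _) = ≤-respʳ (+-congˡ (trans (-‿cong (ι-neg 2ℚ)) (solve 1 (λ x → :- :- x := x) refl (ι 2ℚ)))) (≤⇒0≤- h)

    2- : ∀ {x} → x ∈[-2,2] → 0r ≤ ι 2ℚ - x
    2- (_ , h) = ≤⇒0≤- h

  -- x * x ≤ 4 and (2 + x)(2 + y) + (2 − x)(2 − y) = 8 + 2xy.
  close : ∀ {e x y} → 0r ≤ e → x ∈[-2,2] → y ∈[-2,2] → ¬ Far e x y → (x - y) * (x - y) ≤ ι 8ℚ * e
  close {e} {x} {y} 0≤e hx hy near far =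
    pos+nonneg (0<ₗ ½ *⁺ d) (0≤e +⁰ 0≤e +⁰ 0≤ₗ ½ *⁰ (2+ hx *⁰ 2- hx +⁰ 2+ hy *⁰ 2- hy)) λ a →
    pos+nonneg d (0≤e *⁰ (0≤ₗ ½ *⁰ (2+ hx *⁰ 2+ hy +⁰ 2- hx *⁰ 2- hy) +⁰ 0≤e)) λ b →
    near ( <-respʳ (solve 3 (λ e x y →
             con ½ :* ((x :- y) :* (x :- y) :- con 8ℚ :* e) :+ (e :+ (e
               :+ con ½ :* ((x :+ con 2ℚ) :* (con 2ℚ :- x) :+ (y :+ con 2ℚ) :* (con 2ℚ :- y))))
             := con 4ℚ :- x :* y :- (e :+ e)) refl e x y) a
         , <-respʳ (solve 3 (λ e x y →
             (x :- y) :* (x :- y) :- con 8ℚ :* e :+ e :* (con ½ :* ((x :+ con 2ℚ) :* (y :+ con 2ℚ)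
               :+ (con 2ℚ :- x) :* (con 2ℚ :- y)) :+ e)
             := (x :- y) :* (x :- y) :- e :* (con 4ℚ :- x :* y :- e)) refl e x y) b)
    where
    d = <⇒0<- far

  -- 4/2ⁿ: the quantity 2 - 2cos never exceeds 4, and each backward step halves the threshold.
  η : ℕ → ℚ
  η zero    = 4ℚ
  η (suc n) = ½ ℚ.* η n

  0≤η : ∀ n → 0ℚ ℚ.≤ η n
  0≤η zero    = Rat.0≤ₗ 4ℚ
  0≤η (suc n) = Rat.0≤ₗ ½ Rat.*⁰ 0≤η n

  η≤4 : ∀ n → η n ℚ.≤ 4ℚ
  η≤4 zero    = ℚ.≤-refl
  η≤4 (suc n) = Rat.0≤-⇒≤ _ (Rat.≤⇒0≤- (η≤4 n) Rat.+⁰ Rat.0≤ₗ ½ Rat.*⁰ 0≤η n)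
    (S.solve 1 (λ h → S.con 4ℚ S.:- S.con ½ S.:* h S.:= (S.con 4ℚ S.:- h) S.:+ S.con ½ S.:* h) ≡.refl (η n))
    where module S = +-*-Solver

  -- This is 2ⁿ ≥ n + 1. Such linear decay is all that the archimedean argument in `η-small` needs.
  η-bound : ∀ n → η n ℚ.* (1ℚ ℚ.+ Rat.ι (+ n)) ℚ.≤ 4ℚ
  η-bound zero    = ℚ.≤-refl
  η-bound (suc n) = Rat.0≤-⇒≤ _ (Rat.≤⇒0≤- (η-bound n) Rat.+⁰ Rat.0≤ₗ ½ Rat.*⁰ (0≤η n Rat.*⁰ Rat.0≤ι n))
    (≡.trans (≡.cong (λ k → 4ℚ ℚ.- ½ ℚ.* η n ℚ.* (1ℚ ℚ.+ k)) (Rat.ι-+ (+ 1) (+ n)))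
    (S.solve 2 (λ h k → S.con 4ℚ S.:- S.con ½ S.:* h S.:* (S.con 1ℚ S.:+ (S.con 1ℚ S.:+ k))
      S.:= (S.con 4ℚ S.:- h S.:* (S.con 1ℚ S.:+ k)) S.:+ S.con ½ S.:* (h S.:* k)) ≡.refl (η n) (Rat.ι (+ n))))
    where module S = +-*-Solver

  η-small : ∀ δ → 0ℚ ℚ.< δ → ∃[ N ] (∀ n → n ℕ.≥ N → η n ℚ.< δ)
  η-small δ 0<δ =
    let e , 0<e , δe≡4 = Rat.shrink 0<δ (Rat.0<ₗ 4ℚ)
        k , e<k = Rat.archimedean e
    in k , λ n n≥k → ℚ.≰⇒> λ δ≤η → ℚ.<-irrefl ≡.refl (Rat.0<-⇒< {0ℚ} {0ℚ} _
      (0<δ Rat.*⁺ Rat.<⇒0<- e<k Rat.+⁺⁰ (ℚ.<⇒≤ 0<δ Rat.*⁰ (Rat.≤⇒0≤- (Rat.ι-≤ {+ k} {+ n} (ℤ.+≤+ n≥k)) Rat.+⁰ Rat.0≤ₗ 1ℚ)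
        Rat.+⁰ (Rat.≤⇒0≤- δ≤η Rat.*⁰ (Rat.0≤ₗ 1ℚ Rat.+⁰ Rat.0≤ι n) Rat.+⁰ Rat.≤⇒0≤- (η-bound n))))
      (helper e k n (η n) δe≡4))
    where
    module S = +-*-Solver
    helper : ∀ e k n h → δ ℚ.* e ≡.≡ 4ℚ → 4ℚ ℚ.- 4ℚ ≡.≡ δ ℚ.* (Rat.ι (+ k) ℚ.- e)
      ℚ.+ (δ ℚ.* ((Rat.ι (+ n) ℚ.- Rat.ι (+ k)) ℚ.+ 1ℚ) ℚ.+ ((h ℚ.- δ) ℚ.* (1ℚ ℚ.+ Rat.ι (+ n))
      ℚ.+ (4ℚ ℚ.- h ℚ.* (1ℚ ℚ.+ Rat.ι (+ n)))))
    helper e k n h eq = ≡.trans (≡.cong (λ f → 4ℚ ℚ.- f) (≡.sym eq))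
      (S.solve 5 (λ δ e k n h → S.con 4ℚ S.:- δ S.:* e S.:= δ S.:* (k S.:- e) S.:+ (δ S.:* ((n S.:- k) S.:+ S.con 1ℚ)
        S.:+ ((h S.:- δ) S.:* (S.con 1ℚ S.:+ n) S.:+ (S.con 4ℚ S.:- h S.:* (S.con 1ℚ S.:+ n))))) ≡.refl
        δ e (Rat.ι (+ k)) (Rat.ι (+ n)) h)

module Shadowing (F : RealField) (K : ComplexField F) where

  open OrderedField F
  open AngleDoubling F K
  open Solver using (solve; _:=_; _:+_; _:*_; _:-_; :-_; con)
  private module C = ComplexPlane F K
  open import Data.Rational.Solver using (module +-*-Solver)
  open import Data.Sum using ([_,_]′)
  private
    module S = +-*-Solver
    module CS = C.Solver

  Tℚ : ℚ → ℚ
  Tℚ x = x ℚ.* x ℚ.- 2ℚ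

  ι-sub : ∀ p q → ι (p ℚ.- q) ≈ ι p - ι q
  ι-sub p q = trans (ι-+ p (ℚ.- q)) (+-congˡ (ι-neg q))

  ι-Tℚ : ∀ x → ι (Tℚ x) ≈ T (ι x)
  ι-Tℚ x = trans (ι-sub (x ℚ.* x) 2ℚ) (+-congʳ (ι-* x x))

  Inℚ : ℚ → Set
  Inℚ x = ℚ.- 2ℚ ℚ.≤ x × x ℚ.≤ 2ℚ

  Inℚ-Tℚ : ∀ {x} → Inℚ x → Inℚ (Tℚ x)
  Inℚ-Tℚ {x} (h , k) =
      Rat.0≤-⇒≤ _ (Rat.0≤p² x) (S.solve 1 (λ x → x S.:* x S.:- S.con 2ℚ S.:- S.:- S.con 2ℚ S.:= x S.:* x) ≡.refl x)
    , Rat.0≤-⇒≤ _ (Rat.≤⇒0≤- h Rat.*⁰ Rat.≤⇒0≤- k)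
        (S.solve 1 (λ x → S.con 2ℚ S.:- (x S.:* x S.:- S.con 2ℚ) S.:= (x S.:- S.:- S.con 2ℚ) S.:* (S.con 2ℚ S.:- x)) ≡.refl x)

  Inℚ⇒ : ∀ {x} → Inℚ x → ι x ∈[-2,2]
  Inℚ⇒ (h , k) = ι-≤ h , ι-≤ k

  sqrt-2+ : ∀ y → y ∈[-2,2] → ∃[ s ] (0r ≤ s × s ∈[-2,2] × T s ≈ y)
  sqrt-2+ y (l , u) = s , 0≤s
    , (≤-trans (ι-≤ (Rat.0≤-⇒≤ 2ℚ (Rat.0≤ₗ 2ℚ) ≡.refl)) 0≤s
    , λ 2<s → absurd (<⇒0<- 2<s *⁺ (<⇒0<- 2<s +⁺ (0<ₗ 2ℚ +⁺ 0<ₗ 2ℚ))) (≤⇒0≤- u)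
        (trans (+-congˡ (+-congˡ (-‿cong (sym Ts≈y))))
          (solve 1 (λ s → (s :- con 2ℚ) :* (s :- con 2ℚ :+ (con 2ℚ :+ con 2ℚ)) :+ (con 2ℚ :- (s :* s :- con 2ℚ)) := con 0ℚ) refl s)))
    , Ts≈y
    where
    0≤y+2 : 0r ≤ y + ι 2ℚ
    0≤y+2 = ≤-respʳ (+-congˡ (trans (-‿cong (ι-neg 2ℚ)) (solve 1 (λ x → :- :- x := x) refl (ι 2ℚ)))) (≤⇒0≤- l)
    r = sqrt (y + ι 2ℚ) 0≤y+2
    s = proj₁ r
    0≤s = proj₁ (proj₂ r)
    Ts≈y : T s ≈ y
    Ts≈y = trans (+-congʳ (proj₂ (proj₂ r))) (solve 1 (λ y → y :+ con 2ℚ :- con 2ℚ := y) refl y)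

  neg-∈ : ∀ {s} → s ∈[-2,2] → - s ∈[-2,2]
  neg-∈ {s} (l , u) =
      0≤-⇒≤ _ (≤⇒0≤- u) (trans (+-congˡ (-‿cong (ι-neg 2ℚ))) (solve 1 (λ s → :- s :- :- con 2ℚ := con 2ℚ :- s) refl s))
    , 0≤-⇒≤ _ (≤⇒0≤- l) (trans (solve 1 (λ s → con 2ℚ :- :- s := s :- :- con 2ℚ) refl s) (+-congˡ (-‿cong (sym (ι-neg 2ℚ)))))

  T-even : ∀ s → T (- s) ≈ T s
  T-even = solve 1 (λ s → :- s :* :- s :- con 2ℚ := s :* s :- con 2ℚ) refl

  neg-* : ∀ {x s} → x ≤ 0r → 0r ≤ s → 0r ≤ x * - s
  neg-* {x} {s} h k = ≤-respʳ (solve 2 (λ x s → (con 0ℚ :- x) :* s := x :* :- s) refl x s) (≤⇒0≤- h *⁰ k)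

  -- `Far-T` needs both points on the same side of 0. The sign of the root is copied from `x`, and
  -- it can be decided because `x` is rational.
  preimage : ∀ x y → y ∈[-2,2] → ∃[ s ] (s ∈[-2,2] × T s ≈ y × 0r ≤ ι x * s)
  preimage x y hy =
    let s , 0≤s , hs , Ts≈y = sqrt-2+ y hy in
    [ (λ 0≤x → s , hs , Ts≈y , ι-≤ 0≤x *⁰ 0≤s)
    , (λ x≤0 → - s , neg-∈ hs , trans (T-even s) Ts≈y , neg-* (ι-≤ x≤0) 0≤s)
    ]′ (ℚ.≤-total 0ℚ x)

  -- Pulling τ back along the branches chosen by the orbit of x halves the bound at each step.
  shadow : ∀ n x τ → Inℚ x → Inℚ τ →
           ∃[ y ] (iterate T n y ≈ ι τ × y ∈[-2,2] × ¬ Far (ι (η n)) (ι x) y)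
  -- At threshold 4 being far would require xτ < -4, which is impossible in [-2,2].
  shadow zero x τ hx hτ = ι τ , refl , Inℚ⇒ hτ , λ (a , _) →
    absurd a (0≤ₗ ½ *⁰ ((2+ hx) *⁰ (2+ hτ) +⁰ ≤⇒0≤- (ι-≤ (proj₂ hx)) *⁰ ≤⇒0≤- (ι-≤ (proj₂ hτ))))
      (solve 2 (λ x t → con 4ℚ :- x :* t :- (con 4ℚ :+ con 4ℚ)
          :+ con ½ :* ((x :+ con 2ℚ) :* (t :+ con 2ℚ) :+ (con 2ℚ :- x) :* (con 2ℚ :- t)) := con 0ℚ) refl (ι x) (ι τ))
    where
    2+ : ∀ {x} → Inℚ x → 0r ≤ ι x + ι 2ℚ
    2+ {x} (h , _) = ≤-respʳ (trans (ι-sub x (ℚ.- 2ℚ)) (+-congˡ (trans (-‿cong (ι-neg 2ℚ)) (solve 0 (:- :- con 2ℚ := con 2ℚ) refl))))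
      (ι-≤ (Rat.≤⇒0≤- h))
  shadow (suc n) x τ hx hτ =
    let y′ , Tⁿy′≈τ , hy′ , near = shadow n (Tℚ x) τ (Inℚ-Tℚ hx) hτ
        y , hy , Ty≈y′ , 0≤xy = preimage x y′ hy′
    in y , trans (iterate-cong T-cong n Ty≈y′) Tⁿy′≈τ , hy , λ far →
       Far-T (ι-≤ (0≤η (suc n))) (ι-≤ half≤2) 0≤xy far λ far′ →
       near (Far-resp e+e (sym (ι-Tℚ x)) Ty≈y′ far′)
    where
    e+e : ι (½ ℚ.* η n) + ι (½ ℚ.* η n) ≈ ι (η n)
    e+e = trans (sym (ι-+ _ _)) (reflexive (≡.cong ι (S.solve 1 (λ h → S.con ½ S.:* h S.:+ S.con ½ S.:* h S.:= h) ≡.refl (η n))))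
    half≤2 : ½ ℚ.* η n ℚ.≤ 2ℚ
    half≤2 = Rat.0≤-⇒≤ _ (Rat.0≤ₗ ½ Rat.*⁰ Rat.≤⇒0≤- (η≤4 n))
      (S.solve 1 (λ h → S.con 2ℚ S.:- S.con ½ S.:* h S.:= S.con ½ S.:* (S.con 4ℚ S.:- h)) ≡.refl (η n))

  square-bound : ∀ {δ X x} → ι (x ℚ.- δ) ≤ X → X ≤ ι (x ℚ.+ δ) → (X - ι x) * (X - ι x) ≤ ι (δ ℚ.* δ)
  square-bound {δ} {X} {x} h k = 0≤-⇒≤ _ (≤⇒0≤- h *⁰ ≤⇒0≤- k) (trans (+-congʳ (ι-* δ δ)) (sym
    (trans (*-cong (+-congˡ (-‿cong (ι-sub x δ))) (+-congʳ (ι-+ x δ)))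
      (solve 3 (λ x d X → (X :- (x :- d)) :* (x :+ d :- X) := d :* d :- (X :- x) :* (X :- x)) refl (ι x) (ι δ) X))))

  -- A rational approximation of a point of [-2,2] may overshoot the interval. Moving it to the
  -- nearer endpoint does not spoil the distance and makes its whole orbit bounded.
  clip : ∀ q {δ X} → 0ℚ ℚ.≤ δ → X ∈[-2,2] → ι (q ℚ.- δ) < X → X < ι (q ℚ.+ δ) →
         ∃[ x ] (Inℚ x × (X - ι x) * (X - ι x) ≤ ι (δ ℚ.* δ))
  clip q {δ} {X} 0≤δ (l , u) a b with q ℚ.≤? ℚ.- 2ℚ | 2ℚ ℚ.≤? q
  ... | yes q≤-2 | _ = ℚ.- 2ℚ , (ℚ.≤-refl , Rat.0≤-⇒≤ 4ℚ (Rat.0≤ₗ 4ℚ) ≡.refl)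
    , square-bound {δ} {X} {ℚ.- 2ℚ} (≤-trans (ι-≤ (Rat.0≤-⇒≤ δ 0≤δ (S.solve 1 (λ δ → S.:- S.con 2ℚ S.:- (S.:- S.con 2ℚ S.:- δ) S.:= δ) ≡.refl δ))) l)
        (≤-trans (<⇒≤ b) (ι-≤ (ℚ.+-monoˡ-≤ δ q≤-2)))
  ... | no q≰-2 | yes 2≤q = 2ℚ , (Rat.0≤-⇒≤ 4ℚ (Rat.0≤ₗ 4ℚ) ≡.refl , ℚ.≤-refl)
    , square-bound {δ} {X} {2ℚ} (≤-trans (ι-≤ (ℚ.+-monoˡ-≤ (ℚ.- δ) 2≤q)) (<⇒≤ a))
        (≤-trans u (ι-≤ (Rat.0≤-⇒≤ δ 0≤δ (S.solve 1 (λ δ → S.con 2ℚ S.:+ δ S.:- S.con 2ℚ S.:= δ) ≡.refl δ))))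
  ... | no q≰-2 | no 2≰q = q , (ℚ.<⇒≤ (ℚ.≰⇒> q≰-2) , ℚ.<⇒≤ (ℚ.≰⇒> 2≰q)) , square-bound {δ} {X} {q} (<⇒≤ a) (<⇒≤ b)

-- Zeros of the iterates of 4z + kz², with ℓ = 4/k

module QuadraticMap (F : RealField) (K : ComplexField F)
  (k ℓ : ℚ) (kℓ≡4 : k ℚ.* ℓ ≡ + 4 ℚ./ 1) (1≤k : 1ℚ ℚ.≤ k) (k≤4 : k ℚ.≤ + 4 ℚ./ 1) (0<ℓ : 0ℚ ℚ.< ℓ) where

  open OrderedField F
  open AngleDoubling F K
  open Shadowing F K
  open Solver using (solve; _:=_; _:+_; _:*_; _:-_; :-_; con)
  private module C = ComplexPlane F K
  open C using (Root; _∈[_,0]; re; im; real; κ)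
  open import Data.Rational.Solver using (module +-*-Solver)
  private
    module S = +-*-Solver
    module CS = C.Solver

    k′ ℓ′ : Carrier
    k′ = ι k
    ℓ′ = ι ℓ

    0<k : 0ℚ ℚ.< k
    0<k = ℚ.<-≤-trans (Rat.0<ₗ 1ℚ) 1≤k

    k′ℓ′ : k′ * ℓ′ ≈ ι 4ℚ
    k′ℓ′ = trans (sym (ι-* k ℓ)) (reflexive (≡.cong ι kℓ≡4))

    k′≉0 : ¬ k′ ≈ 0r
    k′≉0 = absurd⁺ (ι-< 0<k)

  Q : C.Carrier → C.Carrier
  Q z = κ 4ℚ C.* z C.+ κ k C.* (z C.* z)

  Q-cong : C.Congruent Q
  Q-cong e = C.+-cong (C.*-congˡ e) (C.*-congˡ (C.*-cong e e))

  re-Q : ∀ z → re (Q z) ≈ ι 4ℚ * re z + k′ * (re z * re z - im z * im z)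
  re-Q z = trans (C.re-+ _ _) (+-cong (C.re-κ* _ _) (trans (C.re-κ* _ _) (*-congˡ (C.re-* z z))))

  im-Q : ∀ z → im (Q z) ≈ ι 4ℚ * im z + k′ * (re z * im z + im z * re z)
  im-Q z = trans (C.im-+ _ _) (+-cong (C.im-κ* _ _) (trans (C.im-κ* _ _) (*-congˡ (C.im-* z z))))

  -- If the imaginary part b did not vanish then 2 + ka = 0, and
  -- 4 + k re(Q z) = (2 + ka)² − k²b² forces k b = 0.
  Q⁻¹-real : ∀ a b → - ℓ′ ≤ ι 4ℚ * a + k′ * (a * a - b * b) →
             ι 4ℚ * b + k′ * (a * b + b * a) ≈ 0r → b ≈ 0r
  Q⁻¹-real a b lower imag = stable-≈ λ b≉0 → b≉0
    (let e = x*y≈0 {b} {ι 4ℚ + ι 2ℚ * (k′ * a)}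
               (trans (solve 3 (λ a b k → b :* (con 4ℚ :+ con 2ℚ :* (k :* a)) := con 4ℚ :* b :+ k :* (a :* b :+ b :* a)) refl a b k′) imag) b≉0
         v = ι 4ℚ + ι 2ℚ * (k′ * a)
     in x*y≈0 {k′} {b} (x²≈0 (≤-antisym
          (0≤-⇒≤ _ (ι-≤ (ℚ.<⇒≤ 0<k) *⁰ ≤⇒0≤- lower) (begin
            0r - k′ * b * (k′ * b)
              ≈⟨ solve 2 (λ k b → con 0ℚ :- k :* b :* (k :* b) := con (½ ℚ.* ½) :* (con 0ℚ :* con 0ℚ) :- k :* b :* (k :* b)) refl k′ b ⟩
            ι (½ ℚ.* ½) * (0r * 0r) - k′ * b * (k′ * b)
              ≈⟨ +-congʳ (*-congˡ (*-cong (sym e) (sym e))) ⟩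
            ι (½ ℚ.* ½) * (v * v) - k′ * b * (k′ * b)
              ≈⟨ solve 3 (λ a b k → con (½ ℚ.* ½) :* ((con 4ℚ :+ con 2ℚ :* (k :* a)) :* (con 4ℚ :+ con 2ℚ :* (k :* a))) :- k :* b :* (k :* b)
                   := k :* (con 4ℚ :* a :+ k :* (a :* a :- b :* b)) :+ con 4ℚ) refl a b k′ ⟩
            k′ * (ι 4ℚ * a + k′ * (a * a - b * b)) + ι 4ℚ
              ≈⟨ +-congˡ (sym k′ℓ′) ⟩
            k′ * (ι 4ℚ * a + k′ * (a * a - b * b)) + k′ * ℓ′
              ≈⟨ solve 3 (λ u k l → k :* u :+ k :* l := k :* (u :- :- l)) refl _ k′ ℓ′ ⟩
            k′ * (ι 4ℚ * a + k′ * (a * a - b * b) - - ℓ′) ∎))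
          (0≤x² (k′ * b)))) k′≉0)
    where open import Relation.Binary.Reasoning.Setoid setoid

  Q⁻¹-upper : ∀ a b → ι 4ℚ * a + k′ * (a * a - b * b) ≤ 0r → b ≈ 0r → a ≤ 0r
  Q⁻¹-upper a b upper b≈0 0<a = absurd (0<ₗ 4ℚ *⁺ 0<a +⁺ ι-< 0<k *⁺ (0<a *⁺ 0<a)) (≤⇒0≤- upper)
    (trans (solve 3 (λ a b k → con 4ℚ :* a :+ k :* (a :* a) :+ (con 0ℚ :- (con 4ℚ :* a :+ k :* (a :* a :- b :* b))) := k :* (b :* b)) refl a b k′)
      (trans (*-congˡ (*-cong b≈0 b≈0)) (solve 1 (λ k → k :* (con 0ℚ :* con 0ℚ) := con 0ℚ) refl k′)))

  Q⁻¹-lower : ∀ a b → ι 4ℚ * a + k′ * (a * a - b * b) ≤ 0r → b ≈ 0r → - ℓ′ ≤ a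
  Q⁻¹-lower a b upper b≈0 a<-ℓ = absurd
    (ι-< 0<k *⁺ ((<⇒0<- a<-ℓ +⁺ ι-< 0<ℓ) *⁺ <⇒0<- a<-ℓ)) (≤⇒0≤- upper)
    (trans (+-congˡ (+-congˡ (-‿cong (+-congʳ (*-congʳ (sym k′ℓ′))))))
      (trans (solve 4 (λ a b k l → k :* ((:- l :- a :+ l) :* (:- l :- a)) :+ (con 0ℚ :- (k :* l :* a :+ k :* (a :* a :- b :* b))) := k :* (b :* b)) refl a b k′ ℓ′)
        (trans (*-congˡ (*-cong b≈0 b≈0)) (solve 1 (λ k → k :* (con 0ℚ :* con 0ℚ) := con 0ℚ) refl k′))))

  Q⁻¹-∈ : ∀ z → Q z ∈[ ℚ.- ℓ ,0] → z ∈[ ℚ.- ℓ ,0]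
  Q⁻¹-∈ z (lower , upper , imag) =
    ≤-resp (sym (ι-neg ℓ)) refl (Q⁻¹-lower a b upper′ b≈0) , Q⁻¹-upper a b upper′ b≈0 , b≈0
    where
    a = re z
    b = im z
    upper′ = ≤-resp (re-Q z) refl upper
    b≈0 = Q⁻¹-real a b (≤-resp (ι-neg ℓ) (re-Q z) lower) (trans (sym (im-Q z)) imag)

  -- The start of the backward induction, and the place where k ≤ 4 matters: it gives ℓ ≥ 1.
  -1∈ : ∀ {z} → z C.≈ κ (ℚ.- 1ℚ) → z ∈[ ℚ.- ℓ ,0]
  -1∈ {z} e = ≤-respʳ re≈ (ι-≤ -ℓ≤-1) , ≤-resp re≈ refl (ι-≤ (Rat.0≤-⇒≤ 1ℚ (Rat.0≤ₗ 1ℚ) ≡.refl))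
    , trans (C.im-cong e) (C.im-real _)
    where
    re≈ = sym (trans (C.re-cong e) (C.re-real _))
    1≤ℓ : 1ℚ ℚ.≤ ℓ
    1≤ℓ = ℚ.≮⇒≥ λ ℓ<1 → ℚ.<-irrefl ≡.refl (Rat.0<-⇒< {4ℚ} {4ℚ} _
      (0<k Rat.*⁺ Rat.<⇒0<- ℓ<1 Rat.+⁺⁰ Rat.≤⇒0≤- k≤4)
      (≡.trans (≡.cong (λ q → 4ℚ ℚ.- q) (≡.sym kℓ≡4))
        (S.solve 2 (λ k l → S.con 4ℚ S.:- k S.:* l S.:= k S.:* (S.con 1ℚ S.:- l) S.:+ (S.con 4ℚ S.:- k)) ≡.refl k ℓ)))
    -ℓ≤-1 : ℚ.- ℓ ℚ.≤ ℚ.- 1ℚ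
    -ℓ≤-1 = ℚ.neg-antimono-≤ 1≤ℓ

  module _ (P : C.Carrier → C.Carrier) (P≈QQ : ∀ z → P z C.≈ Q (Q z)) where

    P-cong : C.Congruent P
    P-cong e = C.trans (P≈QQ _) (C.trans (Q-cong (Q-cong e)) (C.sym (P≈QQ _)))

    ∈-resp : ∀ {z w} → z C.≈ w → z ∈[ ℚ.- ℓ ,0] → w ∈[ ℚ.- ℓ ,0]
    ∈-resp e (l , u , i) = ≤-respʳ (C.re-cong e) l , ≤-resp (C.re-cong e) refl u , trans (sym (C.im-cong e)) i

    Root-∈ : ∀ m z → Root P m z → z ∈[ ℚ.- ℓ ,0]
    Root-∈ m z r = Q⁻¹-∈ z (Q⁻¹-∈ (Q z) (∈-resp (P≈QQ z) (P∈ m r)))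
      where
      P∈ : ∀ m → Root P m z → P z ∈[ ℚ.- ℓ ,0]
      P∈ zero    r = -1∈ r
      P∈ (suc m) r = Root-∈ m (P z) r

    Qᵣ : Carrier → Carrier
    Qᵣ a = ι 4ℚ * a + k′ * (a * a)

    Q-real : ∀ a → Q (real a) C.≈ real (Qᵣ a)
    Q-real a = C.sym (C.trans (C.real-+ _ _) (C.+-cong (C.real-* _ _) (C.trans (C.real-* _ _) (C.*-congˡ (C.real-* a a)))))

    -- The number of iterations of Q in m + 1 iterations of P.
    steps : ℕ → ℕ
    steps zero    = 2
    steps (suc m) = suc (suc (steps m))

    m≤steps : ∀ m → m ℕ.≤ steps m
    m≤steps zero    = ℕ.z≤n
    m≤steps (suc m) = ℕ.s≤s (ℕ.m≤n⇒m≤1+n (m≤steps m))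

    P-real : ∀ a → P (real a) C.≈ real (Qᵣ (Qᵣ a))
    P-real a = C.trans (P≈QQ _) (C.trans (Q-cong (Q-real a)) (Q-real (Qᵣ a)))

    Root-real : ∀ m a → iterate Qᵣ (steps m) a ≈ ι (ℚ.- 1ℚ) → Root P m (real a)
    Root-real zero    a e = C.trans (P-real a) (C.real-cong e)
    Root-real (suc m) a e = C.Root-resp P-cong m (C.sym (P-real a)) (Root-real m (Qᵣ (Qᵣ a)) e)

    conj : ∀ n a → iterate T n (k′ * a + ι 2ℚ) ≈ k′ * iterate Qᵣ n a + ι 2ℚ
    conj zero    a = refl
    conj (suc n) a = trans (iterate-cong T-cong n
      (solve 2 (λ k a → (k :* a :+ con 2ℚ) :* (k :* a :+ con 2ℚ) :- con 2ℚ := k :* (con 4ℚ :* a :+ k :* (a :* a)) :+ con 2ℚ) refl k′ a))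
      (conj n (Qᵣ a))

    -- The image of -1 under the conjugacy z ↦ kz + 2.
    τ : ℚ
    τ = 2ℚ ℚ.- k

    Inℚ-τ : Inℚ τ
    Inℚ-τ = Rat.0≤-⇒≤ _ (Rat.≤⇒0≤- k≤4) (S.solve 1 (λ k → S.con 2ℚ S.:- k S.:- S.:- S.con 2ℚ S.:= S.con 4ℚ S.:- k) ≡.refl k)
          , Rat.0≤-⇒≤ k (ℚ.<⇒≤ 0<k) (S.solve 1 (λ k → S.con 2ℚ S.:- (S.con 2ℚ S.:- k) S.:= k) ≡.refl k)

    -- u = (y − 2)/k, with 1/k = ℓ/4.
    pull : Carrier → Carrier
    pull y = (y - ι 2ℚ) * (ι (½ ℚ.* ½) * ℓ′)

    k-pull : ∀ y → k′ * pull y ≈ y - ι 2ℚ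
    k-pull y = trans (solve 3 (λ k l y → k :* ((y :- con 2ℚ) :* (con (½ ℚ.* ½) :* l)) := (y :- con 2ℚ) :* (con (½ ℚ.* ½) :* (k :* l))) refl k′ ℓ′ y)
      (trans (*-congˡ (*-congˡ k′ℓ′)) (solve 1 (λ y → (y :- con 2ℚ) :* (con (½ ℚ.* ½) :* con 4ℚ) := y :- con 2ℚ) refl y))

    pull-root : ∀ n y → iterate T n y ≈ ι τ → iterate Qᵣ n (pull y) ≈ ι (ℚ.- 1ℚ)
    pull-root n y e = trans (solve 1 (λ q → q := q :+ con 1ℚ :+ con (ℚ.- 1ℚ)) refl q)
      (trans (+-congʳ (x*y≈0 {k′} eq k′≉0)) (solve 0 (con 0ℚ :+ con (ℚ.- 1ℚ) := con (ℚ.- 1ℚ)) refl))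
      where
      q = iterate Qᵣ n (pull y)
      kq+2 : k′ * q + ι 2ℚ ≈ ι τ
      kq+2 = trans (sym (conj n (pull y))) (trans (iterate-cong T-cong n
        (trans (+-congʳ (k-pull y)) (solve 1 (λ y → y :- con 2ℚ :+ con 2ℚ := y) refl y))) e)
      eq : k′ * (q + ι 1ℚ) ≈ 0r
      eq = trans (solve 2 (λ k q → k :* (q :+ con 1ℚ) := (k :* q :+ con 2ℚ) :- (con 2ℚ :- k)) refl k′ q)
        (trans (+-congʳ (trans kq+2 (ι-sub 2ℚ k))) (solve 1 (λ k → (con 2ℚ :- k) :- (con 2ℚ :- k) := con 0ℚ) refl k′))

    -- (a − u)² ≤ k²(a − u)² = ((ka + 2 − x) + (x − y))² ≤ 2(ka + 2 − x)² + 2(x − y)².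
    estimate : ∀ a x y δ e → (k′ * a + ι 2ℚ - ι x) * (k′ * a + ι 2ℚ - ι x) ≤ ι δ →
               (ι x - y) * (ι x - y) ≤ ι 8ℚ * ι e →
               (a - pull y) * (a - pull y) ≤ ι (2ℚ ℚ.* (δ ℚ.+ 8ℚ ℚ.* e))
    estimate a x y δ e h₁ h₂ = 0≤-⇒≤ _
      (0≤ₗ 2ℚ *⁰ (≤⇒0≤- h₁ +⁰ ≤⇒0≤- h₂) +⁰ 0≤x² (X - Y) +⁰ (ι-≤ (Rat.≤⇒0≤- 1≤k) *⁰ (ι-≤ (Rat.0≤ₗ 1ℚ Rat.+⁰ ℚ.<⇒≤ 0<k)) *⁰ 0≤x² (a - pull y)))
      (trans (+-congʳ bound-expand) (trans (solve 6 (λ d e X Y v k → con 2ℚ :* (d :+ con 8ℚ :* e) :- v :* v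
          := con 2ℚ :* ((d :- X :* X) :+ (con 8ℚ :* e :- Y :* Y)) :+ ((X :- Y) :* (X :- Y)
             :+ (k :- con 1ℚ) :* ((con 1ℚ :+ k) :* (v :* v)) :+ ((X :+ Y) :* (X :+ Y) :- (k :* v) :* (k :* v)))) refl
          (ι δ) (ι e) X Y (a - pull y) k′)
        (+-congˡ (trans (+-cong (+-congˡ (*-cong (sym (ι-sub k 1ℚ)) (*-congʳ (sym (ι-+ 1ℚ k))))) vanish)
          (solve 1 (λ s → s :+ con 0ℚ := s) refl _)))))
      where
      X = k′ * a + ι 2ℚ - ι x
      Y = ι x - y
      bound-expand : ι (2ℚ ℚ.* (δ ℚ.+ 8ℚ ℚ.* e)) ≈ ι 2ℚ * (ι δ + ι 8ℚ * ι e)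
      bound-expand = trans (ι-* _ _) (*-congˡ (trans (ι-+ _ _) (+-congˡ (ι-* _ _))))
      kv : k′ * (a - pull y) ≈ X + Y
      kv = trans (solve 3 (λ k a p → k :* (a :- p) := k :* a :- k :* p) refl k′ a (pull y))
        (trans (+-congˡ (-‿cong (k-pull y)))
          (solve 4 (λ k a x y → k :* a :- (y :- con 2ℚ) := k :* a :+ con 2ℚ :- x :+ (x :- y)) refl k′ a (ι x) y))
      vanish : (X + Y) * (X + Y) - k′ * (a - pull y) * (k′ * (a - pull y)) ≈ 0r
      vanish = trans (+-congˡ (-‿cong (*-cong kv kv))) (solve 1 (λ s → s :* s :- s :* s := con 0ℚ) refl (X + Y))

    rescale : ∀ z → z ∈[ ℚ.- ℓ ,0] → k′ * re z + ι 2ℚ ∈[-2,2]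
    rescale z (lower , upper , _) =
        0≤-⇒≤ _ (ι-≤ (ℚ.<⇒≤ 0<k) *⁰ ≤⇒0≤- lower) (trans (+-cong refl (-‿cong (ι-neg 2ℚ)))
          (trans (solve 2 (λ k a → k :* a :+ con 2ℚ :- :- con 2ℚ := k :* a :+ con 4ℚ) refl k′ (re z))
            (trans (+-congˡ (sym k′ℓ′)) (trans (solve 3 (λ k a l → k :* a :+ k :* l := k :* (a :- :- l)) refl k′ (re z) ℓ′)
              (*-congˡ (+-congˡ (-‿cong (sym (ι-neg ℓ)))))))))
      , 0≤-⇒≤ _ (ι-≤ (ℚ.<⇒≤ 0<k) *⁰ ≤⇒0≤- upper)
          (solve 2 (λ k a → con 2ℚ :- (k :* a :+ con 2ℚ) := k :* (con 0ℚ :- a)) refl k′ (re z))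

    dense : ∀ ε → 0ℚ ℚ.< ε → ∃[ M ] (∀ m → m ℕ.≥ M → ∀ z → z ∈[ ℚ.- ℓ ,0] →
            ∃[ w ] (Root P m w × C.∣ z C.- w ∣² < ι (ε ℚ.* ε)))
    dense ε 0<ε = from-small (η-small (c ℚ.* (ε ℚ.* ε)) (Rat.0<ₗ c Rat.*⁺ (0<ε Rat.*⁺ 0<ε)))
      where
      c δ : ℚ
      -- With δ = ε/2 and e < ε²/64 the bound 2(δ² + 8e) of `estimate` is below ε²/2 + ε²/4.
      c = ½ ℚ.* (½ ℚ.* (½ ℚ.* (½ ℚ.* (½ ℚ.* ½))))
      δ = ½ ℚ.* ε
      0<δ : 0ℚ ℚ.< δ
      0<δ = Rat.0<ₗ ½ Rat.*⁺ 0<ε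
      bound : ∀ e → e ℚ.< c ℚ.* (ε ℚ.* ε) → 2ℚ ℚ.* (δ ℚ.* δ ℚ.+ 8ℚ ℚ.* e) ℚ.< ε ℚ.* ε
      bound e h = Rat.0<-⇒< _ (Rat.0<ₗ (2ℚ ℚ.* 8ℚ) Rat.*⁺ Rat.<⇒0<- h Rat.+⁺ Rat.0<ₗ (½ ℚ.* ½) Rat.*⁺ (0<ε Rat.*⁺ 0<ε))
        (S.solve 2 (λ t e → t S.:* t S.:- S.con 2ℚ S.:* (S.con ½ S.:* t S.:* (S.con ½ S.:* t) S.:+ S.con 8ℚ S.:* e)
          S.:= S.con (2ℚ ℚ.* 8ℚ) S.:* (S.con c S.:* (t S.:* t) S.:- e) S.:+ S.con (½ ℚ.* ½) S.:* (t S.:* t)) ≡.refl ε e)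
      dist : ∀ z u → im z ≈ 0r → C.∣ z C.- real u ∣² ≈ (re z - u) * (re z - u)
      dist z u e = trans (+-cong (*-cong r r) (*-cong i i)) (solve 1 (λ s → s :+ con 0ℚ :* con 0ℚ := s) refl _)
        where
        r = trans (C.re-+ z (C.- real u)) (+-congˡ (trans (C.re-neg _) (-‿cong (C.re-real u))))
        i = trans (C.im-+ z (C.- real u)) (trans (+-cong e (trans (C.im-neg _) (-‿cong (C.im-real u))))
              (solve 0 (con 0ℚ :- con 0ℚ := con 0ℚ) refl))

      from-shadow : ∀ m z x → im z ≈ 0r → Inℚ x → η (steps m) ℚ.< c ℚ.* (ε ℚ.* ε) →
        (k′ * re z + ι 2ℚ - ι x) * (k′ * re z + ι 2ℚ - ι x) ≤ ι (δ ℚ.* δ) →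
        ∃[ y ] (iterate T (steps m) y ≈ ι τ × y ∈[-2,2] × ¬ Far (ι (η (steps m))) (ι x) y) →
        ∃[ w ] (Root P m w × C.∣ z C.- w ∣² < ι (ε ℚ.* ε))
      from-shadow m z x imag hx small Xx (y , Tⁿy≈τ , hy , near) =
          real (pull y) , Root-real m (pull y) (pull-root (steps m) y Tⁿy≈τ)
        , <-respˡ (sym (dist z (pull y) imag)) (≤-ι⇒<-ι
            (estimate (re z) x y (δ ℚ.* δ) (η (steps m)) Xx (close (ι-≤ (0≤η (steps m))) (Inℚ⇒ hx) hy near))
            (bound (η (steps m)) small))

      from-clip : ∀ m z → im z ≈ 0r → η (steps m) ℚ.< c ℚ.* (ε ℚ.* ε) →
        ∃[ x ] (Inℚ x × (k′ * re z + ι 2ℚ - ι x) * (k′ * re z + ι 2ℚ - ι x) ≤ ι (δ ℚ.* δ)) →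
        ∃[ w ] (Root P m w × C.∣ z C.- w ∣² < ι (ε ℚ.* ε))
      from-clip m z imag small (x , hx , Xx) = from-shadow m z x imag hx small Xx (shadow (steps m) x τ hx Inℚ-τ)

      from-approx : ∀ m z → z ∈[ ℚ.- ℓ ,0] → η (steps m) ℚ.< c ℚ.* (ε ℚ.* ε) →
        ∃[ q ] (ι (q ℚ.- δ) < k′ * re z + ι 2ℚ × k′ * re z + ι 2ℚ < ι (q ℚ.+ δ)) →
        ∃[ w ] (Root P m w × C.∣ z C.- w ∣² < ι (ε ℚ.* ε))
      from-approx m z z∈ small (q , q-δ<X , X<q+δ) = from-clip m z (proj₂ (proj₂ z∈)) small
        (clip q (ℚ.<⇒≤ 0<δ) (rescale z z∈) q-δ<X X<q+δ)

      from-small : ∃[ M ] (∀ n → n ℕ.≥ M → η n ℚ.< c ℚ.* (ε ℚ.* ε)) →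
        ∃[ M ] (∀ m → m ℕ.≥ M → ∀ z → z ∈[ ℚ.- ℓ ,0] → ∃[ w ] (Root P m w × C.∣ z C.- w ∣² < ι (ε ℚ.* ε)))
      from-small (M , small) = M , λ m m≥M z z∈ →
        from-approx m z z∈ (small (steps m) (ℕ.≤-trans m≥M (m≤steps m))) (approx (k′ * re z + ι 2ℚ) δ 0<δ)

    rootLimit : C.RootLimit P (ℚ.- ℓ)
    rootLimit ε 0<ε = both (dense ε 0<ε)
      where
      both : ∃[ M ] (∀ m → m ℕ.≥ M → ∀ z → z ∈[ ℚ.- ℓ ,0] → ∃[ w ] (Root P m w × C.∣ z C.- w ∣² < ι (ε ℚ.* ε))) →
             ∃[ M ] (∀ m → m ℕ.≥ M →
               (∀ z → Root P m z → ∃[ w ] (w ∈[ ℚ.- ℓ ,0] × C.∣ z C.- w ∣² < ι (ε ℚ.* ε)))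
             × (∀ z → z ∈[ ℚ.- ℓ ,0] → ∃[ w ] (Root P m w × C.∣ z C.- w ∣² < ι (ε ℚ.* ε))))
      both (M , near) = M , λ m m≥M → (λ z r → z , Root-∈ m z r , C.self-distance z ε 0<ε) , near m m≥M

-- Subsets of a lexicographic product as families of blocks

module Blocks where

  open import Defs hiding (_≈_)
  open import Data.Bool using (Bool)
  open import Data.Fin as Fin using (Fin; zero; suc; combine)
  import Data.Fin.Properties as Fin
  open import Data.Fin.Subset as Subset using (Subset; inside; outside; _∈_)
  import Data.Fin.Subset.Properties as Subset
  open import Data.List as List using (List; _++_)
  open import Data.Vec as Vec using (Vec; []; _∷_; lookup)
  import Data.Vec.Properties as Vec

  subsetsOf : ∀ {n} → Subset n → List (Subset n)
  subsetsOf []            = List.[ [] ]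
  subsetsOf (outside ∷ A) = List.map (outside ∷_) (subsetsOf A)
  subsetsOf (inside ∷ A)  = List.map (outside ∷_) (subsetsOf A) ++ List.map (inside ∷_) (subsetsOf A)

  nonempty : ∀ {m} → Subset m → Bool
  nonempty []            = outside
  nonempty (outside ∷ T) = nonempty T
  nonempty (inside ∷ T)  = inside

  ∈⇒lookup : ∀ {n} {S : Subset n} {u} → u ∈ S → lookup S u ≡ inside
  ∈⇒lookup = Vec.[]=⇒lookup

  lookup⇒∈ : ∀ {n} {S : Subset n} {u} → lookup S u ≡ inside → u ∈ S
  lookup⇒∈ {S = S} {u} = Vec.lookup⇒[]= u S

  lookup-concat : ∀ {m n} (V : Vec (Subset m) n) i j → lookup (Vec.concat V) (combine i j) ≡ lookup (lookup V i) j
  lookup-concat (T ∷ V) zero    j = Vec.lookup-++ˡ T (Vec.concat V) j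
  lookup-concat (T ∷ V) (suc i) j = ≡.trans (Vec.lookup-++ʳ T (Vec.concat V) (combine i j)) (lookup-concat V i j)

  ∣++∣ : ∀ {m n} (S : Subset m) (T : Subset n) → Subset.∣ S Vec.++ T ∣ ≡ Subset.∣ S ∣ ℕ.+ Subset.∣ T ∣
  ∣++∣ []            T = ≡.refl
  ∣++∣ (outside ∷ S) T = ∣++∣ S T
  ∣++∣ (inside ∷ S)  T = ≡.cong suc (∣++∣ S T)

  nonempty⇒∃ : ∀ {m} (T : Subset m) → nonempty T ≡ inside → Subset.Nonempty T
  nonempty⇒∃ (outside ∷ T) h = let i , i∈T = nonempty⇒∃ T h in suc i , Vec.there i∈T
  nonempty⇒∃ (inside ∷ T)  h = zero , Vec.here

  ∃⇒nonempty : ∀ {m} {T : Subset m} {i} → i ∈ T → nonempty T ≡ inside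
  ∃⇒nonempty Vec.here                        = ≡.refl
  ∃⇒nonempty {T = outside ∷ T} (Vec.there h) = ∃⇒nonempty h
  ∃⇒nonempty {T = inside ∷ T}  (Vec.there h) = ≡.refl

  -- A subset of V(G) × V(H) is written `Vec.concat V`, with one block in V(H) for each vertex of G;
  -- this is its projection to V(G).
  supp : ∀ {m n} → Vec (Subset m) n → Subset n
  supp = Vec.map nonempty

  ∈supp⁻ : ∀ {m n} (V : Vec (Subset m) n) {u} → u ∈ supp V → Subset.Nonempty (lookup V u)
  ∈supp⁻ V {u} h = nonempty⇒∃ (lookup V u) (≡.trans (≡.sym (Vec.lookup-map u nonempty V)) (∈⇒lookup h))

  ∈supp⁺ : ∀ {m n} (V : Vec (Subset m) n) {u i} → i ∈ lookup V u → u ∈ supp V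
  ∈supp⁺ V {u} h = lookup⇒∈ (≡.trans (Vec.lookup-map u nonempty V) (∃⇒nonempty h))

  module _ (G H : Graph) where

    private
      m = order H
      n = order G

    LexAdj : Fin n × Fin m → Fin n × Fin m → Set
    LexAdj (i , j) (i′ , j′) = Adj G i i′ ⊎ (i ≡ i′ × Adj H j j′)

    Adj-combine⁺ : ∀ i j i′ j′ → Adj G i i′ ⊎ (i ≡ i′ × Adj H j j′) → Adj (G ⟦ H ⟧) (combine i j) (combine i′ j′)
    Adj-combine⁺ i j i′ j′ = ≡.subst₂ LexAdj (≡.sym (Fin.remQuot-combine {n} {m} i j)) (≡.sym (Fin.remQuot-combine {n} {m} i′ j′))

    Adj-combine⁻ : ∀ i j i′ j′ → Adj (G ⟦ H ⟧) (combine i j) (combine i′ j′) → Adj G i i′ ⊎ (i ≡ i′ × Adj H j j′)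
    Adj-combine⁻ i j i′ j′ = ≡.subst₂ LexAdj (Fin.remQuot-combine {n} {m} i j) (Fin.remQuot-combine {n} {m} i′ j′)

    ∈concat⁺ : ∀ (V : Vec (Subset m) n) {i j} → j ∈ lookup V i → combine i j ∈ Vec.concat V
    ∈concat⁺ V {i} {j} h = lookup⇒∈ (≡.trans (lookup-concat V i j) (∈⇒lookup h))

    ∈concat⁻ : ∀ (V : Vec (Subset m) n) {i j} → combine i j ∈ Vec.concat V → j ∈ lookup V i
    ∈concat⁻ V {i} {j} h = lookup⇒∈ (≡.trans (≡.sym (lookup-concat V i j)) (∈⇒lookup h))

    -- Between different blocks adjacency is that of G alone, and inside a block that of H alone.
    -- Together with `independent⁺` this characterises the independent sets of the product.
    independent⁻ : ∀ V → Independent (G ⟦ H ⟧) (Vec.concat V) →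
                   Independent G (supp V) × (∀ i → Independent H (lookup V i))
    independent⁻ V ind =
        (λ i i′ i∈ i′∈ adj → let j , j∈ = ∈supp⁻ V i∈ ; j′ , j′∈ = ∈supp⁻ V i′∈ in
           ind _ _ (∈concat⁺ V j∈) (∈concat⁺ V j′∈) (Adj-combine⁺ i j i′ j′ (inj₁ adj)))
      , (λ i j j′ j∈ j′∈ adj → ind _ _ (∈concat⁺ V j∈) (∈concat⁺ V j′∈) (Adj-combine⁺ i j i j′ (inj₂ (≡.refl , adj))))

    independent⁺ : ∀ V → Independent G (supp V) → (∀ i → Independent H (lookup V i)) →
                   Independent (G ⟦ H ⟧) (Vec.concat V)
    independent⁺ V indG indH p q p∈ q∈ adj with Fin.combine-surjective {n} {m} p | Fin.combine-surjective {n} {m} q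
    ... | i , j , ≡.refl | i′ , j′ , ≡.refl with Adj-combine⁻ i j i′ j′ adj
    ... | inj₁ a = indG i i′ (∈supp⁺ V (∈concat⁻ V p∈)) (∈supp⁺ V (∈concat⁻ V q∈)) a
    ... | inj₂ (≡.refl , a) = indH i j j′ (∈concat⁻ V p∈) (∈concat⁻ V q∈) a

module IndependenceNumber where

  open import Defs hiding (_≈_)
  open Blocks
  open import Data.Bool using (true; false)
  open import Data.Nat using (_≤_; _<_; _+_; _*_; z≤n; s≤s)
  open import Data.Fin using (zero; suc)
  open import Data.Fin.Subset as Subset using (Subset; inside; outside; ∣_∣) renaming (_∈_ to _∈ˢ_)
  import Data.Fin.Subset.Properties as Subset
  open import Data.List as List using (List)
  open import Data.List.Extrema.Nat using (xs≤max; argmax-sel)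
  open import Data.List.Membership.Propositional using (_∈_)
  open import Data.List.Membership.Propositional.Properties using (∈-filter⁺; ∈-filter⁻; ∈-map⁺; ∈-map⁻; ∈-++⁺ˡ; ∈-++⁺ʳ)
  open import Data.List.Relation.Unary.All as All using (All)
  import Data.List.Relation.Unary.All.Properties as All
  open import Data.List.Relation.Unary.Any using (here)
  open import Data.Vec as Vec using (Vec; []; _∷_; lookup)
  import Data.Vec.Properties as Vec
  open import Relation.Binary.PropositionalEquality
  open import Function using (id; _∘_)

  ∈subsets : ∀ {n} (S : Subset n) → S ∈ subsets n
  ∈subsets []            = here refl
  ∈subsets (outside ∷ S) = ∈-++⁺ˡ (∈-map⁺ (outside ∷_) (∈subsets S))
  ∈subsets (inside ∷ S)  = ∈-++⁺ʳ _ (∈-map⁺ (inside ∷_) (∈subsets S))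

  ∈independentSets : ∀ G S → Independent G S → S ∈ independentSets G
  ∈independentSets G S ind = ∈-filter⁺ (independent? G) (∈subsets S) ind

  ∣∣≤α : ∀ G S → Independent G S → ∣ S ∣ ≤ independenceNumber G
  ∣∣≤α G S ind = All.lookup (xs≤max 0 _) (∈-map⁺ ∣_∣ (∈independentSets G S ind))

  sizes≤α : ∀ G → All (λ S → ∣ S ∣ < suc (independenceNumber G)) (independentSets G)
  sizes≤α G = All.map s≤s (All.map⁻ (xs≤max 0 (List.map ∣_∣ (independentSets G))))

  maximum : ∀ G → ∃[ S ] (Independent G S × ∣ S ∣ ≡ independenceNumber G)
  maximum G with argmax-sel id 0 (List.map ∣_∣ (independentSets G))
  ... | inj₁ α≡0 = Subset.⊥ , (λ _ _ u∈ _ _ → Subset.∉⊥ u∈) , trans (Subset.∣⊥∣≡0 (order G)) (sym α≡0)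
  ... | inj₂ α∈ with ∈-map⁻ ∣_∣ α∈
  ... | S , S∈ , α≡ = S , proj₂ (∈-filter⁻ (independent? G) {xs = subsets (order G)} S∈) , sym α≡

  ∣⊥∣ : ∀ {m} (T : Subset m) → nonempty T ≡ outside → ∣ T ∣ ≡ 0
  ∣⊥∣ []            _ = refl
  ∣⊥∣ (outside ∷ T) h = ∣⊥∣ T h

  ∣concat∣≤ : ∀ {m n} (V : Vec (Subset m) n) b → (∀ i → ∣ lookup V i ∣ ≤ b) → ∣ Vec.concat V ∣ ≤ ∣ supp V ∣ * b
  ∣concat∣≤ []      b h = z≤n
  ∣concat∣≤ (T ∷ V) b h with nonempty T in e
  ... | true  = ℕ.≤-trans (ℕ.≤-reflexive (∣++∣ T _)) (ℕ.+-mono-≤ (h zero) (∣concat∣≤ V b (h ∘ suc)))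
  ... | false = ℕ.≤-trans (ℕ.≤-reflexive (trans (∣++∣ T _) (cong (_+ ∣ Vec.concat V ∣) (∣⊥∣ T e)))) (∣concat∣≤ V b (h ∘ suc))

  blowup : ∀ {m n} → Subset m → Subset n → Vec (Subset m) n
  blowup T = Vec.map λ { inside → T ; outside → Subset.⊥ }

  ∣blowup∣ : ∀ {m n} (T : Subset m) (A : Subset n) → ∣ Vec.concat (blowup T A) ∣ ≡ ∣ A ∣ * ∣ T ∣
  ∣blowup∣ T []                    = refl
  ∣blowup∣ T (inside ∷ A)          = trans (∣++∣ T _) (cong (λ k → ∣ T ∣ + k) (∣blowup∣ T A))
  ∣blowup∣ {m} T (outside ∷ A)     = trans (∣++∣ {m} Subset.⊥ _) (cong₂ _+_ (Subset.∣⊥∣≡0 m) (∣blowup∣ T A))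

  lookup-blowup : ∀ {m n} (T : Subset m) (A : Subset n) i →
                  (lookup (blowup T A) i ≡ T × lookup A i ≡ inside) ⊎ lookup (blowup T A) i ≡ Subset.⊥
  lookup-blowup T (inside ∷ A)  zero    = inj₁ (refl , refl)
  lookup-blowup T (outside ∷ A) zero    = inj₂ refl
  lookup-blowup T (_ ∷ A)       (suc i) = lookup-blowup T A i

  -- An independent set has at most α(G) nonempty blocks of size at most α(H). Placing a maximum
  -- independent set of H over every vertex of one of G attains this.
  α-⟦⟧ : ∀ G H → independenceNumber (G ⟦ H ⟧) ≡ independenceNumber G * independenceNumber H
  α-⟦⟧ G H = ℕ.≤-antisym upper lower
    where
    m = order H
    n = order G
    upper : independenceNumber (G ⟦ H ⟧) ≤ independenceNumber G * independenceNumber H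
    upper with maximum (G ⟦ H ⟧)
    ... | S , ind , ∣S∣≡α with Vec.group n m S
    ... | V , refl = let indG , indH = independent⁻ G H V ind in
      ℕ.≤-trans (ℕ.≤-reflexive (sym ∣S∣≡α)) (ℕ.≤-trans (∣concat∣≤ V _ (λ i → ∣∣≤α H _ (indH i)))
        (ℕ.*-monoˡ-≤ (independenceNumber H) (∣∣≤α G _ indG)))
    lower : independenceNumber G * independenceNumber H ≤ independenceNumber (G ⟦ H ⟧)
    lower with maximum G | maximum H
    ... | A , indA , ∣A∣≡ | T , indT , ∣T∣≡ = subst (_≤ independenceNumber (G ⟦ H ⟧))
      (trans (∣blowup∣ T A) (cong₂ _*_ ∣A∣≡ ∣T∣≡))
      (∣∣≤α (G ⟦ H ⟧) _ (independent⁺ G H (blowup T A) indSupp indBlocks))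
      where
      ⊆A : ∀ {u} → u ∈ˢ supp (blowup T A) → u ∈ˢ A
      ⊆A {u} u∈ with ∈supp⁻ (blowup T A) u∈ | lookup-blowup T A u
      ... | _ , _  | inj₁ (_ , e) = lookup⇒∈ e
      ... | i , i∈ | inj₂ e with () ← Subset.∉⊥ (subst (i ∈ˢ_) e i∈)
      indSupp : Independent G (supp (blowup T A))
      indSupp u v u∈ v∈ = indA u v (⊆A u∈) (⊆A v∈)
      indBlocks : ∀ i → Independent H (lookup (blowup T A) i)
      indBlocks i with lookup-blowup T A i
      ... | inj₁ (e , _) = subst (Independent H) (sym e) indT
      ... | inj₂ e       = subst (Independent H) (sym e) (λ _ _ u∈ _ _ → Subset.∉⊥ u∈)

-- Sums over subsets and the composition law, over any commutative ring

module SubsetSums (R : CommutativeRing 0ℓ 0ℓ) where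

  open import Defs using (subsets)
  open Blocks using (subsetsOf; nonempty)
  open CommutativeRing R hiding (zero)
  open import Relation.Binary.Reasoning.Setoid setoid
  open import Data.Bool using (Bool; true; false; if_then_else_)
  open import Data.Nat using (s≤s)
  open import Data.Fin.Subset as Subset using (Subset; inside; outside; ∁; _∩_; ∣_∣)
  open import Data.List as List using (List; []; _∷_; _++_; filter; length; foldr; applyUpTo)
  import Data.List.Properties as List
  open import Data.List.Relation.Unary.All using (All; []; _∷_)
  open import Data.Vec as Vec using (Vec; []; _∷_)
  open import Relation.Nullary using (does)
  open import Relation.Unary using (Pred; Decidable)
  open import Function using (_∘_)

  pow : Carrier → ℕ → Carrier
  pow z zero    = 1#
  pow z (suc n) = z * pow z n

  pow-+ : ∀ z m n → pow z (m ℕ.+ n) ≈ pow z m * pow z n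
  pow-+ z zero    n = sym (*-identityˡ _)
  pow-+ z (suc m) n = trans (*-congˡ (pow-+ z m n)) (sym (*-assoc _ _ _))

  Σˡ : {X : Set} → (X → Carrier) → List X → Carrier
  Σˡ f = foldr (λ x acc → f x + acc) 0#

  Σˡ-++ : ∀ {X : Set} (f : X → Carrier) xs ys → Σˡ f (xs ++ ys) ≈ Σˡ f xs + Σˡ f ys
  Σˡ-++ f []       ys = sym (+-identityˡ _)
  Σˡ-++ f (x ∷ xs) ys = trans (+-congˡ (Σˡ-++ f xs ys)) (sym (+-assoc _ _ _))

  Σˡ-map : ∀ {X Y : Set} (f : Y → Carrier) (g : X → Y) xs → Σˡ f (List.map g xs) ≈ Σˡ (f ∘ g) xs
  Σˡ-map f g []       = refl
  Σˡ-map f g (x ∷ xs) = +-congˡ (Σˡ-map f g xs)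

  Σˡ-filter : ∀ {X : Set} (f : X → Carrier) {P : Pred X 0ℓ} (P? : Decidable P) xs →
              Σˡ f (filter P? xs) ≈ Σˡ (λ x → if does (P? x) then f x else 0#) xs
  Σˡ-filter f P? []       = refl
  Σˡ-filter f P? (x ∷ xs) with does (P? x)
  ... | true  = +-congˡ (Σˡ-filter f P? xs)
  ... | false = trans (Σˡ-filter f P? xs) (sym (+-identityˡ _))

  Σ⊆ : ∀ {n} → Subset n → (Subset n → Carrier) → Carrier
  Σ⊆ []            f = f []
  Σ⊆ (outside ∷ A) f = Σ⊆ A (f ∘ (outside ∷_))
  Σ⊆ (inside ∷ A)  f = Σ⊆ A (f ∘ (outside ∷_)) + Σ⊆ A (f ∘ (inside ∷_))

  Σ⊆-subsetsOf : ∀ {n} (A : Subset n) f → Σˡ f (subsetsOf A) ≈ Σ⊆ A f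
  Σ⊆-subsetsOf []            f = +-identityʳ _
  Σ⊆-subsetsOf (outside ∷ A) f = trans (Σˡ-map f _ (subsetsOf A)) (Σ⊆-subsetsOf A _)
  Σ⊆-subsetsOf (inside ∷ A)  f = trans (Σˡ-++ f (List.map (outside ∷_) (subsetsOf A)) _)
    (+-cong (trans (Σˡ-map f _ (subsetsOf A)) (Σ⊆-subsetsOf A _))
            (trans (Σˡ-map f _ (subsetsOf A)) (Σ⊆-subsetsOf A _)))

  -- Recursion on the ground set and not a fold over `subsets n`, so that splitting by blocks or by
  -- parts of the vertex set is a plain induction.
  Σₙ : ∀ n → (Subset n → Carrier) → Carrier
  Σₙ zero    f = f []
  Σₙ (suc n) f = Σₙ n (f ∘ (outside ∷_)) + Σₙ n (f ∘ (inside ∷_))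

  Σₙ-subsets : ∀ n f → Σˡ f (subsets n) ≈ Σₙ n f
  Σₙ-subsets zero    f = +-identityʳ _
  Σₙ-subsets (suc n) f = trans (Σˡ-++ f (List.map (outside ∷_) (subsets n)) _)
    (+-cong (trans (Σˡ-map f _ (subsets n)) (Σₙ-subsets n _))
            (trans (Σˡ-map f _ (subsets n)) (Σₙ-subsets n _)))

  Σₙ-cong : ∀ n {f g} → (∀ S → f S ≈ g S) → Σₙ n f ≈ Σₙ n g
  Σₙ-cong zero    h = h []
  Σₙ-cong (suc n) h = +-cong (Σₙ-cong n (h ∘ (outside ∷_))) (Σₙ-cong n (h ∘ (inside ∷_)))

  Σₙ-*ʳ : ∀ n f c → Σₙ n (λ S → f S * c) ≈ Σₙ n f * c
  Σₙ-*ʳ zero    f c = refl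
  Σₙ-*ʳ (suc n) f c = trans (+-cong (Σₙ-*ʳ n _ c) (Σₙ-*ʳ n _ c)) (sym (distribʳ c _ _))

  -- Subsets correspond to pairs of a subset of A and one of its complement, so this is
  -- distributivity. It later factors I_G along a separation.
  Σₙ-∩-∁ : ∀ {n} (A : Subset n) f g → Σₙ n (λ S → f (S ∩ A) * g (S ∩ ∁ A)) ≈ Σ⊆ A f * Σ⊆ (∁ A) g
  Σₙ-∩-∁ []            f g = refl
  Σₙ-∩-∁ (outside ∷ A) f g = trans (+-cong (Σₙ-∩-∁ A _ _) (Σₙ-∩-∁ A _ _)) (sym (distribˡ _ _ _))
  Σₙ-∩-∁ (inside ∷ A)  f g = trans (+-cong (Σₙ-∩-∁ A _ _) (Σₙ-∩-∁ A _ _)) (sym (distribʳ _ _ _))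

  Σₙ-++ : ∀ m n f → Σₙ (m ℕ.+ n) f ≈ Σₙ m (λ T → Σₙ n (λ S → f (T Vec.++ S)))
  Σₙ-++ zero    n f = refl
  Σₙ-++ (suc m) n f = +-cong (Σₙ-++ m n _) (Σₙ-++ m n _)

  module _ {m : ℕ} where

    Σᵇ : ∀ n → (Vec (Subset m) n → Carrier) → Carrier
    Σᵇ zero    f = f []
    Σᵇ (suc n) f = Σₙ m (λ T → Σᵇ n (λ V → f (T ∷ V)))

    Σᵇ-concat : ∀ n f → Σₙ (n ℕ.* m) f ≈ Σᵇ n (f ∘ Vec.concat)
    Σᵇ-concat zero    f = refl
    Σᵇ-concat (suc n) f = trans (Σₙ-++ m (n ℕ.* m) f) (Σₙ-cong m (λ T → Σᵇ-concat n _))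

    Σᵇ-cong : ∀ n {f g} → (∀ V → f V ≈ g V) → Σᵇ n f ≈ Σᵇ n g
    Σᵇ-cong zero    h = h []
    Σᵇ-cong (suc n) h = Σₙ-cong m (λ T → Σᵇ-cong n (λ V → h (T ∷ V)))

    Σᵇ-*ˡ : ∀ n c f → Σᵇ n (λ V → c * f V) ≈ c * Σᵇ n f
    Σᵇ-*ˡ zero    c f = refl
    Σᵇ-*ˡ (suc n) c f = trans (Σₙ-cong m (λ T → trans (Σᵇ-*ˡ n c _) (*-comm c _)))
      (trans (Σₙ-*ʳ m _ c) (*-comm _ c))

  -- The source of the -1 in the composition law: only nonempty blocks count towards the support,
  -- and their total weight is the full sum minus the weight of the empty set.
  Σₙ-nonempty : ∀ m w (h : Bool → Carrier) →
    Σₙ m (λ T → w T * h (nonempty T)) ≈ w Subset.⊥ * h outside + (Σₙ m w - w Subset.⊥) * h inside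
  Σₙ-nonempty zero    w h = begin
    w [] * h outside                                      ≈⟨ sym (+-identityʳ _) ⟩
    w [] * h outside + 0#                                 ≈⟨ +-congˡ (sym (zeroˡ _)) ⟩
    w [] * h outside + 0# * h inside                      ≈⟨ +-congˡ (*-congʳ (sym (-‿inverseʳ _))) ⟩
    w [] * h outside + (w [] - w []) * h inside           ∎
  Σₙ-nonempty (suc m) w h = begin
    Σₙ m (λ T → w (outside ∷ T) * h (nonempty T)) + Σₙ m (λ T → w (inside ∷ T) * h inside)
      ≈⟨ +-cong (Σₙ-nonempty m (w ∘ (outside ∷_)) h) (Σₙ-*ʳ m _ _) ⟩
    e * h outside + (a - e) * h inside + b * h inside
      ≈⟨ +-assoc _ _ _ ⟩
    e * h outside + ((a - e) * h inside + b * h inside)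
      ≈⟨ +-congˡ (sym (distribʳ _ _ _)) ⟩
    e * h outside + (a - e + b) * h inside
      ≈⟨ +-congˡ (*-congʳ (trans (+-assoc _ _ _) (trans (+-congˡ (+-comm _ _)) (sym (+-assoc _ _ _))))) ⟩
    e * h outside + (a + b - e) * h inside ∎
    where
    e = w Subset.⊥
    a = Σₙ m (w ∘ (outside ∷_))
    b = Σₙ m (w ∘ (inside ∷_))

  Π : ∀ {m n} → (Subset m → Carrier) → Vec (Subset m) n → Carrier
  Π w []      = 1#
  Π w (T ∷ V) = w T * Π w V

  -- Grouping the families of subsets by their set of nonempty members.
  Σᵇ-support : ∀ {m} n w (g : Subset n → Carrier) → w Subset.⊥ ≈ 1# →
    Σᵇ {m} n (λ V → g (Vec.map nonempty V) * Π w V)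
      ≈ Σₙ n (λ A → g A * pow (Σₙ m w - 1#) ∣ A ∣)
  Σᵇ-support     zero    w g w∅ = refl
  Σᵇ-support {m} (suc n) w g w∅ = begin
    Σₙ m (λ T → Σᵇ n (λ V → g (nonempty T ∷ Vec.map nonempty V) * (w T * Π w V)))
      ≈⟨ Σₙ-cong m (λ T → trans (Σᵇ-cong n (λ V → exchange _ _ _)) (trans (Σᵇ-*ˡ n (w T) _)
           (*-congˡ (Σᵇ-support n w (g ∘ (nonempty T ∷_)) w∅)))) ⟩
    Σₙ m (λ T → w T * h (nonempty T))
      ≈⟨ Σₙ-nonempty m w h ⟩
    w Subset.⊥ * h outside + (Σₙ m w - w Subset.⊥) * h inside
      ≈⟨ +-cong (trans (*-congʳ w∅) (*-identityˡ _)) (*-congʳ (+-congˡ (-‿cong w∅))) ⟩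
    h outside + W * h inside
      ≈⟨ +-congˡ (trans (*-comm _ _) (sym (Σₙ-*ʳ n _ W))) ⟩
    h outside + Σₙ n (λ A → g (inside ∷ A) * pow W ∣ A ∣ * W)
      ≈⟨ +-congˡ (Σₙ-cong n (λ A → trans (*-assoc _ _ _) (*-congˡ (*-comm _ _)))) ⟩
    h outside + Σₙ n (λ A → g (inside ∷ A) * (W * pow W ∣ A ∣)) ∎
    where
    W = Σₙ m w - 1#
    h : Bool → Carrier
    h b = Σₙ n (λ A → g (b ∷ A) * pow W ∣ A ∣)
    exchange : ∀ a b c → a * (b * c) ≈ b * (a * c)
    exchange a b c = trans (sym (*-assoc a b c)) (trans (*-congʳ (*-comm a b)) (*-assoc b a c))

  -- Counts are embedded in an arbitrary ring because the same sums are evaluated in ℂ for the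
  -- dynamics and in ℤ for divisibility.
  emb : ℕ → Carrier
  emb zero    = 0#
  emb (suc n) = 1# + emb n

  Σᵢ : ℕ → (ℕ → Carrier) → Carrier
  Σᵢ N f = foldr _+_ 0# (applyUpTo f N)

  Σᵢ-cong : ∀ N {f g} → (∀ i → f i ≈ g i) → Σᵢ N f ≈ Σᵢ N g
  Σᵢ-cong zero    h = refl
  Σᵢ-cong (suc N) h = +-cong (h 0) (Σᵢ-cong N (h ∘ suc))

  Σᵢ-0 : ∀ N f → (∀ i → f i ≈ 0#) → Σᵢ N f ≈ 0#
  Σᵢ-0 zero    f h = refl
  Σᵢ-0 (suc N) f h = trans (+-cong (h 0) (Σᵢ-0 N (f ∘ suc) (h ∘ suc))) (+-identityˡ _)

  Σᵢ-δ : ∀ N (f : ℕ → Carrier) s → s ℕ.< N → Σᵢ N (λ i → if does (s ℕ.≟ i) then f i else 0#) ≈ f s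
  Σᵢ-δ (suc N) f zero    _         = trans (+-congˡ (Σᵢ-0 N _ (λ _ → refl))) (+-identityʳ _)
  Σᵢ-δ (suc N) f (suc s) (s≤s s<N) = trans (+-identityˡ _) (Σᵢ-δ N (f ∘ suc) s s<N)

  Σᵢ-+ : ∀ N f g → Σᵢ N (λ i → f i + g i) ≈ Σᵢ N f + Σᵢ N g
  Σᵢ-+ zero    f g = sym (+-identityˡ _)
  Σᵢ-+ (suc N) f g = trans (+-congˡ (Σᵢ-+ N _ _)) (trans (+-assoc _ _ _) (trans (+-congˡ (trans (sym (+-assoc _ _ _))
    (trans (+-congʳ (+-comm _ _)) (+-assoc _ _ _)))) (sym (+-assoc _ _ _))))

  module _ {X : Set} (s : X → ℕ) where

    countOf : List X → ℕ → ℕ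
    countOf xs i = length (filter (λ x → s x ℕ.≟ i) xs)

    -- Double counting: each `x` contributes to the single term i = `s x`, which the bound N keeps
    -- within range.
    Σˡ-bySize : ∀ N z xs → All (λ x → s x ℕ.< N) xs →
                Σᵢ N (λ i → emb (countOf xs i) * pow z i) ≈ Σˡ (λ x → pow z (s x)) xs
    Σˡ-bySize N z []       _           = Σᵢ-0 N _ (λ i → zeroˡ _)
    Σˡ-bySize N z (x ∷ xs) (sx<N ∷ hs) = begin
      Σᵢ N (λ i → emb (countOf (x ∷ xs) i) * pow z i)
        ≈⟨ Σᵢ-cong N step ⟩
      Σᵢ N (λ i → (if does (s x ℕ.≟ i) then pow z i else 0#) + emb (countOf xs i) * pow z i)
        ≈⟨ Σᵢ-+ N _ _ ⟩
      Σᵢ N (λ i → if does (s x ℕ.≟ i) then pow z i else 0#) + Σᵢ N (λ i → emb (countOf xs i) * pow z i)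
        ≈⟨ +-cong (Σᵢ-δ N (pow z) (s x) sx<N) (Σˡ-bySize N z xs hs) ⟩
      pow z (s x) + Σˡ (λ x → pow z (s x)) xs ∎
      where
      step : ∀ i → emb (countOf (x ∷ xs) i) * pow z i
           ≈ (if does (s x ℕ.≟ i) then pow z i else 0#) + emb (countOf xs i) * pow z i
      step i with does (s x ℕ.≟ i)
      ... | true  = trans (distribʳ _ _ _) (+-congʳ (*-identityˡ _))
      ... | false = sym (+-identityˡ _)

  Σ⊆-∅ : ∀ {n} (A : Subset n) f → (∀ S → ∣ S ∣ ≡.≢ 0 → f S ≈ 0#) → Σ⊆ A f ≈ f Subset.⊥
  Σ⊆-∅ []            f h = refl
  Σ⊆-∅ (outside ∷ A) f h = Σ⊆-∅ A _ (h ∘ (outside ∷_))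
  Σ⊆-∅ (inside ∷ A)  f h = trans (+-cong (Σ⊆-∅ A _ (h ∘ (outside ∷_))) (zeros A (λ S → h (inside ∷ S) (λ ()))))
    (+-identityʳ _)
    where
    zeros : ∀ {n} (A : Subset n) {f} → (∀ S → f S ≈ 0#) → Σ⊆ A f ≈ 0#
    zeros []            h = h []
    zeros (outside ∷ A) h = zeros A (h ∘ (outside ∷_))
    zeros (inside ∷ A)  h = trans (+-cong (zeros A (h ∘ (outside ∷_))) (zeros A (h ∘ (inside ∷_)))) (+-identityʳ _)

module IndependencePolynomial (R : CommutativeRing 0ℓ 0ℓ) where

  open import Defs hiding (_≈_)
  open Blocks
  open IndependenceNumber using (sizes≤α)
  import Data.List.Properties as List
  open SubsetSums R
  open CommutativeRing R hiding (zero)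
  open import Relation.Binary.Reasoning.Setoid setoid
  open import Data.Bool using (true; false; if_then_else_)
  open import Data.Fin as Fin using (Fin; zero; suc)
  import Data.Fin.Properties as Fin
  open import Data.Fin.Subset as Subset using (Subset)
  import Data.Fin.Subset.Properties as Subset
  import Data.List as List
  open import Data.Vec as Vec using (Vec; []; _∷_; lookup)
  import Data.Vec.Properties as Vec
  open import Relation.Nullary using (does)
  open import Relation.Nullary.Decidable using (dec-true; dec-false)
  open import Function using (_∘_)

  when : ∀ {A : Set} → Dec A → Carrier → Carrier
  when d x = if does d then x else 0#

  when-yes : ∀ {A : Set} (d : Dec A) {x} → A → when d x ≈ x
  when-yes d a rewrite dec-true d a = refl

  when-no : ∀ {A : Set} (d : Dec A) {x} → ¬ A → when d x ≈ 0#
  when-no d ¬a rewrite dec-false d ¬a = refl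

  weight : (G : Graph) → Carrier → Subset (order G) → Carrier
  weight G z S = when (independent? G S) (pow z Subset.∣ S ∣)

  poly : Graph → Carrier → Carrier
  poly G z = Σₙ (order G) (weight G z)

  poly-list : ∀ G z → Σˡ (λ S → pow z Subset.∣ S ∣) (independentSets G) ≈ poly G z
  poly-list G z = trans (Σˡ-filter _ (independent? G) (subsets (order G))) (Σₙ-subsets (order G) _)

  module _ (G H : Graph) where

    private
      m = order H
      n = order G

    Π-independent : ∀ {n} z (V : Vec (Subset m) n) → (∀ i → Independent H (lookup V i)) →
                    Π (weight H z) V ≈ pow z Subset.∣ Vec.concat V ∣
    Π-independent z []      ind = refl
    Π-independent z (T ∷ V) ind = trans (*-cong (when-yes (independent? H T) (ind zero)) (Π-independent z V (ind ∘ suc)))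
      (trans (sym (pow-+ z Subset.∣ T ∣ _)) (reflexive (≡.cong (pow z) (≡.sym (∣++∣ T (Vec.concat V))))))

    Π-dependent : ∀ {n} z (V : Vec (Subset m) n) i → ¬ Independent H (lookup V i) → Π (weight H z) V ≈ 0#
    Π-dependent z (T ∷ V) zero    dep = trans (*-congʳ (when-no (independent? H T) dep)) (zeroˡ _)
    Π-dependent z (T ∷ V) (suc i) dep = trans (*-congˡ (Π-dependent z V i dep)) (zeroʳ _)

    weight-concat : ∀ z (V : Vec (Subset m) n) → weight (G ⟦ H ⟧) z (Vec.concat V)
                    ≈ when (independent? G (supp V)) 1# * Π (weight H z) V
    weight-concat z V = by-cases (independent? G (supp V)) (Fin.all? (λ i → independent? H (lookup V i)))
      where
      GH? = independent? (G ⟦ H ⟧) (Vec.concat V)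
      G?  = independent? G (supp V)
      by-cases : Dec (Independent G (supp V)) → Dec (∀ i → Independent H (lookup V i)) →
                 weight (G ⟦ H ⟧) z (Vec.concat V) ≈ when G? 1# * Π (weight H z) V
      by-cases (yes indG) (yes indH) = trans (when-yes GH? (independent⁺ G H V indG indH))
        (sym (trans (*-congʳ (when-yes G? indG)) (trans (*-identityˡ _) (Π-independent z V indH))))
      by-cases (yes indG) (no ¬indH) = trans (when-no GH? (¬indH ∘ proj₂ ∘ independent⁻ G H V))
        (let i , dep = Fin.¬∀⟶∃¬ n _ (λ i → independent? H (lookup V i)) ¬indH in
         sym (trans (*-congˡ (Π-dependent z V i dep)) (zeroʳ _)))
      by-cases (no ¬indG) _ = trans (when-no GH? (¬indG ∘ proj₁ ∘ independent⁻ G H V))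
        (sym (trans (*-congʳ (when-no G? ¬indG)) (zeroˡ _)))

    weight-⊥ : ∀ z → weight H z Subset.⊥ ≈ 1#
    weight-⊥ z = trans (when-yes (independent? H Subset.⊥) (λ u v u∈ _ _ → Subset.∉⊥ u∈))
      (reflexive (≡.cong (pow z) (Subset.∣⊥∣≡0 m)))

    -- Fix the support A. Over each of its vertices the block ranges over the nonempty independent
    -- sets of H, of total weight I_H(z) - 1, so the sets with support A contribute (I_H(z) - 1) to
    -- the power of the size of A.
    poly-⟦⟧ : ∀ z → poly (G ⟦ H ⟧) z ≈ poly G (poly H z - 1#)
    poly-⟦⟧ z = begin
      Σₙ (n ℕ.* m) (weight (G ⟦ H ⟧) z)                                       ≈⟨ Σᵇ-concat n _ ⟩
      Σᵇ n (λ V → weight (G ⟦ H ⟧) z (Vec.concat V))                          ≈⟨ Σᵇ-cong n (weight-concat z) ⟩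
      Σᵇ n (λ V → when (independent? G (supp V)) 1# * Π (weight H z) V)       ≈⟨ Σᵇ-support n _ (λ A → when (independent? G A) 1#) (weight-⊥ z) ⟩
      Σₙ n (λ A → when (independent? G A) 1# * pow W Subset.∣ A ∣)            ≈⟨ Σₙ-cong n (λ A → when-* (independent? G A)) ⟩
      Σₙ n (weight G W) ∎
      where
      W = poly H z - 1#
      when-* : ∀ {A : Set} (d : Dec A) {x} → when d 1# * x ≈ when d x
      when-* d with does d
      ... | true  = *-identityˡ _
      ... | false = zeroˡ _

  poly-coefficients : ∀ G z → Σᵢ (suc (independenceNumber G)) (λ i → emb (coefficient G i) * pow z i) ≈ poly G z
  poly-coefficients G z = trans (Σˡ-bySize Subset.∣_∣ _ z (independentSets G) (sizes≤α G)) (poly-list G z)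

  module _ (e : ℕ → Carrier) (e≈emb : ∀ n → e n ≈ emb n)
           (p : Carrier → ℕ → Carrier) (p≈pow : ∀ z n → p z n ≈ pow z n) where

    -- The embedding and the powers are parameters, so that `independencePolynomial` with its own
    -- `fromℕ` and `_^ᶜ_` is literally an instance.
    poly-formula : ∀ G z → List.foldr _+_ 0# (List.map (λ i → e (coefficient G i) * p z i) (List.upTo (suc (independenceNumber G)))) ≈ poly G z
    poly-formula G z = trans (reflexive (≡.cong (List.foldr _+_ 0#) (List.map-upTo _ (suc (independenceNumber G)))))
      (trans (Σᵢ-cong (suc (independenceNumber G)) (λ i → *-cong (e≈emb (coefficient G i)) (p≈pow z i))) (poly-coefficients G z))

  pow-cong : ∀ n {z w} → z ≈ w → pow z n ≈ pow w n
  pow-cong zero    e = refl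
  pow-cong (suc n) e = *-cong e (pow-cong n e)

  poly-cong : ∀ G {z w} → z ≈ w → poly G z ≈ poly G w
  poly-cong G e = Σₙ-cong (order G) (λ S → when-cong (independent? G S) (pow-cong Subset.∣ S ∣ e))
    where
    when-cong : ∀ {A : Set} (d : Dec A) {x y} → x ≈ y → when d x ≈ when d y
    when-cong d e with does d
    ... | true  = e
    ... | false = refl

-- Zeros of I for lexicographic powers as preimages of -1, and the four examples

module IteratedPolynomial (F : RealField) (K : ComplexField F) where

  open import Defs using (Graph; independenceNumber; coefficient; _⟦_⟧; _^[1+_])
  open OrderedField F using (ι)
  open ComplexPlane F K
  open SubsetSums commutativeRing using (Σᵢ; emb; pow)
  open IndependencePolynomial commutativeRing
  open Solver using (solve; _:=_; _:+_; _:*_; _:-_; :-_; con)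
  open import Relation.Binary.Reasoning.Setoid setoid

  P : Graph → Carrier → Carrier
  P G z = poly G z - 1#

  P-cong : ∀ G → Congruent (P G)
  P-cong G e = +-congʳ (poly-cong G e)

  P-⟦⟧ : ∀ G H z → P (G ⟦ H ⟧) z ≈ P G (P H z)
  P-⟦⟧ G H z = +-congʳ (poly-⟦⟧ G H z)

  private
    iterates : (Carrier → Carrier) → ℕ → Carrier → Carrier
    iterates f zero    z = f z
    iterates f (suc m) z = iterates f m (f z)

    -- A lexicographic power adds its new factor on the outside, whereas `Root` applies the map on
    -- the inside.
    iterates-suc : ∀ f m z → f (iterates f m z) ≡.≡ iterates f (suc m) z
    iterates-suc f zero    z = ≡.refl
    iterates-suc f (suc m) z = iterates-suc f m (f z)

    P-power : ∀ G m z → P (G ^[1+ m ]) z ≈ iterates (P G) m z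
    P-power G zero    z = refl
    P-power G (suc m) z = begin
      P (G ⟦ G ^[1+ m ] ⟧) z    ≈⟨ P-⟦⟧ G (G ^[1+ m ]) z ⟩
      P G (P (G ^[1+ m ]) z)    ≈⟨ P-cong G (P-power G m z) ⟩
      P G (iterates (P G) m z)  ≡⟨ iterates-suc (P G) m z ⟩
      iterates (P G) (suc m) z  ∎

    iterates⇒Root : ∀ f m z → iterates f m z ≈ κ (ℚ.- 1ℚ) → Root f m z
    iterates⇒Root f zero    z e = e
    iterates⇒Root f (suc m) z e = iterates⇒Root f m (f z) e

    Root⇒iterates : ∀ f m z → Root f m z → iterates f m z ≈ κ (ℚ.- 1ℚ)
    Root⇒iterates f zero    z e = e
    Root⇒iterates f (suc m) z e = Root⇒iterates f m (f z) e

  zero⇒Root : ∀ G m z → poly (G ^[1+ m ]) z ≈ 0# → Root (P G) m z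
  zero⇒Root G m z e = iterates⇒Root (P G) m z (begin
    iterates (P G) m z              ≈⟨ sym (P-power G m z) ⟩
    poly (G ^[1+ m ]) z - 1#        ≈⟨ +-cong (trans e (sym real-0)) (-‿cong (sym real-1)) ⟩
    κ 0ℚ - κ 1ℚ                     ≈⟨ solve 0 (con 0ℚ :- con 1ℚ := con (ℚ.- 1ℚ)) refl ⟩
    κ (ℚ.- 1ℚ) ∎)

  Root⇒zero : ∀ G m z → Root (P G) m z → poly (G ^[1+ m ]) z ≈ 0#
  Root⇒zero G m z r = begin
    poly (G ^[1+ m ]) z                    ≈⟨ solve 2 (λ p o → p := p :- o :+ o) refl _ 1# ⟩
    P (G ^[1+ m ]) z + 1#                  ≈⟨ +-cong (trans (P-power G m z) (Root⇒iterates (P G) m z r)) (sym real-1) ⟩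
    κ (ℚ.- 1ℚ) + κ 1ℚ                      ≈⟨ solve 0 (con (ℚ.- 1ℚ) :+ con 1ℚ := con 0ℚ) refl ⟩
    κ 0ℚ                                   ≈⟨ real-0 ⟩
    0# ∎

  κℕ : ℕ → Carrier
  κℕ n = κ (Rat.ι (+ n))

  emb≈κ : ∀ n → emb n ≈ κℕ n
  emb≈κ zero    = sym real-0
  emb≈κ (suc n) = trans (+-cong (sym real-1) (emb≈κ n)) (trans (sym (real-+ _ _)) (real-cong
    (R.trans (R.sym (R.ι-+ 1ℚ (Rat.ι (+ n)))) (R.reflexive (≡.cong ι (≡.sym (Rat.ι-+ (+ 1) (+ n))))))))
    where module R = OrderedField F

  poly₂ : ∀ G z → independenceNumber G ≡.≡ 2 →
          poly G z ≈ κℕ (coefficient G 0) + (κℕ (coefficient G 1) * z + κℕ (coefficient G 2) * (z * z))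
  poly₂ G z α≡2 = trans (sym (poly-coefficients G z)) (trans
    (reflexive (≡.cong (λ α → Σᵢ (suc α) (λ i → emb (coefficient G i) * pow z i)) α≡2))
    (trans (+-cong (*-cong (c 0) (sym real-1)) (+-cong (*-cong (c 1) z¹) (+-cong (*-cong (c 2) (*-congˡ z¹)) (sym real-0))))
      (solve 4 (λ a b c z → a :* con 1ℚ :+ (b :* (z :* con 1ℚ) :+ (c :* (z :* (z :* con 1ℚ)) :+ con 0ℚ))
        := a :+ (b :* z :+ c :* (z :* z))) refl _ _ _ z)))
    where
    c : ∀ i → emb (coefficient G i) ≈ κℕ (coefficient G i)
    c i = emb≈κ (coefficient G i)
    z¹ = *-congˡ (sym real-1)

  poly₄ : ∀ G z → independenceNumber G ≡.≡ 4 →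
          poly G z ≈ κℕ (coefficient G 0) + (κℕ (coefficient G 1) * z + (κℕ (coefficient G 2) * (z * z)
                     + (κℕ (coefficient G 3) * (z * (z * z)) + κℕ (coefficient G 4) * (z * (z * (z * z))))))
  poly₄ G z α≡4 = trans (sym (poly-coefficients G z)) (trans
    (reflexive (≡.cong (λ α → Σᵢ (suc α) (λ i → emb (coefficient G i) * pow z i)) α≡4))
    (trans (+-cong (*-cong (c 0) (sym real-1)) (+-cong (*-cong (c 1) z¹) (+-cong (*-cong (c 2) (*-congˡ z¹))
        (+-cong (*-cong (c 3) (*-congˡ (*-congˡ z¹))) (+-cong (*-cong (c 4) (*-congˡ (*-congˡ (*-congˡ z¹)))) (sym real-0))))))
      (solve 6 (λ a b c d e z → a :* con 1ℚ :+ (b :* (z :* con 1ℚ) :+ (c :* (z :* (z :* con 1ℚ)) :+ (d :* (z :* (z :* (z :* con 1ℚ)))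
           :+ (e :* (z :* (z :* (z :* (z :* con 1ℚ)))) :+ con 0ℚ))))
        := a :+ (b :* z :+ (c :* (z :* z) :+ (d :* (z :* (z :* z)) :+ e :* (z :* (z :* (z :* z))))))) refl _ _ _ _ _ z)))
    where
    c : ∀ i → emb (coefficient G i) ≈ κℕ (coefficient G i)
    c i = emb≈κ (coefficient G i)
    z¹ = *-congˡ (sym real-1)

module LexicographicSquare (F : RealField) (K : ComplexField F) where

  open import Defs using (Graph; independenceNumber; coefficient; _⟦_⟧)
  private module C = ComplexPlane F K
  private module I = IteratedPolynomial F K
  open import Data.Rational using (_/_)
  open C.Solver using (solve; _:=_; _:+_; _:*_; _:-_; :-_; con)

  module Squared (G : Graph) (α≡2 : independenceNumber G ≡ 2) (c₀ : coefficient G 0 ≡ 1) (c₁ : coefficient G 1 ≡ 4)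
    (ℓ : ℚ) (kℓ≡4 : Rat.ι (+ coefficient G 2) ℚ.* ℓ ≡ + 4 / 1)
    (1≤k : 1ℚ ℚ.≤ Rat.ι (+ coefficient G 2)) (k≤4 : Rat.ι (+ coefficient G 2) ℚ.≤ + 4 / 1) (0<ℓ : 0ℚ ℚ.< ℓ) where

    private
      k : ℚ
      k = Rat.ι (+ coefficient G 2)

    open QuadraticMap F K k ℓ kℓ≡4 1≤k k≤4 0<ℓ

    P≈Q : ∀ z → I.P G z C.≈ Q z
    P≈Q z = C.trans (C.+-cong (C.trans (I.poly₂ G z α≡2)
        (C.reflexive (≡.cong₂ (λ a b → I.κℕ a C.+ (I.κℕ b C.* z C.+ I.κℕ (coefficient G 2) C.* (z C.* z))) c₀ c₁)))
        (C.-‿cong (C.sym C.real-1)))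
      (solve 2 (λ z k → con 1ℚ :+ (con (+ 4 / 1) :* z :+ k :* (z :* z)) :- con 1ℚ
        := con (+ 4 / 1) :* z :+ k :* (z :* z)) C.refl z (C.κ k))

    P≈QQ : ∀ z → I.P (G ⟦ G ⟧) z C.≈ Q (Q z)
    P≈QQ z = C.trans (I.P-⟦⟧ G G z) (C.trans (P≈Q _) (Q-cong (P≈Q z)))

    squareLimit : C.RootLimit (I.P (G ⟦ G ⟧)) (ℚ.- ℓ)
    squareLimit = rootLimit (I.P (G ⟦ G ⟧)) P≈QQ

module ZerosAsRoots where

  open import Defs
  open RealNumbers
  open ComplexNumbers
  private module C = ComplexPlane realField complexField
  private module I = IteratedPolynomial realField complexField
  open SubsetSums ℂ-ring
  open IndependencePolynomial ℂ-ring

  private module K = CommutativeRing ℂ-ring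

  fromℕ≈emb : ∀ n → fromℕ n ≈ emb n
  fromℕ≈emb zero    = K.refl {fromℕ 0}
  fromℕ≈emb (suc n) = K.trans {fromℕ (suc n)} {fromℕ 1 +ᶜ fromℕ n} {emb (suc n)}
    (≐⇒≈ᶜ (fromℕ (suc n)) (fromℕ 1 +ᶜ fromℕ n) (λ _ → Rat.ι-+ (+ 1) (+ n)) (λ _ → ≡.refl))
    (K.+-congˡ {fromℕ 1} {fromℕ n} {emb n} (fromℕ≈emb n))

  ^ᶜ≈pow : ∀ z n → z ^ᶜ n ≈ pow z n
  ^ᶜ≈pow z zero    = K.refl {fromℕ 1}
  ^ᶜ≈pow z (suc n) = K.*-congˡ {z} {z ^ᶜ n} {pow z n} (^ᶜ≈pow z n)

  independencePolynomial≈poly : ∀ G z → independencePolynomial G z ≈ poly G z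
  independencePolynomial≈poly = poly-formula fromℕ fromℕ≈emb _^ᶜ_ ^ᶜ≈pow

  Zeros⇒Root : ∀ G m z → Zeros (G ^[1+ m ]) z → C.Root (I.P G) m z
  Zeros⇒Root G m z z∈ = I.zero⇒Root G m z
    (K.trans {poly (G ^[1+ m ]) z} {independencePolynomial (G ^[1+ m ]) z} {fromℕ 0}
      (K.sym {independencePolynomial (G ^[1+ m ]) z} {poly (G ^[1+ m ]) z} (independencePolynomial≈poly (G ^[1+ m ]) z)) z∈)

  Root⇒Zeros : ∀ G m z → C.Root (I.P G) m z → Zeros (G ^[1+ m ]) z
  Root⇒Zeros G m z r =
    K.trans {independencePolynomial (G ^[1+ m ]) z} {poly (G ^[1+ m ]) z} {fromℕ 0}
      (independencePolynomial≈poly (G ^[1+ m ]) z) (I.Root⇒zero G m z r)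

module Existence where

  open import Defs
  open RealNumbers
  open ComplexNumbers
  open IndependenceNumber using (α-⟦⟧)
  open ZerosAsRoots
  private module C = ComplexPlane realField complexField
  private module I = IteratedPolynomial realField complexField
  private module S = LexicographicSquare realField complexField
  open import Data.Bool using (Bool; true; false; T; T?)
  open import Data.Fin using (Fin)
  import Data.Fin.Properties as Fin
  open import Data.Nat using (NonZero)
  open import Data.Rational using (-_; _/_)
  open import Data.Vec using (Vec; []; _∷_; lookup)
  open import Relation.Binary.PropositionalEquality using (refl; trans)
  open import Relation.Nullary.Decidable using (from-yes; toWitness; True; _→-dec_; ¬?)

  private
    pattern ○ = false
    pattern ● = true

  graph : ∀ {n} (A : Vec (Vec Bool n) n) →
          {True (Fin.all? λ i → Fin.all? λ j → T? (lookup (lookup A i) j) →-dec T? (lookup (lookup A j) i))} →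
          {True (Fin.all? λ i → ¬? (T? (lookup (lookup A i) i)))} → Graph
  graph {n} A {s} {i} = record
    { order  = n
    ; Adj    = λ i j → T (lookup (lookup A i) j)
    ; adj?   = λ i j → T? (lookup (lookup A i) j)
    ; symm   = λ {i} {j} → toWitness s i j
    ; irrefl = λ { {u} refl → toWitness i u }
    }

  -- The complement of H k is triangle-free with k edges, so that I_{H k} = 1 + 4z + kz².
  H : ℕ → Graph
  H 1 = graph ((○ ∷ ○ ∷ ● ∷ ● ∷ []) ∷ (○ ∷ ○ ∷ ● ∷ ● ∷ []) ∷ (● ∷ ● ∷ ○ ∷ ● ∷ []) ∷ (● ∷ ● ∷ ● ∷ ○ ∷ []) ∷ [])
  H 2 = graph ((○ ∷ ○ ∷ ● ∷ ● ∷ []) ∷ (○ ∷ ○ ∷ ○ ∷ ● ∷ []) ∷ (● ∷ ○ ∷ ○ ∷ ● ∷ []) ∷ (● ∷ ● ∷ ● ∷ ○ ∷ []) ∷ [])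
  H 3 = graph ((○ ∷ ○ ∷ ● ∷ ● ∷ []) ∷ (○ ∷ ○ ∷ ○ ∷ ● ∷ []) ∷ (● ∷ ○ ∷ ○ ∷ ○ ∷ []) ∷ (● ∷ ● ∷ ○ ∷ ○ ∷ []) ∷ [])
  H _ = graph ((○ ∷ ○ ∷ ● ∷ ○ ∷ []) ∷ (○ ∷ ○ ∷ ○ ∷ ● ∷ []) ∷ (● ∷ ○ ∷ ○ ∷ ○ ∷ []) ∷ (○ ∷ ● ∷ ○ ∷ ○ ∷ []) ∷ [])

  limit⇒attractor : ∀ G q → C.RootLimit (I.P G) q → IndependenceAttractor G [ q ,0]
  limit⇒attractor G q limit ε 0<ε =
    let M , near = limit ε 0<ε in
    M , λ m m≥M →
        (λ z z∈ → proj₁ (near m m≥M) z (Zeros⇒Root G m z z∈))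
      , (λ z z∈ → let w , r , z~w = proj₂ (near m m≥M) z z∈ in w , Root⇒Zeros G m w r , z~w)

  module _ (G : Graph) (α≡2 : independenceNumber G ≡ 2) (c₀ : coefficient G 0 ≡ 1) (c₁ : coefficient G 1 ≡ 4)
    (ℓ : ℚ) (kℓ≡4 : Rat.ι (+ coefficient G 2) ℚ.* ℓ ≡ + 4 / 1)
    (1≤k : 1ℚ ℚ.≤ Rat.ι (+ coefficient G 2)) (k≤4 : Rat.ι (+ coefficient G 2) ℚ.≤ + 4 / 1) (0<ℓ : 0ℚ ℚ.< ℓ) where

    example : ∃[ G ] (independenceNumber G ≡ 4 × IndependenceAttractor G [ ℚ.- ℓ ,0])
    example = G ⟦ G ⟧ , trans (α-⟦⟧ G G) (≡.cong₂ ℕ._*_ α≡2 α≡2)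
      , limit⇒attractor (G ⟦ G ⟧) (ℚ.- ℓ) (S.Squared.squareLimit G α≡2 c₀ c₁ ℓ kℓ≡4 1≤k k≤4 0<ℓ)

  existence : ∀ (k : ℕ) .{{_ : NonZero k}} → k ℕ.≤ 4 →
              ∃[ G ] (independenceNumber G ≡ 4 × IndependenceAttractor G [ - (+ 4 / k) ,0])
  existence 1 _ = example (H 1) refl refl refl (+ 4 / 1) refl (from-yes (1ℚ ℚ.≤? 1ℚ)) (from-yes (1ℚ ℚ.≤? + 4 / 1)) (Rat.0<ₗ (+ 4 / 1))
  existence 2 _ = example (H 2) refl refl refl (+ 4 / 2) refl (from-yes (1ℚ ℚ.≤? + 2 / 1)) (from-yes (+ 2 / 1 ℚ.≤? + 4 / 1)) (Rat.0<ₗ (+ 4 / 2))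
  existence 3 _ = example (H 3) refl refl refl (+ 4 / 3) refl (from-yes (1ℚ ℚ.≤? + 3 / 1)) (from-yes (+ 3 / 1 ℚ.≤? + 4 / 1)) (Rat.0<ₗ (+ 4 / 3))
  existence 4 _ = example (H 4) refl refl refl (+ 4 / 4) refl (from-yes (1ℚ ℚ.≤? + 4 / 1)) (from-yes (+ 4 / 1 ℚ.≤? + 4 / 1)) (Rat.0<ₗ (+ 4 / 4))
  existence (suc (suc (suc (suc (suc _))))) (ℕ.s≤s (ℕ.s≤s (ℕ.s≤s (ℕ.s≤s ()))))

-- Continuity and the invariance of the limit interval

module Continuity (F : RealField) (K : ComplexField F) where

  private module R = OrderedField F
  open R using (0r; ι; _<_; _≤_; _+⁺_; _*⁺_; _+⁰_; _*⁰_)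
  open ComplexPlane F K
  open import Data.Rational.Solver using (module +-*-Solver)
  open R.Solver using (solve; _:=_; _:+_; _:*_; _:-_; :-_; con)
  private
    module S = +-*-Solver
    module C = Solver

  ¼ 2ℚ : ℚ
  ¼ = ½ ℚ.* ½
  2ℚ = + 2 ℚ./ 1

  ∣∣²-cong : ∀ {z w} → z ≈ w → ∣ z ∣² R.≈ ∣ w ∣²
  ∣∣²-cong e = R.+-cong (R.*-cong (re-cong e) (re-cong e)) (R.*-cong (im-cong e) (im-cong e))

  0≤∣∣² : ∀ z → 0r ≤ ∣ z ∣²
  0≤∣∣² z = R.0≤x² (re z) +⁰ R.0≤x² (im z)

  ∣+∣² : ∀ z w → ∣ z + w ∣² ≤ ι 2ℚ R.* (∣ z ∣² R.+ ∣ w ∣²)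
  ∣+∣² z w = R.0≤-⇒≤ _ (R.0≤x² (re z R.- re w) +⁰ R.0≤x² (im z R.- im w))
    (R.trans (R.+-congˡ (R.-‿cong (R.+-cong (R.*-cong (re-+ z w) (re-+ z w)) (R.*-cong (im-+ z w) (im-+ z w)))))
      (solve 4 (λ a b c d → con 2ℚ :* (a :* a :+ b :* b :+ (c :* c :+ d :* d)) :- ((a :+ c) :* (a :+ c) :+ (b :+ d) :* (b :+ d))
        := (a :- c) :* (a :- c) :+ (b :- d) :* (b :- d)) R.refl (re z) (im z) (re w) (im w)))

  ∣*∣² : ∀ z w → ∣ z * w ∣² R.≈ ∣ z ∣² R.* ∣ w ∣²
  ∣*∣² z w = R.trans (R.+-cong (R.*-cong (re-* z w) (re-* z w)) (R.*-cong (im-* z w) (im-* z w)))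
    (solve 4 (λ a b c d → (a :* c :- b :* d) :* (a :* c :- b :* d) :+ (a :* d :+ b :* c) :* (a :* d :+ b :* c)
      := (a :* a :+ b :* b) :* (c :* c :+ d :* d)) R.refl (re z) (im z) (re w) (im w))

  ∣neg∣² : ∀ z → ∣ - z ∣² R.≈ ∣ z ∣²
  ∣neg∣² z = R.trans (R.+-cong (R.*-cong (re-neg z) (re-neg z)) (R.*-cong (im-neg z) (im-neg z)))
    (solve 2 (λ a b → :- a :* :- a :+ :- b :* :- b := a :* a :+ b :* b) R.refl (re z) (im z))

  -- Distances enter through their squares, whence the factor 4.
  ∣+∣²-< : ∀ {z w ε} → ∣ z ∣² ≤ ι (¼ ℚ.* ε) → ∣ w ∣² ≤ ι (¼ ℚ.* ε) → ∣ z + w ∣² ≤ ι ε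
  ∣+∣²-< {z} {w} {ε} h k = R.≤-trans (∣+∣² z w) (R.0≤-⇒≤ _
    (R.0≤ₗ 2ℚ *⁰ (R.≤⇒0≤- h +⁰ R.≤⇒0≤- k))
    (R.trans (R.+-congʳ (R.trans (R.reflexive (≡.cong ι (≡.sym four))) (R.trans (R.ι-* 2ℚ _) (R.*-congˡ (R.ι-+ _ _)))))
      (solve 3 (λ e a b → con 2ℚ :* (e :+ e) :- con 2ℚ :* (a :+ b) := con 2ℚ :* ((e :- a) :+ (e :- b))) R.refl (ι (¼ ℚ.* ε)) ∣ z ∣² ∣ w ∣²)))
    where
    four : 2ℚ ℚ.* (¼ ℚ.* ε ℚ.+ ¼ ℚ.* ε) ≡.≡ ε
    four = S.solve 1 (λ ε → S.con 2ℚ S.:* (S.con ¼ S.:* ε S.:+ S.con ¼ S.:* ε) S.:= ε) ≡.refl ε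

  -- Squared distances avoid square roots, and non-strict bounds can be proved by nonnegative
  -- certificates.
  Continuous : (Carrier → Carrier) → Set
  Continuous f = ∀ z ε → 0ℚ ℚ.< ε → ∃[ δ ] (0ℚ ℚ.< δ × (∀ w → ∣ w - z ∣² ≤ ι δ → ∣ f w - f z ∣² ≤ ι ε))

  min-pos : ∀ {a b} → 0ℚ ℚ.< a → 0ℚ ℚ.< b → ∃[ c ] (0ℚ ℚ.< c × c ℚ.≤ a × c ℚ.≤ b)
  min-pos {a} {b} 0<a 0<b with ℚ.≤-total a b
  ... | inj₁ a≤b = a , 0<a , ℚ.≤-refl , a≤b
  ... | inj₂ b≤a = b , 0<b , b≤a , ℚ.≤-refl

  0<¼* : ∀ {ε} → 0ℚ ℚ.< ε → 0ℚ ℚ.< ¼ ℚ.* ε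
  0<¼* = Rat.0<ₗ ¼ Rat.*⁺_

  id-continuous : Continuous (λ z → z)
  id-continuous z ε 0<ε = ε , 0<ε , λ _ h → h

  const-continuous : ∀ c → Continuous (λ _ → c)
  const-continuous c z ε 0<ε = 1ℚ , Rat.0<ₗ 1ℚ , λ w _ → R.≤-resp (R.sym zero²) R.refl (R.ι-≤ (ℚ.<⇒≤ 0<ε))
    where
    zero² : ∣ c - c ∣² R.≈ 0r
    zero² = R.trans (∣∣²-cong (C.solve 1 (λ c → c C.:- c C.:= C.con 0ℚ) refl c))
      (R.trans (R.+-cong (R.*-cong (re-real _) (re-real _)) (R.*-cong (im-real _) (im-real _)))
        (solve 0 (con 0ℚ :* con 0ℚ :+ con 0ℚ :* con 0ℚ := con 0ℚ) R.refl))

  +-continuous : ∀ {f g} → Continuous f → Continuous g → Continuous (λ z → f z + g z)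
  +-continuous {f} {g} cf cg z ε 0<ε =
    let δ₁ , 0<δ₁ , h₁ = cf z (¼ ℚ.* ε) (0<¼* 0<ε)
        δ₂ , 0<δ₂ , h₂ = cg z (¼ ℚ.* ε) (0<¼* 0<ε)
        δ , 0<δ , δ≤δ₁ , δ≤δ₂ = min-pos 0<δ₁ 0<δ₂
    in δ , 0<δ , λ w h → R.≤-resp (∣∣²-cong (C.solve 4 (λ a b c d → (a C.:- c) C.:+ (b C.:- d) C.:= a C.:+ b C.:- (c C.:+ d)) refl (f w) (g w) (f z) (g z))) R.refl
      (∣+∣²-< (h₁ w (R.≤-trans h (R.ι-≤ δ≤δ₁))) (h₂ w (R.≤-trans h (R.ι-≤ δ≤δ₂))))

  upper-bound : ∀ x → ∃[ B ] (0ℚ ℚ.< B × x ≤ ι B)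
  upper-bound x =
    let q , _ , x<q+1 = R.approx x 1ℚ (Rat.0<ₗ 1ℚ)
        k , q+1<k = Rat.archimedean (q ℚ.+ 1ℚ)
    in 1ℚ ℚ.+ Rat.ι (+ k) , Rat.0<ₗ 1ℚ Rat.+⁺⁰ Rat.0≤ι k
     , R.<⇒≤ (R.<-trans x<q+1 (R.ι-< (Rat.0<-⇒< _ (Rat.<⇒0<- q+1<k Rat.+⁺ Rat.0<ₗ 1ℚ)
         (S.solve 2 (λ a b → S.con 1ℚ S.:+ b S.:- a S.:= (b S.:- a) S.:+ S.con 1ℚ) ≡.refl (q ℚ.+ 1ℚ) (Rat.ι (+ k))))))

  ∣*∣²-≤ : ∀ {z w B δ ε} → 0ℚ ℚ.≤ B → ∣ z ∣² ≤ ι B → ∣ w ∣² ≤ ι δ → B ℚ.* δ ≡.≡ ε → ∣ z * w ∣² ≤ ι ε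
  ∣*∣²-≤ {z} {w} {B} {δ} {ε} 0≤B h k eq = R.0≤-⇒≤ _
    (R.≤⇒0≤- h *⁰ 0≤∣∣² w +⁰ R.ι-≤ 0≤B *⁰ R.≤⇒0≤- k)
    (R.trans (R.+-cong (R.trans (R.reflexive (≡.cong ι (≡.sym eq))) (R.ι-* B δ)) (R.-‿cong (∣*∣² z w)))
      (solve 4 (λ B d a b → B :* d :- a :* b := (B :- a) :* b :+ B :* (d :- b)) R.refl (ι B) (ι δ) ∣ z ∣² ∣ w ∣²))

  -- fg(w) − fg(z) = f(w)(g(w) − g(z)) + g(z)(f(w) − f(z)), with f(w) bounded near z.
  *-continuous : ∀ {f g} → Continuous f → Continuous g → Continuous (λ z → f z * g z)
  *-continuous {f} {g} cf cg z ε 0<ε =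
    let B₁ , 0<B₁ , fz≤ = upper-bound ∣ f z ∣²
        B₂ , 0<B₂ , gz≤ = upper-bound ∣ g z ∣²
        δ₁ , 0<δ₁ , h₁ = cf z B₁ 0<B₁
        e₂ , 0<e₂ , eq₂ = Rat.shrink (Rat.0<ₗ (2ℚ ℚ.* 2ℚ) Rat.*⁺ 0<B₁) (0<¼* 0<ε)
        δ₂ , 0<δ₂ , h₂ = cg z e₂ 0<e₂
        e₃ , 0<e₃ , eq₃ = Rat.shrink 0<B₂ (0<¼* 0<ε)
        δ₃ , 0<δ₃ , h₃ = cf z e₃ 0<e₃
        δ₁₂ , 0<δ₁₂ , ≤δ₁ , ≤δ₂ = min-pos 0<δ₁ 0<δ₂
        δ , 0<δ , ≤δ₁₂ , ≤δ₃ = min-pos 0<δ₁₂ 0<δ₃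
    in δ , 0<δ , λ w h →
       let h₁₂ = R.≤-trans h (R.ι-≤ ≤δ₁₂)
           fw≤ : ∣ f w ∣² ≤ ι (2ℚ ℚ.* 2ℚ ℚ.* B₁)
           fw≤ = R.≤-resp (∣∣²-cong (C.solve 2 (λ a b → (a C.:- b) C.:+ b C.:= a) refl (f w) (f z))) R.refl
             (∣+∣²-< {ε = 2ℚ ℚ.* 2ℚ ℚ.* B₁} (R.≤-respʳ (quarter B₁) (h₁ w (R.≤-trans h₁₂ (R.ι-≤ ≤δ₁)))) (R.≤-respʳ (quarter B₁) fz≤))
       in R.≤-resp (∣∣²-cong (C.solve 4 (λ a b c d → a C.:* (b C.:- d) C.:+ d C.:* (a C.:- c) C.:= a C.:* b C.:- c C.:* d) refl (f w) (g w) (f z) (g z))) R.refl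
         (∣+∣²-< (∣*∣²-≤ (ℚ.<⇒≤ (Rat.0<ₗ (2ℚ ℚ.* 2ℚ) Rat.*⁺ 0<B₁)) fw≤ (h₂ w (R.≤-trans h₁₂ (R.ι-≤ ≤δ₂))) eq₂)
                  (∣*∣²-≤ (ℚ.<⇒≤ 0<B₂) gz≤ (h₃ w (R.≤-trans h (R.ι-≤ ≤δ₃))) eq₃))
    where
    quarter : ∀ B → ι B R.≈ ι (¼ ℚ.* (2ℚ ℚ.* 2ℚ ℚ.* B))
    quarter B = R.reflexive (≡.cong ι (S.solve 1 (λ B → B S.:= S.con ¼ S.:* (S.con 2ℚ S.:* S.con 2ℚ S.:* B)) ≡.refl B))

  -- Each condition on `z` is refutable: a violation exceeds some rational e > 0, and a point of the
  -- interval closer than e contradicts it.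
  closed : ∀ {q} z → (∀ ε → 0ℚ ℚ.< ε → ∃[ v ] (v ∈[ q ,0] × ∣ z - v ∣² ≤ ι ε)) → z ∈[ q ,0]
  closed {q} z near = lower , upper , real′
    where
    -- d > e > 0 bounds a coordinate of z − v, whose square is at most e²/4.
    too-far : ∀ {d e} → 0ℚ ℚ.< e → ι e < d → d R.* d ≤ ι (¼ ℚ.* (e ℚ.* e)) → ⊥
    too-far {d} {e} 0<e e<d h = R.absurd
      (R.<⇒0<- e<d *⁺ (R.<⇒0<- e<d +⁺ (R.ι-< 0<e +⁺ R.ι-< 0<e)) +⁺ R.0<ₗ (1ℚ ℚ.- ¼) *⁺ (R.ι-< 0<e *⁺ R.ι-< 0<e))
      (R.≤⇒0≤- h)
      (R.trans (R.+-congˡ (R.+-congʳ (R.trans (R.ι-* ¼ _) (R.*-congˡ (R.ι-* e e)))))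
        (solve 2 (λ d e → (d :- e) :* (d :- e :+ (e :+ e)) :+ con (1ℚ ℚ.- ¼) :* (e :* e) :+ (con ¼ :* (e :* e) :- d :* d) := con 0ℚ) R.refl d (ι e)))
    0<¼ : ∀ {e} → 0ℚ ℚ.< e → 0ℚ ℚ.< ¼ ℚ.* (e ℚ.* e)
    0<¼ 0<e = 0<¼* (0<e Rat.*⁺ 0<e)
    re² : ∀ v {c} → ∣ z - v ∣² ≤ c → (re z R.- re v) R.* (re z R.- re v) ≤ c
    re² v h = R.≤-trans (R.0≤-⇒≤ _ (R.0≤x² (im (z - v)))
      (R.trans (R.+-congˡ (R.-‿cong (R.*-cong r r))) (solve 2 (λ a b → a :* a :+ b :* b :- a :* a := b :* b) R.refl (re (z - v)) (im (z - v))))) h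
      where r = R.sym (R.trans (re-+ z (- v)) (R.+-congˡ (re-neg v)))
    im² : ∀ v {c} → im v R.≈ 0r → ∣ z - v ∣² ≤ c → im z R.* im z ≤ c
    im² v e h = R.≤-trans (R.0≤-⇒≤ _ (R.0≤x² (re (z - v)))
      (R.trans (R.+-congˡ (R.-‿cong (R.*-cong r r))) (solve 2 (λ a b → a :* a :+ b :* b :- b :* b := a :* a) R.refl (re (z - v)) (im (z - v))))) h
      where r = R.sym (R.trans (im-+ z (- v)) (R.trans (R.+-congˡ (R.trans (im-neg v) (R.-‿cong e))) (solve 1 (λ x → x :- con 0ℚ := x) R.refl (im z))))
    upper : re z ≤ 0r
    upper 0<re =
      let e , 0<e , e<re = R.archimedean 0<re
          v , (_ , re≤0 , _) , h = near _ (0<¼ 0<e)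
      in R.≤⇒¬¬ (R.0≤-⇒≤ _ (R.≤⇒0≤- re≤0) (solve 2 (λ a b → a :- b :- a := con 0ℚ :- b) R.refl (re z) (re v))) λ where
           (inj₁ lt) → too-far 0<e (R.<-trans e<re lt) (re² v h)
           (inj₂ eq) → too-far 0<e (R.<-respʳ eq e<re) (re² v h)
    lower : ι q ≤ re z
    lower re<q =
      let e , 0<e , e<d = R.archimedean (R.<⇒0<- re<q)
          v , (q≤re , _ , _) , h = near _ (0<¼ 0<e)
          h′ = R.≤-resp (solve 2 (λ a b → (a :- b) :* (a :- b) := (b :- a) :* (b :- a)) R.refl (re z) (re v)) R.refl (re² v h)
      in R.≤⇒¬¬ (R.0≤-⇒≤ _ (R.≤⇒0≤- q≤re) (solve 3 (λ q a b → b :- a :- (q :- a) := b :- q) R.refl (ι q) (re z) (re v))) λ where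
           (inj₁ lt) → too-far 0<e (R.<-trans e<d lt) h′
           (inj₂ eq) → too-far 0<e (R.<-respʳ eq e<d) h′
    real′ : im z R.≈ 0r
    real′ = R.tight
      (λ im<0 → let e , 0<e , e<d = R.archimedean (R.<⇒0<- im<0)
                    v , (_ , _ , im≈0) , h = near _ (0<¼ 0<e)
                in too-far 0<e e<d (R.≤-resp (solve 1 (λ a → a :* a := (con 0ℚ :- a) :* (con 0ℚ :- a)) R.refl (im z)) R.refl (im² v im≈0 h)))
      (λ 0<im → let e , 0<e , e<d = R.archimedean 0<im
                    v , (_ , _ , im≈0) , h = near _ (0<¼ 0<e)
                in too-far 0<e e<d (im² v im≈0 h))

  small-square : ∀ ε → 0ℚ ℚ.< ε → ∃[ e ] (0ℚ ℚ.< e × e ℚ.* e ℚ.≤ ε)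
  small-square ε 0<ε =
    let e , 0<e , e≤1 , e≤ε = min-pos (Rat.0<ₗ 1ℚ) 0<ε in
    e , 0<e , Rat.0≤-⇒≤ _ (ℚ.<⇒≤ 0<e Rat.*⁰ Rat.≤⇒0≤- e≤1 Rat.+⁰ Rat.≤⇒0≤- e≤ε)
      (S.solve 2 (λ e ε → ε S.:- e S.:* e S.:= e S.:* (S.con 1ℚ S.:- e) S.:+ (ε S.:- e)) ≡.refl e ε)

  ∣-∣²-sym : ∀ z w → ∣ z - w ∣² R.≈ ∣ w - z ∣²
  ∣-∣²-sym z w = R.trans (R.sym (∣neg∣² (z - w))) (∣∣²-cong (C.solve 2 (λ z w → C.:- (z C.:- w) C.:= w C.:- z) refl z w))

  module Limit {P : Carrier → Carrier} (cont : Continuous P) {q : ℚ} (limit : RootLimit P q) where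

    -- Near z there is a zero w of a late level. Its image is a zero of the level before, hence near
    -- the interval, and near P(z) by continuity. The interval being closed, it contains P(z).
    invariant : ∀ z → z ∈[ q ,0] → P z ∈[ q ,0]
    invariant z z∈ = closed (P z) λ ε 0<ε →
      let e , 0<e , e²≤ = small-square (¼ ℚ.* ε) (0<¼* 0<ε)
          δ , 0<δ , near = cont z (¼ ℚ.* ε) (0<¼* 0<ε)
          d , 0<d , d²≤ = small-square δ 0<δ
          M , h = limit e 0<e
          N , k = limit d 0<d
          m = M ℕ.⊔ N
          -- Level m + 1, so that P(w) is a zero of level m, which is still late enough for the
          -- other estimate.
          w , root , z~w = proj₂ (k (suc m) (ℕ.m≤n⇒m≤1+n (ℕ.m≤n⊔m M N))) z z∈
          v , v∈ , Pw~v = proj₁ (h m (ℕ.m≤m⊔n M N)) (P w) root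
          w~z = near w (R.≤-resp (∣-∣²-sym z w) R.refl (R.≤-trans (R.<⇒≤ z~w) (R.ι-≤ d²≤)))
      in v , v∈ , R.≤-resp (∣∣²-cong (C.solve 3 (λ a b c → (a C.:- b) C.:+ (b C.:- c) C.:= a C.:- c) refl (P z) (P w) v)) R.refl
           (∣+∣²-< (R.≤-resp (∣-∣²-sym (P w) (P z)) R.refl w~z) (R.≤-trans (R.<⇒≤ Pw~v) (R.ι-≤ e²≤)))

    invariant-ℚ : ∀ {x y} → q ℚ.≤ x → x ℚ.≤ 0ℚ → P (κ x) ≈ κ y → q ℚ.≤ y × y ℚ.≤ 0ℚ
    invariant-ℚ {x} {y} q≤x x≤0 e =
      let l , u , _ = invariant (κ x) (R.≤-respʳ (R.sym (re-real _)) (R.ι-≤ q≤x) , R.≤-resp (R.sym (re-real _)) R.refl (R.ι-≤ x≤0) , im-real _)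
          re≈ = R.trans (re-cong e) (re-real _)
      in R.ι-≤⁻ (R.≤-respʳ re≈ l) , R.ι-≤⁻ (R.≤-resp re≈ R.refl u)

    -- In general zeros only accumulate on the interval; one that recurs at arbitrarily late levels
    -- is within every ε of it and so lies in it.
    recurrent-∈ : ∀ z → (∀ M → ∃[ m ] (m ℕ.≥ M × Root P m z)) → z ∈[ q ,0]
    recurrent-∈ z rec = closed z λ ε 0<ε →
      let e , 0<e , e²≤ = small-square ε 0<ε
          M , h = limit e 0<e
          m , m≥M , root = rec M
          v , v∈ , z~v = proj₁ (h m m≥M) z root
      in v , v∈ , R.≤-trans (R.<⇒≤ z~v) (R.ι-≤ e²≤)

-- The case k = 2 with I_G(-1) = 0: real dynamics in the coordinate t

module RealDynamics (F : RealField) (K : ComplexField F) where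

  private module R = OrderedField F
  open R using (0r; ι; _<_; _≤_; _+⁺_; _*⁺_; _+⁰_; _*⁰_)
  open ComplexPlane F K
  open Continuity F K
  open import Data.Rational.Solver using (module +-*-Solver)
  open R.Solver using (solve; _:=_; _:+_; _:*_; _:-_; :-_; con)
  private
    module S = +-*-Solver
    module C = Solver

  -1ℚ -2ℚ : ℚ
  -1ℚ = ℚ.- 1ℚ
  -2ℚ = ℚ.- 2ℚ

  square-< : ∀ {d e} → 0r < e → d R.* d < e R.* e → ¬ ¬ (d < e × R.- e < d)
  square-< {d} {e} 0<e h k = nn (λ e≤d → (R.<⇒≤ 0<e +⁰ 0r≤d e≤d) , R.≤⇒0≤- e≤d , solve 2 (λ d e → e :* e :- d :* d :+ (e :+ d) :* (d :- e) := con 0ℚ) R.refl d e) λ d<e →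
    nn (λ d≤-e → (R.<⇒≤ 0<e +⁰ R.≤-respʳ (solve 1 (λ d → con 0ℚ :- d := :- d) R.refl d) (R.≤⇒0≤- (R.≤-trans d≤-e -e≤0)))
               , R.≤⇒0≤- d≤-e , solve 2 (λ d e → e :* e :- d :* d :+ (e :- d) :* (:- e :- d) := con 0ℚ) R.refl d e) λ -e<d → k (d<e , -e<d)
    where
    nn : ∀ {A : Set} {x y} → (¬ A → 0r ≤ x × 0r ≤ y × e R.* e R.- d R.* d R.+ x R.* y R.≈ 0r) → (A → ⊥) → ⊥
    nn g n = let x≥0 , y≥0 , eq = g n in R.absurd (R.<⇒0<- h) (x≥0 *⁰ y≥0) eq
    0r≤d : e ≤ d → 0r ≤ d
    0r≤d e≤d = R.≤-trans (R.<⇒≤ 0<e) e≤d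
    -e≤0 : R.- e ≤ 0r
    -e≤0 = R.0≤-⇒≤ _ (R.<⇒≤ 0<e) (solve 1 (λ e → con 0ℚ :- :- e := e) R.refl e)

  -- P(z) + 1 = t c(t) in the coordinate t = z + 1, which carries [−2,0] to [−1,1].
  module Centred {P : Carrier → Carrier} (P-cong : Congruent P) (cont : Continuous P) (limit : RootLimit P -2ℚ)
    (c₀ c₁ c₂ c₃ : ℚ)
    (P≈ : ∀ t → P (t - κ 1ℚ) ≈ t * (κ c₀ + (κ c₁ * t + (κ c₂ * (t * t) + κ c₃ * (t * (t * t))))) - κ 1ℚ) where

    open Limit cont limit

    f c : R.Carrier → R.Carrier
    c t = ι c₀ R.+ (ι c₁ R.* t R.+ (ι c₂ R.* (t R.* t) R.+ ι c₃ R.* (t R.* (t R.* t))))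
    f t = t R.* c t

    cᶜ : Carrier → Carrier
    cᶜ t = κ c₀ + (κ c₁ * t + (κ c₂ * (t * t) + κ c₃ * (t * (t * t))))

    real-c : ∀ t → cᶜ (real t) ≈ real (c t)
    real-c t = sym (trans (real-+ _ _) (+-congˡ (trans (real-+ _ _) (+-cong (real-* _ _) (trans (real-+ _ _)
      (+-cong (trans (real-* _ _) (*-congˡ (real-* _ _))) (trans (real-* _ _) (*-congˡ (trans (real-* _ _) (*-congˡ (real-* _ _)))))))))))

    at : R.Carrier → Carrier
    at t = real t - κ 1ℚ

    at-cong : ∀ {s t} → s R.≈ t → at s ≈ at t
    at-cong e = +-congʳ (real-cong e)

    P-at : ∀ t → P (at t) ≈ at (f t)
    P-at t = trans (P≈ (real t)) (+-congʳ (trans (*-congˡ (real-c t)) (sym (real-* _ _))))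

    at-0 : ∀ {t} → t R.≈ 0r → at t ≈ κ -1ℚ
    at-0 e = trans (at-cong e) (C.solve 0 (C.con 0ℚ C.:- C.con 1ℚ C.:= C.con -1ℚ) refl)

    fixed : P (κ -1ℚ) ≈ κ -1ℚ
    fixed = trans (P-cong (sym (at-0 {0r} R.refl))) (trans (P-at 0r)
      (at-0 (solve 1 (λ x → con 0ℚ :* x := con 0ℚ) R.refl (c 0r))))

    -- Because f(0) = 0, the point -1 is fixed by P, so whatever has reached -1 stays there.
    Root-suc : ∀ m z → Root P m z → Root P (suc m) z
    Root-suc zero    z r = trans (P-cong r) fixed
    Root-suc (suc m) z r = Root-suc m (P z) r

    Root-+ : ∀ k m z → Root P m z → Root P (k ℕ.+ m) z
    Root-+ zero    m z r = r
    Root-+ (suc k) m z r = Root-suc (k ℕ.+ m) z (Root-+ k m z r)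

    Root-∈ : ∀ m z → Root P m z → z ∈[ -2ℚ ,0]
    Root-∈ m z r = recurrent-∈ z λ M → M ℕ.+ m , ℕ.m≤m+n M m , Root-+ M m z r

    coord : Carrier → R.Carrier
    coord z = re z R.+ ι 1ℚ

    at-coord : ∀ {z} → im z R.≈ 0r → z ≈ at (coord z)
    at-coord {z} e = ext
      (R.sym (R.trans (re-+ _ _) (R.trans (R.+-cong (re-real _) (R.trans (re-neg _) (R.-‿cong (re-real _))))
        (solve 1 (λ a → a :+ con 1ℚ :- con 1ℚ := a) R.refl (re z)))))
      (R.trans e (R.sym (R.trans (im-+ _ _) (R.trans (R.+-cong (im-real _) (R.trans (im-neg _) (R.-‿cong (im-real _))))
        (solve 0 (con 0ℚ :- con 0ℚ := con 0ℚ) R.refl)))))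

    coord-at : ∀ t → coord (at t) R.≈ t
    coord-at t = R.trans (R.+-congʳ (R.trans (re-+ _ _) (R.+-cong (re-real _) (R.trans (re-neg _) (R.-‿cong (re-real _))))))
      (solve 1 (λ t → t :- con 1ℚ :+ con 1ℚ := t) R.refl t)

    im-at : ∀ t → im (at t) R.≈ 0r
    im-at t = R.trans (im-+ _ _) (R.trans (R.+-cong (im-real _) (R.trans (im-neg _) (R.-‿cong (im-real _))))
      (solve 0 (con 0ℚ :- con 0ℚ := con 0ℚ) R.refl))

    lower : ∀ {t} → at t ∈[ -2ℚ ,0] → 0r ≤ t R.+ ι 1ℚ
    lower {t} (l , _ , _) = R.≤-respʳ (R.trans (solve 1 (λ r → r :- con -2ℚ := r :+ con 1ℚ :+ con 1ℚ) R.refl (re (at t)))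
      (R.+-congʳ (coord-at t))) (R.≤⇒0≤- l)

    upper : ∀ {t} → at t ∈[ -2ℚ ,0] → 0r ≤ ι 1ℚ R.- t
    upper {t} (_ , u , _) = R.≤-respʳ (R.trans (solve 1 (λ r → con 0ℚ :- r := con 1ℚ :- (r :+ con 1ℚ)) R.refl (re (at t)))
      (R.+-congˡ (R.-‿cong (coord-at t)))) (R.≤⇒0≤- u)

    ∈-resp : ∀ {z w} → z ≈ w → z ∈[ -2ℚ ,0] → w ∈[ -2ℚ ,0]
    ∈-resp e (l , u , i) = R.≤-respʳ (re-cong e) l , R.≤-resp (re-cong e) R.refl u , R.trans (R.sym (im-cong e)) i

    at⇒0 : ∀ {t} → at t ≈ κ -1ℚ → t R.≈ 0r
    at⇒0 {t} e = R.trans (R.sym (coord-at t)) (R.trans (R.+-congʳ (R.trans (re-cong e) (re-real _)))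
      (solve 0 (con -1ℚ :+ con 1ℚ := con 0ℚ) R.refl))

    -- All roots are real, so an open set of reals that f maps into itself must contain 0.
    trap : (S : R.Carrier → Set) → (∀ {t} → S t → ¬ ¬ S (f t)) →
           (∀ {t} → S t → ¬ t R.≈ 0r) →
           ∀ x ε → 0ℚ ℚ.< ε → -1ℚ ℚ.≤ x → x ℚ.≤ 1ℚ → (∀ t → (ι x R.- t) R.* (ι x R.- t) < ι (ε ℚ.* ε) → ¬ ¬ S t) → ⊥
    trap S S-f S-0 x ε 0<ε -1≤x x≤1 ball =
      let M , h = limit ε 0<ε
          w , r , x~w = proj₂ (h M ℕ.≤-refl) (at (ι x)) x∈
          _ , _ , im≈0 = Root-∈ M w r
          w≈ = at-coord im≈0
      in ball (coord w) (R.<-respˡ (distance (∣∣²-cong (+-congˡ (-‿cong w≈)))) x~w) λ s → no-root M s (Root-resp P-cong M w≈ r)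
      where
      x∈ : at (ι x) ∈[ -2ℚ ,0]
      x∈ = R.≤-respʳ re≈ (R.≤-trans (R.ι-≤ (ℚ.+-monoˡ-≤ -1ℚ -1≤x)) (R.≈⇒≤ (R.ι-+ x -1ℚ)))
         , R.≤-resp re≈ R.refl (R.≤-trans (R.≈⇒≤ (R.sym (R.ι-+ x -1ℚ))) (R.ι-≤ (ℚ.+-monoˡ-≤ -1ℚ x≤1)))
         , im-at _
        where
        re≈ : ι x R.+ ι -1ℚ R.≈ re (at (ι x))
        re≈ = R.sym (R.trans (re-+ _ _) (R.+-cong (re-real _) (R.trans (re-neg _) (R.trans (R.-‿cong (re-real _)) (R.sym (R.ι-neg 1ℚ))))))
      distance : ∀ {d t} → d R.≈ ∣ at (ι x) - at t ∣² → d R.≈ (ι x R.- t) R.* (ι x R.- t)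
      distance {d} {t} e = R.trans e (R.trans (∣∣²-cong (trans (C.solve 3 (λ a b o → a C.:- o C.:- (b C.:- o) C.:= a C.:- b) refl (real (ι x)) (real t) (κ 1ℚ))
        (sym (trans (real-+ _ _) (+-congˡ (real-neg _)))))) (R.trans (R.+-cong (R.*-cong (re-real _) (re-real _)) (R.*-cong (im-real _) (im-real _)))
          (solve 1 (λ a → a :* a :+ con 0ℚ :* con 0ℚ := a :* a) R.refl (ι x R.- t))))
      no-root : ∀ m {t} → S t → ¬ Root P m (at t)
      no-root zero    {t} s r = S-f s λ s′ → S-0 s′ (at⇒0 (trans (sym (P-at t)) r))
      no-root (suc m) {t} s r = S-f s λ s′ → no-root m s′ (Root-resp P-cong m (P-at t) r)

    ∈-at : ∀ {t} → 0r ≤ t R.+ ι 1ℚ → 0r ≤ ι 1ℚ R.- t → at t ∈[ -2ℚ ,0]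
    ∈-at {t} l u = R.0≤-⇒≤ _ l (R.trans (solve 1 (λ r → r :- con -2ℚ := r :+ con 1ℚ :+ con 1ℚ) R.refl (re (at t))) (R.+-congʳ (coord-at t)))
      , R.0≤-⇒≤ _ u (R.trans (solve 1 (λ r → con 0ℚ :- r := con 1ℚ :- (r :+ con 1ℚ)) R.refl (re (at t))) (R.+-congˡ (R.-‿cong (coord-at t))))
      , im-at t

    Real-root : R.Carrier → Set
    Real-root r = 0r ≤ r R.+ ι 1ℚ × 0r ≤ ι 1ℚ R.- r × c r R.≈ 0r

    -- Otherwise f would preserve the nonzero points of [−1,1].
    real-root : ¬ ¬ (∃[ r ] Real-root r)
    real-root none = trap S S-f (λ (t≉0 , _) → t≉0) ½ ¼ (Rat.0<ₗ ¼) (Rat.0≤-⇒≤ (1ℚ ℚ.+ ½) (Rat.0≤ₗ _) ≡.refl) (Rat.0≤-⇒≤ ½ (Rat.0≤ₗ _) ≡.refl) ball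
      where
      S : R.Carrier → Set
      S t = ¬ t R.≈ 0r × at t ∈[ -2ℚ ,0]
      S-f : ∀ {t} → S t → ¬ ¬ S (f t)
      S-f {t} (t≉0 , t∈) k = k ((λ ft≈0 → none (t , lower t∈ , upper t∈ , R.x*y≈0 ft≈0 t≉0)) , ∈-resp (P-at t) (invariant (at t) t∈))
      ball : ∀ t → (ι ½ R.- t) R.* (ι ½ R.- t) < ι (¼ ℚ.* ¼) → ¬ ¬ S t
      ball t h k = square-< (R.0<ₗ ¼) (R.<-respʳ (R.ι-* ¼ ¼) h) λ (a , b) →
        k ( (λ t≈0 → R.absurd⁺ (R.<⇒0<- a +⁺ R.0<ₗ ¼) (R.trans (R.+-congʳ (R.+-congˡ (R.-‿cong (R.+-congˡ (R.-‿cong t≈0)))))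
              (solve 0 (con ¼ :- (con ½ :- con 0ℚ) :+ con ¼ := con 0ℚ) R.refl)))
          , ∈-at (R.≤-respʳ (solve 1 (λ t → con ¼ :- (con ½ :- t) :+ con (1ℚ ℚ.+ ¼) := t :+ con 1ℚ) R.refl t) (R.<⇒≤ (R.<⇒0<- a +⁺ R.0<ₗ (1ℚ ℚ.+ ¼))))
                 (R.≤-respʳ (solve 1 (λ t → con ½ :- t :- :- con ¼ :+ con ¼ := con 1ℚ :- t) R.refl t) (R.<⇒≤ (R.<⇒0<- b +⁺ R.0<ₗ ¼))))

    -- c(t) = (t − r)(c₃t² + q₁t + q₀) for a root r.
    module Cofactor (0<c₃ : 0ℚ ℚ.< c₃) (r : R.Carrier) (c[r]≈0 : c r R.≈ 0r) where

      q₁ q₀ D : R.Carrier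
      q₁ = ι c₂ R.+ ι c₃ R.* r
      q₀ = ι c₁ R.+ (ι c₂ R.* r R.+ ι c₃ R.* (r R.* r))
      D  = q₁ R.* q₁ R.- ι (2ℚ ℚ.* 2ℚ) R.* (ι c₃ R.* q₀)

      -- 1/(2c₃), the denominator in the quadratic formula.
      inverse = Rat.shrink (Rat.0<ₗ 2ℚ Rat.*⁺ 0<c₃) (Rat.0<ₗ 1ℚ)
      e : ℚ
      e = proj₁ inverse
      0<e : 0ℚ ℚ.< e
      0<e = proj₁ (proj₂ inverse)

      2c₃e : κ 2ℚ * κ c₃ * κ e ≈ κ 1ℚ
      2c₃e = trans (*-congʳ (sym (real-* _ _))) (trans (sym (real-* _ _)) (real-cong
        (R.trans (R.*-congʳ (R.sym (R.ι-* 2ℚ c₃))) (R.trans (R.sym (R.ι-* _ _)) (R.reflexive (≡.cong ι (proj₂ (proj₂ inverse))))))))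

      2c₃eᵣ : ι 2ℚ R.* ι c₃ R.* ι e R.≈ ι 1ℚ
      2c₃eᵣ = R.trans (R.*-congʳ (R.sym (R.ι-* 2ℚ c₃))) (R.trans (R.sym (R.ι-* _ _)) (R.reflexive (≡.cong ι (proj₂ (proj₂ inverse)))))

      Q₁ Q₀ Dᶜ : Carrier
      Q₁ = κ c₂ + κ c₃ * real r
      Q₀ = κ c₁ + (κ c₂ * real r + κ c₃ * (real r * real r))
      Dᶜ = Q₁ * Q₁ - κ (2ℚ ℚ.* 2ℚ) * (κ c₃ * Q₀)

      Q₁≈ : Q₁ ≈ real q₁
      Q₁≈ = sym (trans (real-+ _ _) (+-congˡ (real-* _ _)))

      Q₀≈ : Q₀ ≈ real q₀
      Q₀≈ = sym (trans (real-+ _ _) (+-congˡ (trans (real-+ _ _) (+-cong (real-* _ _) (trans (real-* _ _) (*-congˡ (real-* _ _)))))))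

      D≈ : Dᶜ ≈ real D
      D≈ = trans (+-cong (trans (*-cong Q₁≈ Q₁≈) (sym (real-* _ _))) (-‿cong (trans (*-congˡ (trans (*-congˡ Q₀≈) (sym (real-* _ _)))) (sym (real-* _ _)))))
        (sym (trans (real-+ _ _) (+-congˡ (real-neg _))))

      -- The quadratic formula for any complex square root V of the discriminant, so that one
      -- statement serves both signs of D.
      quadratic : ∀ V → V * V ≈ Dᶜ → let v = (V - Q₁) * κ e in κ c₃ * (v * v) + (Q₁ * v + Q₀) ≈ κ 0ℚ
      quadratic V V²≈D = begin
        κ c₃ * ((V - Q₁) * κ e * ((V - Q₁) * κ e)) + (Q₁ * ((V - Q₁) * κ e) + Q₀)
          ≈⟨ C.solve 5 (λ c e V q p → c C.:* ((V C.:- q) C.:* e C.:* ((V C.:- q) C.:* e)) C.:+ (q C.:* ((V C.:- q) C.:* e) C.:+ p)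
               C.:= C.con ½ C.:* (C.con 2ℚ C.:* c C.:* e) C.:* (e C.:* ((V C.:- q) C.:* (V C.:- q))) C.:+ (q C.:* ((V C.:- q) C.:* e) C.:+ p)) refl (κ c₃) (κ e) V Q₁ Q₀ ⟩
        κ ½ * (κ 2ℚ * κ c₃ * κ e) * (κ e * ((V - Q₁) * (V - Q₁))) + (Q₁ * ((V - Q₁) * κ e) + Q₀)
          ≈⟨ +-congʳ (*-congʳ (*-congˡ 2c₃e)) ⟩
        κ ½ * κ 1ℚ * (κ e * ((V - Q₁) * (V - Q₁))) + (Q₁ * ((V - Q₁) * κ e) + Q₀)
          ≈⟨ C.solve 4 (λ e V q p → C.con ½ C.:* C.con 1ℚ C.:* (e C.:* ((V C.:- q) C.:* (V C.:- q))) C.:+ (q C.:* ((V C.:- q) C.:* e) C.:+ p)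
               C.:= C.con ½ C.:* (e C.:* (V C.:* V C.:- q C.:* q)) C.:+ p) refl (κ e) V Q₁ Q₀ ⟩
        κ ½ * (κ e * (V * V - Q₁ * Q₁)) + Q₀
          ≈⟨ +-congʳ (*-congˡ (*-congˡ (+-congʳ V²≈D))) ⟩
        κ ½ * (κ e * (Dᶜ - Q₁ * Q₁)) + Q₀
          ≈⟨ C.solve 4 (λ c e q p → C.con ½ C.:* (e C.:* (q C.:* q C.:- C.con (2ℚ ℚ.* 2ℚ) C.:* (c C.:* p) C.:- q C.:* q)) C.:+ p
               C.:= p C.:- (C.con 2ℚ C.:* c C.:* e) C.:* p) refl (κ c₃) (κ e) Q₁ Q₀ ⟩
        Q₀ - (κ 2ℚ * κ c₃ * κ e) * Q₀
          ≈⟨ +-congˡ (-‿cong (*-congʳ 2c₃e)) ⟩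
        Q₀ - κ 1ℚ * Q₀
          ≈⟨ C.solve 1 (λ p → p C.:- C.con 1ℚ C.:* p C.:= C.con 0ℚ) refl Q₀ ⟩
        κ 0ℚ ∎
        where open import Relation.Binary.Reasoning.Setoid setoid

      -- A zero v of the cofactor is a zero of c and hence of f, so v - 1 is a zero of level 0. All
      -- zeros lie in the interval exactly, which forces even an a priori complex v to be real.
      root : ∀ V → V * V ≈ real D → ((V - Q₁) * κ e - κ 1ℚ) ∈[ -2ℚ ,0]
      root V V² = Root-∈ 0 (v - κ 1ℚ) (trans (P≈ v) (trans (+-congʳ (trans (*-congˡ c[v]≈0)
        (C.solve 1 (λ v → v C.:* C.con 0ℚ C.:= C.con 0ℚ) refl v))) (C.solve 0 (C.con 0ℚ C.:- C.con 1ℚ C.:= C.con -1ℚ) refl)))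
        where
        v = (V - Q₁) * κ e
        c[v]≈0 : cᶜ v ≈ κ 0ℚ
        c[v]≈0 = trans (C.solve 6 (λ a b c d v r →
            a C.:+ (b C.:* v C.:+ (c C.:* (v C.:* v) C.:+ d C.:* (v C.:* (v C.:* v))))
            C.:= (v C.:- r) C.:* (d C.:* (v C.:* v) C.:+ ((c C.:+ d C.:* r) C.:* v C.:+ (b C.:+ (c C.:* r C.:+ d C.:* (r C.:* r)))))
              C.:+ (a C.:+ (b C.:* r C.:+ (c C.:* (r C.:* r) C.:+ d C.:* (r C.:* (r C.:* r)))))) refl
            (κ c₀) (κ c₁) (κ c₂) (κ c₃) v (real r))
          (trans (+-cong (*-congˡ (quadratic V (trans V² (sym D≈)))) (trans (real-c r) (real-cong c[r]≈0)))
            (C.solve 1 (λ a → a C.:* C.con 0ℚ C.:+ C.con 0ℚ C.:= C.con 0ℚ) refl (v - real r)))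

      -- If D were negative, V = i√(-D) would give a zero with imaginary part √(-D)/(2c₃), off the
      -- real interval.
      0≤D : 0r ≤ D
      0≤D D<0 = R.<-irrefl (R.<-respˡ D≈0 D<0)
        where
        sq = R.sqrt (R.- D) (R.≤-respʳ (solve 1 (λ D → con 0ℚ :- D := :- D) R.refl D) (R.<⇒≤ (R.<⇒0<- D<0)))
        s = proj₁ sq
        s² = proj₂ (proj₂ sq)
        V² : (0r +i s) * (0r +i s) ≈ real D
        V² = ext (R.trans (re-* _ _) (R.trans (R.+-cong (R.*-cong (re-+i _ _) (re-+i _ _)) (R.-‿cong (R.*-cong (im-+i _ _) (im-+i _ _))))
                   (R.trans (R.+-congˡ (R.-‿cong s²)) (R.trans (solve 1 (λ D → con 0ℚ :* con 0ℚ :- :- D := D) R.refl D) (R.sym (re-real D))))))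
                 (R.trans (im-* _ _) (R.trans (R.+-cong (R.*-cong (re-+i _ _) (im-+i _ _)) (R.*-cong (im-+i _ _) (re-+i _ _)))
                   (R.trans (solve 1 (λ s → con 0ℚ :* s :+ s :* con 0ℚ := con 0ℚ) R.refl s) (R.sym (im-real D)))))
        im≈ : im (((0r +i s) - Q₁) * κ e - κ 1ℚ) R.≈ ι e R.* s
        im≈ = R.trans (im-+ _ _) (R.trans (R.+-cong (R.trans (im-cong (*-comm _ _)) (R.trans (im-κ* e _) (R.*-congˡ (R.trans (im-+ _ _)
                (R.+-cong (im-+i _ _) (R.trans (im-neg _) (R.-‿cong (R.trans (im-cong Q₁≈) (im-real _)))))))))
                (R.trans (im-neg _) (R.-‿cong (im-real _))))
              (solve 2 (λ e s → e :* (s :- con 0ℚ) :- con 0ℚ := e :* s) R.refl (ι e) s))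
        s≈0 : s R.≈ 0r
        s≈0 = R.x*y≈0 {ι e} (R.trans (R.sym im≈) (proj₂ (proj₂ (root _ V²)))) (R.absurd⁺ (R.ι-< 0<e))
        D≈0 : D R.≈ 0r
        D≈0 = R.trans (solve 1 (λ D → D := :- :- D) R.refl D) (R.trans (R.-‿cong (R.sym s²)) (R.trans (R.-‿cong (R.*-cong s≈0 s≈0))
                (solve 0 (:- (con 0ℚ :* con 0ℚ) := con 0ℚ) R.refl)))

      -- The smaller root (−q₁ − √D)/2c₃ is at least −1.
      0≤q[-1] : 0r ≤ ι c₃ R.- q₁ R.+ q₀
      0≤q[-1] neg = R.absurd (R.0<ₗ (2ℚ ℚ.* 2ℚ) *⁺ (R.ι-< 0<c₃ *⁺ R.<⇒0<- neg)) (bound *⁰ (bound +⁰ (0≤s +⁰ 0≤s)))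
        (R.trans (+ʳ (R.trans (solve 4 (λ c q p s → (con 2ℚ :* c :- q :- s) :* (con 2ℚ :* c :- q :- s :+ (s :+ s))
              := con (2ℚ ℚ.* 2ℚ) :* (c :* (c :- q :+ p)) :+ ((q :* q :- con (2ℚ ℚ.* 2ℚ) :* (c :* p)) :- s :* s)) R.refl (ι c₃) q₁ q₀ s)
            (R.+-congˡ (R.+-congˡ (R.-‿cong s²)))))
          (solve 3 (λ c x D → con (2ℚ ℚ.* 2ℚ) :* (c :* (con 0ℚ :- x)) :+ (con (2ℚ ℚ.* 2ℚ) :* (c :* x) :+ (D :- D)) := con 0ℚ) R.refl (ι c₃) (ι c₃ R.- q₁ R.+ q₀) D))
        where
        +ʳ = R.+-congˡ
        sq = R.sqrt D 0≤D
        s = proj₁ sq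
        0≤s = proj₁ (proj₂ sq)
        s² = proj₂ (proj₂ sq)
        V² : real (R.- s) * real (R.- s) ≈ real D
        V² = trans (sym (real-* _ _)) (real-cong (R.trans (solve 1 (λ s → :- s :* :- s := s :* s) R.refl s) s²))
        v = (R.- s R.- q₁) R.* ι e
        v≈ : (real (R.- s) - Q₁) * κ e - κ 1ℚ ≈ at v
        v≈ = +-congʳ (sym (trans (real-* _ _) (*-congʳ (trans (real-+ _ _) (+-congˡ (trans (real-neg _) (-‿cong (sym Q₁≈))))))))
        bound : 0r ≤ ι 2ℚ R.* ι c₃ R.- q₁ R.- s
        bound = R.≤-respʳ (R.trans (solve 4 (λ c e q s → con 2ℚ :* c :* ((:- s :- q) :* e :+ con 1ℚ) := con 2ℚ :* c :* e :* (:- s :- q) :+ con 2ℚ :* c) R.refl (ι c₃) (ι e) q₁ s)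
            (R.trans (R.+-congʳ (R.*-congʳ 2c₃eᵣ)) (solve 3 (λ c q s → con 1ℚ :* (:- s :- q) :+ con 2ℚ :* c := con 2ℚ :* c :- q :- s) R.refl (ι c₃) q₁ s)))
          (R.<⇒≤ (R.0<ₗ 2ℚ *⁺ R.ι-< 0<c₃) *⁰ lower (∈-resp v≈ (root _ V²)))

module QuarticCases (F : RealField) (K : ComplexField F) where

  private module R = OrderedField F
  open R using (0r; ι; _<_; _≤_; _+⁺_; _*⁺_; _+⁰_; _*⁰_)
  open ComplexPlane F K using (Carrier; Congruent; RootLimit; κ; _≈_; _+_; _-_; _*_)
  open Continuity F K
  open RealDynamics F K
  open import Data.Rational using (_/_)
  open R.Solver using (solve; _:=_; _:+_; _:*_; _:-_; :-_; con)

  module Cases {P : Carrier → Carrier} (P-cong : Congruent P) (cont : Continuous P) (limit : RootLimit P -2ℚ)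
    (c₀ c₁ c₂ c₃ : ℚ) (0<c₃ : 0ℚ ℚ.< c₃)
    (P≈ : ∀ t → P (t - κ 1ℚ) ≈ t * (κ c₀ + (κ c₁ * t + (κ c₂ * (t * t) + κ c₃ * (t * (t * t))))) - κ 1ℚ) where

    open Centred P-cong cont limit c₀ c₁ c₂ c₃ P≈

    -- In c(t) = (t - r)q(t) both r + 1 and q(-1) are nonnegative, so c(-1) = -(r + 1)q(-1) ≤ 0.
    c[-1]≢1 : ¬ (ι c₀ R.- ι c₁ R.+ ι c₂ R.- ι c₃ R.≈ ι 1ℚ)
    c[-1]≢1 e = real-root λ (r , l , _ , cr≈0) → let open Cofactor 0<c₃ r cr≈0 using (0≤q[-1]) in
      R.absurd (R.<-respʳ (R.sym e) (R.0<ₗ 1ℚ)) (l *⁰ 0≤q[-1])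
        (R.trans (solve 5 (λ a b c d r → a :- b :+ c :- d :+ (r :+ con 1ℚ) :* (d :- (c :+ d :* r) :+ (b :+ (c :* r :+ d :* (r :* r))))
           := a :+ (b :* r :+ (c :* (r :* r) :+ d :* (r :* (r :* r))))) R.refl (ι c₀) (ι c₁) (ι c₂) (ι c₃) r) cr≈0)

    -- The two equations say f(1) = f(-1) = 1, that is I_G(0) = I_G(-2) = 1.
    module Even (e₁ : ι c₁ R.≈ ι 1ℚ R.- ι c₃) (e₂ : ι c₂ R.≈ R.- ι c₀) where

      f≈ : ∀ {a} → ι c₀ R.≈ a → ∀ t → f t R.≈ t R.* (a R.+ ((ι 1ℚ R.- ι c₃) R.* t R.+ (R.- a R.* (t R.* t) R.+ ι c₃ R.* (t R.* (t R.* t)))))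
      f≈ e t = R.*-congˡ (R.+-cong e (R.+-cong (R.*-congʳ e₁) (R.+-congʳ (R.*-congʳ (R.trans e₂ (R.-‿cong e))))))

      c≈ : ∀ {a} → ι c₀ R.≈ a → ∀ t → c t R.≈ a R.+ ((ι 1ℚ R.- ι c₃) R.* t R.+ (R.- a R.* (t R.* t) R.+ ι c₃ R.* (t R.* (t R.* t))))
      c≈ e t = R.+-cong e (R.+-cong (R.*-congʳ e₁) (R.+-congʳ (R.*-congʳ (R.trans e₂ (R.-‿cong e)))))

      private
        g : R.Carrier
        g = ι c₃ R.- ι 1ℚ
        tenth : ℚ
        tenth = + 1 / 10

        ball : ∀ t → (ι (+ 1 / 20) R.- t) R.* (ι (+ 1 / 20) R.- t) < ι ((+ 1 / 20) ℚ.* (+ 1 / 20)) →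
               ¬ ¬ (0r < t × 0r < ι tenth R.- t)
        ball t h k = square-< (R.0<ₗ (+ 1 / 20)) (R.<-respʳ (R.ι-* _ _) h) λ (a , b) →
          k ( R.<-respʳ (solve 1 (λ t → con (+ 1 / 20) :- (con (+ 1 / 20) :- t) := t) R.refl t) (R.<⇒0<- a)
            , R.<-respʳ (solve 1 (λ t → con (+ 1 / 20) :- t :- :- con (+ 1 / 20) := con tenth :- t) R.refl t) (R.<⇒0<- b))

        pos≉0 : ∀ {t} → 0r < t → ¬ t R.≈ 0r
        pos≉0 = R.absurd⁺

      -- The interval (0, 1/10) is mapped into itself: t - f(t) = t²(1 - t)(t + g(1 + t)) is
      -- nonnegative there, and c₃ ≤ 4 keeps f positive.
      c₀≢1 : ι c₀ R.≈ ι 1ℚ → 0r ≤ g → 0r ≤ ι (+ 4 / 1) R.- ι c₃ → ⊥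
      c₀≢1 e 0≤g 0≤h = trap (λ t → 0r < t × 0r < ι tenth R.- t) step (λ (0<t , _) → pos≉0 0<t)
        (+ 1 / 20) (+ 1 / 20) (Rat.0<ₗ _) (Rat.0≤-⇒≤ (+ 21 / 20) (Rat.0≤ₗ _) ≡.refl) (Rat.0≤-⇒≤ (+ 19 / 20) (Rat.0≤ₗ _) ≡.refl) ball
        where
        step : ∀ {t} → 0r < t × 0r < ι tenth R.- t → ¬ ¬ (0r < f t × 0r < ι tenth R.- f t)
        step {t} (0<t , 0<a) k =
          -- 69/100 = 1 - 3/10 - 1/100 is f(t)/t at t = 1/10 and c₃ = 4 without its cubic term.
          R.pos+nonneg (R.0<ₗ (+ 69 / 100) +⁺ R.0<ₗ (+ 31 / 10) *⁺ 0<a) (0≤t *⁰ 0≤a +⁰ (0≤h *⁰ 0≤t +⁰ R.ι-≤ (ℚ.<⇒≤ 0<c₃) *⁰ (0≤t *⁰ (0≤t *⁰ 0≤t)))) λ p →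
          R.pos+nonneg 0<a (0≤t *⁰ (0≤t *⁰ ((0≤a +⁰ R.0≤ₗ (+ 9 / 10)) *⁰ (0≤t +⁰ 0≤g *⁰ (0≤t +⁰ R.0≤ₗ 1ℚ))))) λ q →
          k ( R.<-respʳ (R.trans (solve 2 (λ t c → t :* (con (+ 69 / 100) :+ con (+ 31 / 10) :* (con tenth :- t)
                :+ (t :* (con tenth :- t) :+ ((con (+ 4 / 1) :- c) :* t :+ c :* (t :* (t :* t)))))
                := t :* (con 1ℚ :+ ((con 1ℚ :- c) :* t :+ (:- con 1ℚ :* (t :* t) :+ c :* (t :* (t :* t)))))) R.refl t (ι c₃)) (R.sym (f≈ e t))) (0<t *⁺ p)
            , R.<-respʳ (R.trans (solve 2 (λ t c → con tenth :- t :+ t :* (t :* ((con tenth :- t :+ con (+ 9 / 10)) :* (t :+ (c :- con 1ℚ) :* (t :+ con 1ℚ))))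
                := con tenth :- t :* (con 1ℚ :+ ((con 1ℚ :- c) :* t :+ (:- con 1ℚ :* (t :* t) :+ c :* (t :* (t :* t)))))) R.refl t (ι c₃)) (R.+-congˡ (R.-‿cong (R.sym (f≈ e t))))) q)
          where
          0≤t = R.<⇒≤ 0<t
          0≤a = R.<⇒≤ 0<a

      -- The intervals (0, 1/10) and (−1/10 − g/100, 0) are exchanged.
      c₀≢-1 : ι c₀ R.≈ ι -1ℚ → 0r ≤ g → 0r ≤ ι (+ 4 / 1) R.- ι c₃ → ⊥
      c₀≢-1 e 0≤g 0≤h = trap S step (λ { (inj₁ (0<t , _)) → pos≉0 0<t ; (inj₂ (0<y , _)) t≈0 →
            pos≉0 0<y (R.trans (R.-‿cong t≈0) (solve 0 (:- con 0ℚ := con 0ℚ) R.refl)) })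
        (+ 1 / 20) (+ 1 / 20) (Rat.0<ₗ _) (Rat.0≤-⇒≤ (+ 21 / 20) (Rat.0≤ₗ _) ≡.refl) (Rat.0≤-⇒≤ (+ 19 / 20) (Rat.0≤ₗ _) ≡.refl)
        (λ t h k → ball t h λ s → k (inj₁ s))
        where
        S : R.Carrier → Set
        -- The length 1/10 + g/100 comes from -f(t) = t + gt² - t³ - c₃t⁴ for t < 1/10. On the way
        -- back f(-y) = y - gy² - y³ + c₃y⁴ loses the excess again.
        S t = (0r < t × 0r < ι tenth R.- t) ⊎ (0r < R.- t × 0r < ι tenth R.+ g R.* ι (+ 1 / 100) R.- R.- t)
        0≤c₃ = R.ι-≤ (ℚ.<⇒≤ 0<c₃)
        step : ∀ {t} → S t → ¬ ¬ S (f t)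
        step {t} (inj₁ (0<t , 0<a)) k =
          R.pos+nonneg (R.0<ₗ (+ 49 / 50) +⁺ R.0<ₗ (+ 1 / 5) *⁺ 0<a)
            (R.0≤ₗ 2ℚ *⁰ (0≤t *⁰ 0≤a) +⁰ (0≤t *⁰ (0≤t *⁰ 0≤1-t) +⁰ 0≤g *⁰ (0≤t *⁰ (0≤1-t *⁰ (0≤t +⁰ R.0≤ₗ 1ℚ))))) λ p →
          R.pos+nonneg 0<a (0≤g *⁰ (0≤a *⁰ (0≤t +⁰ R.0≤ₗ tenth)) +⁰ (0≤t *⁰ (0≤t *⁰ 0≤t) +⁰ 0≤c₃ *⁰ ((0≤t *⁰ 0≤t) *⁰ (0≤t *⁰ 0≤t)))) λ q →
          k (inj₂
            ( R.<-respʳ (R.trans (solve 2 (λ t c → let a = con tenth :- t ; g = c :- con 1ℚ in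
                t :* (con (+ 49 / 50) :+ con (+ 1 / 5) :* a :+ (con 2ℚ :* (t :* a) :+ (t :* (t :* (a :+ con (+ 9 / 10))) :+ g :* (t :* ((a :+ con (+ 9 / 10)) :* (t :+ con 1ℚ))))))
                := :- (t :* (con -1ℚ :+ ((con 1ℚ :- c) :* t :+ (:- con -1ℚ :* (t :* t) :+ c :* (t :* (t :* t))))))) R.refl t (ι c₃)) (R.-‿cong (R.sym (f≈ e t)))) (0<t *⁺ p)
            , R.<-respʳ (R.trans (solve 2 (λ t c → let a = con tenth :- t ; g = c :- con 1ℚ in
                a :+ (g :* (a :* (t :+ con tenth)) :+ (t :* (t :* t) :+ c :* ((t :* t) :* (t :* t))))
                := con tenth :+ g :* con (+ 1 / 100) :- :- (t :* (con -1ℚ :+ ((con 1ℚ :- c) :* t :+ (:- con -1ℚ :* (t :* t) :+ c :* (t :* (t :* t))))))) R.refl t (ι c₃))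
                (R.+-congˡ (R.-‿cong (R.-‿cong (R.sym (f≈ e t)))))) q))
          where
          0≤t = R.<⇒≤ 0<t
          0≤a = R.<⇒≤ 0<a
          0≤1-t = 0≤a +⁰ R.0≤ₗ (+ 9 / 10)
        step {t} (inj₂ (0<y , 0<b)) k =
          R.pos+nonneg (R.0<ₗ (+ 5931 / 10000)) (R.0≤ₗ (+ 313 / 100) *⁰ 0≤b′ +⁰ (0≤y *⁰ 0≤b′ +⁰ (0≤h *⁰ 0≤y +⁰ 0≤c₃ *⁰ (0≤y *⁰ (0≤y *⁰ 0≤y))))) λ p →
          R.pos+nonneg (0<y *⁺ (0<y *⁺ 0<y) *⁺ R.0<ₗ (+ 12 / 25))
            (0≤y *⁰ (0≤y *⁰ 0≤y) *⁰ (R.0≤ₗ (+ 4 / 1) *⁰ 0≤b′ +⁰ 0≤h *⁰ 0≤y)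
             +⁰ (R.<⇒≤ 0<b *⁰ (R.0≤ₗ (+ 11 / 50) +⁰ (R.0≤ₗ (+ 13 / 50) *⁰ 0≤h +⁰ (R.0≤ₗ (+ 1 / 50) *⁰ (0≤g *⁰ 0≤h) +⁰ 0≤g *⁰ R.<⇒≤ 0<b)))
             +⁰ (R.0≤ₗ (+ 1 / 500) *⁰ (0≤g *⁰ 0≤g) +⁰ R.0≤ₗ (+ 1 / 10000) *⁰ (0≤g *⁰ (0≤g *⁰ 0≤g))))) λ q →
          k (inj₁
            ( R.<-respʳ (R.trans (solve 2 (λ t c → let y = :- t ; g = c :- con 1ℚ ; h = con (+ 4 / 1) :- c ; b = con tenth :+ g :* con (+ 1 / 100) :- y ; b′ = b :+ h :* con (+ 1 / 100) in
                y :* (con (+ 5931 / 10000) :+ (con (+ 313 / 100) :* b′ :+ (y :* b′ :+ (h :* y :+ c :* (y :* (y :* y))))))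
                := t :* (con -1ℚ :+ ((con 1ℚ :- c) :* t :+ (:- con -1ℚ :* (t :* t) :+ c :* (t :* (t :* t)))))) R.refl t (ι c₃)) (R.sym (f≈ e t))) (0<y *⁺ p)
            , R.<-respʳ (R.trans (solve 2 (λ t c → let y = :- t ; g = c :- con 1ℚ ; h = con (+ 4 / 1) :- c ; b = con tenth :+ g :* con (+ 1 / 100) :- y ; b′ = b :+ h :* con (+ 1 / 100) in
                y :* (y :* y :* con (+ 12 / 25)) :+ (y :* (y :* y :* (con (+ 4 / 1) :* b′ :+ h :* y))
                  :+ (b :* (con (+ 11 / 50) :+ (con (+ 13 / 50) :* h :+ (con (+ 1 / 50) :* (g :* h) :+ g :* b)))
                  :+ (con (+ 1 / 500) :* (g :* g) :+ con (+ 1 / 10000) :* (g :* (g :* g)))))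
                := con tenth :- t :* (con -1ℚ :+ ((con 1ℚ :- c) :* t :+ (:- con -1ℚ :* (t :* t) :+ c :* (t :* (t :* t)))))) R.refl t (ι c₃))
                (R.+-congˡ (R.-‿cong (R.sym (f≈ e t))))) q))
          where
          0≤y = R.<⇒≤ 0<y
          0≤b′ : 0r ≤ ι tenth R.+ g R.* ι (+ 1 / 100) R.- R.- t R.+ (ι (+ 4 / 1) R.- ι c₃) R.* ι (+ 1 / 100)
          0≤b′ = R.<⇒≤ 0<b +⁰ 0≤h *⁰ R.0≤ₗ (+ 1 / 100)

      private
        ball² : ∀ t → (ι (+ 1 / 20) R.- t) R.* (ι (+ 1 / 20) R.- t) < ι ((+ 1 / 20) ℚ.* (+ 1 / 20)) →
                ¬ ¬ (0r < t R.* t × 0r < ι (+ 1 / 100) R.- t R.* t)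
        ball² t h k = ball t h λ (0<t , 0<a) → k (0<t *⁺ 0<t
          , R.<-respʳ (solve 1 (λ t → (con tenth :- t) :* (t :+ con tenth) := con (+ 1 / 100) :- t :* t) R.refl t) (0<a *⁺ (0<t +⁺ R.0<ₗ tenth)))

        -- For c₀ = 0 the derivative of f at 0 vanishes, and a whole punctured neighbourhood of 0 is
        -- trapped. Describing it by t² treats both signs at once.
        trap² : (∀ t → 0r < t R.* t → 0r < ι (+ 1 / 100) R.- t R.* t → ¬ ¬ (0r < f t R.* f t × 0r < ι (+ 1 / 100) R.- f t R.* f t)) → ⊥
        trap² step = trap (λ t → 0r < t R.* t × 0r < ι (+ 1 / 100) R.- t R.* t) (λ (a , b) → step _ a b)
          (λ (0<t² , _) t≈0 → pos≉0 0<t² (R.trans (R.*-cong t≈0 t≈0) (solve 0 (con 0ℚ :* con 0ℚ := con 0ℚ) R.refl)))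
          (+ 1 / 20) (+ 1 / 20) (Rat.0<ₗ _) (Rat.0≤-⇒≤ (+ 21 / 20) (Rat.0≤ₗ _) ≡.refl) (Rat.0≤-⇒≤ (+ 19 / 20) (Rat.0≤ₗ _) ≡.refl) ball²

      c₀≢0-1 : ι c₀ R.≈ 0r → ι c₃ R.≈ ι 1ℚ → ⊥
      c₀≢0-1 e e₃ = trap² λ t 0<u 0<a k →
        R.pos+nonneg (0<a +⁺ (0<u *⁺ R.0<ₗ (+ 99 / 100)))
          (R.<⇒≤ (0<u *⁺ 0<a) +⁰ R.<⇒≤ (0<u *⁺ 0<u) *⁰ ((R.<⇒≤ 0<a +⁰ R.0≤ₗ (+ 99 / 100)) *⁰ (R.0≤ₗ 1ℚ +⁰ R.<⇒≤ 0<u))) λ q →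
        let f≈t⁴ = R.trans (f≈ e t) (R.trans (R.*-congˡ (R.+-congˡ (R.+-cong (R.*-congʳ (R.+-congˡ (R.-‿cong e₃))) (R.+-congˡ (R.*-congʳ e₃)))))
                     (solve 1 (λ t → t :* (con 0ℚ :+ ((con 1ℚ :- con 1ℚ) :* t :+ (:- con 0ℚ :* (t :* t) :+ con 1ℚ :* (t :* (t :* t))))) := (t :* t) :* (t :* t)) R.refl t))
        in k ( R.<-respʳ (R.*-cong (R.sym f≈t⁴) (R.sym f≈t⁴)) ((0<u *⁺ 0<u) *⁺ (0<u *⁺ 0<u))
             , R.<-respʳ (R.trans (solve 1 (λ u → con (+ 1 / 100) :- u :+ u :* con (+ 99 / 100)
                   :+ (u :* (con (+ 1 / 100) :- u) :+ u :* u :* ((con (+ 1 / 100) :- u :+ con (+ 99 / 100)) :* (con 1ℚ :+ u)))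
                   := con (+ 1 / 100) :- (u :* u) :* (u :* u)) R.refl (t R.* t)) (R.+-congˡ (R.-‿cong (R.*-cong (R.sym f≈t⁴) (R.sym f≈t⁴))))) q)

      -- With u = t² one has f(t) = -um for m = c₃ - 1 - c₃u. For 2 ≤ c₃ ≤ 5 and u < 1/100 this m is
      -- positive and below 4, so 0 < |f(t)| < 1/25. For c₃ = 1 the leading part of m vanishes,
      -- hence the separate case.
      c₀≢0-2 : ι c₀ R.≈ 0r → 0r ≤ ι c₃ R.- ι 2ℚ → 0r ≤ ι (+ 5 / 1) R.- ι c₃ → ⊥
      c₀≢0-2 e 0≤g 0≤h = trap² λ t 0<u 0<a k → let 0≤u = R.<⇒≤ 0<u ; 0≤a = R.<⇒≤ 0<a in
        R.pos+nonneg (R.0<ₗ (+ 98 / 100)) (R.0≤ₗ 2ℚ *⁰ 0≤a +⁰ 0≤g *⁰ (0≤a +⁰ R.0≤ₗ (+ 99 / 100))) λ 0<m →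
        R.pos+nonneg (R.0<ₗ (+ 84 / 10000)) (R.0≤ₗ (+ 16 / 100) *⁰ 0≤a +⁰ (R.0≤ₗ (+ 16 / 1) *⁰ (0≤u *⁰ 0≤a)
            +⁰ (0≤u *⁰ 0≤u) *⁰ ((0≤h +⁰ R.ι-≤ (ℚ.<⇒≤ 0<c₃) *⁰ 0≤u) *⁰ (R.0≤ₗ (+ 4 / 1) +⁰ R.<⇒≤ 0<m)))) λ q →
        k ( R.<-respʳ (R.trans (solve 2 (λ t c → let u = t :* t ; m = con (+ 98 / 100) :+ (con 2ℚ :* (con (+ 1 / 100) :- u) :+ (c :- con 2ℚ) :* (con (+ 1 / 100) :- u :+ con (+ 99 / 100))) ; f = t :* (con 0ℚ :+ ((con 1ℚ :- c) :* t :+ (:- con 0ℚ :* (t :* t) :+ c :* (t :* (t :* t))))) in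
                u :* m :* (u :* m) := f :* f) R.refl t (ι c₃)) (R.*-cong (R.sym (f≈ e t)) (R.sym (f≈ e t)))) ((0<u *⁺ 0<m) *⁺ (0<u *⁺ 0<m))
          , R.<-respʳ (R.trans (solve 2 (λ t c → let u = t :* t ; a = con (+ 1 / 100) :- u ; m = con (+ 98 / 100) :+ (con 2ℚ :* a :+ (c :- con 2ℚ) :* (a :+ con (+ 99 / 100))) ; f = t :* (con 0ℚ :+ ((con 1ℚ :- c) :* t :+ (:- con 0ℚ :* (t :* t) :+ c :* (t :* (t :* t))))) in
                con (+ 84 / 10000) :+ (con (+ 16 / 100) :* a :+ (con (+ 16 / 1) :* (u :* a) :+ u :* u :* ((con (+ 5 / 1) :- c :+ c :* u) :* (con (+ 4 / 1) :+ m))))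
                := con (+ 1 / 100) :- f :* f) R.refl t (ι c₃)) (R.+-congˡ (R.-‿cong (R.*-cong (R.sym (f≈ e t)) (R.sym (f≈ e t)))))) q)

      private
        D≈ : ∀ {a k} → ι c₀ R.≈ a → ι c₃ R.≈ k → ∀ r (cr≈0 : c r R.≈ 0r) →
             Cofactor.D 0<c₃ r cr≈0 R.≈ (R.- a R.+ k R.* r) R.* (R.- a R.+ k R.* r)
               R.- ι (2ℚ ℚ.* 2ℚ) R.* (k R.* (ι 1ℚ R.- k R.+ (R.- a R.* r R.+ k R.* (r R.* r))))
        D≈ e k r _ = R.+-cong (R.*-cong q₁ q₁) (R.-‿cong (R.*-congˡ (R.*-cong k
            (R.+-cong (R.trans e₁ (R.+-congˡ (R.-‿cong k))) (R.+-cong (R.*-congʳ (R.trans e₂ (R.-‿cong e))) (R.*-congʳ k))))))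
          where q₁ = R.+-cong (R.trans e₂ (R.-‿cong e)) (R.*-congʳ k)

        c≈′ : ∀ {a k} → ι c₀ R.≈ a → ι c₃ R.≈ k → ∀ t →
              c t R.≈ a R.+ ((ι 1ℚ R.- k) R.* t R.+ (R.- a R.* (t R.* t) R.+ k R.* (t R.* (t R.* t))))
        c≈′ e k t = R.trans (c≈ e t) (R.+-congˡ (R.+-cong (R.*-congʳ (R.+-congˡ (R.-‿cong k))) (R.+-congˡ (R.*-congʳ k))))

      -- c(r) = (1 − r)D(r)/3 + (r² + 2)/3.
      c₀≢2-1 : ι c₀ R.≈ ι 2ℚ → ι c₃ R.≈ ι 1ℚ → ⊥
      c₀≢2-1 e k = real-root λ (r , _ , u , cr≈0) →
        R.absurd (R.0<ₗ (+ 2 / 3)) (R.0≤ₗ (+ 1 / 3) *⁰ (u *⁰ R.≤-respʳ (D≈ e k r cr≈0) (Cofactor.0≤D 0<c₃ r cr≈0)) +⁰ R.0≤ₗ (+ 1 / 3) *⁰ R.0≤x² r)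
          (R.trans (solve 1 (λ r → con (+ 2 / 3) :+ (con (+ 1 / 3) :* ((con 1ℚ :- r) :* ((:- con 2ℚ :+ con 1ℚ :* r) :* (:- con 2ℚ :+ con 1ℚ :* r)
              :- con (2ℚ ℚ.* 2ℚ) :* (con 1ℚ :* (con 1ℚ :- con 1ℚ :+ (:- con 2ℚ :* r :+ con 1ℚ :* (r :* r))))))
              :+ con (+ 1 / 3) :* (r :* r))
            := con 2ℚ :+ ((con 1ℚ :- con 1ℚ) :* r :+ (:- con 2ℚ :* (r :* r) :+ con 1ℚ :* (r :* (r :* r))))) R.refl r)
            (R.trans (R.sym (c≈′ e k r)) cr≈0))

      -- The mirror image under t ↦ -t, which changes the sign of c₀: -c(r) = (1 + r)D(r)/3 + (r² +
      -- 2)/3.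
      c₀≢-2-1 : ι c₀ R.≈ ι -2ℚ → ι c₃ R.≈ ι 1ℚ → ⊥
      c₀≢-2-1 e k = real-root λ (r , l , _ , cr≈0) →
        R.absurd (R.0<ₗ (+ 2 / 3)) (R.0≤ₗ (+ 1 / 3) *⁰ (l *⁰ R.≤-respʳ (D≈ e k r cr≈0) (Cofactor.0≤D 0<c₃ r cr≈0)) +⁰ R.0≤ₗ (+ 1 / 3) *⁰ R.0≤x² r)
          (R.trans (solve 1 (λ r → con (+ 2 / 3) :+ (con (+ 1 / 3) :* ((r :+ con 1ℚ) :* ((:- con -2ℚ :+ con 1ℚ :* r) :* (:- con -2ℚ :+ con 1ℚ :* r)
              :- con (2ℚ ℚ.* 2ℚ) :* (con 1ℚ :* (con 1ℚ :- con 1ℚ :+ (:- con -2ℚ :* r :+ con 1ℚ :* (r :* r))))))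
              :+ con (+ 1 / 3) :* (r :* r))
            := :- (con -2ℚ :+ ((con 1ℚ :- con 1ℚ) :* r :+ (:- con -2ℚ :* (r :* r) :+ con 1ℚ :* (r :* (r :* r)))))) R.refl r)
            (R.trans (R.-‿cong (R.trans (R.sym (c≈′ e k r)) cr≈0)) (solve 0 (:- con 0ℚ := con 0ℚ) R.refl)))

      -- c(r) = (1 − r)D(r)/8 + (1 + r)(r − ½)²/2 + (r − ⅛)²/2 + 47/128.
      c₀≢2-2 : ι c₀ R.≈ ι 2ℚ → ι c₃ R.≈ ι 2ℚ → ⊥
      c₀≢2-2 e k = real-root λ (r , l , u , cr≈0) →
        R.absurd (R.0<ₗ (+ 47 / 128)) (R.0≤ₗ (+ 1 / 8) *⁰ (u *⁰ R.≤-respʳ (D≈ e k r cr≈0) (Cofactor.0≤D 0<c₃ r cr≈0))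
            +⁰ (R.0≤ₗ ½ *⁰ (l *⁰ R.0≤x² (r R.- ι ½)) +⁰ R.0≤ₗ ½ *⁰ R.0≤x² (r R.- ι (+ 1 / 8))))
          (R.trans (solve 1 (λ r → con (+ 47 / 128) :+ (con (+ 1 / 8) :* ((con 1ℚ :- r) :* ((:- con 2ℚ :+ con 2ℚ :* r) :* (:- con 2ℚ :+ con 2ℚ :* r)
              :- con (2ℚ ℚ.* 2ℚ) :* (con 2ℚ :* (con 1ℚ :- con 2ℚ :+ (:- con 2ℚ :* r :+ con 2ℚ :* (r :* r))))))
              :+ (con ½ :* ((r :+ con 1ℚ) :* ((r :- con ½) :* (r :- con ½))) :+ con ½ :* ((r :- con (+ 1 / 8)) :* (r :- con (+ 1 / 8)))))
            := con 2ℚ :+ ((con 1ℚ :- con 2ℚ) :* r :+ (:- con 2ℚ :* (r :* r) :+ con 2ℚ :* (r :* (r :* r))))) R.refl r)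
            (R.trans (R.sym (c≈′ e k r)) cr≈0))

      -- Again the mirror image: -c(r) = (1 + r)D(r)/8 + (1 - r)(r + ½)²/2 + (r + ⅛)²/2 + 47/128.
      c₀≢-2-2 : ι c₀ R.≈ ι -2ℚ → ι c₃ R.≈ ι 2ℚ → ⊥
      c₀≢-2-2 e k = real-root λ (r , l , u , cr≈0) →
        R.absurd (R.0<ₗ (+ 47 / 128)) (R.0≤ₗ (+ 1 / 8) *⁰ (l *⁰ R.≤-respʳ (D≈ e k r cr≈0) (Cofactor.0≤D 0<c₃ r cr≈0))
            +⁰ (R.0≤ₗ ½ *⁰ (u *⁰ R.0≤x² (r R.+ ι ½)) +⁰ R.0≤ₗ ½ *⁰ R.0≤x² (r R.+ ι (+ 1 / 8))))
          (R.trans (solve 1 (λ r → con (+ 47 / 128) :+ (con (+ 1 / 8) :* ((r :+ con 1ℚ) :* ((:- con -2ℚ :+ con 2ℚ :* r) :* (:- con -2ℚ :+ con 2ℚ :* r)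
              :- con (2ℚ ℚ.* 2ℚ) :* (con 2ℚ :* (con 1ℚ :- con 2ℚ :+ (:- con -2ℚ :* r :+ con 2ℚ :* (r :* r))))))
              :+ (con ½ :* ((con 1ℚ :- r) :* ((r :+ con ½) :* (r :+ con ½))) :+ con ½ :* ((r :+ con (+ 1 / 8)) :* (r :+ con (+ 1 / 8)))))
            := :- (con -2ℚ :+ ((con 1ℚ :- con 2ℚ) :* r :+ (:- con -2ℚ :* (r :* r) :+ con 2ℚ :* (r :* (r :* r)))))) R.refl r)
            (R.trans (R.-‿cong (R.trans (R.sym (c≈′ e k r)) cr≈0)) (solve 0 (:- con 0ℚ := con 0ℚ) R.refl)))

-- Nonreal zeros of the iterates of (2t² - 1)²

module NonrealZeros (F : RealField) (K : ComplexField F) where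

  private module R = OrderedField F
  open R using (0r; ι; _<_; _≤_; _*⁺_; _+⁰_; _*⁰_)
  open ComplexPlane F K
  open Continuity F K
  open import Data.Rational using (_/_)
  open R.Solver using (solve; _:=_; _:+_; _:*_; _:-_; :-_; con)
  private module C = Solver

  ≤-from-² : ∀ {x y} → 0r ≤ y → x R.* x ≤ y R.* y → x ≤ y
  ≤-from-² {x} {y} 0≤y h y<x = R.absurd (R.<⇒0<- y<x *⁺ R.<⇒0<- y<x) (R.≤⇒0≤- h +⁰ (R.0≤ₗ 2ℚ *⁰ (0≤y *⁰ R.<⇒≤ (R.<⇒0<- y<x))))
    (solve 2 (λ x y → (x :- y) :* (x :- y) :+ (y :* y :- x :* x :+ con 2ℚ :* (y :* (x :- y))) := con 0ℚ) R.refl x y)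

  module _ {P : Carrier → Carrier} (P-cong : Congruent P) {q : ℚ} (limit : RootLimit P q)
    (P≈ : ∀ t → P (t - κ 1ℚ) ≈ (κ 2ℚ * (t * t) - κ 1ℚ) * (κ 2ℚ * (t * t) - κ 1ℚ) - κ 1ℚ) where

    private
      In : R.Carrier → Set
      In v = ι ½ ≤ v × v ≤ ι 1ℚ

      f : R.Carrier → R.Carrier
      f t = (ι 2ℚ R.* (t R.* t) R.- ι 1ℚ) R.* (ι 2ℚ R.* (t R.* t) R.- ι 1ℚ)

      at : R.Carrier → Carrier
      at t = real t - κ 1ℚ

      at-cong : ∀ {s t} → s R.≈ t → at s ≈ at t
      at-cong e = +-congʳ (real-cong e)

      P-at : ∀ t → P (at t) ≈ at (f t)
      P-at t = trans (P≈ (real t)) (+-congʳ (sym (trans (real-* _ _) (*-cong g g))))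
        where
        g : real (ι 2ℚ R.* (t R.* t) R.- ι 1ℚ) ≈ κ 2ℚ * (real t * real t) - κ 1ℚ
        g = trans (real-+ _ _) (+-cong (trans (real-* _ _) (*-congˡ (real-* _ _))) (real-neg _))

      sqrt-In : ∀ x → 0r ≤ x R.- ι (+ 1 / 4) → 0r ≤ ι 1ℚ R.- x → ∃[ u ] (In u × u R.* u R.≈ x)
      sqrt-In x l h = u
        , ( ≤-from-² 0≤u (R.0≤-⇒≤ _ l (R.trans (R.+-congʳ u²) (solve 1 (λ x → x :- con ½ :* con ½ := x :- con (+ 1 / 4)) R.refl x)))
          , ≤-from-² (R.0≤ₗ 1ℚ) (R.0≤-⇒≤ _ h (R.trans (R.+-congˡ (R.-‿cong u²)) (solve 1 (λ x → con 1ℚ :* con 1ℚ :- x := con 1ℚ :- x) R.refl x))))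
        , u²
        where
        r = R.sqrt x (R.≤-respʳ (solve 1 (λ x → x :- con (+ 1 / 4) :+ con (+ 1 / 4) := x) R.refl x) (l +⁰ R.0≤ₗ (+ 1 / 4)))
        u = proj₁ r
        0≤u = proj₁ (proj₂ r)
        u² = proj₂ (proj₂ r)

      preimage : ∀ v → In v → ∃[ u ] (In u × f u R.≈ v)
      preimage v (l , h) = from-s (sqrt-In v
          (R.≤-respʳ (solve 1 (λ v → v :- con ½ :+ con (+ 1 / 4) := v :- con (+ 1 / 4)) R.refl v) (R.≤⇒0≤- l +⁰ R.0≤ₗ (+ 1 / 4)))
          (R.≤⇒0≤- h))
        where
        from-u : ∀ s → s R.* s R.≈ v → ∃[ u ] (In u × u R.* u R.≈ ι ½ R.* (s R.+ ι 1ℚ)) → ∃[ u ] (In u × f u R.≈ v)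
        from-u s s² (u , u∈ , u²) = u , u∈ , R.trans (R.*-cong 2u²-1 2u²-1) s²
          where
          2u²-1 : ι 2ℚ R.* (u R.* u) R.- ι 1ℚ R.≈ s
          2u²-1 = R.trans (R.+-congʳ (R.*-congˡ u²)) (solve 1 (λ s → con 2ℚ :* (con ½ :* (s :+ con 1ℚ)) :- con 1ℚ := s) R.refl s)
        from-s : ∃[ s ] (In s × s R.* s R.≈ v) → ∃[ u ] (In u × f u R.≈ v)
        from-s (s , (½≤s , s≤1) , s²) = from-u s s² (sqrt-In (ι ½ R.* (s R.+ ι 1ℚ))
          (R.≤-respʳ (solve 1 (λ s → con ½ :* (s :- con ½) :+ con ½ := con ½ :* (s :+ con 1ℚ) :- con (+ 1 / 4)) R.refl s) (R.0≤ₗ ½ *⁰ R.≤⇒0≤- ½≤s +⁰ R.0≤ₗ ½))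
          (R.≤-respʳ (solve 1 (λ s → con ½ :* (con 1ℚ :- s) := con 1ℚ :- con ½ :* (s :+ con 1ℚ)) R.refl s) (R.0≤ₗ ½ *⁰ R.≤⇒0≤- s≤1)))

      -- A zero of level m with coordinate in [½, 1]. The lower bound ½ keeps the nonreal preimages
      -- of its negative uniformly away from the real axis.
      Chain : ℕ → Set
      Chain m = ∃[ v ] (In v × Root P m (at v))

      chain-start : ∃[ v ] (In v × v R.* v R.≈ ι ½) → Chain 0
      chain-start (v , v∈ , v²) = v , v∈ , trans (P-at v) (trans (at-cong (R.trans (R.*-cong 2v²-1 2v²-1) (solve 0 (con 0ℚ :* con 0ℚ := con 0ℚ) R.refl)))
        (C.solve 0 (C.con 0ℚ C.:- C.con 1ℚ C.:= C.con (ℚ.- 1ℚ)) refl))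
        where
        2v²-1 : ι 2ℚ R.* (v R.* v) R.- ι 1ℚ R.≈ 0r
        2v²-1 = R.trans (R.+-congʳ (R.*-congˡ v²)) (solve 0 (con 2ℚ :* con ½ :- con 1ℚ := con 0ℚ) R.refl)

      chain-step : ∀ m v → Root P m (at v) → ∃[ u ] (In u × f u R.≈ v) → Chain (suc m)
      chain-step m v r (u , u∈ , fu≈v) = u , u∈ , Root-resp P-cong m (sym (trans (P-at u) (at-cong fu≈v))) r

      chain : ∀ m → Chain m
      chain zero = chain-start (sqrt-In (ι ½) (R.≤-respʳ (solve 0 (con (+ 1 / 4) := con ½ :- con (+ 1 / 4)) R.refl) (R.0≤ₗ (+ 1 / 4)))
                                              (R.≤-respʳ (solve 0 (con ½ := con 1ℚ :- con ½) R.refl) (R.0≤ₗ ½)))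
      chain (suc m) = extend (chain m)
        where
        extend : Chain m → Chain (suc m)
        extend (v , v∈ , r) = chain-step m v r (preimage v v∈)

      -- Since f is even. The negative values obtained this way have no real preimage under the
      -- square f.
      Root-neg : ∀ m v → Root P m (at v) → Root P m (at (R.- v))
      Root-neg m v = flip m
        where
        even : P (at v) ≈ P (at (R.- v))
        even = trans (P-at v) (trans (at-cong (solve 1 (λ v → (con 2ℚ :* (v :* v) :- con 1ℚ) :* (con 2ℚ :* (v :* v) :- con 1ℚ)
          := (con 2ℚ :* (:- v :* :- v) :- con 1ℚ) :* (con 2ℚ :* (:- v :* :- v) :- con 1ℚ)) R.refl v)) (sym (P-at (R.- v))))
        flip : ∀ m → Root P m (at v) → Root P m (at (R.- v))
        flip zero    r = trans (sym even) r
        flip (suc m) r = Root-resp P-cong m even r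

      -- w = a + bi with a² − b² = ½ and (4ab)² = v satisfies (2w² − 1)² = −v.
      nonreal : ∀ v → In v → ∃[ w ] (P w ≈ at (R.- v) × ι (+ 1 / 20) ≤ im w R.* im w)
      nonreal v (l , h) = w - κ 1ℚ , Pw≈ , R.≤-respʳ (R.*-cong im≈ im≈) b-big
        where
        -- N is a² + b²: from (a² - b²)² + (2ab)² = N² with a² - b² = ½ and (4ab)² = v one gets N² =
        -- (v + 1)/4.
        N′ = sqrt-In (ι (+ 1 / 4) R.* (v R.+ ι 1ℚ))
          (R.≤-respʳ (solve 1 (λ v → con (+ 1 / 4) :* (v :- con ½) :+ con (+ 1 / 8) := con (+ 1 / 4) :* (v :+ con 1ℚ) :- con (+ 1 / 4)) R.refl v)
            (R.0≤ₗ (+ 1 / 4) *⁰ R.≤⇒0≤- l +⁰ R.0≤ₗ (+ 1 / 8)))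
          (R.≤-respʳ (solve 1 (λ v → con (+ 1 / 4) :* (con 1ℚ :- v) :+ con ½ := con 1ℚ :- con (+ 1 / 4) :* (v :+ con 1ℚ)) R.refl v)
            (R.0≤ₗ (+ 1 / 4) *⁰ R.≤⇒0≤- h +⁰ R.0≤ₗ ½))
        N = proj₁ N′
        N² = proj₂ (proj₂ N′)
        ½≤N = proj₁ (proj₁ (proj₂ N′))
        a′ = R.sqrt (ι ½ R.* (N R.- ι ½ R.+ ι 1ℚ)) (R.0≤ₗ ½ *⁰ (R.≤⇒0≤- ½≤N +⁰ R.0≤ₗ 1ℚ))
        b′ = R.sqrt (ι ½ R.* (N R.- ι ½)) (R.0≤ₗ ½ *⁰ R.≤⇒0≤- ½≤N)
        a = proj₁ a′
        b = proj₁ b′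
        a² = proj₂ (proj₂ a′)
        b² = proj₂ (proj₂ b′)
        w : Carrier
        w = a +i b
        u = κ 2ℚ * (w * w) - κ 1ℚ
        re-u : re u R.≈ 0r
        re-u = R.trans (re-+ _ _) (R.trans (R.+-cong (R.trans (re-κ* 2ℚ (w * w)) (R.*-congˡ (R.trans (re-* w w)
            (R.+-cong (R.trans (R.*-cong (re-+i a b) (re-+i a b)) a²) (R.-‿cong (R.trans (R.*-cong (im-+i a b) (im-+i a b)) b²))))))
            (R.trans (re-neg _) (R.-‿cong (re-real _))))
          (solve 1 (λ N → con 2ℚ :* (con ½ :* (N :- con ½ :+ con 1ℚ) :- con ½ :* (N :- con ½)) :- con 1ℚ := con 0ℚ) R.refl N))
        im-u : im u R.≈ ι (+ 4 / 1) R.* (a R.* b)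
        im-u = R.trans (im-+ _ _) (R.trans (R.+-cong (R.trans (im-κ* 2ℚ (w * w)) (R.*-congˡ (R.trans (im-* w w)
            (R.+-cong (R.*-cong (re-+i a b) (im-+i a b)) (R.*-cong (im-+i a b) (re-+i a b))))))
            (R.trans (im-neg _) (R.-‿cong (im-real _))))
          (solve 2 (λ a b → con 2ℚ :* (a :* b :+ b :* a) :- con 0ℚ := con (+ 4 / 1) :* (a :* b)) R.refl a b))
        im-u² : im u R.* im u R.≈ v
        im-u² = R.trans (R.*-cong im-u im-u) (R.trans (solve 2 (λ a b → con (+ 4 / 1) :* (a :* b) :* (con (+ 4 / 1) :* (a :* b))
              := con (+ 16 / 1) :* ((a :* a) :* (b :* b))) R.refl a b)
          (R.trans (R.*-congˡ (R.*-cong a² b²)) (R.trans (solve 1 (λ N → con (+ 16 / 1) :* ((con ½ :* (N :- con ½ :+ con 1ℚ)) :* (con ½ :* (N :- con ½)))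
              := con (+ 4 / 1) :* (N :* N) :- con 1ℚ) R.refl N)
            (R.trans (R.+-congʳ (R.*-congˡ N²)) (solve 1 (λ v → con (+ 4 / 1) :* (con (+ 1 / 4) :* (v :+ con 1ℚ)) :- con 1ℚ := v) R.refl v)))))
        u² : u * u ≈ real (R.- v)
        u² = ext
          (R.trans (re-* u u) (R.trans (R.+-cong (R.*-cong re-u re-u) (R.-‿cong im-u²))
            (R.trans (solve 1 (λ v → con 0ℚ :* con 0ℚ :- v := :- v) R.refl v) (R.sym (re-real _)))))
          (R.trans (im-* u u) (R.trans (R.+-cong (R.*-congʳ re-u) (R.*-congˡ re-u))
            (R.trans (solve 1 (λ y → con 0ℚ :* y :+ y :* con 0ℚ := con 0ℚ) R.refl (im u)) (R.sym (im-real _)))))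
        Pw≈ : P (w - κ 1ℚ) ≈ at (R.- v)
        Pw≈ = trans (P≈ w) (+-congʳ u²)
        im≈ : b R.≈ im (w - κ 1ℚ)
        im≈ = R.sym (R.trans (im-+ _ _) (R.trans (R.+-cong (im-+i a b) (R.trans (im-neg _) (R.-‿cong (im-real _)))) (solve 1 (λ b → b :- con 0ℚ := b) R.refl b)))
        -- N² ≥ 3/8 > 9/25 because v ≥ ½; then b² = (N - ½)/2 ≥ 1/20.
        3/5≤N : ι (+ 3 / 5) ≤ N
        3/5≤N = ≤-from-² (R.≤-trans (R.0≤ₗ ½) ½≤N) (R.0≤-⇒≤ _ (R.0≤ₗ (+ 1 / 4) *⁰ R.≤⇒0≤- l +⁰ R.0≤ₗ (+ 3 / 200))
          (R.trans (R.+-congʳ N²) (solve 1 (λ v → con (+ 1 / 4) :* (v :+ con 1ℚ) :- con (+ 3 / 5) :* con (+ 3 / 5)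
            := con (+ 1 / 4) :* (v :- con ½) :+ con (+ 3 / 200)) R.refl v)))
        b-big : ι (+ 1 / 20) ≤ b R.* b
        b-big = R.0≤-⇒≤ _ (R.0≤ₗ ½ *⁰ R.≤⇒0≤- 3/5≤N) (R.trans (R.+-congʳ b²)
          (solve 1 (λ N → con ½ :* (N :- con ½) :- con (+ 1 / 20) := con ½ :* (N :- con (+ 3 / 5))) R.refl N))

    limit-nonreal : ⊥
    -- The tolerance satisfies (1/5)² = 1/25 < 1/20, so no real point is that close to the nonreal
    -- zeros.
    limit-nonreal = at-stage (limit (+ 1 / 5) (Rat.0<ₗ _))
      where
      far : ∀ w → ι (+ 1 / 20) R.≤ im w R.* im w → ∃[ x ] (x ∈[ q ,0] × ∣ w - x ∣² R.< ι ((+ 1 / 5) ℚ.* (+ 1 / 5))) → ⊥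
      far w big (x , (_ , _ , im≈0) , w~x) = R.absurd (R.<⇒0<- w~x) (R.0≤x² (re (w - x)) +⁰ (R.≤⇒0≤- big +⁰ R.0≤ₗ (+ 1 / 100)))
        (R.trans (R.+-cong (R.+-cong (R.ι-* (+ 1 / 5) (+ 1 / 5)) (R.-‿cong (R.+-congˡ (R.*-cong im≈ im≈)))) R.refl)
          (solve 2 (λ a b → con (+ 1 / 5) :* con (+ 1 / 5) :- (a :* a :+ b :* b) :+ (a :* a :+ (b :* b :- con (+ 1 / 20) :+ con (+ 1 / 100))) := con 0ℚ) R.refl (re (w - x)) (im w)))
        where
        im≈ : im (w - x) R.≈ im w
        im≈ = R.trans (im-+ w (- x)) (R.trans (R.+-congˡ (R.trans (im-neg x) (R.-‿cong im≈0))) (solve 1 (λ y → y :- con 0ℚ := y) R.refl (im w)))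
      at-stage : ∃[ M ] (∀ m → m ℕ.≥ M → (∀ z → Root P m z → ∃[ w ] (w ∈[ q ,0] × ∣ z - w ∣² R.< ι ((+ 1 / 5) ℚ.* (+ 1 / 5)))) × _) → ⊥
      at-stage (M , h) = from-chain (chain M)
        where
        from-nonreal : ∀ v → Root P M (at v) → ∃[ w ] (P w ≈ at (R.- v) × ι (+ 1 / 20) R.≤ im w R.* im w) → ⊥
        from-nonreal v r (w , Pw≈ , big) = far w big (proj₁ (h (suc M) (ℕ.n≤1+n M)) w (Root-resp P-cong M (sym Pw≈) (Root-neg M v r)))
        from-chain : Chain M → ⊥
        from-chain (v , v∈ , r) = from-nonreal v r (nonreal v v∈)

-- Separations of a disconnected graph and the factorisation of I_G

module SeparatedGraph where

  open import Defs hiding (_≈_)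
  open Blocks
  open IndependenceNumber
  open import Data.Bool using (true)
  open import Data.Nat using (_≤_; _<_; s≤s)
  open import Data.Fin using (Fin; zero; suc)
  open import Data.Fin.Subset as Subset using (Subset; inside; outside; ∣_∣; ∁; _∩_; ⁅_⁆) renaming (_∈_ to _∈ˢ_; _∉_ to _∉ˢ_)
  import Data.Fin.Subset.Properties as Subset
  open import Data.List as List using (List; []; _∷_; filter; length)
  open import Data.List.Membership.Propositional using (_∈_)
  open import Data.List.Membership.Propositional.Properties using (∈-filter⁺; ∈-filter⁻; ∈-map⁺; ∈-map⁻; ∈-++⁺ˡ; ∈-++⁺ʳ; ∈-++⁻; ∈-length)
  open import Data.List.Relation.Unary.All as All using (All)
  open import Data.List.Relation.Unary.Any using (here; there)
  open import Data.Vec as Vec using (Vec; []; _∷_; tabulate)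
  import Data.Vec.Properties as Vec
  open import Relation.Binary.Construct.Closure.ReflexiveTransitive using (Star; ε; _◅_; _◅◅_)
  open import Relation.Binary.PropositionalEquality
  open import Relation.Nullary using (does)
  open import Relation.Nullary.Decidable using (dec-true; ¬¬-excluded-middle)
  open import Function using (_∘_)

  -- Double negation shift, which holds over a finite index set.
  ¬¬-∀ : ∀ n {P : Fin n → Set} → (∀ i → ¬ ¬ P i) → ¬ ¬ (∀ i → P i)
  ¬¬-∀ zero    h k = k λ ()
  ¬¬-∀ (suc n) h k = h zero λ p₀ → ¬¬-∀ n (h ∘ suc) λ ps → k λ { zero → p₀ ; (suc i) → ps i }

  record Separation (G : Graph) : Set where
    field
      A      : Subset (order G)
      u v    : Fin (order G)
      u∈     : u ∈ˢ A
      v∈     : v ∈ˢ ∁ A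
      closed : ∀ x y → Adj G x y → x ∈ˢ A → y ∈ˢ A

  -- `Disconnected` only denies that all pairs are joined. If no separation existed, every pair u, v
  -- would be joined: otherwise the vertices reachable from u, a subset once reachability is decided
  -- under double negation, would separate u from v.
  separation : ∀ G → Disconnected G → ¬ ¬ Separation G
  separation G disconnected none = ¬¬-∀ n (λ u → ¬¬-∀ n (connected u)) disconnected
    where
    n = order G
    connected : ∀ u v → ¬ ¬ Star (Adj G) u v
    connected u v ¬uv = ¬¬-∀ n (λ x → ¬¬-excluded-middle {A = Star (Adj G) u x}) λ dec →
      let A : Subset n
          A = tabulate (λ x → does (dec x))
          ∈⁺ : ∀ {x} → Star (Adj G) u x → x ∈ˢ A
          ∈⁺ {x} s = lookup⇒∈ (trans (Vec.lookup∘tabulate _ x) (dec-true (dec x) s))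
          ∈⁻ : ∀ {x} → x ∈ˢ A → Star (Adj G) u x
          ∈⁻ {x} x∈ = reached (dec x) (trans (sym (Vec.lookup∘tabulate _ x)) (∈⇒lookup x∈))
      in none record
        { A = A ; u = u ; v = v ; u∈ = ∈⁺ ε
        ; v∈ = Subset.x∉p⇒x∈∁p (λ v∈ → ¬uv (∈⁻ v∈))
        ; closed = λ x y a x∈ → ∈⁺ (∈⁻ x∈ ◅◅ a ◅ ε) }
      where
      reached : ∀ {P : Set} (d : Dec P) → does d ≡ true → P
      reached (yes p) _ = p

  subsets≡subsetsOf-⊤ : ∀ n → subsets n ≡ subsetsOf {n} Subset.⊤
  subsets≡subsetsOf-⊤ zero    = refl
  subsets≡subsetsOf-⊤ (suc n) rewrite subsets≡subsetsOf-⊤ n = refl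

  ∩-size : ∀ {n} (A S : Subset n) → ∣ S ∣ ≡ ∣ S ∩ A ∣ ℕ.+ ∣ S ∩ ∁ A ∣
  ∩-size []            []            = refl
  ∩-size (outside ∷ A) (outside ∷ S) = ∩-size A S
  ∩-size (outside ∷ A) (inside ∷ S)  = trans (cong suc (∩-size A S)) (sym (ℕ.+-suc _ _))
  ∩-size (inside ∷ A)  (outside ∷ S) = ∩-size A S
  ∩-size (inside ∷ A)  (inside ∷ S)  = cong suc (∩-size A S)

  ∈subsetsOf⇒∩ : ∀ {n} (A : Subset n) {S} → S ∈ subsetsOf A → S ∩ A ≡ S
  ∈subsetsOf⇒∩ []            {[]} _ = refl
  ∈subsetsOf⇒∩ (outside ∷ A) S∈ with ∈-map⁻ (outside ∷_) S∈
  ... | T , T∈ , refl = cong (outside ∷_) (∈subsetsOf⇒∩ A T∈)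
  ∈subsetsOf⇒∩ (inside ∷ A) S∈ with ∈-++⁻ (List.map (outside ∷_) (subsetsOf A)) S∈
  ... | inj₁ h with T , T∈ , refl ← ∈-map⁻ (outside ∷_) h = cong (outside ∷_) (∈subsetsOf⇒∩ A T∈)
  ... | inj₂ h with T , T∈ , refl ← ∈-map⁻ (inside ∷_) h  = cong (inside ∷_) (∈subsetsOf⇒∩ A T∈)

  ∩∈subsetsOf : ∀ {n} (A S : Subset n) → S ∩ A ∈ subsetsOf A
  ∩∈subsetsOf []            []            = here refl
  ∩∈subsetsOf (outside ∷ A) (outside ∷ S) = ∈-map⁺ (outside ∷_) (∩∈subsetsOf A S)
  ∩∈subsetsOf (outside ∷ A) (inside ∷ S)  = ∈-map⁺ (outside ∷_) (∩∈subsetsOf A S)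
  ∩∈subsetsOf (inside ∷ A)  (outside ∷ S) = ∈-++⁺ˡ (∈-map⁺ (outside ∷_) (∩∈subsetsOf A S))
  ∩∈subsetsOf (inside ∷ A)  (inside ∷ S)  = ∈-++⁺ʳ _ (∈-map⁺ (inside ∷_) (∩∈subsetsOf A S))

  merge : ∀ {n} → Subset n → Subset n → Subset n → Subset n
  merge []            []      []      = []
  merge (outside ∷ A) (_ ∷ S) (t ∷ T) = t ∷ merge A S T
  merge (inside ∷ A)  (s ∷ S) (_ ∷ T) = s ∷ merge A S T

  merge-∩ : ∀ {n} (A S T : Subset n) → merge A S T ∩ A ≡ S ∩ A
  merge-∩ []            []            []            = refl
  merge-∩ (outside ∷ A) (outside ∷ S) (outside ∷ T) = cong (outside ∷_) (merge-∩ A S T)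
  merge-∩ (outside ∷ A) (outside ∷ S) (inside ∷ T)  = cong (outside ∷_) (merge-∩ A S T)
  merge-∩ (outside ∷ A) (inside ∷ S)  (outside ∷ T) = cong (outside ∷_) (merge-∩ A S T)
  merge-∩ (outside ∷ A) (inside ∷ S)  (inside ∷ T)  = cong (outside ∷_) (merge-∩ A S T)
  merge-∩ (inside ∷ A)  (s ∷ S)       (_ ∷ T)       = cong (_ ∷_) (merge-∩ A S T)

  merge-∩-∁ : ∀ {n} (A S T : Subset n) → merge A S T ∩ ∁ A ≡ T ∩ ∁ A
  merge-∩-∁ []            []            []            = refl
  merge-∩-∁ (outside ∷ A) (s ∷ S)       (t ∷ T)       = cong (_ ∷_) (merge-∩-∁ A S T)
  merge-∩-∁ (inside ∷ A)  (outside ∷ S) (outside ∷ T) = cong (outside ∷_) (merge-∩-∁ A S T)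
  merge-∩-∁ (inside ∷ A)  (outside ∷ S) (inside ∷ T)  = cong (outside ∷_) (merge-∩-∁ A S T)
  merge-∩-∁ (inside ∷ A)  (inside ∷ S)  (outside ∷ T) = cong (outside ∷_) (merge-∩-∁ A S T)
  merge-∩-∁ (inside ∷ A)  (inside ∷ S)  (inside ∷ T)  = cong (outside ∷_) (merge-∩-∁ A S T)

  module Parts {G : Graph} (sep : Separation G) where

    open Separation sep public

    B : Subset (order G)
    B = ∁ A

    Independent-∩ : ∀ {S} C → Independent G S → Independent G (S ∩ C)
    Independent-∩ {S} C ind x y x∈ y∈ = ind x y (Subset.p∩q⊆p S C x∈) (Subset.p∩q⊆p S C y∈)

    Independent-parts : ∀ {S} → Independent G (S ∩ A) → Independent G (S ∩ B) → Independent G S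
    Independent-parts {S} indA indB x y x∈ y∈ adj with x Subset.∈? A | y Subset.∈? A
    ... | yes x∈A | yes y∈A = indA x y (Subset.x∈p∩q⁺ (x∈ , x∈A)) (Subset.x∈p∩q⁺ (y∈ , y∈A)) adj
    ... | yes x∈A | no y∉A  = y∉A (closed x y adj x∈A)
    ... | no x∉A  | yes y∈A = x∉A (closed y x (symm G adj) y∈A)
    ... | no x∉A  | no y∉A  = indB x y (Subset.x∈p∩q⁺ (x∈ , Subset.x∉p⇒x∈∁p x∉A)) (Subset.x∈p∩q⁺ (y∈ , Subset.x∉p⇒x∈∁p y∉A)) adj

    independentIn : Subset (order G) → List (Subset (order G))
    independentIn C = filter (independent? G) (subsetsOf C)

    count : Subset (order G) → ℕ → ℕ
    count C i = length (filter (λ S → ∣ S ∣ ℕ.≟ i) (independentIn C))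

    -- Each side of a separation has a vertex, so neither factor of I_G is the constant 1.
    count-singleton : ∀ C x → x ∈ˢ C → 1 ≤ count C 1
    count-singleton C x x∈ = ∈-length (∈-filter⁺ (λ S → ∣ S ∣ ℕ.≟ 1) {x = ⁅ x ⁆}
        (∈-filter⁺ (independent? G) (subst (_∈ subsetsOf C) ∩≡ (∩∈subsetsOf C ⁅ x ⁆)) single) (Subset.∣⁅x⁆∣≡1 x))
      where
      single : Independent G ⁅ x ⁆
      single y z y∈ z∈ adj = irrefl G (trans (Subset.x∈⁅y⁆⇒x≡y x y∈) (sym (Subset.x∈⁅y⁆⇒x≡y x z∈))) adj
      ∩≡ : ⁅ x ⁆ ∩ C ≡ ⁅ x ⁆
      ∩≡ = Subset.⊆-antisym (Subset.p∩q⊆p _ C) (λ {y} y∈ → Subset.x∈p∩q⁺ (y∈ , subst (_∈ˢ C) (sym (Subset.x∈⁅y⁆⇒x≡y x y∈)) x∈))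

    -- No edge crosses the separation, so independent sets of the two sides unite to an independent
    -- set of G.
    sizes : ∀ {S T} → S ∈ independentIn A → T ∈ independentIn B → ∣ S ∣ ℕ.+ ∣ T ∣ ≤ independenceNumber G
    sizes {S} {T} S∈ T∈ =
      let S∈A , indS = ∈-filter⁻ (independent? G) {xs = subsetsOf A} S∈
          T∈B , indT = ∈-filter⁻ (independent? G) {xs = subsetsOf B} T∈
          eqA = trans (merge-∩ A S T) (∈subsetsOf⇒∩ A S∈A)
          eqB = trans (merge-∩-∁ A S T) (∈subsetsOf⇒∩ B T∈B)
      in subst (_≤ independenceNumber G) (trans (∩-size A (merge A S T)) (cong₂ (λ p q → ∣ p ∣ ℕ.+ ∣ q ∣) eqA eqB))
           (∣∣≤α G (merge A S T) (Independent-parts (subst (Independent G) (sym eqA) indS) (subst (Independent G) (sym eqB) indT)))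

    Bounded : Subset (order G) → ℕ → Set
    Bounded C k = All (λ S → ∣ S ∣ < suc k) (independentIn C)

    bounded-or : ∀ C k → Bounded C k ⊎ (∃[ S ] (S ∈ independentIn C × k < ∣ S ∣))
    bounded-or C k with All.all? (λ S → ∣ S ∣ ℕ.<? suc k) (independentIn C)
    ... | yes b = inj₁ b
    ... | no ¬b = inj₂ (find (independentIn C) ¬b)
      where
      find : ∀ L → ¬ All (λ S → ∣ S ∣ < suc k) L → ∃[ S ] (S ∈ L × k < ∣ S ∣)
      find []      ¬b = ⊥-elim (¬b All.[])
      find (S ∷ L) ¬b with ∣ S ∣ ℕ.<? suc k
      ... | no ¬lt = S , here refl , ℕ.≮⇒≥ ¬lt
      ... | yes lt = let T , T∈ , h = find L (λ b → ¬b (lt All.∷ b)) in T , there T∈ , h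

    -- An independent set with three elements on one side leaves room for a single element on the other.
    shapes : independenceNumber G ≡ 4 → Bounded A 1 ⊎ Bounded B 1 ⊎ (Bounded A 2 × Bounded B 2)
    shapes α≡4 with bounded-or A 2 | bounded-or B 2
    ... | inj₁ bA | inj₁ bB = inj₂ (inj₂ (bA , bB))
    ... | inj₂ (S , S∈ , 2<S) | _ = inj₂ (inj₁ (All.tabulate λ {T} T∈ → s≤s (ℕ.+-cancelˡ-≤ 3 _ _
            (ℕ.≤-trans (ℕ.+-monoˡ-≤ ∣ T ∣ 2<S) (ℕ.≤-trans (sizes S∈ T∈) (ℕ.≤-reflexive α≡4))))))
    ... | inj₁ _ | inj₂ (T , T∈ , 2<T) = inj₁ (All.tabulate λ {S} S∈ → s≤s (ℕ.+-cancelʳ-≤ 3 _ _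
            (ℕ.≤-trans (ℕ.+-monoʳ-≤ ∣ S ∣ 2<T) (ℕ.≤-trans (sizes S∈ T∈) (ℕ.≤-reflexive α≡4)))))

  top-coefficient : ∀ G → 1 ≤ coefficient G (independenceNumber G)
  top-coefficient G = let S , ind , ∣S∣≡ = maximum G in
    ∈-length (∈-filter⁺ (λ S → ∣ S ∣ ℕ.≟ independenceNumber G) (∈independentSets G S ind) ∣S∣≡)

module Factorisation (R : CommutativeRing 0ℓ 0ℓ) where

  open import Defs hiding (_≈_)
  open Blocks
  open SeparatedGraph
  open SubsetSums R
  open IndependencePolynomial R
  open CommutativeRing R hiding (zero)
  open import Relation.Binary.Reasoning.Setoid setoid
  open import Data.Nat using (s≤s)
  open import Data.Fin.Subset as Subset using (Subset; ∣_∣; _∩_)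
  import Data.Fin.Subset.Properties as Subset
  open import Data.List using (List; filter)
  open import Data.List.Relation.Unary.All as All using (All)
  open import Function using (_∘_)

  module Counting (G : Graph) (C : Subset (order G)) where

    independentIn : List (Subset (order G))
    independentIn = filter (independent? G) (subsetsOf C)

    count : ℕ → ℕ
    count = countOf ∣_∣ independentIn

    Σ⊆-counts : ∀ N z → All (λ S → ∣ S ∣ ℕ.< N) independentIn → Σᵢ N (λ i → emb (count i) * pow z i) ≈ Σ⊆ C (weight G z)
    Σ⊆-counts N z bounded = trans (Σˡ-bySize ∣_∣ N z independentIn bounded)
      (trans (Σˡ-filter _ (independent? G) (subsetsOf C)) (Σ⊆-subsetsOf C _))

    pow-0 : ∀ i → pow 0# (suc i) ≈ 0#
    pow-0 i = zeroˡ _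

    -- Evaluation at z = 0, where only the empty set has nonzero weight.
    count-0 : emb (count 0) ≈ 1#
    count-0 = begin
      emb (count 0)                                        ≈⟨ sym (trans (+-cong (*-identityʳ _) (Σᵢ-0 (order G) _ (λ i → trans (*-congˡ (pow-0 i)) (zeroʳ _)))) (+-identityʳ _)) ⟩
      Σᵢ (suc (order G)) (λ i → emb (count i) * pow 0# i)  ≈⟨ Σ⊆-counts _ 0# (All.universal (λ S → s≤s (Subset.∣p∣≤n S)) _) ⟩
      Σ⊆ C (weight G 0#)                                   ≈⟨ Σ⊆-∅ C _ vanish ⟩
      weight G 0# Subset.⊥                                 ≈⟨ weight-⊥ G G 0# ⟩
      1# ∎
      where
      vanish : ∀ S → ∣ S ∣ ≡.≢ 0 → weight G 0# S ≈ 0#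
      vanish S ∣S∣≢0 with ∣ S ∣
      ... | zero  = ⊥-elim (∣S∣≢0 ≡.refl)
      ... | suc i = when-0 (independent? G S)
        where
        when-0 : ∀ {A : Set} (d : Dec A) → when d (pow 0# (suc i)) ≈ 0#
        when-0 (yes _) = pow-0 i
        when-0 (no _)  = refl

    linear : All (λ S → ∣ S ∣ ℕ.< 2) independentIn → ∀ z → Σ⊆ C (weight G z) ≈ 1# + emb (count 1) * z
    linear b z = trans (sym (Σ⊆-counts 2 z b))
      (+-cong (trans (*-identityʳ _) count-0) (trans (+-identityʳ _) (*-congˡ (*-identityʳ z))))

    quadratic : All (λ S → ∣ S ∣ ℕ.< 3) independentIn → ∀ z →
                Σ⊆ C (weight G z) ≈ 1# + (emb (count 1) * z + emb (count 2) * (z * z))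
    quadratic b z = trans (sym (Σ⊆-counts 3 z b))
      (+-cong (trans (*-identityʳ _) count-0) (+-cong (*-congˡ (*-identityʳ z)) (trans (+-identityʳ _) (*-congˡ (*-congˡ (*-identityʳ z))))))

  coefficient-0 : ∀ G → emb (coefficient G 0) ≈ 1#
  coefficient-0 G = trans (reflexive (≡.cong (λ L → emb (countOf ∣_∣ (filter (independent? G) L) 0)) (subsets≡subsetsOf-⊤ (order G))))
    (Counting.count-0 G Subset.⊤)

  module Factor {G : Graph} (sep : Separation G) where

    open Parts sep hiding (count; independentIn)

    weight-parts : ∀ z S → weight G z S ≈ weight G z (S ∩ A) * weight G z (S ∩ B)
    weight-parts z S = by-cases (independent? G (S ∩ A)) (independent? G (S ∩ B))
      where
      S? = independent? G S
      A? = independent? G (S ∩ A)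
      B? = independent? G (S ∩ B)
      by-cases : Dec (Independent G (S ∩ A)) → Dec (Independent G (S ∩ B)) →
                 weight G z S ≈ weight G z (S ∩ A) * weight G z (S ∩ B)
      by-cases (yes a) (yes b) = trans (when-yes S? (Independent-parts a b))
        (trans (reflexive (≡.cong (pow z) (∩-size A S))) (trans (pow-+ z ∣ S ∩ A ∣ ∣ S ∩ B ∣) (sym (*-cong (when-yes A? a) (when-yes B? b)))))
      by-cases (no ¬a) _ = trans (when-no S? (¬a ∘ Independent-∩ {S} A)) (sym (trans (*-congʳ (when-no A? ¬a)) (zeroˡ _)))
      by-cases _ (no ¬b) = trans (when-no S? (¬b ∘ Independent-∩ {S} B)) (sym (trans (*-congˡ (when-no B? ¬b)) (zeroʳ _)))

    poly-parts : ∀ z → poly G z ≈ Σ⊆ A (weight G z) * Σ⊆ B (weight G z)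
    poly-parts z = trans (Σₙ-cong (order G) (weight-parts z)) (Σₙ-∩-∁ A _ _)

-- Integer constraints on the quartic and on its factors

module IntegerQuartics where

  open import Data.Integer as ℤ hiding (suc; _≤?_)
  open import Data.Integer.Solver using (module +-*-Solver)
  open import Relation.Binary.PropositionalEquality
  open +-*-Solver

  infixr 6 _⊕_
  infixr 7 _⊗_

  _⊕_ : ∀ {x y} → 0ℤ ≤ x → 0ℤ ≤ y → 0ℤ ≤ x + y
  _⊕_ = ℤ.+-mono-≤

  _⊗_ : ∀ n {x} → 0ℤ ≤ x → 0ℤ ≤ + n * x
  n ⊗ (+≤+ {n = m} _) = subst (0ℤ ≤_) (ℤ.pos-* n m) (+≤+ ℕ.z≤n)

  0≤+ : ∀ n → 0ℤ ≤ + n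
  0≤+ n = +≤+ ℕ.z≤n

  absurd : ∀ {x} n → 0ℤ ≤ x → x ≡ -[1+ n ] → ⊥
  absurd n h refl with () ← h

  0≤-cancel : ∀ n x → 0ℤ ≤ + suc n * x → 0ℤ ≤ x
  0≤-cancel n x h = ℤ.*-cancelˡ-≤-pos 0ℤ x (+ suc n) (subst (_≤ + suc n * x) (sym (ℤ.*-zeroʳ (+ suc n))) h)

  natural : ∀ {x} → 0ℤ ≤ x → ∃[ n ] x ≡ + n
  natural (+≤+ {n = n} _) = n , refl

  unit : ∀ {x} → ∣ x ∣ ≡ 1 → x ≡ 1ℤ ⊎ x ≡ -1ℤ
  unit {+ _}       e = inj₁ (cong +_ e)
  unit { -[1+ n ]} e = inj₂ (cong -[1+_] (ℕ.suc-injective e))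

  unit-factor : ∀ x y → ∣ x * y ∣ ≡ 1 → x ≡ 1ℤ ⊎ x ≡ -1ℤ
  unit-factor x y e = unit (ℕ.m*n≡1⇒m≡1 ∣ x ∣ ∣ y ∣ (trans (sym (ℤ.abs-* x y)) e))

  below : ∀ n k m {x y} → k ℕ.< n ℕ.* m → 0ℤ ≤ x → 0ℤ ≤ y → + n * x + y ≡ + k → ∃[ i ] (i ℕ.< m × x ≡ + i)
  below n k m {x} {y} k<nm 0≤x 0≤y e =
    let i , x≡ = natural 0≤x
        l , y≡ = natural 0≤y
        eq : n ℕ.* i ℕ.+ l ≡ k
        eq = ℤ.+-injective (trans (ℤ.pos-+ (n ℕ.* i) l) (trans (cong (_+ + l) (ℤ.pos-* n i))
          (trans (cong₂ (λ x y → + n * x + y) (sym x≡) (sym y≡)) e)))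
    in i , ℕ.*-cancelˡ-< n i m (ℕ.≤-<-trans (subst (n ℕ.* i ℕ.≤_) eq (ℕ.m≤m+n _ l)) k<nm) , x≡

  small : ∀ n k {x y} → k ℕ.< n → 0ℤ ≤ x → 0ℤ ≤ y → + n * x + y ≡ + k → x ≡ 0ℤ
  small n k k<n 0≤x 0≤y e with below n k 1 (subst (k ℕ.<_) (sym (ℕ.*-identityʳ n)) k<n) 0≤x 0≤y e
  ... | 0 , _ , x≡0 = x≡0
  ... | suc _ , ℕ.s≤s () , _

  q : ℤ → ℤ → ℤ → ℤ
  q b₁ b₂ z = 1ℤ + (b₁ * z + b₂ * (z * z))

  Unit : ℤ → Set
  Unit x = x ≡ 1ℤ ⊎ x ≡ -1ℤ

  private
    b₁-from : ∀ b₁ b₂ → + 4 * (b₁ - 1ℤ) ≡ -1ℤ - (+ 4) * q b₁ b₂ (- (+ 2)) + q b₁ b₂ (- (+ 4))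
    b₁-from = solve 2 (λ a b → con (+ 4) :* (a :- con 1ℤ) := con -1ℤ :- con (+ 4) :* (con 1ℤ :+ (a :* con (- (+ 2)) :+ b :* (con (- (+ 2)) :* con (- (+ 2)))))
      :+ (con 1ℤ :+ (a :* con (- (+ 4)) :+ b :* (con (- (+ 4)) :* con (- (+ 4)))))) refl

    b₂-from : ∀ b₁ b₂ → + 8 * b₂ + 0ℤ ≡ 1ℤ - (+ 2) * q b₁ b₂ (- (+ 2)) + q b₁ b₂ (- (+ 4))
    b₂-from = solve 2 (λ a b → con (+ 8) :* b :+ con 0ℤ := con 1ℤ :- con (+ 2) :* (con 1ℤ :+ (a :* con (- (+ 2)) :+ b :* (con (- (+ 2)) :* con (- (+ 2)))))
      :+ (con 1ℤ :+ (a :* con (- (+ 4)) :+ b :* (con (- (+ 4)) :* con (- (+ 4)))))) refl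

    cong-affine : ∀ {x y} x′ y′ → x ≡ x′ → y ≡ y′ → ∀ c d → c - d * y + x ≡ c - d * y′ + x′
    cong-affine _ _ refl refl c d = refl

    not-8 : ∀ k {b} → k ℕ.< 8 → k ≢ 0 → 0ℤ ≤ b → + 8 * b + 0ℤ ≡ + k → ⊥
    not-8 k {b} k<8 k≢0 0≤b e = k≢0 (ℤ.+-injective (trans (sym e) (cong (λ b → + 8 * b + 0ℤ) (small 8 k k<8 0≤b (0≤+ 0) e))))

  -- With q(0) = 1 the two values determine q. If q(-2) = 1 then b₁ is 0 or -1/2; if q(-2) = -1 then
  -- b₂ is 1/2 or 1/4.
  no-units-2-4 : ∀ b₁ b₂ → 0ℤ ≤ b₁ - 1ℤ → 0ℤ ≤ b₂ → Unit (q b₁ b₂ (- (+ 2))) → Unit (q b₁ b₂ (- (+ 4))) → ⊥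
  no-units-2-4 b₁ b₂ h _ (inj₁ y) (inj₁ x) = absurd 3 (4 ⊗ h) (trans (b₁-from b₁ b₂) (cong-affine 1ℤ 1ℤ x y -1ℤ (+ 4)))
  no-units-2-4 b₁ b₂ h _ (inj₁ y) (inj₂ x) = absurd 5 (4 ⊗ h) (trans (b₁-from b₁ b₂) (cong-affine -1ℤ 1ℤ x y -1ℤ (+ 4)))
  no-units-2-4 b₁ b₂ _ h (inj₂ y) (inj₁ x) = not-8 4 (ℕ.<ᵇ⇒< 4 8 _) (λ ()) h (trans (b₂-from b₁ b₂) (cong-affine 1ℤ -1ℤ x y 1ℤ (+ 2)))
  no-units-2-4 b₁ b₂ _ h (inj₂ y) (inj₂ x) = not-8 2 (ℕ.<ᵇ⇒< 2 8 _) (λ ()) h (trans (b₂-from b₁ b₂) (cong-affine -1ℤ -1ℤ x y 1ℤ (+ 2)))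

  private
    2b₂ : ∀ b₁ b₂ → + 2 * b₂ ≡ 1ℤ - (+ 2) * q b₁ b₂ -1ℤ + q b₁ b₂ (- (+ 2))
    2b₂ = solve 2 (λ a b → con (+ 2) :* b := con 1ℤ :- con (+ 2) :* (con 1ℤ :+ (a :* con -1ℤ :+ b :* (con -1ℤ :* con -1ℤ)))
      :+ (con 1ℤ :+ (a :* con (- (+ 2)) :+ b :* (con (- (+ 2)) :* con (- (+ 2)))))) refl

    2b₁ : ∀ b₁ b₂ → + 2 * b₁ ≡ + 3 - (+ 4) * q b₁ b₂ -1ℤ + q b₁ b₂ (- (+ 2))
    2b₁ = solve 2 (λ a b → con (+ 2) :* a := con (+ 3) :- con (+ 4) :* (con 1ℤ :+ (a :* con -1ℤ :+ b :* (con -1ℤ :* con -1ℤ)))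
      :+ (con 1ℤ :+ (a :* con (- (+ 2)) :+ b :* (con (- (+ 2)) :* con (- (+ 2)))))) refl

    2b₁-2 : ∀ b₁ b₂ → + 2 * (b₁ - 1ℤ) ≡ 1ℤ - (+ 4) * q b₁ b₂ -1ℤ + q b₁ b₂ (- (+ 2))
    2b₁-2 = solve 2 (λ a b → con (+ 2) :* (a :- con 1ℤ) := con 1ℤ :- con (+ 4) :* (con 1ℤ :+ (a :* con -1ℤ :+ b :* (con -1ℤ :* con -1ℤ)))
      :+ (con 1ℤ :+ (a :* con (- (+ 2)) :+ b :* (con (- (+ 2)) :* con (- (+ 2)))))) refl

    halve : ∀ x y → + 2 * x ≡ + 2 * y → x ≡ y
    halve x y = ℤ.*-cancelˡ-≡ (+ 2) x y

  -- Interpolation again: q(-1) = 1 would give b₁ = 0 or b₂ = -1. The survivors are 1 + 4z + 2z² =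
  -- 2t² - 1 and 1 + 3z + z², where t = z + 1.
  units-1-2 : ∀ b₁ b₂ → 0ℤ ≤ b₁ - 1ℤ → 0ℤ ≤ b₂ → Unit (q b₁ b₂ (- (+ 2))) → Unit (q b₁ b₂ -1ℤ) →
              (b₁ ≡ + 4 × b₂ ≡ + 2) ⊎ (b₁ ≡ + 3 × b₂ ≡ + 1)
  units-1-2 b₁ b₂ _ _ (inj₁ y) (inj₂ z) = inj₁
    ( halve b₁ (+ 4) (trans (2b₁ b₁ b₂) (cong-affine 1ℤ -1ℤ y z (+ 3) (+ 4)))
    , halve b₂ (+ 2) (trans (2b₂ b₁ b₂) (cong-affine 1ℤ -1ℤ y z 1ℤ (+ 2))))
  units-1-2 b₁ b₂ _ _ (inj₂ y) (inj₂ z) = inj₂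
    ( halve b₁ (+ 3) (trans (2b₁ b₁ b₂) (cong-affine -1ℤ -1ℤ y z (+ 3) (+ 4)))
    , halve b₂ (+ 1) (trans (2b₂ b₁ b₂) (cong-affine -1ℤ -1ℤ y z 1ℤ (+ 2))))
  units-1-2 b₁ b₂ h _ (inj₁ y) (inj₁ z) = ⊥-elim (absurd 1 (2 ⊗ h) (trans (2b₁-2 b₁ b₂) (cong-affine 1ℤ 1ℤ y z 1ℤ (+ 4))))
  units-1-2 b₁ b₂ _ h (inj₂ y) (inj₁ z) = ⊥-elim (absurd 1 (2 ⊗ h) (trans (2b₂ b₁ b₂) (cong-affine -1ℤ 1ℤ y z 1ℤ (+ 2))))

  private
    linear-4 : ∀ n → + 4 * (n - 1ℤ) ≡ - (+ 3) - 1ℤ * (1ℤ + n * - (+ 4)) + 0ℤ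
    linear-4 = solve 1 (λ n → con (+ 4) :* (n :- con 1ℤ) := con (- (+ 3)) :- con 1ℤ :* (con 1ℤ :+ n :* con (- (+ 4))) :+ con 0ℤ) refl

    linear-2 : ∀ n → + 2 * (n - 1ℤ) ≡ -1ℤ - 1ℤ * (1ℤ + n * - (+ 2)) + 0ℤ
    linear-2 = solve 1 (λ n → con (+ 2) :* (n :- con 1ℤ) := con -1ℤ :- con 1ℤ :* (con 1ℤ :+ n :* con (- (+ 2))) :+ con 0ℤ) refl

  unit-linear-4 : ∀ n → 0ℤ ≤ n - 1ℤ → Unit (1ℤ + n * - (+ 4)) → ⊥
  unit-linear-4 n h (inj₁ e) = absurd 3 (4 ⊗ h) (trans (linear-4 n) (cong-affine 0ℤ 1ℤ refl e (- (+ 3)) 1ℤ))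
  unit-linear-4 n h (inj₂ e) = absurd 1 (4 ⊗ h) (trans (linear-4 n) (cong-affine 0ℤ -1ℤ refl e (- (+ 3)) 1ℤ))

  unit-linear-2 : ∀ n → 0ℤ ≤ n - 1ℤ → Unit (1ℤ + n * - (+ 2)) → n - 1ℤ ≡ 0ℤ
  unit-linear-2 n h (inj₁ e) = ⊥-elim (absurd 1 (2 ⊗ h) (trans (linear-2 n) (cong-affine 0ℤ 1ℤ refl e -1ℤ 1ℤ)))
  unit-linear-2 n h (inj₂ e) = halve (n - 1ℤ) 0ℤ (trans (linear-2 n) (cong-affine 0ℤ -1ℤ refl e -1ℤ 1ℤ))

  -- The possibilities for (c₀, c₃) when f(t) = t(c₀ + (1 − c₃)t − c₀t² + c₃t³) satisfies f(±3/5) ≥ −1.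
  data Candidate (c₀ c₃ : ℤ) : Set where
    zero-one : c₀ ≡ 0ℤ → c₃ ≡ 1ℤ → Candidate c₀ c₃
    zero-two : c₀ ≡ 0ℤ → + 2 ≤ c₃ → c₃ ≤ + 5 → Candidate c₀ c₃
    one      : c₀ ≡ 1ℤ → c₃ ≤ + 4 → Candidate c₀ c₃
    -one     : c₀ ≡ -1ℤ → c₃ ≤ + 4 → Candidate c₀ c₃
    two      : c₀ ≡ + 2 → c₃ ≡ 1ℤ ⊎ c₃ ≡ + 2 → Candidate c₀ c₃
    -two     : c₀ ≡ - (+ 2) → c₃ ≡ 1ℤ ⊎ c₃ ≡ + 2 → Candidate c₀ c₃

  private
    from-predecessor : ∀ {c e} → c - 1ℤ ≡ e → c ≡ e + 1ℤ
    from-predecessor {c} h = trans (solve 1 (λ c → c := c :- con 1ℤ :+ con 1ℤ) refl c) (cong (_+ 1ℤ) h)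

    ≤-from : ∀ {c i m} → c ≡ + i + 1ℤ → i ℕ.< m → c ≤ + m
    ≤-from {i = i} {m} refl i<m = subst (_≤ + m) (ℤ.+-comm 1ℤ (+ i)) (+≤+ i<m)

    split₁ : ∀ s c₃ → + 240 * s + (+ 144 * (c₃ - 1ℤ) + (+ 850 - + 240 * s - + 144 * c₃)) ≡ + 706
    split₁ = solve 2 (λ s c → con (+ 240) :* s :+ (con (+ 144) :* (c :- con 1ℤ) :+ (con (+ 850) :- con (+ 240) :* s :- con (+ 144) :* c)) := con (+ 706)) refl

    split₂ : ∀ s c₃ → + 144 * (c₃ - 1ℤ) + (+ 850 - + 240 * s - + 144 * c₃) ≡ + 706 - + 240 * s
    split₂ = solve 2 (λ s c → con (+ 144) :* (c :- con 1ℤ) :+ (con (+ 850) :- con (+ 240) :* s :- con (+ 144) :* c) := con (+ 706) :- con (+ 240) :* s) refl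

    -- s = |c₀|
    Magnitude : ℤ → ℤ → Set
    Magnitude s c₃ = (s ≡ 0ℤ × (c₃ ≡ 1ℤ ⊎ (+ 2 ≤ c₃ × c₃ ≤ + 5))) ⊎ (s ≡ 1ℤ × c₃ ≤ + 4) ⊎ (s ≡ + 2 × (c₃ ≡ 1ℤ ⊎ c₃ ≡ + 2))

    magnitude : ∀ s c₃ → 0ℤ ≤ s → 1ℤ ≤ c₃ → 0ℤ ≤ + 850 - + 240 * s - + 144 * c₃ → Magnitude s c₃
    -- As c₃ ≥ 1, the bound leaves 240s ≤ 850 - 144 = 706 < 720, so s < 3; each s then bounds c₃ in
    -- the same way.
    magnitude s c₃ 0≤s 1≤c₃ b = by-s (below 240 706 3 (ℕ.<ᵇ⇒< 706 720 _) 0≤s (144 ⊗ 0≤e ⊕ b) (split₁ s c₃))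
      where
      0≤e = ℤ.i≤j⇒0≤j-i 1≤c₃
      c₃-below : ∀ i k m → s ≡ + i → k ℕ.< 144 ℕ.* m → + 706 - + 240 * + i ≡ + k → ∃[ e ] (e ℕ.< m × c₃ - 1ℤ ≡ + e)
      c₃-below i k m s≡ k< eq = below 144 k m k< 0≤e b (trans (split₂ s c₃) (trans (cong (λ s → + 706 - + 240 * s) s≡) eq))
      by-s : ∃[ i ] (i ℕ.< 3 × s ≡ + i) → Magnitude s c₃
      by-s (0 , _ , s≡) = from-e (c₃-below 0 706 5 s≡ (ℕ.<ᵇ⇒< 706 720 _) refl)
        where
        from-e : ∃[ e ] (e ℕ.< 5 × c₃ - 1ℤ ≡ + e) → Magnitude s c₃
        from-e (zero  , _   , e) = inj₁ (s≡ , inj₁ (from-predecessor e))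
        from-e (suc i , i<5 , e) = inj₁ (s≡ , inj₂ (subst (+ 2 ≤_) (sym (trans (from-predecessor e) (ℤ.+-comm (+ suc i) 1ℤ))) (+≤+ (ℕ.s≤s (ℕ.s≤s ℕ.z≤n))) , ≤-from (from-predecessor e) i<5))
      by-s (1 , _ , s≡) = from-e (c₃-below 1 466 4 s≡ (ℕ.<ᵇ⇒< 466 576 _) refl)
        where
        from-e : ∃[ e ] (e ℕ.< 4 × c₃ - 1ℤ ≡ + e) → Magnitude s c₃
        from-e (i , i<4 , e) = inj₂ (inj₁ (s≡ , ≤-from (from-predecessor e) i<4))
      by-s (2 , _ , s≡) = from-e (c₃-below 2 226 2 s≡ (ℕ.<ᵇ⇒< 226 288 _) refl)
        where
        from-e : ∃[ e ] (e ℕ.< 2 × c₃ - 1ℤ ≡ + e) → Magnitude s c₃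
        from-e (0 , _ , e) = inj₂ (inj₂ (s≡ , inj₁ (from-predecessor e)))
        from-e (1 , _ , e) = inj₂ (inj₂ (s≡ , inj₂ (from-predecessor e)))
        from-e (suc (suc _) , ℕ.s≤s (ℕ.s≤s ()) , _)
      by-s (suc (suc (suc _)) , ℕ.s≤s (ℕ.s≤s (ℕ.s≤s ())) , _)

  -- The hypotheses are 625(f(±3/5) + 1) = 850 ± 240c₀ - 144c₃ ≥ 0; together they bound 240|c₀| +
  -- 144c₃ by 850.
  candidate : ∀ c₀ c₃ → 1ℤ ≤ c₃ → 0ℤ ≤ + 850 - + 240 * c₀ - + 144 * c₃ → 0ℤ ≤ + 850 - + 240 * (- c₀) - + 144 * c₃ → Candidate c₀ c₃
  candidate c₀ c₃ 1≤c₃ h k = by-sign (ℤ.≤-total 0ℤ c₀)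
    where
    flip : ∀ {x} → - c₀ ≡ x → c₀ ≡ - x
    flip e = trans (sym (ℤ.neg-involutive c₀)) (cong -_ e)
    by-sign : 0ℤ ≤ c₀ ⊎ c₀ ≤ 0ℤ → Candidate c₀ c₃
    by-sign (inj₁ 0≤c₀) = on⁺ (magnitude c₀ c₃ 0≤c₀ 1≤c₃ h)
      where
      on⁺ : Magnitude c₀ c₃ → Candidate c₀ c₃
      on⁺ (inj₁ (z , inj₁ e))       = zero-one z e
      on⁺ (inj₁ (z , inj₂ (l , u))) = zero-two z l u
      on⁺ (inj₂ (inj₁ (z , u)))     = one z u
      on⁺ (inj₂ (inj₂ (z , e)))     = two z e
    by-sign (inj₂ c₀≤0) = on⁻ (magnitude (- c₀) c₃ (ℤ.neg-mono-≤ c₀≤0) 1≤c₃ k)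
      where
      on⁻ : Magnitude (- c₀) c₃ → Candidate c₀ c₃
      on⁻ (inj₁ (z , inj₁ e))       = zero-one (flip z) e
      on⁻ (inj₁ (z , inj₂ (l , u))) = zero-two (flip z) l u
      on⁻ (inj₂ (inj₁ (z , u)))     = -one (flip z) u
      on⁻ (inj₂ (inj₂ (z , e)))     = -two (flip z) e

  module Quartic (a₁ a₂ a₃ a₄ : ℤ) where

    p : ℤ → ℤ
    p z = a₁ * z + (a₂ * (z * z) + (a₃ * (z * (z * z)) + a₄ * (z * (z * (z * z)))))

    -- 625 p(m/5)
    h : ℤ → ℤ
    h m = + 125 * (a₁ * m) + (+ 25 * (a₂ * (m * m)) + (+ 5 * (a₃ * (m * (m * m))) + a₄ * (m * (m * (m * m)))))

    h-5 : ∀ z → h (+ 5 * z) ≡ + 625 * p z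
    h-5 z = solve 5 (λ a b c d z → let m = con (+ 5) :* z in
        con (+ 125) :* (a :* m) :+ (con (+ 25) :* (b :* (m :* m)) :+ (con (+ 5) :* (c :* (m :* (m :* m))) :+ d :* (m :* (m :* (m :* m)))))
        := con (+ 625) :* (a :* z :+ (b :* (z :* z) :+ (c :* (z :* (z :* z)) :+ d :* (z :* (z :* (z :* z))))))) refl a₁ a₂ a₃ a₄ z

    ≤0 : ∀ z → 0ℤ ≤ - h (+ 5 * z) → 0ℤ ≤ - p z
    ≤0 z b = 0≤-cancel 624 (- p z) (subst (0ℤ ≤_) (trans (cong -_ (h-5 z)) (solve 1 (λ p → :- (con (+ 625) :* p) := con (+ 625) :* :- p) refl (p z))) b)

    ≥ : ∀ z q → 0ℤ ≤ h (+ 5 * z) + + 625 * q → 0ℤ ≤ p z + q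
    ≥ z q b = 0≤-cancel 624 (p z + q) (subst (0ℤ ≤_) (trans (cong (λ x → x + + 625 * q) (h-5 z)) (solve 2 (λ p q → con (+ 625) :* p :+ con (+ 625) :* q := con (+ 625) :* (p :+ q)) refl (p z) q)) b)

    private
      -- The divided difference of p at z = −2, −2 ± 7/5, 0 and −4, where (z + 2)² is 0, 49/25, 4 and 4.
      difference : + 2550 * - p (- (+ 2)) + (+ 1225 * - p (- (+ 4)) + (+ 4 * (h (- (+ 3)) + + 625 * + 4) + (+ 4 * (h (- (+ 17)) + + 625 * + 4) + + 19992 * (a₄ - 1ℤ)))) ≡ + 8
      difference = solve 4 (λ a b c d →
        let p = λ z → a :* con z :+ (b :* (con z :* con z) :+ (c :* (con z :* (con z :* con z)) :+ d :* (con z :* (con z :* (con z :* con z)))))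
            h = λ m → con (+ 125) :* (a :* con m) :+ (con (+ 25) :* (b :* (con m :* con m)) :+ (con (+ 5) :* (c :* (con m :* (con m :* con m))) :+ d :* (con m :* (con m :* (con m :* con m)))))
        in con (+ 2550) :* :- p (- (+ 2)) :+ (con (+ 1225) :* :- p (- (+ 4)) :+ (con (+ 4) :* (h (- (+ 3)) :+ con (+ 625) :* con (+ 4)) :+ (con (+ 4) :* (h (- (+ 17)) :+ con (+ 625) :* con (+ 4)) :+ con (+ 19992) :* (d :- con 1ℤ)))) := con (+ 8)) refl a₁ a₂ a₃ a₄

    -- Integrality of a₄ makes the extremal property of T₄ rigid.
    extremal : 1ℤ ≤ a₄ → (∀ m → - (+ 20) ≤ m → m ≤ 0ℤ → 0ℤ ≤ - h m × 0ℤ ≤ h m + + 625 * + 4) → p (- (+ 2)) ≡ 0ℤ × p (- (+ 4)) ≡ 0ℤ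
    -- At the true extremal points the right-hand side of `difference` would be 0. Replacing √2 by
    -- 7/5 leaves 8, which is less than the weights 2550 and 1225 of the nonnegative integers -p(-2)
    -- and -p(-4), so these vanish.
    extremal 1≤a₄ bound = zero-of (small 2550 8 (ℕ.<ᵇ⇒< 8 2550 _) y₂ (1225 ⊗ y₄ ⊕ rest) difference)
                        , zero-of (small 1225 8 (ℕ.<ᵇ⇒< 8 1225 _) y₄ (2550 ⊗ y₂ ⊕ rest) (trans (exchange (+ 1225 * - p (- (+ 4))) (+ 2550 * - p (- (+ 2))) _) difference))
      where
      y₂ : 0ℤ ≤ - p (- (+ 2))
      y₂ = ≤0 (- (+ 2)) (proj₁ (bound (- (+ 10)) (-≤- (ℕ.m≤m+n 9 10)) -≤+))
      y₄ : 0ℤ ≤ - p (- (+ 4))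
      y₄ = ≤0 (- (+ 4)) (proj₁ (bound (- (+ 20)) ℤ.≤-refl -≤+))
      rest : 0ℤ ≤ + 4 * (h (- (+ 3)) + + 625 * + 4) + (+ 4 * (h (- (+ 17)) + + 625 * + 4) + + 19992 * (a₄ - 1ℤ))
      rest = 4 ⊗ proj₂ (bound (- (+ 3)) (-≤- (ℕ.m≤m+n 2 17)) -≤+) ⊕ 4 ⊗ proj₂ (bound (- (+ 17)) (-≤- (ℕ.m≤m+n 16 3)) -≤+) ⊕ 19992 ⊗ ℤ.i≤j⇒0≤j-i 1≤a₄
      exchange : ∀ a b c → a + (b + c) ≡ b + (a + c)
      exchange = solve 3 (λ a b c → a :+ (b :+ c) := b :+ (a :+ c)) refl
      zero-of : ∀ {x} → - x ≡ 0ℤ → x ≡ 0ℤ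
      zero-of {x} e = trans (sym (ℤ.neg-involutive x)) (cong -_ e)

    -- Taylor coefficients at -1: p(t - 1) = p(-1) + t(c₀ + c₁t + c₂t² + a₄t³).
    c₀ c₁ c₂ : ℤ
    c₀ = a₁ - + 2 * a₂ + + 3 * a₃ - + 4 * a₄
    c₁ = a₂ - + 3 * a₃ + + 6 * a₄
    c₂ = a₃ - + 4 * a₄

    -- The left side is c(-1). For p(-1) = -1 and p(-2) = -2 it equals 1, the value that the real
    -- root of c excludes.
    c[-1] : c₀ - c₁ + c₂ - a₄ ≡ p -1ℤ - p (- (+ 2))
    c[-1] = solve 4 (λ a b c d →
      let p = λ z → a :* con z :+ (b :* (con z :* con z) :+ (c :* (con z :* (con z :* con z)) :+ d :* (con z :* (con z :* (con z :* con z)))))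
          c₀ = a :- con (+ 2) :* b :+ con (+ 3) :* c :- con (+ 4) :* d ; c₁ = b :- con (+ 3) :* c :+ con (+ 6) :* d ; c₂ = c :- con (+ 4) :* d
      in c₀ :- c₁ :+ c₂ :- d := p -1ℤ :- p (- (+ 2))) refl a₁ a₂ a₃ a₄

    private
      odd-part : + 2 * (c₂ + c₀) ≡ - p (- (+ 2))
      odd-part = solve 4 (λ a b c d →
        let p = λ z → a :* con z :+ (b :* (con z :* con z) :+ (c :* (con z :* (con z :* con z)) :+ d :* (con z :* (con z :* (con z :* con z)))))
            c₀ = a :- con (+ 2) :* b :+ con (+ 3) :* c :- con (+ 4) :* d ; c₂ = c :- con (+ 4) :* d
        in con (+ 2) :* (c₂ :+ c₀) := :- p (- (+ 2))) refl a₁ a₂ a₃ a₄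

      even-part : + 2 * (c₁ + a₄ - 1ℤ) ≡ p (- (+ 2)) - + 2 * (1ℤ + p -1ℤ)
      even-part = solve 4 (λ a b c d →
        let p = λ z → a :* con z :+ (b :* (con z :* con z) :+ (c :* (con z :* (con z :* con z)) :+ d :* (con z :* (con z :* (con z :* con z)))))
            c₁ = b :- con (+ 3) :* c :+ con (+ 6) :* d
        in con (+ 2) :* (c₁ :+ d :- con 1ℤ) := p (- (+ 2)) :- con (+ 2) :* (con 1ℤ :+ p -1ℤ)) refl a₁ a₂ a₃ a₄

      at-2/5 : h (- (+ 2)) + + 625 * + 2 ≡ + 850 - + 240 * - c₀ - + 144 * a₄ + (+ 225 * (c₁ + a₄ - 1ℤ) + + 135 * (c₂ + c₀)) + + 625 * (1ℤ + p -1ℤ)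
      at-2/5 = solve 4 (λ a b c d →
        let p = λ z → a :* con z :+ (b :* (con z :* con z) :+ (c :* (con z :* (con z :* con z)) :+ d :* (con z :* (con z :* (con z :* con z)))))
            h = λ m → con (+ 125) :* (a :* con m) :+ (con (+ 25) :* (b :* (con m :* con m)) :+ (con (+ 5) :* (c :* (con m :* (con m :* con m))) :+ d :* (con m :* (con m :* (con m :* con m)))))
            c₀ = a :- con (+ 2) :* b :+ con (+ 3) :* c :- con (+ 4) :* d ; c₁ = b :- con (+ 3) :* c :+ con (+ 6) :* d ; c₂ = c :- con (+ 4) :* d
        in h (- (+ 2)) :+ con (+ 625) :* con (+ 2) := con (+ 850) :- con (+ 240) :* :- c₀ :- con (+ 144) :* d :+ (con (+ 225) :* (c₁ :+ d :- con 1ℤ) :+ con (+ 135) :* (c₂ :+ c₀)) :+ con (+ 625) :* (con 1ℤ :+ p -1ℤ)) refl a₁ a₂ a₃ a₄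

      at-8/5 : h (- (+ 8)) + + 625 * + 2 ≡ + 850 - + 240 * c₀ - + 144 * a₄ + (+ 225 * (c₁ + a₄ - 1ℤ) + - (+ 135 * (c₂ + c₀))) + + 625 * (1ℤ + p -1ℤ)
      at-8/5 = solve 4 (λ a b c d →
        let p = λ z → a :* con z :+ (b :* (con z :* con z) :+ (c :* (con z :* (con z :* con z)) :+ d :* (con z :* (con z :* (con z :* con z)))))
            h = λ m → con (+ 125) :* (a :* con m) :+ (con (+ 25) :* (b :* (con m :* con m)) :+ (con (+ 5) :* (c :* (con m :* (con m :* con m))) :+ d :* (con m :* (con m :* (con m :* con m)))))
            c₀ = a :- con (+ 2) :* b :+ con (+ 3) :* c :- con (+ 4) :* d ; c₁ = b :- con (+ 3) :* c :+ con (+ 6) :* d ; c₂ = c :- con (+ 4) :* d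
        in h (- (+ 8)) :+ con (+ 625) :* con (+ 2) := con (+ 850) :- con (+ 240) :* c₀ :- con (+ 144) :* d :+ (con (+ 225) :* (c₁ :+ d :- con 1ℤ) :+ :- (con (+ 135) :* (c₂ :+ c₀))) :+ con (+ 625) :* (con 1ℤ :+ p -1ℤ)) refl a₁ a₂ a₃ a₄

    module _ (p[-1] : p -1ℤ ≡ -1ℤ) (p[-2] : p (- (+ 2)) ≡ 0ℤ) where

      c₂+c₀ : c₂ + c₀ ≡ 0ℤ
      c₂+c₀ = halve (c₂ + c₀) 0ℤ (trans odd-part (cong -_ p[-2]))

      c₁+c₃-1 : c₁ + a₄ - 1ℤ ≡ 0ℤ
      c₁+c₃-1 = halve (c₁ + a₄ - 1ℤ) 0ℤ (trans even-part (cong₂ (λ x y → x - + 2 * (1ℤ + y)) p[-2] p[-1]))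

      candidates : 1ℤ ≤ a₄ → 0ℤ ≤ h (- (+ 2)) + + 625 * + 2 → 0ℤ ≤ h (- (+ 8)) + + 625 * + 2 → Candidate c₀ a₄
      candidates 1≤a₄ b₂ b₈ = candidate c₀ a₄ 1≤a₄
        (subst (0ℤ ≤_) (trans at-8/5 (drop (+ 850 - + 240 * c₀ - + 144 * a₄) (λ x y → + 225 * x + - (+ 135 * y)) refl)) b₈)
        (subst (0ℤ ≤_) (trans at-2/5 (drop (+ 850 - + 240 * - c₀ - + 144 * a₄) (λ x y → + 225 * x + + 135 * y) refl)) b₂)
        where
        drop : ∀ u (g : ℤ → ℤ → ℤ) → g 0ℤ 0ℤ ≡ 0ℤ → u + g (c₁ + a₄ - 1ℤ) (c₂ + c₀) + + 625 * (1ℤ + p -1ℤ) ≡ u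
        drop u g g0 = trans (cong₂ (λ x y → u + x + + 625 * (1ℤ + y)) (trans (cong₂ g c₁+c₃-1 c₂+c₀) g0) p[-1])
          (trans (ℤ.+-identityʳ _) (ℤ.+-identityʳ u))

    private
      half : ℤ
      half = a₁ - + 2 * a₂ + + 4 * a₃ - + 8 * a₄

      p[-2]-even : - p (- (+ 2)) ≡ + 2 * half
      p[-2]-even = solve 4 (λ a b c d →
        let p = λ z → a :* con z :+ (b :* (con z :* con z) :+ (c :* (con z :* (con z :* con z)) :+ d :* (con z :* (con z :* (con z :* con z)))))
        in :- p (- (+ 2)) := con (+ 2) :* (a :- con (+ 2) :* b :+ con (+ 4) :* c :- con (+ 8) :* d)) refl a₁ a₂ a₃ a₄

      from-neg : ∀ {x} y → - x ≡ y → x ≡ - y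
      from-neg {x} y e = trans (sym (ℤ.neg-involutive x)) (cong -_ e)

      cancel : ∀ x → - x + (x + + 2) ≡ + 2
      cancel = solve 1 (λ x → :- x :+ (x :+ con (+ 2)) := con (+ 2)) refl

    -- Every term of p(-2) is even, which rules out the middle value -1. Hence I_G(-2) = ±1 whenever
    -- the interval is [-2,0].
    p[-2]-cases : 0ℤ ≤ - p (- (+ 2)) → 0ℤ ≤ p (- (+ 2)) + + 2 → p (- (+ 2)) ≡ 0ℤ ⊎ p (- (+ 2)) ≡ - (+ 2)
    p[-2]-cases l u = cases (below 2 2 2 (ℕ.<ᵇ⇒< 2 4 _) (0≤-cancel 1 half (subst (0ℤ ≤_) p[-2]-even l)) u
                               (trans (cong (_+ (p (- (+ 2)) + + 2)) (sym p[-2]-even)) (cancel (p (- (+ 2))))))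
      where
      cases : ∃[ i ] (i ℕ.< 2 × half ≡ + i) → p (- (+ 2)) ≡ 0ℤ ⊎ p (- (+ 2)) ≡ - (+ 2)
      cases (0 , _ , e) = inj₁ (from-neg 0ℤ (trans p[-2]-even (cong (+ 2 *_) e)))
      cases (1 , _ , e) = inj₂ (from-neg (+ 2) (trans p[-2]-even (cong (+ 2 *_) e)))
      cases (suc (suc _) , ℕ.s≤s (ℕ.s≤s ()) , _)

    p[-1]-cases : 0ℤ ≤ - p -1ℤ → 0ℤ ≤ p -1ℤ + + 2 → p -1ℤ ≡ -1ℤ ⊎ (p -1ℤ ≡ 0ℤ ⊎ p -1ℤ ≡ - (+ 2))
    p[-1]-cases l u = cases (below 1 2 3 (ℕ.<ᵇ⇒< 2 3 _) l u (trans (cong (_+ (p -1ℤ + + 2)) (ℤ.*-identityˡ (- p -1ℤ))) (cancel (p -1ℤ))))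
      where
      cases : ∃[ i ] (i ℕ.< 3 × - p -1ℤ ≡ + i) → p -1ℤ ≡ -1ℤ ⊎ (p -1ℤ ≡ 0ℤ ⊎ p -1ℤ ≡ - (+ 2))
      cases (0 , _ , e) = inj₂ (inj₁ (from-neg 0ℤ e))
      cases (1 , _ , e) = inj₁ (from-neg 1ℤ e)
      cases (2 , _ , e) = inj₂ (inj₂ (from-neg (+ 2) e))
      cases (suc (suc (suc _)) , ℕ.s≤s (ℕ.s≤s (ℕ.s≤s ())) , _)

-- The two contradictions for disconnected graphs

module Nonexistence (F : RealField) (K : ComplexField F) where

  open import Defs using (Graph; order; independenceNumber; coefficient)
  private module R = OrderedField F
  open R using (ι)
  open ComplexPlane F K
  open Continuity F K
  open IteratedPolynomial F K
  open QuarticCases F K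
  open RealDynamics F K using (-1ℚ; -2ℚ)
  open NonrealZeros F K using (limit-nonreal)
  open SubsetSums commutativeRing using (emb)
  open IndependencePolynomial commutativeRing using (poly)
  open Factorisation commutativeRing using (coefficient-0)
  open SeparatedGraph
  open IntegerQuartics hiding (absurd)
  open import Data.Integer using (0ℤ; 1ℤ; -1ℤ)
  import Data.Integer.Solver
  open import Data.Rational using (_/_)
  import Data.Rational.Solver
  open import Data.Fin.Subset using (Subset; _∈_)
  private
    module S = Data.Rational.Solver.+-*-Solver
    module Z = Data.Integer.Solver.+-*-Solver
    module C = Solver
    module ℤΣ = SubsetSums ℤ.+-*-commutativeRing
    module ℤP = IndependencePolynomial ℤ.+-*-commutativeRing
    module ℤS = Factorisation ℤ.+-*-commutativeRing

  κ-+ : ∀ p q → κ (p ℚ.+ q) ≈ κ p + κ q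
  κ-+ p q = trans (real-cong (R.ι-+ p q)) (real-+ (ι p) (ι q))

  κ-* : ∀ p q → κ (p ℚ.* q) ≈ κ p * κ q
  κ-* p q = trans (real-cong (R.ι-* p q)) (real-* (ι p) (ι q))

  κ-neg : ∀ p → κ (ℚ.- p) ≈ - κ p
  κ-neg p = trans (real-cong (R.ι-neg p)) (real-neg (ι p))

  κℤ : ℤ → Carrier
  κℤ z = κ (Rat.ι z)

  κℤ-+ : ∀ m n → κℤ (m ℤ.+ n) ≈ κℤ m + κℤ n
  κℤ-+ m n = trans (reflexive (≡.cong κ (Rat.ι-+ m n))) (κ-+ _ _)

  κℤ-sub : ∀ m n → κℤ (m ℤ.- n) ≈ κℤ m - κℤ n
  κℤ-sub m n = trans (κℤ-+ m (ℤ.- n)) (+-congˡ (trans (reflexive (≡.cong κ (Rat.ι-neg n))) (κ-neg _)))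

  κℤ-* : ∀ m n → κℤ (m ℤ.* n) ≈ κℤ m * κℤ n
  κℤ-* m n = trans (reflexive (≡.cong κ (Rat.ι-* m n))) (κ-* _ _)

  Continuous-resp : ∀ {f g} → (∀ z → f z ≈ g z) → Continuous g → Continuous f
  Continuous-resp e c z ε 0<ε = let δ , 0<δ , h = c z ε 0<ε in
    δ , 0<δ , λ w w~z → R.≤-resp (∣∣²-cong (+-cong (sym (e w)) (-‿cong (sym (e z))))) R.refl (h w w~z)

  embℤ : ∀ n → ℤΣ.emb n ≡ + n
  embℤ zero    = ≡.refl
  embℤ (suc n) = ≡.cong (λ k → 1ℤ ℤ.+ k) (embℤ n)

  module _ (G : Graph) (α≡4 : independenceNumber G ≡ 4) where

    a : ℕ → ℤ
    a i = + coefficient G i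

    open Quartic (a 1) (a 2) (a 3) (a 4)

    1≤a₄ : 1ℤ ℤ.≤ a 4
    1≤a₄ = ℤ.+≤+ (≡.subst (λ α → 1 ℕ.≤ coefficient G α) α≡4 (top-coefficient G))

    quartic : Carrier → Carrier
    quartic z = κℤ (a 1) * z + (κℤ (a 2) * (z * z) + (κℤ (a 3) * (z * (z * z)) + κℤ (a 4) * (z * (z * (z * z)))))

    P≈ : ∀ z → P G z ≈ quartic z
    P≈ z = trans (+-cong (poly₄ G z α≡4) (-‿cong (sym real-1))) (trans
      (+-congʳ (+-congʳ (trans (sym (emb≈κ (coefficient G 0))) (trans (coefficient-0 G) (sym real-1)))))
      (C.solve 1 (λ q → C.con 1ℚ C.:+ q C.:- C.con 1ℚ C.:= q) refl (quartic z)))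

    P-continuous : Continuous (P G)
    P-continuous = Continuous-resp P≈
      (+-continuous (*-continuous (const-continuous _) id)
      (+-continuous (*-continuous (const-continuous _) (*-continuous id id))
      (+-continuous (*-continuous (const-continuous _) (*-continuous id (*-continuous id id)))
                    (*-continuous (const-continuous _) (*-continuous id (*-continuous id (*-continuous id id)))))))
      where id = id-continuous

    pℚ : ℚ → ℚ
    pℚ x = Rat.ι (a 1) ℚ.* x ℚ.+ (Rat.ι (a 2) ℚ.* (x ℚ.* x) ℚ.+ (Rat.ι (a 3) ℚ.* (x ℚ.* (x ℚ.* x)) ℚ.+ Rat.ι (a 4) ℚ.* (x ℚ.* (x ℚ.* (x ℚ.* x)))))

    P-κ : ∀ x → P G (κ x) ≈ κ (pℚ x)
    P-κ x = trans (P≈ (κ x)) (sym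
      (trans (κ-+ _ _) (+-cong (κ-* _ _)
      (trans (κ-+ _ _) (+-cong (trans (κ-* _ _) (*-congˡ (κ-* x x)))
      (trans (κ-+ _ _) (+-cong (trans (κ-* _ _) (*-congˡ x³)) (trans (κ-* _ _) (*-congˡ (trans (κ-* _ _) (*-congˡ x³)))))))))))
      where
      x³ : κ (x ℚ.* (x ℚ.* x)) ≈ κ x * (κ x * κ x)
      x³ = trans (κ-* _ _) (*-congˡ (κ-* x x))

    h-pℚ : ∀ x m → (+ 5 / 1) ℚ.* x ≡ Rat.ι m → Rat.ι (h m) ≡ (+ 625 / 1) ℚ.* pℚ x
    h-pℚ x m 5x≡m = ≡.trans ι-h (≡.trans (≡.cong g (≡.sym 5x≡m))
      (S.solve 5 (λ a b c d x → let m = S.con (+ 5 / 1) S.:* x in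
        S.con (+ 125 / 1) S.:* (a S.:* m) S.:+ (S.con (+ 25 / 1) S.:* (b S.:* (m S.:* m)) S.:+ (S.con (+ 5 / 1) S.:* (c S.:* (m S.:* (m S.:* m))) S.:+ d S.:* (m S.:* (m S.:* (m S.:* m)))))
        S.:= S.con (+ 625 / 1) S.:* (a S.:* x S.:+ (b S.:* (x S.:* x) S.:+ (c S.:* (x S.:* (x S.:* x)) S.:+ d S.:* (x S.:* (x S.:* (x S.:* x))))))) ≡.refl
        (Rat.ι (a 1)) (Rat.ι (a 2)) (Rat.ι (a 3)) (Rat.ι (a 4)) x))
      where
      g : ℚ → ℚ
      g m = (+ 125 / 1) ℚ.* (Rat.ι (a 1) ℚ.* m) ℚ.+ ((+ 25 / 1) ℚ.* (Rat.ι (a 2) ℚ.* (m ℚ.* m)) ℚ.+ ((+ 5 / 1) ℚ.* (Rat.ι (a 3) ℚ.* (m ℚ.* (m ℚ.* m))) ℚ.+ Rat.ι (a 4) ℚ.* (m ℚ.* (m ℚ.* (m ℚ.* m)))))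
      infixl 1 _⨾_
      _⨾_ : ∀ {x y z : ℚ} → x ≡ y → y ≡ z → x ≡ z
      _⨾_ = ≡.trans
      m³ : Rat.ι (m ℤ.* (m ℤ.* m)) ≡ Rat.ι m ℚ.* (Rat.ι m ℚ.* Rat.ι m)
      m³ = Rat.ι-* m (m ℤ.* m) ⨾ ≡.cong (Rat.ι m ℚ.*_) (Rat.ι-* m m)
      ι-h : Rat.ι (h m) ≡ g (Rat.ι m)
      ι-h = Rat.ι-+ (+ 125 ℤ.* (a 1 ℤ.* m)) _ ⨾ ≡.cong₂ ℚ._+_ (Rat.ι-* (+ 125) (a 1 ℤ.* m) ⨾ ≡.cong ((+ 125 / 1) ℚ.*_) (Rat.ι-* (a 1) m))
        (Rat.ι-+ (+ 25 ℤ.* (a 2 ℤ.* (m ℤ.* m))) _ ⨾ ≡.cong₂ ℚ._+_ (Rat.ι-* (+ 25) (a 2 ℤ.* (m ℤ.* m)) ⨾ ≡.cong ((+ 25 / 1) ℚ.*_) (Rat.ι-* (a 2) (m ℤ.* m) ⨾ ≡.cong (Rat.ι (a 2) ℚ.*_) (Rat.ι-* m m)))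
        (Rat.ι-+ (+ 5 ℤ.* (a 3 ℤ.* (m ℤ.* (m ℤ.* m)))) _ ⨾ ≡.cong₂ ℚ._+_ (Rat.ι-* (+ 5) (a 3 ℤ.* (m ℤ.* (m ℤ.* m))) ⨾ ≡.cong ((+ 5 / 1) ℚ.*_) (Rat.ι-* (a 3) (m ℤ.* (m ℤ.* m)) ⨾ ≡.cong (Rat.ι (a 3) ℚ.*_) m³))
        (Rat.ι-* (a 4) (m ℤ.* (m ℤ.* (m ℤ.* m))) ⨾ ≡.cong (Rat.ι (a 4) ℚ.*_) (Rat.ι-* m (m ℤ.* (m ℤ.* m)) ⨾ ≡.cong (Rat.ι m ℚ.*_) m³))))

    -- Invariance of the interval at the rational point m/5, multiplied by 625 so that only integers
    -- remain.
    h-bound : ∀ Q → RootLimit (P G) (ℚ.- Rat.ι Q) → ∀ m → ℤ.- (+ 5 ℤ.* Q) ℤ.≤ m → m ℤ.≤ 0ℤ →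
              0ℤ ℤ.≤ ℤ.- h m × 0ℤ ℤ.≤ h m ℤ.+ + 625 ℤ.* Q
    h-bound Q limit m l u =
        Rat.ι-≤⁻ {0ℤ} {ℤ.- h m} (Rat.0≤-⇒≤ _ (Rat.0≤ₗ (+ 625 / 1) Rat.*⁰ Rat.≤⇒0≤- (proj₂ b))
          (≡.trans (≡.cong (ℚ._- 0ℚ) (≡.trans (Rat.ι-neg (h m)) (≡.cong ℚ.-_ (h-pℚ x m 5x≡m))))
            (S.solve 1 (λ p → S.:- (S.con (+ 625 / 1) S.:* p) S.:- S.con 0ℚ S.:= S.con (+ 625 / 1) S.:* (S.con 0ℚ S.:- p)) ≡.refl (pℚ x))))
      , Rat.ι-≤⁻ {0ℤ} {h m ℤ.+ + 625 ℤ.* Q} (Rat.0≤-⇒≤ _ (Rat.0≤ₗ (+ 625 / 1) Rat.*⁰ Rat.≤⇒0≤- (proj₁ b))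
          (≡.trans (≡.cong (ℚ._- 0ℚ) (≡.trans (Rat.ι-+ (h m) (+ 625 ℤ.* Q)) (≡.cong₂ ℚ._+_ (h-pℚ x m 5x≡m) (Rat.ι-* (+ 625) Q))))
            (S.solve 2 (λ p q → S.con (+ 625 / 1) S.:* p S.:+ S.con (+ 625 / 1) S.:* q S.:- S.con 0ℚ S.:= S.con (+ 625 / 1) S.:* (p S.:- S.:- q)) ≡.refl (pℚ x) (Rat.ι Q))))
      where
      x : ℚ
      x = (+ 1 / 5) ℚ.* Rat.ι m
      5x≡m : (+ 5 / 1) ℚ.* x ≡ Rat.ι m
      5x≡m = S.solve 1 (λ m → S.con (+ 5 / 1) S.:* (S.con (+ 1 / 5) S.:* m) S.:= m) ≡.refl (Rat.ι m)
      ι-l : ℚ.- ((+ 5 / 1) ℚ.* Rat.ι Q) ℚ.≤ Rat.ι m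
      ι-l = ≡.subst (ℚ._≤ Rat.ι m) (≡.trans (Rat.ι-neg (+ 5 ℤ.* Q)) (≡.cong ℚ.-_ (Rat.ι-* (+ 5) Q))) (Rat.ι-≤ l)
      b : ℚ.- Rat.ι Q ℚ.≤ pℚ x × pℚ x ℚ.≤ 0ℚ
      b = Limit.invariant-ℚ P-continuous limit
        (Rat.0≤-⇒≤ _ (Rat.0≤ₗ (+ 1 / 5) Rat.*⁰ Rat.≤⇒0≤- ι-l)
          (S.solve 2 (λ m q → S.con (+ 1 / 5) S.:* m S.:- S.:- q S.:= S.con (+ 1 / 5) S.:* (m S.:- S.:- (S.con (+ 5 / 1) S.:* q))) ≡.refl (Rat.ι m) (Rat.ι Q)))
        (Rat.0≤-⇒≤ _ (Rat.0≤ₗ (+ 1 / 5) Rat.*⁰ Rat.≤⇒0≤- (Rat.ι-≤ u))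
          (S.solve 1 (λ m → S.con 0ℚ S.:- S.con (+ 1 / 5) S.:* m S.:= S.con (+ 1 / 5) S.:* (S.con 0ℚ S.:- m)) ≡.refl (Rat.ι m)))
        (P-κ x)

    -- The coefficients that define P over ℂ also evaluate I_G inside ℤ, where a factorisation of ±1
    -- consists of units.
    polyℤ : ∀ z → ℤP.poly G z ≡ 1ℤ ℤ.+ p z
    polyℤ z = ≡.trans (≡.sym (ℤP.poly-coefficients G z)) (≡.trans
      (≡.cong (λ α → ℤΣ.Σᵢ (suc α) (λ i → ℤΣ.emb (coefficient G i) ℤ.* ℤΣ.pow z i)) α≡4)
      (≡.trans (≡.cong₂ ℤ._+_ (≡.cong (ℤ._* 1ℤ) (ℤS.coefficient-0 G)) (≡.cong₂ ℤ._+_ (c 1) (≡.cong₂ ℤ._+_ (c 2) (≡.cong₂ ℤ._+_ (c 3) (≡.cong (ℤ._+ 0ℤ) (c 4))))))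
        (Z.solve 5 (λ a b c d z → Z.con 1ℤ Z.:* Z.con 1ℤ Z.:+ (a Z.:* (z Z.:* Z.con 1ℤ) Z.:+ (b Z.:* (z Z.:* (z Z.:* Z.con 1ℤ)) Z.:+ (c Z.:* (z Z.:* (z Z.:* (z Z.:* Z.con 1ℤ))) Z.:+ (d Z.:* (z Z.:* (z Z.:* (z Z.:* (z Z.:* Z.con 1ℤ)))) Z.:+ Z.con 0ℤ))))
          Z.:= Z.con 1ℤ Z.:+ (a Z.:* z Z.:+ (b Z.:* (z Z.:* z) Z.:+ (c Z.:* (z Z.:* (z Z.:* z)) Z.:+ d Z.:* (z Z.:* (z Z.:* (z Z.:* z))))))) ≡.refl (a 1) (a 2) (a 3) (a 4) z)))
      where
      c : ∀ i → ℤΣ.emb (coefficient G i) ℤ.* ℤΣ.pow z i ≡ a i ℤ.* ℤΣ.pow z i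
      c i = ≡.cong (ℤ._* ℤΣ.pow z i) (embℤ (coefficient G i))

    κℤ-p : ∀ z → κℤ (p z) ≈ quartic (κℤ z)
    κℤ-p z = trans (κℤ-+ (a 1 ℤ.* z) _) (+-cong (κℤ-* (a 1) z)
      (trans (κℤ-+ (a 2 ℤ.* (z ℤ.* z)) _) (+-cong (trans (κℤ-* (a 2) _) (*-congˡ (κℤ-* z z)))
      (trans (κℤ-+ (a 3 ℤ.* (z ℤ.* (z ℤ.* z))) _) (+-cong (trans (κℤ-* (a 3) _) (*-congˡ z³)) (trans (κℤ-* (a 4) _) (*-congˡ (trans (κℤ-* z _) (*-congˡ z³)))))))))
      where
      z³ : κℤ (z ℤ.* (z ℤ.* z)) ≈ κℤ z * (κℤ z * κℤ z)
      z³ = trans (κℤ-* z _) (*-congˡ (κℤ-* z z))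

    ≤⇒0≤ι : ∀ {m n} → m ℤ.≤ n → R.0r R.≤ ι (Rat.ι n) R.- ι (Rat.ι m)
    ≤⇒0≤ι h = R.≤⇒0≤- (R.ι-≤ (Rat.ι-≤ h))

    ιℤ : ∀ {m n} → m ≡ n → ι (Rat.ι m) R.≈ ι (Rat.ι n)
    ιℤ e = R.reflexive (≡.cong (λ z → ι (Rat.ι z)) e)

    ιℤ-sub : ∀ m n → ι (Rat.ι (m ℤ.- n)) R.≈ ι (Rat.ι m) R.- ι (Rat.ι n)
    ιℤ-sub m n = R.trans (R.reflexive (≡.cong ι (≡.trans (Rat.ι-+ m (ℤ.- n)) (≡.cong (λ q → Rat.ι m ℚ.+ q) (Rat.ι-neg n)))))
      (R.trans (R.ι-+ _ _) (R.+-congˡ (R.ι-neg _)))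

    ιℤ-+ : ∀ m n → ι (Rat.ι (m ℤ.+ n)) R.≈ ι (Rat.ι m) R.+ ι (Rat.ι n)
    ιℤ-+ m n = R.trans (R.reflexive (≡.cong ι (Rat.ι-+ m n))) (R.ι-+ _ _)

    -- Here I_G(-1) = 0, so -1 is a fixed point of P, and factoring I_G(-1) would yield no units.
    module Resonant (limit : RootLimit (P G) -2ℚ) (p[-1]≡-1 : p -1ℤ ≡ -1ℤ) where

      centred : ∀ t → P G (t - κ 1ℚ) ≈ t * (κℤ c₀ + (κℤ c₁ * t + (κℤ c₂ * (t * t) + κℤ (a 4) * (t * (t * t))))) - κ 1ℚ
      centred t = begin
        P G (t - κ 1ℚ)
          ≈⟨ P≈ (t - κ 1ℚ) ⟩
        quartic (t - κ 1ℚ)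
          ≈⟨ C.solve 5 (λ a b c d t → let z = t C.:- C.con 1ℚ ; n = C.con -1ℚ ; f = λ z → a C.:* z C.:+ (b C.:* (z C.:* z) C.:+ (c C.:* (z C.:* (z C.:* z)) C.:+ d C.:* (z C.:* (z C.:* (z C.:* z))))) ; e₀ = a C.:- C.con 2ℚ C.:* b C.:+ C.con (+ 3 / 1) C.:* c C.:- C.con (+ 4 / 1) C.:* d ; e₁ = b C.:- C.con (+ 3 / 1) C.:* c C.:+ C.con (+ 6 / 1) C.:* d ; e₂ = c C.:- C.con (+ 4 / 1) C.:* d in f z C.:= t C.:* (e₀ C.:+ (e₁ C.:* t C.:+ (e₂ C.:* (t C.:* t) C.:+ d C.:* (t C.:* (t C.:* t))))) C.:+ f n) refl
              (κℤ (a 1)) (κℤ (a 2)) (κℤ (a 3)) (κℤ (a 4)) t ⟩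
        t * (e₀ + (e₁ * t + (e₂ * (t * t) + κℤ (a 4) * (t * (t * t))))) + quartic (κ -1ℚ)
          ≈⟨ +-cong (*-congˡ (+-cong (sym c₀≈) (+-cong (*-congʳ (sym c₁≈)) (+-congʳ (*-congʳ (sym c₂≈))))))
                    (trans (sym (κℤ-p -1ℤ)) (trans (reflexive (≡.cong κℤ p[-1]≡-1)) (κ-neg 1ℚ))) ⟩
        t * (κℤ c₀ + (κℤ c₁ * t + (κℤ c₂ * (t * t) + κℤ (a 4) * (t * (t * t))))) - κ 1ℚ ∎
        where
        open import Relation.Binary.Reasoning.Setoid setoid
        e₀ = κℤ (a 1) - κ 2ℚ * κℤ (a 2) + κ (+ 3 / 1) * κℤ (a 3) - κ (+ 4 / 1) * κℤ (a 4)
        e₁ = κℤ (a 2) - κ (+ 3 / 1) * κℤ (a 3) + κ (+ 6 / 1) * κℤ (a 4)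
        e₂ = κℤ (a 3) - κ (+ 4 / 1) * κℤ (a 4)
        c₀≈ : κℤ c₀ ≈ e₀
        c₀≈ = trans (κℤ-sub (a 1 ℤ.- + 2 ℤ.* a 2 ℤ.+ + 3 ℤ.* a 3) (+ 4 ℤ.* a 4)) (+-cong (trans (κℤ-+ (a 1 ℤ.- + 2 ℤ.* a 2) (+ 3 ℤ.* a 3)) (+-cong (trans (κℤ-sub (a 1) (+ 2 ℤ.* a 2))
          (+-congˡ (-‿cong (κℤ-* (+ 2) (a 2))))) (κℤ-* (+ 3) (a 3)))) (-‿cong (κℤ-* (+ 4) (a 4))))
        c₁≈ : κℤ c₁ ≈ e₁
        c₁≈ = trans (κℤ-+ (a 2 ℤ.- + 3 ℤ.* a 3) (+ 6 ℤ.* a 4)) (+-cong (trans (κℤ-sub (a 2) (+ 3 ℤ.* a 3)) (+-congˡ (-‿cong (κℤ-* (+ 3) (a 3))))) (κℤ-* (+ 6) (a 4)))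
        c₂≈ : κℤ c₂ ≈ e₂
        c₂≈ = trans (κℤ-sub (a 3) (+ 4 ℤ.* a 4)) (+-congˡ (-‿cong (κℤ-* (+ 4) (a 4))))

      0<c₃ : 0ℚ ℚ.< Rat.ι (a 4)
      0<c₃ = ℚ.<-≤-trans (Rat.0<ₗ 1ℚ) (Rat.ι-≤ {1ℤ} {a 4} 1≤a₄)

      open Cases (P-cong G) P-continuous limit (Rat.ι c₀) (Rat.ι c₁) (Rat.ι c₂) (Rat.ι (a 4)) 0<c₃ centred

      at-2≢-2 : p (ℤ.- (+ 2)) ≡ ℤ.- (+ 2) → ⊥
      at-2≢-2 e = c[-1]≢1 (R.trans (R.sym (R.trans (ιℤ-sub (c₀ ℤ.- c₁ ℤ.+ c₂) (a 4)) (R.+-congʳ (R.trans (ιℤ-+ (c₀ ℤ.- c₁) c₂) (R.+-congʳ (ιℤ-sub c₀ c₁))))))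
        (ιℤ (≡.trans c[-1] (≡.cong₂ ℤ._-_ p[-1]≡-1 e))))

      at-2≢0 : p (ℤ.- (+ 2)) ≡ 0ℤ → ⊥
      at-2≢0 e = by-candidate (candidates p[-1]≡-1 e 1≤a₄
          (proj₂ (h-bound (+ 2) limit (ℤ.- (+ 2)) (ℤ.-≤- (ℕ.m≤m+n 1 8)) ℤ.-≤+))
          (proj₂ (h-bound (+ 2) limit (ℤ.- (+ 8)) (ℤ.-≤- (ℕ.m≤m+n 7 2)) ℤ.-≤+)))
        where
        open Even
          (R.trans (ιℤ (≡.trans (Z.solve 2 (λ c d → c Z.:= (c Z.:+ d Z.:- Z.con 1ℤ) Z.:+ (Z.con 1ℤ Z.:- d)) ≡.refl c₁ (a 4))
            (≡.trans (≡.cong (λ x → x ℤ.+ (1ℤ ℤ.- a 4)) (c₁+c₃-1 p[-1]≡-1 e)) (ℤ.+-identityˡ (1ℤ ℤ.- a 4))))) (ιℤ-sub 1ℤ (a 4)))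
          (R.trans (ιℤ (≡.trans (Z.solve 2 (λ c d → c Z.:= (c Z.:+ d) Z.:+ Z.:- d) ≡.refl c₂ c₀)
            (≡.trans (≡.cong (λ x → x ℤ.+ ℤ.- c₀) (c₂+c₀ p[-1]≡-1 e)) (ℤ.+-identityˡ (ℤ.- c₀)))))
            (R.trans (R.reflexive (≡.cong ι (Rat.ι-neg c₀))) (R.ι-neg _)))
        by-candidate : Candidate c₀ (a 4) → ⊥
        by-candidate (zero-one z k)        = c₀≢0-1 (ιℤ z) (ιℤ k)
        by-candidate (zero-two z l u)      = c₀≢0-2 (ιℤ z) (≤⇒0≤ι l) (≤⇒0≤ι u)
        by-candidate (one z u)             = c₀≢1 (ιℤ z) (≤⇒0≤ι 1≤a₄) (≤⇒0≤ι u)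
        by-candidate (-one z u)            = c₀≢-1 (ιℤ z) (≤⇒0≤ι 1≤a₄) (≤⇒0≤ι u)
        by-candidate (two z (inj₁ k))      = c₀≢2-1 (ιℤ z) (ιℤ k)
        by-candidate (two z (inj₂ k))      = c₀≢2-2 (ιℤ z) (ιℤ k)
        by-candidate (-two z (inj₁ k))     = c₀≢-2-1 (ιℤ z) (ιℤ k)
        by-candidate (-two z (inj₂ k))     = c₀≢-2-2 (ιℤ z) (ιℤ k)

    module Separated (sep : Separation G) where

      open Parts sep
      open ℤS.Factor sep using (poly-parts)

      1≤count : ∀ C {u} → u ∈ C → 0ℤ ℤ.≤ + count C 1 ℤ.- 1ℤ
      1≤count C u∈ = ℤ.i≤j⇒0≤j-i (ℤ.+≤+ (count-singleton C _ u∈))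

      part : Subset (order G) → ℤ → ℤ
      part C z = ℤΣ.Σ⊆ C (ℤP.weight G z)

      product : ∀ z → 1ℤ ℤ.+ p z ≡ part A z ℤ.* part B z
      product z = ≡.trans (≡.sym (polyℤ z)) (poly-parts z)

      unit-A : ∀ z → ℤ.∣ 1ℤ ℤ.+ p z ∣ ≡ 1 → Unit (part A z)
      unit-A z e = unit-factor (part A z) (part B z) (≡.trans (≡.cong ℤ.∣_∣ (≡.sym (product z))) e)

      unit-B : ∀ z → ℤ.∣ 1ℤ ℤ.+ p z ∣ ≡ 1 → Unit (part B z)
      unit-B z e = unit-factor (part B z) (part A z) (≡.trans (≡.cong ℤ.∣_∣ (≡.trans (ℤ.*-comm (part B z) (part A z)) (≡.sym (product z)))) e)

      linear : ∀ C → Bounded C 1 → ∀ z → part C z ≡ 1ℤ ℤ.+ + count C 1 ℤ.* z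
      linear C b z = ≡.trans (ℤS.Counting.linear G C b z) (≡.cong (λ n → 1ℤ ℤ.+ n ℤ.* z) (embℤ (count C 1)))

      quadratic : ∀ C → Bounded C 2 → ∀ z → part C z ≡ q (+ count C 1) (+ count C 2) z
      quadratic C b z = ≡.trans (ℤS.Counting.quadratic G C b z)
        (≡.cong₂ (λ m n → 1ℤ ℤ.+ (m ℤ.* z ℤ.+ n ℤ.* (z ℤ.* z))) (embℤ (count C 1)) (embℤ (count C 2)))

      no-limit-4 : RootLimit (P G) (ℚ.- Rat.ι (+ 4)) → ⊥
      no-limit-4 limit = by-shape (shapes α≡4)
        where
        extreme = extremal 1≤a₄ (h-bound (+ 4) limit)
        one₂ : ℤ.∣ 1ℤ ℤ.+ p (ℤ.- (+ 2)) ∣ ≡ 1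
        one₂ = ≡.cong (λ x → ℤ.∣ 1ℤ ℤ.+ x ∣) (proj₁ extreme)
        one₄ : ℤ.∣ 1ℤ ℤ.+ p (ℤ.- (+ 4)) ∣ ≡ 1
        one₄ = ≡.cong (λ x → ℤ.∣ 1ℤ ℤ.+ x ∣) (proj₂ extreme)
        by-shape : Bounded A 1 ⊎ Bounded B 1 ⊎ (Bounded A 2 × Bounded B 2) → ⊥
        by-shape (inj₁ bA) = unit-linear-4 (+ count A 1) (1≤count A u∈) (≡.subst Unit (linear A bA (ℤ.- (+ 4))) (unit-A (ℤ.- (+ 4)) one₄))
        by-shape (inj₂ (inj₁ bB)) = unit-linear-4 (+ count B 1) (1≤count B v∈) (≡.subst Unit (linear B bB (ℤ.- (+ 4))) (unit-B (ℤ.- (+ 4)) one₄))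
        by-shape (inj₂ (inj₂ (bA , _))) = no-units-2-4 (+ count A 1) (+ count A 2) (1≤count A u∈) (0≤+ (count A 2))
          (≡.subst Unit (quadratic A bA (ℤ.- (+ 2))) (unit-A (ℤ.- (+ 2)) one₂)) (≡.subst Unit (quadratic A bA (ℤ.- (+ 4))) (unit-A (ℤ.- (+ 4)) one₄))

      module Kʳ = Factorisation commutativeRing

      partᶜ : Subset (order G) → Carrier → Carrier
      partᶜ C z = SubsetSums.Σ⊆ commutativeRing C (IndependencePolynomial.weight commutativeRing G z)

      -- Integer values identify the factors; after that they are needed as functions on ℂ, to
      -- evaluate at -6/5 and to recognise (2t² - 1)².
      quadraticᶜ : ∀ C → Bounded C 2 → ∀ {m n} → + count C 1 ≡ + m → + count C 2 ≡ + n → ∀ z → partᶜ C z ≈ κ 1ℚ + (κℕ m * z + κℕ n * (z * z))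
      quadraticᶜ C b e₁ e₂ z = trans (Kʳ.Counting.quadratic G C b z) (+-cong (sym real-1)
        (+-cong (*-congʳ (trans (emb≈κ (count C 1)) (reflexive (≡.cong κℤ e₁)))) (*-congʳ (trans (emb≈κ (count C 2)) (reflexive (≡.cong κℤ e₂))))))

      P-product : ∀ {f g} z → partᶜ A z ≈ f → partᶜ B z ≈ g → P G z ≈ f * g - κ 1ℚ
      P-product z e₁ e₂ = +-cong (trans (Kʳ.Factor.poly-parts sep z) (*-cong e₁ e₂)) (-‿cong (sym real-1))

      no-limit-2 : RootLimit (P G) -2ℚ → ⊥
      no-limit-2 limit = by-p[-1] (p[-1]-cases (≤0 -1ℤ (proj₁ (h-bound (+ 2) limit (ℤ.- (+ 5)) (ℤ.-≤- (ℕ.m≤m+n 4 5)) ℤ.-≤+)))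
                                              (≥ -1ℤ (+ 2) (proj₂ (h-bound (+ 2) limit (ℤ.- (+ 5)) (ℤ.-≤- (ℕ.m≤m+n 4 5)) ℤ.-≤+))))
        where
        h₁₀ = h-bound (+ 2) limit (ℤ.- (+ 10)) ℤ.≤-refl ℤ.-≤+
        at-2 : p (ℤ.- (+ 2)) ≡ 0ℤ ⊎ p (ℤ.- (+ 2)) ≡ ℤ.- (+ 2)
        at-2 = p[-2]-cases (≤0 (ℤ.- (+ 2)) (proj₁ h₁₀)) (≥ (ℤ.- (+ 2)) (+ 2) (proj₂ h₁₀))
        one₂ : p (ℤ.- (+ 2)) ≡ 0ℤ ⊎ p (ℤ.- (+ 2)) ≡ ℤ.- (+ 2) → ℤ.∣ 1ℤ ℤ.+ p (ℤ.- (+ 2)) ∣ ≡ 1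
        one₂ (inj₁ e) = ≡.cong (λ x → ℤ.∣ 1ℤ ℤ.+ x ∣) e
        one₂ (inj₂ e) = ≡.cong (λ x → ℤ.∣ 1ℤ ℤ.+ x ∣) e
        resonant : p -1ℤ ≡ -1ℤ → p (ℤ.- (+ 2)) ≡ 0ℤ ⊎ p (ℤ.- (+ 2)) ≡ ℤ.- (+ 2) → ⊥
        resonant e (inj₁ e′) = Resonant.at-2≢0 limit e e′
        resonant e (inj₂ e′) = Resonant.at-2≢-2 limit e e′
        -- A linear factor that is a unit at -2 must be 1 + z, but this vanishes at -1, where it
        -- should be a unit as well.
        vanishing : ∀ n → + n ℤ.- 1ℤ ≡ 0ℤ → Unit (1ℤ ℤ.+ + n ℤ.* -1ℤ) → ⊥
        vanishing n e u = no-unit (≡.subst Unit (≡.trans (Z.solve 1 (λ n → Z.con 1ℤ Z.:+ n Z.:* Z.con -1ℤ Z.:= Z.:- (n Z.:- Z.con 1ℤ)) ≡.refl (+ n)) (≡.cong ℤ.-_ e)) u)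
          where
          no-unit : Unit 0ℤ → ⊥
          no-unit (inj₁ ())
          no-unit (inj₂ ())
        x : Carrier
        -- At -6/5 the two surviving quadratics equal -23/25 and -29/25. Every product of two of
        -- them exceeds 1, which the interval forbids, except the square of the first.
        x = κ (ℚ.- (+ 6 / 5))
        value₄₂ : κ 1ℚ + (κℕ 4 * x + κℕ 2 * (x * x)) ≈ κ (ℚ.- (+ 23 / 25))
        value₄₂ = C.solve 0 (let z = C.con (ℚ.- (+ 6 / 5)) in C.con 1ℚ C.:+ (C.con (+ 4 / 1) C.:* z C.:+ C.con 2ℚ C.:* (z C.:* z)) C.:= C.con (ℚ.- (+ 23 / 25))) refl
        value₃₁ : κ 1ℚ + (κℕ 3 * x + κℕ 1 * (x * x)) ≈ κ (ℚ.- (+ 29 / 25))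
        value₃₁ = C.solve 0 (let z = C.con (ℚ.- (+ 6 / 5)) in C.con 1ℚ C.:+ (C.con (+ 3 / 1) C.:* z C.:+ C.con 1ℚ C.:* (z C.:* z)) C.:= C.con (ℚ.- (+ 29 / 25))) refl
        too-big : ∀ {y} → P G x ≈ κ y → 0ℚ ℚ.< y → ⊥
        too-big e 0<y = ℚ.<-irrefl ≡.refl (ℚ.<-≤-trans 0<y (proj₂ (Limit.invariant-ℚ P-continuous limit
          (Rat.0≤-⇒≤ (+ 4 / 5) (Rat.0≤ₗ _) ≡.refl) (Rat.0≤-⇒≤ (+ 6 / 5) (Rat.0≤ₗ _) ≡.refl) e)))
        both : Bounded A 2 → Bounded B 2 →
               (+ count A 1 ≡ + 4 × + count A 2 ≡ + 2) ⊎ (+ count A 1 ≡ + 3 × + count A 2 ≡ + 1) →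
               (+ count B 1 ≡ + 4 × + count B 2 ≡ + 2) ⊎ (+ count B 1 ≡ + 3 × + count B 2 ≡ + 1) → ⊥
        both bA bB (inj₁ (a₁ , a₂)) (inj₁ (b₁ , b₂)) = limit-nonreal (P-cong G) limit λ t →
          trans (P-product (t - κ 1ℚ) (quadraticᶜ A bA a₁ a₂ (t - κ 1ℚ)) (quadraticᶜ B bB b₁ b₂ (t - κ 1ℚ)))
            (+-congʳ (*-cong (square t) (square t)))
          where
          square : ∀ t → κ 1ℚ + (κℕ 4 * (t - κ 1ℚ) + κℕ 2 * ((t - κ 1ℚ) * (t - κ 1ℚ))) ≈ κ 2ℚ * (t * t) - κ 1ℚ
          square t = C.solve 1 (λ t → let z = t C.:- C.con 1ℚ in C.con 1ℚ C.:+ (C.con (+ 4 / 1) C.:* z C.:+ C.con 2ℚ C.:* (z C.:* z)) C.:= C.con 2ℚ C.:* (t C.:* t) C.:- C.con 1ℚ) refl t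
        both bA bB (inj₁ (a₁ , a₂)) (inj₂ (b₁ , b₂)) = too-big (trans (P-product x (trans (quadraticᶜ A bA a₁ a₂ x) value₄₂) (trans (quadraticᶜ B bB b₁ b₂ x) value₃₁))
          (C.solve 0 (C.con (ℚ.- (+ 23 / 25)) C.:* C.con (ℚ.- (+ 29 / 25)) C.:- C.con 1ℚ C.:= C.con (+ 42 / 625)) refl)) (Rat.0<ₗ _)
        both bA bB (inj₂ (a₁ , a₂)) (inj₁ (b₁ , b₂)) = too-big (trans (P-product x (trans (quadraticᶜ A bA a₁ a₂ x) value₃₁) (trans (quadraticᶜ B bB b₁ b₂ x) value₄₂))
          (C.solve 0 (C.con (ℚ.- (+ 29 / 25)) C.:* C.con (ℚ.- (+ 23 / 25)) C.:- C.con 1ℚ C.:= C.con (+ 42 / 625)) refl)) (Rat.0<ₗ _)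
        both bA bB (inj₂ (a₁ , a₂)) (inj₂ (b₁ , b₂)) = too-big (trans (P-product x (trans (quadraticᶜ A bA a₁ a₂ x) value₃₁) (trans (quadraticᶜ B bB b₁ b₂ x) value₃₁))
          (C.solve 0 (C.con (ℚ.- (+ 29 / 25)) C.:* C.con (ℚ.- (+ 29 / 25)) C.:- C.con 1ℚ C.:= C.con (+ 216 / 625)) refl)) (Rat.0<ₗ _)
        by-shape : ℤ.∣ 1ℤ ℤ.+ p -1ℤ ∣ ≡ 1 → ℤ.∣ 1ℤ ℤ.+ p (ℤ.- (+ 2)) ∣ ≡ 1 →
                   Bounded A 1 ⊎ Bounded B 1 ⊎ (Bounded A 2 × Bounded B 2) → ⊥
        by-shape e₁ e₂ (inj₁ bA) = vanishing (count A 1)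
          (unit-linear-2 (+ count A 1) (1≤count A u∈) (≡.subst Unit (linear A bA (ℤ.- (+ 2))) (unit-A (ℤ.- (+ 2)) e₂))) (≡.subst Unit (linear A bA -1ℤ) (unit-A -1ℤ e₁))
        by-shape e₁ e₂ (inj₂ (inj₁ bB)) = vanishing (count B 1)
          (unit-linear-2 (+ count B 1) (1≤count B v∈) (≡.subst Unit (linear B bB (ℤ.- (+ 2))) (unit-B (ℤ.- (+ 2)) e₂))) (≡.subst Unit (linear B bB -1ℤ) (unit-B -1ℤ e₁))
        by-shape e₁ e₂ (inj₂ (inj₂ (bA , bB))) = both bA bB
          (units-1-2 (+ count A 1) (+ count A 2) (1≤count A u∈) (0≤+ (count A 2)) (≡.subst Unit (quadratic A bA (ℤ.- (+ 2))) (unit-A (ℤ.- (+ 2)) e₂)) (≡.subst Unit (quadratic A bA -1ℤ) (unit-A -1ℤ e₁)))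
          (units-1-2 (+ count B 1) (+ count B 2) (1≤count B v∈) (0≤+ (count B 2)) (≡.subst Unit (quadratic B bB (ℤ.- (+ 2))) (unit-B (ℤ.- (+ 2)) e₂)) (≡.subst Unit (quadratic B bB -1ℤ) (unit-B -1ℤ e₁)))
        -- In the last two cases I_G(-1) = ±1, so both factors are units at -1 and at -2.
        by-p[-1] : p -1ℤ ≡ -1ℤ ⊎ (p -1ℤ ≡ 0ℤ ⊎ p -1ℤ ≡ ℤ.- (+ 2)) → ⊥
        by-p[-1] (inj₁ e)        = resonant e at-2
        by-p[-1] (inj₂ (inj₁ e)) = by-shape (≡.cong (λ x → ℤ.∣ 1ℤ ℤ.+ x ∣) e) (one₂ at-2) (shapes α≡4)
        by-p[-1] (inj₂ (inj₂ e)) = by-shape (≡.cong (λ x → ℤ.∣ 1ℤ ℤ.+ x ∣) e) (one₂ at-2) (shapes α≡4)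

open import Defs
open RealNumbers using (realField)
open ComplexNumbers using (complexField)
open ZerosAsRoots using (Zeros⇒Root; Root⇒Zeros)
open Existence using (existence)
open SeparatedGraph using (separation)
private module C = ComplexPlane realField complexField
private module I = IteratedPolynomial realField complexField
private module Obstruction = Nonexistence realField complexField
open import Data.Nat using (NonZero; _≤_; s≤s)
open import Data.Rational using (-_; _/_)

attractor⇒limit : ∀ G q → IndependenceAttractor G [ q ,0] → C.RootLimit (I.P G) q
attractor⇒limit G q attractor ε 0<ε =
  let M , near = attractor ε 0<ε in
  M , λ m m≥M →
      (λ z r → proj₁ (near m m≥M) z (Root⇒Zeros G m z r))
    , (λ z z∈ → let w , w∈ , z~w = proj₂ (near m m≥M) z z∈ in w , Zeros⇒Root G m w w∈ , z~w)

nonexistence : ∀ (k : ℕ) .{{_ : NonZero k}} → k ≤ 2 →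
  ¬ (∃[ G ] (Disconnected G × independenceNumber G ≡ 4 × IndependenceAttractor G [ - (+ 4 / k) ,0]))
nonexistence 1 _ (G , disconnected , α≡4 , attractor) = separation G disconnected λ sep →
  Obstruction.Separated.no-limit-4 G α≡4 sep (attractor⇒limit G (- (+ 4 / 1)) attractor)
nonexistence 2 _ (G , disconnected , α≡4 , attractor) = separation G disconnected λ sep →
  Obstruction.Separated.no-limit-2 G α≡4 sep (attractor⇒limit G (- (+ 4 / 2)) attractor)
nonexistence (suc (suc (suc _))) (s≤s (s≤s ()))

theoremC : (∀ (k : ℕ) .{{_ : NonZero k}} → k ≤ 4 →
    ∃[ G ] (independenceNumber G ≡ 4 × IndependenceAttractor G [ - (+ 4 / k) ,0]))
    ×
    (∀ (k : ℕ) .{{_ : NonZero k}} → k ≤ 2 →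
    ¬ (∃[ G ] (Disconnected G × independenceNumber G ≡ 4
    × IndependenceAttractor G [ - (+ 4 / k) ,0])))
theoremC = existence , nonexistence
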